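{- Let $\zeta$ be the Riemann zeta function and $s=\sigma+it$ with $\sigma,t$ real, $0<\sigma\le2$ and $t\ge2$. Then $$|\zeta(s)|\le 1+\frac{t}{\sigma}.$$ -}

module Defs where

open import Data.Nat.Base as ℕ using (ℕ; zero; suc; _!)
import Data.Nat.Properties as ℕ
open import Data.Integer.Base as ℤ using (+_)
import Data.Integer.Properties as ℤ
open import Data.Rational.Base as ℚ using (ℚ; mkℚ; 0ℚ; 1ℚ; ½; ↥_; toℚᵘ)
import Data.Rational.Properties as ℚ
import Data.Rational.Unnormalised.Base as ℚᵘ
import Data.Rational.Unnormalised.Properties as ℚᵘ
open import Data.Rational.Solver using (module +-*-Solver)
open import Data.Product.Base using (Σ-syntax; ∃-syntax; _×_; _,_; proj₁; proj₂)
open import Data.Sum.Base using (_⊎_; inj₁; inj₂)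
open import Relation.Nullary.Decidable.Core using (yes; no)
open import Relation.Nullary.Negation.Core using (¬_; contradiction)
open import Relation.Binary.PropositionalEquality.Core
  using (_≡_; refl; sym; trans; cong; subst)

------------------------------------------------------------------------
-- Rational estimates

module RationalLemmas where
  open import Data.Rational.Base using (_+_; _*_; _-_; -_; _≤_; _<_; ∣_∣; 1/_)
  open import Data.Rational.Properties using (module ≤-Reasoning)
  open ≤-Reasoning
  open +-*-Solver using (solve; _:=_; _:+_; _:*_; _:-_; :-_; con)

  0<1 : 0ℚ < 1ℚ
  0<1 = ℚ.positive⁻¹ 1ℚ

  +-pos : ∀ {p q} → 0ℚ < p → 0ℚ < q → 0ℚ < p + q
  +-pos = ℚ.+-mono-<

  *-pos : ∀ {p q} → 0ℚ < p → 0ℚ < q → 0ℚ < p * q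
  *-pos {p} {q} 0<p 0<q = ℚ.positive⁻¹ (p * q) {{ℚ.pos*pos⇒pos p {{ℚ.positive 0<p}} q {{ℚ.positive 0<q}}}}

  half-pos : ∀ {ε} → 0ℚ < ε → 0ℚ < ½ * ε
  half-pos = *-pos (ℚ.positive⁻¹ ½)

  *-monoʳ : ∀ {r p q} → 0ℚ ≤ r → p ≤ q → r * p ≤ r * q
  *-monoʳ {r} 0≤r = ℚ.*-monoˡ-≤-nonNeg r {{ℚ.nonNegative 0≤r}}

  *-monoˡ : ∀ {r p q} → 0ℚ ≤ r → p ≤ q → p * r ≤ q * r
  *-monoˡ {r} 0≤r = ℚ.*-monoʳ-≤-nonNeg r {{ℚ.nonNegative 0≤r}}

  *-mono : ∀ {p q r s} → 0ℚ ≤ r → 0ℚ ≤ q → p ≤ q → r ≤ s → p * r ≤ q * s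
  *-mono 0≤r 0≤q p≤q r≤s = ℚ.≤-trans (*-monoˡ 0≤r p≤q) (*-monoʳ 0≤q r≤s)

  p≤∣p∣ : ∀ p → p ≤ ∣ p ∣
  p≤∣p∣ p with ℚ.≤-total 0ℚ p
  ... | inj₁ 0≤p = ℚ.≤-reflexive (sym (ℚ.0≤p⇒∣p∣≡p 0≤p))
  ... | inj₂ p≤0 = ℚ.≤-trans p≤0 (ℚ.0≤∣p∣ p)

  ∣p-q∣≡∣q-p∣ : ∀ p q → ∣ p - q ∣ ≡ ∣ q - p ∣
  ∣p-q∣≡∣q-p∣ p q = trans
    (cong ∣_∣ (solve 2 (λ x y → x :- y := :- (y :- x)) refl p q))
    (ℚ.∣-p∣≡∣p∣ (q - p))

  ∣-∣<⇒< : ∀ {p q ε} → ∣ p - q ∣ < ε → p < q + ε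
  ∣-∣<⇒< {p} {q} {ε} d = begin-strict
    p             ≡⟨ solve 2 (λ x y → x := y :+ (x :- y)) refl p q ⟩
    q + (p - q)   ≤⟨ ℚ.+-monoʳ-≤ q (p≤∣p∣ (p - q)) ⟩
    q + ∣ p - q ∣ <⟨ ℚ.+-monoʳ-< q d ⟩
    q + ε         ∎

  <⇒∣-∣< : ∀ {p q ε} → p < q + ε → q < p + ε → ∣ p - q ∣ < ε
  <⇒∣-∣< {p} {q} {ε} p<q+ε q<p+ε with ℚ.∣p∣≡p∨∣p∣≡-p (p - q)
  ... | inj₁ eq = begin-strict
    ∣ p - q ∣ ≡⟨ eq ⟩
    p - q     <⟨ ℚ.+-monoˡ-< (- q) p<q+ε ⟩
    q + ε - q ≡⟨ solve 2 (λ y e → y :+ e :- y := e) refl q ε ⟩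
    ε         ∎
  ... | inj₂ eq = begin-strict
    ∣ p - q ∣  ≡⟨ eq ⟩
    - (p - q)  ≡⟨ solve 2 (λ x y → :- (x :- y) := y :- x) refl p q ⟩
    q - p      <⟨ ℚ.+-monoˡ-< (- p) q<p+ε ⟩
    p + ε - p  ≡⟨ solve 2 (λ y e → y :+ e :- y := e) refl p ε ⟩
    ε          ∎

  ∣p∣≤∣q∣+∣p-q∣ : ∀ p q → ∣ p ∣ ≤ ∣ q ∣ + ∣ p - q ∣
  ∣p∣≤∣q∣+∣p-q∣ p q = begin
    ∣ p ∣             ≡⟨ cong ∣_∣ (solve 2 (λ x y → x := y :+ (x :- y)) refl p q) ⟩
    ∣ q + (p - q) ∣   ≤⟨ ℚ.∣p+q∣≤∣p∣+∣q∣ q (p - q) ⟩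
    ∣ q ∣ + ∣ p - q ∣ ∎

  p<p+q : ∀ p {q} → 0ℚ < q → p < p + q
  p<p+q p {q} 0<q = begin-strict
    p      ≡⟨ ℚ.+-identityʳ p ⟨
    p + 0ℚ <⟨ ℚ.+-monoʳ-< p 0<q ⟩
    p + q  ∎

  recip : ∀ {p} → 0ℚ < p → ℚ
  recip {p} 0<p = (1/ p) {{ℚ.>-nonZero 0<p}}

  recip-pos : ∀ {p} (0<p : 0ℚ < p) → 0ℚ < recip 0<p
  recip-pos {p} 0<p = ℚ.positive⁻¹ (recip 0<p) {{ℚ.1/pos⇒pos p {{ℚ.positive 0<p}}}}

  recip-inverse : ∀ {p} (0<p : 0ℚ < p) → p * recip 0<p ≡ 1ℚ
  recip-inverse {p} 0<p = ℚ.*-inverseʳ p {{ℚ.>-nonZero 0<p}}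

  recip-antimono : ∀ {p q} (0<p : 0ℚ < p) (0<q : 0ℚ < q) → p ≤ q → recip 0<q ≤ recip 0<p
  recip-antimono {p} {q} 0<p 0<q p≤q = begin
    q⁻¹              ≡⟨ ℚ.*-identityˡ q⁻¹ ⟨
    1ℚ * q⁻¹         ≡⟨ cong (_* q⁻¹) (recip-inverse 0<p) ⟨
    p * p⁻¹ * q⁻¹    ≤⟨ *-monoˡ (ℚ.<⇒≤ (recip-pos 0<q)) (*-monoˡ (ℚ.<⇒≤ (recip-pos 0<p)) p≤q) ⟩
    q * p⁻¹ * q⁻¹    ≡⟨ solve 3 (λ x y z → x :* y :* z := y :* (x :* z)) refl q p⁻¹ q⁻¹ ⟩
    p⁻¹ * (q * q⁻¹)  ≡⟨ cong (p⁻¹ *_) (recip-inverse 0<q) ⟩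
    p⁻¹ * 1ℚ         ≡⟨ ℚ.*-identityʳ p⁻¹ ⟩
    p⁻¹              ∎
    where p⁻¹ = recip 0<p; q⁻¹ = recip 0<q

  recip-sub : ∀ {p q} (0<p : 0ℚ < p) (0<q : 0ℚ < q) →
              recip 0<p - recip 0<q ≡ (q - p) * (recip 0<p * recip 0<q)
  recip-sub {p} {q} 0<p 0<q = sym (begin-equality
    (q - p) * (p⁻¹ * q⁻¹)
      ≡⟨ solve 4 (λ x y u v → (y :- x) :* (u :* v) := (y :* v) :* u :- (x :* u) :* v) refl p q p⁻¹ q⁻¹ ⟩
    q * q⁻¹ * p⁻¹ - p * p⁻¹ * q⁻¹
      ≡⟨ cong (λ z → z * p⁻¹ - p * p⁻¹ * q⁻¹) (recip-inverse 0<q) ⟩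
    1ℚ * p⁻¹ - p * p⁻¹ * q⁻¹
      ≡⟨ cong (λ z → 1ℚ * p⁻¹ - z * q⁻¹) (recip-inverse 0<p) ⟩
    1ℚ * p⁻¹ - 1ℚ * q⁻¹
      ≡⟨ solve 2 (λ u v → con 1ℚ :* u :- con 1ℚ :* v := u :- v) refl p⁻¹ q⁻¹ ⟩
    p⁻¹ - q⁻¹ ∎)
    where p⁻¹ = recip 0<p; q⁻¹ = recip 0<q

  fromℕ : ℕ → ℚ
  fromℕ n = + n ℚ./ 1

  fromℕ-suc : ∀ n → fromℕ (suc n) ≡ 1ℚ + fromℕ n
  fromℕ-suc n = ℚ.toℚᵘ-injective (ℚᵘ.≃-trans (ℚ.toℚᵘ-fromℚᵘ (ℚᵘ.mkℚᵘ (+ suc n) 0))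
    (ℚᵘ.≃-sym (ℚᵘ.≃-trans (ℚ.toℚᵘ-homo-+ 1ℚ (fromℕ n))
      (ℚᵘ.≃-trans (ℚᵘ.+-congʳ ℚᵘ.1ℚᵘ (ℚ.toℚᵘ-fromℚᵘ (ℚᵘ.mkℚᵘ (+ n) 0)))
        (ℚᵘ.*≡* (cong (λ k → (+ 1 ℤ.+ k) ℤ.* + 1) (ℤ.*-identityʳ (+ n))))))))

  fromℕ-nonNeg : ∀ n → 0ℚ ≤ fromℕ n
  fromℕ-nonNeg zero    = ℚ.≤-refl
  fromℕ-nonNeg (suc n) = subst (0ℚ ≤_) (sym (fromℕ-suc n))
    (ℚ.+-mono-≤ (ℚ.<⇒≤ 0<1) (fromℕ-nonNeg n))

  fromℕ-pos : ∀ n → 0ℚ < fromℕ (suc n)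
  fromℕ-pos n = subst (0ℚ <_) (sym (fromℕ-suc n)) (ℚ.+-mono-<-≤ 0<1 (fromℕ-nonNeg n))

  fromℕ-mono : ∀ {m n} → m ℕ.≤ n → fromℕ m ≤ fromℕ n
  fromℕ-mono {n = n} ℕ.z≤n = fromℕ-nonNeg n
  fromℕ-mono {suc m} {suc n} (ℕ.s≤s m≤n) rewrite fromℕ-suc m | fromℕ-suc n =
    ℚ.+-monoʳ-≤ 1ℚ (fromℕ-mono m≤n)

  bound : ℚ → ℕ
  bound p = ℤ.∣ ↥ p ∣

  archimedean : ∀ p → p ≤ fromℕ (bound p)
  archimedean p@(mkℚ n d _) = ℚ.toℚᵘ-cancel-≤ (ℚᵘ.≤-respʳ-≃
    (ℚᵘ.≃-sym (ℚ.toℚᵘ-fromℚᵘ (ℚᵘ.mkℚᵘ (+ ℤ.∣ n ∣) 0))) (ℚᵘ.*≤* (le n)))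
    where
    le : ∀ n → n ℤ.* + 1 ℤ.≤ + ℤ.∣ n ∣ ℤ.* + suc d
    le (+ k) = subst (ℤ._≤ + k ℤ.* + suc d) refl
      (ℤ.*-monoˡ-≤-nonNeg (+ k) (ℤ.+≤+ (ℕ.s≤s ℕ.z≤n)))
    le ℤ.-[1+ k ] = ℤ.-≤+

  mesh : ℕ → ℚ
  mesh n = recip (fromℕ-pos n)

  mesh-small : ∀ ε → 0ℚ < ε → ∃[ N ] (∀ {n} → N ℕ.≤ n → mesh n < ε)
  mesh-small ε 0<ε = bound ε⁻¹ , λ {n} N≤n → small n N≤n
    where
    ε⁻¹ = recip 0<ε
    small : ∀ n → bound ε⁻¹ ℕ.≤ n → mesh n < ε
    small n N≤n = ℚ.*-cancelˡ-<-nonNeg k {{ℚ.nonNegative (ℚ.<⇒≤ (fromℕ-pos n))}} (begin-strict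
      k * mesh n             ≡⟨ recip-inverse (fromℕ-pos n) ⟩
      1ℚ                     ≡⟨ recip-inverse 0<ε ⟨
      ε * ε⁻¹                ≤⟨ *-monoʳ (ℚ.<⇒≤ 0<ε) (ℚ.≤-trans (archimedean ε⁻¹) (fromℕ-mono N≤n)) ⟩
      ε * fromℕ n            <⟨ ℚ.*-monoʳ-<-pos ε {{ℚ.positive 0<ε}}
                                  (subst (fromℕ n <_) (trans (ℚ.+-comm (fromℕ n) 1ℚ) (sym (fromℕ-suc n)))
                                    (p<p+q (fromℕ n) 0<1)) ⟩
      ε * k                  ≡⟨ ℚ.*-comm ε k ⟩
      k * ε                  ∎)
      where k = fromℕ (suc n)

  -- The largest multiple k·h of h, with k no larger than the last
  -- argument, whose square is at most q (and 0 if there is none).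
  largestRoot : (h q : ℚ) → ℕ → ℚ
  largestRoot h q zero = 0ℚ
  largestRoot h q (suc k) with (fromℕ (suc k) * h) * (fromℕ (suc k) * h) ℚ.≤? q
  ... | yes _ = fromℕ (suc k) * h
  ... | no  _ = largestRoot h q k

  record IsRoot (h q r : ℚ) : Set where
    field
      nonNeg : 0ℚ ≤ r
      lower  : r ≡ 0ℚ ⊎ r * r ≤ q
      upper  : q < (r + h) * (r + h)

  largestRoot-isRoot : ∀ h q k → 0ℚ < h →
    q < (fromℕ (suc k) * h) * (fromℕ (suc k) * h) → IsRoot h q (largestRoot h q k)
  largestRoot-isRoot h q zero 0<h q< = record
    { nonNeg = ℚ.≤-refl
    ; lower  = inj₁ refl
    ; upper  = subst (q <_)
        (cong (λ z → z * z) (trans (ℚ.*-identityˡ h) (sym (ℚ.+-identityˡ h)))) q<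
    }
  largestRoot-isRoot h q (suc k) 0<h q< with (fromℕ (suc k) * h) * (fromℕ (suc k) * h) ℚ.≤? q
  ... | yes p = record
    { nonNeg = ℚ.<⇒≤ (*-pos (fromℕ-pos k) 0<h)
    ; lower  = inj₂ p
    ; upper  = subst (q <_) (cong (λ z → z * z) step) q<
    }
    where
    step : fromℕ (suc (suc k)) * h ≡ fromℕ (suc k) * h + h
    step = trans (cong (_* h) (fromℕ-suc (suc k)))
      (solve 2 (λ x y → (con 1ℚ :+ x) :* y := x :* y :+ y) refl (fromℕ (suc k)) h)
  ... | no ¬p = largestRoot-isRoot h q k 0<h (ℚ.≰⇒> ¬p)

  rootFuel : ℕ → ℚ → ℕ
  rootFuel n q = bound ((∣ q ∣ + 1ℚ) * fromℕ (suc n))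

  rootFuel-enough : ∀ n q → q < (fromℕ (suc (rootFuel n q)) * mesh n) * (fromℕ (suc (rootFuel n q)) * mesh n)
  rootFuel-enough n q = begin-strict
    q                                       ≤⟨ p≤∣p∣ q ⟩
    ∣ q ∣                                   <⟨ p<p+q ∣ q ∣ 0<1 ⟩
    b                                       ≡⟨ ℚ.*-identityˡ b ⟨
    1ℚ * b                                  ≤⟨ *-mono 0≤b 0≤b 1≤b ℚ.≤-refl ⟩
    b * b                                   ≤⟨ *-mono 0≤b (ℚ.≤-trans 0≤b b≤) b≤ b≤ ⟩
    (fromℕ (suc K) * h) * (fromℕ (suc K) * h) ∎
    where
    h = mesh n
    b = ∣ q ∣ + 1ℚ
    K = rootFuel n q
    1≤b : 1ℚ ≤ b
    1≤b = subst (_≤ b) (ℚ.+-identityˡ 1ℚ) (ℚ.+-monoˡ-≤ 1ℚ (ℚ.0≤∣p∣ q))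
    0≤b : 0ℚ ≤ b
    0≤b = ℚ.≤-trans (ℚ.<⇒≤ 0<1) 1≤b
    b≤ : b ≤ fromℕ (suc K) * h
    b≤ = begin
      b                       ≡⟨ ℚ.*-identityʳ b ⟨
      b * 1ℚ                  ≡⟨ cong (b *_) (recip-inverse (fromℕ-pos n)) ⟨
      b * (fromℕ (suc n) * h) ≡⟨ ℚ.*-assoc b (fromℕ (suc n)) h ⟨
      b * fromℕ (suc n) * h   ≤⟨ *-monoˡ (ℚ.<⇒≤ (recip-pos (fromℕ-pos n)))
                                   (ℚ.≤-trans (archimedean (b * fromℕ (suc n))) (fromℕ-mono (ℕ.n≤1+n K))) ⟩
      fromℕ (suc K) * h       ∎

  -- Opaque for the sake of term size; rootApprox-isRoot characterises it.
  opaque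
    -- The square root of q rounded down to a multiple of 1/(n+1).
    rootApprox : ℕ → ℚ → ℚ
    rootApprox n q = largestRoot (mesh n) q (rootFuel n q)

    rootApprox-isRoot : ∀ n q → IsRoot (mesh n) q (rootApprox n q)
    rootApprox-isRoot n q = largestRoot-isRoot (mesh n) q (rootFuel n q)
      (recip-pos (fromℕ-pos n)) (rootFuel-enough n q)

  isRoot-close : ∀ {h k p q r s η} → 0ℚ < η → IsRoot h p r → IsRoot k q s → 0ℚ < k → k < η →
                 p < q + η * η → r < s + (η + η)
  isRoot-close {h} {k} {p} {q} {r} {s} {η} 0<η R S 0<k k<η p<q+η² = ℚ.≰⇒> absurd
    where
    module R = IsRoot R
    module S = IsRoot S
    0≤η = ℚ.<⇒≤ 0<η
    0≤s+η : 0ℚ ≤ s + η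
    0≤s+η = ℚ.+-mono-≤ S.nonNeg 0≤η
    absurd : ¬ (s + (η + η) ≤ r)
    absurd le with R.lower
    ... | inj₁ refl = ℚ.<-irrefl refl (ℚ.<-≤-trans
            (ℚ.+-mono-≤-< S.nonNeg (+-pos 0<η 0<η)) le)
    ... | inj₂ r²≤p = ℚ.<-irrefl refl (begin-strict
      p                               <⟨ p<q+η² ⟩
      q + η * η                       ≤⟨ ℚ.+-monoˡ-≤ (η * η) (ℚ.<⇒≤ q<) ⟩
      (s + η) * (s + η) + η * η       ≡⟨ ℚ.+-identityʳ _ ⟨
      (s + η) * (s + η) + η * η + 0ℚ  ≤⟨ ℚ.+-monoʳ-≤ ((s + η) * (s + η) + η * η) cross ⟩
      (s + η) * (s + η) + η * η + ((s + η) * η + (s + η) * η)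
        ≡⟨ solve 2 (λ x e → (x :+ e) :* (x :+ e) :+ e :* e :+ ((x :+ e) :* e :+ (x :+ e) :* e)
                          := (x :+ (e :+ e)) :* (x :+ (e :+ e))) refl s η ⟩
      (s + (η + η)) * (s + (η + η))   ≤⟨ *-mono 0≤t R.nonNeg le le ⟩
      r * r                           ≤⟨ r²≤p ⟩
      p                               ∎)
      where
      0≤t : 0ℚ ≤ s + (η + η)
      0≤t = ℚ.+-mono-≤ S.nonNeg (ℚ.+-mono-≤ 0≤η 0≤η)
      0≤sη : 0ℚ ≤ (s + η) * η
      0≤sη = subst (_≤ (s + η) * η) (ℚ.*-zeroˡ η) (*-monoˡ 0≤η 0≤s+η)
      cross : 0ℚ ≤ (s + η) * η + (s + η) * η
      cross = ℚ.+-mono-≤ 0≤sη 0≤sη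
      q< : q < (s + η) * (s + η)
      q< = ℚ.<-≤-trans S.upper (*-mono (ℚ.+-mono-≤ S.nonNeg (ℚ.<⇒≤ 0<k)) 0≤s+η s+k≤ s+k≤)
        where s+k≤ = ℚ.+-monoʳ-≤ s (ℚ.<⇒≤ k<η)
  half-above : ∀ p q → ∣ p - q ∣ < ½ → 1ℚ ≤ p → 0ℚ + ½ ≤ q
  half-above p q d 1≤p = ℚ.≮⇒≥ λ q<½ → ℚ.<-irrefl refl (begin-strict
    p      <⟨ ∣-∣<⇒< {p} {q} {½} d ⟩
    q + ½  <⟨ ℚ.+-monoˡ-< ½ q<½ ⟩
    1ℚ     ≤⟨ 1≤p ⟩
    p      ∎)

  half-below : ∀ p q → ∣ p - q ∣ < ½ → q ≤ 1ℚ → p + ½ ≤ fromℕ 2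
  half-below p q d q≤1 = begin
    p + ½      ≤⟨ ℚ.+-monoˡ-≤ ½ (ℚ.<⇒≤ (∣-∣<⇒< {p} {q} {½} d)) ⟩
    q + ½ + ½  ≤⟨ ℚ.+-monoˡ-≤ ½ (ℚ.+-monoˡ-≤ ½ q≤1) ⟩
    fromℕ 2    ∎

open RationalLemmas using (fromℕ; mesh; rootApprox)

------------------------------------------------------------------------
-- Real numbers: Cauchy sequences of rationals

IsCauchy : (ℕ → ℚ) → Set
IsCauchy x = ∀ ε → 0ℚ ℚ.< ε →
  ∃[ N ] (∀ {m n} → N ℕ.≤ m → N ℕ.≤ n → ℚ.∣ x m ℚ.- x n ∣ ℚ.< ε)

record ℝ : Set where
  constructor mkℝ
  field
    seq      : ℕ → ℚ
    isCauchy : IsCauchy seq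

open ℝ

module CauchyLemmas where
  open RationalLemmas
  open import Data.Rational.Base using (_+_; _*_; _-_; -_; _≤_; _<_; ∣_∣)
  open import Data.Rational.Properties using (module ≤-Reasoning)
  open ≤-Reasoning
  open +-*-Solver using (solve; _:=_; _:+_; _:*_; _:-_; :-_; con)

  scaled : ∀ x C → 0ℚ < C →
    (∀ ε → 0ℚ < ε → ∃[ N ] (∀ {m n} → N ℕ.≤ m → N ℕ.≤ n → ∣ x m - x n ∣ < C * ε)) →
    IsCauchy x
  scaled x C 0<C h ε 0<ε with h (recip 0<C * ε) (*-pos (recip-pos 0<C) 0<ε)
  ... | N , d = N , λ {m} {n} N≤m N≤n → subst (∣ x m - x n ∣ <_) eq (d N≤m N≤n)
    where
    eq : C * (recip 0<C * ε) ≡ ε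
    eq = trans (sym (ℚ.*-assoc C (recip 0<C) ε))
      (trans (cong (_* ε) (recip-inverse 0<C)) (ℚ.*-identityˡ ε))

  EventuallyBounded : (ℕ → ℚ) → Set
  EventuallyBounded x = ∃[ B ] 0ℚ < B × ∃[ N ] (∀ {n} → N ℕ.≤ n → ∣ x n ∣ ≤ B)

  -- Abstract because only the existence of the moduli matters, and unfolding
  -- them makes terms that mention real numbers enormous.
  abstract
    constant : ∀ q → IsCauchy (λ _ → q)
    constant q ε 0<ε = 0 , λ _ _ → subst (_< ε) (sym (cong ∣_∣ (ℚ.+-inverseʳ q))) 0<ε

    sum : ∀ x y → IsCauchy x → IsCauchy y → IsCauchy (λ n → x n + y n)
    sum x y cx cy = scaled (λ n → x n + y n) (1ℚ + 1ℚ) (+-pos 0<1 0<1) λ ε 0<ε →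
      let (M , dx) = cx ε 0<ε
          (N , dy) = cy ε 0<ε
      in M ℕ.⊔ N , λ {m} {n} ≤m ≤n → begin-strict
        ∣ (x m + y m) - (x n + y n) ∣
          ≡⟨ cong ∣_∣ (solve 4 (λ a b c d → (a :+ b) :- (c :+ d) := (a :- c) :+ (b :- d)) refl (x m) (y m) (x n) (y n)) ⟩
        ∣ (x m - x n) + (y m - y n) ∣   ≤⟨ ℚ.∣p+q∣≤∣p∣+∣q∣ (x m - x n) (y m - y n) ⟩
        ∣ x m - x n ∣ + ∣ y m - y n ∣
          <⟨ ℚ.+-mono-< (dx (ℕ.m⊔n≤o⇒m≤o M N ≤m) (ℕ.m⊔n≤o⇒m≤o M N ≤n))
                        (dy (ℕ.m⊔n≤o⇒n≤o M N ≤m) (ℕ.m⊔n≤o⇒n≤o M N ≤n)) ⟩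
        ε + ε                           ≡⟨ solve 1 (λ e → e :+ e := (con 1ℚ :+ con 1ℚ) :* e) refl ε ⟩
        (1ℚ + 1ℚ) * ε                   ∎

    negation : ∀ x → IsCauchy x → IsCauchy (λ n → - x n)
    negation x cx ε 0<ε with cx ε 0<ε
    ... | N , d = N , λ {m} {n} ≤m ≤n → subst (_< ε) (eq m n) (d ≤m ≤n)
      where
      eq : ∀ m n → ∣ x m - x n ∣ ≡ ∣ - x m - - x n ∣
      eq m n = trans (∣p-q∣≡∣q-p∣ (x m) (x n))
        (cong ∣_∣ (solve 2 (λ a b → b :- a := :- a :- :- b) refl (x m) (x n)))

    eventuallyBounded : ∀ x → IsCauchy x → EventuallyBounded x
    eventuallyBounded x cx =
      let (N , d) = cx 1ℚ 0<1
      in ∣ x N ∣ + 1ℚ , ℚ.+-mono-≤-< (ℚ.0≤∣p∣ (x N)) 0<1 , N , λ {n} N≤n →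
        ℚ.≤-trans (∣p∣≤∣q∣+∣p-q∣ (x n) (x N)) (ℚ.+-monoʳ-≤ ∣ x N ∣ (ℚ.<⇒≤ (d N≤n ℕ.≤-refl)))

    boundedProduct : ∀ x y → EventuallyBounded x → EventuallyBounded y →
                     IsCauchy x → IsCauchy y → IsCauchy (λ n → x n * y n)
    boundedProduct x y (A , 0<A , K , x≤A) (B , 0<B , L , y≤B) cx cy =
      scaled (λ n → x n * y n) (A + B) (+-pos 0<A 0<B) λ ε 0<ε →
        let (M , dx) = cx ε 0<ε
            (N , dy) = cy ε 0<ε
        in (K ℕ.⊔ L) ℕ.⊔ (M ℕ.⊔ N) , λ {m} {n} ≤m ≤n →
          let K⊔L≤m = ℕ.m⊔n≤o⇒m≤o (K ℕ.⊔ L) (M ℕ.⊔ N) ≤m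
              K⊔L≤n = ℕ.m⊔n≤o⇒m≤o (K ℕ.⊔ L) (M ℕ.⊔ N) ≤n
              M⊔N≤m = ℕ.m⊔n≤o⇒n≤o (K ℕ.⊔ L) (M ℕ.⊔ N) ≤m
              M⊔N≤n = ℕ.m⊔n≤o⇒n≤o (K ℕ.⊔ L) (M ℕ.⊔ N) ≤n
          in begin-strict
          ∣ x m * y m - x n * y n ∣
            ≡⟨ cong ∣_∣ (solve 4 (λ a b c d → a :* b :- c :* d := a :* (b :- d) :+ d :* (a :- c)) refl (x m) (y m) (x n) (y n)) ⟩
          ∣ x m * (y m - y n) + y n * (x m - x n) ∣
            ≤⟨ ℚ.∣p+q∣≤∣p∣+∣q∣ (x m * (y m - y n)) (y n * (x m - x n)) ⟩
          ∣ x m * (y m - y n) ∣ + ∣ y n * (x m - x n) ∣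
            <⟨ ℚ.+-mono-<
                 (small 0<A (x≤A (ℕ.m⊔n≤o⇒m≤o K L K⊔L≤m))
                   (dy (ℕ.m⊔n≤o⇒n≤o M N M⊔N≤m) (ℕ.m⊔n≤o⇒n≤o M N M⊔N≤n)))
                 (small 0<B (y≤B (ℕ.m⊔n≤o⇒n≤o K L K⊔L≤n))
                   (dx (ℕ.m⊔n≤o⇒m≤o M N M⊔N≤m) (ℕ.m⊔n≤o⇒m≤o M N M⊔N≤n))) ⟩
          A * ε + B * ε ≡⟨ ℚ.*-distribʳ-+ ε A B ⟨
          (A + B) * ε   ∎
      where
      small : ∀ {C p q ε} → 0ℚ < C → ∣ p ∣ ≤ C → ∣ q ∣ < ε → ∣ p * q ∣ < C * ε
      small {C} {p} {q} {ε} 0<C p≤C q<ε = begin-strict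
        ∣ p * q ∣     ≡⟨ ℚ.∣p*q∣≡∣p∣*∣q∣ p q ⟩
        ∣ p ∣ * ∣ q ∣ ≤⟨ *-monoˡ (ℚ.0≤∣p∣ q) p≤C ⟩
        C * ∣ q ∣     <⟨ ℚ.*-monoʳ-<-pos C {{ℚ.positive 0<C}} q<ε ⟩
        C * ε         ∎

    product : ∀ x y → IsCauchy x → IsCauchy y → IsCauchy (λ n → x n * y n)
    product x y cx cy =
      boundedProduct x y (eventuallyBounded x cx) (eventuallyBounded y cy) cx cy

    shift : ∀ x k → IsCauchy x → IsCauchy (λ n → x (k ℕ.+ n))
    shift x k cx ε 0<ε with cx ε 0<ε
    ... | N , d = N , λ {m} {n} ≤m ≤n →
      d (ℕ.≤-trans ≤m (ℕ.m≤n+m m k)) (ℕ.≤-trans ≤n (ℕ.m≤n+m n k))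

    reciprocal : ∀ x {c} → 0ℚ < c → (∀ n → c ≤ x n) → (0<x : ∀ n → 0ℚ < x n) →
                 IsCauchy x → IsCauchy (λ n → recip (0<x n))
    reciprocal x {c} 0<c c≤x 0<x cx = scaled r C (*-pos 0<c⁻¹ 0<c⁻¹) λ ε 0<ε →
      let (N , d) = cx ε 0<ε
      in N , λ {m} {n} ≤m ≤n → begin-strict
        ∣ r m - r n ∣                 ≡⟨ cong ∣_∣ (recip-sub (0<x m) (0<x n)) ⟩
        ∣ (x n - x m) * (r m * r n) ∣ ≡⟨ ℚ.∣p*q∣≡∣p∣*∣q∣ (x n - x m) (r m * r n) ⟩
        ∣ x n - x m ∣ * ∣ r m * r n ∣ ≡⟨ cong (∣ x n - x m ∣ *_) (ℚ.0≤p⇒∣p∣≡p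
                                           (ℚ.<⇒≤ (*-pos (recip-pos (0<x m)) (recip-pos (0<x n))))) ⟩
        ∣ x n - x m ∣ * (r m * r n)   ≤⟨ *-monoʳ (ℚ.0≤∣p∣ (x n - x m))
                                           (*-mono (ℚ.<⇒≤ (recip-pos (0<x n))) (ℚ.<⇒≤ 0<c⁻¹)
                                             (recip-antimono 0<c (0<x m) (c≤x m))
                                             (recip-antimono 0<c (0<x n) (c≤x n))) ⟩
        ∣ x n - x m ∣ * C             ≡⟨ ℚ.*-comm ∣ x n - x m ∣ C ⟩
        C * ∣ x n - x m ∣             <⟨ ℚ.*-monoʳ-<-pos C {{ℚ.positive (*-pos 0<c⁻¹ 0<c⁻¹)}} (d ≤n ≤m) ⟩
        C * ε                         ∎
      where
      r : ℕ → ℚ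
      r n = recip (0<x n)
      0<c⁻¹ : 0ℚ < recip 0<c
      0<c⁻¹ = recip-pos 0<c
      C : ℚ
      C = recip 0<c * recip 0<c

    root : ∀ x → IsCauchy x → IsCauchy (λ n → rootApprox n (x n))
    root x cx = scaled (λ n → rootApprox n (x n)) (1ℚ + 1ℚ) (+-pos 0<1 0<1) λ η 0<η →
      let (M , d) = cx (η * η) (*-pos 0<η 0<η)
          (N , s) = mesh-small η 0<η
          near : ∀ {m n} → M ℕ.⊔ N ℕ.≤ m → M ℕ.⊔ N ℕ.≤ n →
                 rootApprox m (x m) < rootApprox n (x n) + (1ℚ + 1ℚ) * η
          near {m} {n} ≤m ≤n = subst (λ z → rootApprox m (x m) < rootApprox n (x n) + z)
            (solve 1 (λ e → e :+ e := (con 1ℚ :+ con 1ℚ) :* e) refl η)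
            (isRoot-close 0<η (rootApprox-isRoot m (x m)) (rootApprox-isRoot n (x n))
              (recip-pos (fromℕ-pos n)) (s (ℕ.m⊔n≤o⇒n≤o M N ≤n))
              (∣-∣<⇒< (d (ℕ.m⊔n≤o⇒m≤o M N ≤m) (ℕ.m⊔n≤o⇒m≤o M N ≤n))))
      in M ℕ.⊔ N , λ ≤m ≤n → <⇒∣-∣< (near ≤m ≤n) (near ≤n ≤m)

infix  4 _<_ _≤_ _≈_ _#ℝ_
infixl 6 _+_ _-_
infixl 7 _*_ _/_[_]
infix  8 -_ √_

fromℚ : ℚ → ℝ
fromℚ q = mkℝ (λ _ → q) (CauchyLemmas.constant q)

0ℝ 1ℝ 2ℝ : ℝ
0ℝ = fromℚ 0ℚ
1ℝ = fromℚ 1ℚ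
2ℝ = fromℚ (fromℕ 2)

_+_ _*_ : ℝ → ℝ → ℝ
x + y = mkℝ (λ n → seq x n ℚ.+ seq y n) (CauchyLemmas.sum (seq x) (seq y) (isCauchy x) (isCauchy y))
x * y = mkℝ (λ n → seq x n ℚ.* seq y n) (CauchyLemmas.product (seq x) (seq y) (isCauchy x) (isCauchy y))

-_ : ℝ → ℝ
- x = mkℝ (λ n → ℚ.- seq x n) (CauchyLemmas.negation (seq x) (isCauchy x))

_-_ : ℝ → ℝ → ℝ
x - y = x + - y

-- For negative x this is 0.
√_ : ℝ → ℝ
√ x = mkℝ (λ n → rootApprox n (seq x n)) (CauchyLemmas.root (seq x) (isCauchy x))

record _≈_ (x y : ℝ) : Set where
  constructor mk≈
  field
    close : ∀ ε → 0ℚ ℚ.< ε →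
      ∃[ N ] (∀ {n} → N ℕ.≤ n → ℚ.∣ seq x n ℚ.- seq y n ∣ ℚ.< ε)

record _<_ (x y : ℝ) : Set where
  constructor mk<
  field
    gap       : ℚ
    gap-pos   : 0ℚ ℚ.< gap
    from      : ℕ
    separated : ∀ {n} → from ℕ.≤ n → seq x n ℚ.+ gap ℚ.≤ seq y n

_≤_ _#ℝ_ : ℝ → ℝ → Set
x ≤ y  = ¬ (y < x)
x #ℝ y = x < y ⊎ y < x

-- The sequence of y is shifted to start where it is bounded below.
_/_[_] : (x y : ℝ) → 0ℝ < y → ℝ
x / y [ mk< c 0<c N c≤y ] = x * mkℝ (λ n → RationalLemmas.recip (0<y n))
  (CauchyLemmas.reciprocal (λ n → seq y (N ℕ.+ n)) 0<c c≤ 0<y (CauchyLemmas.shift (seq y) N (isCauchy y)))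
  where
  c≤ : ∀ n → c ℚ.≤ seq y (N ℕ.+ n)
  c≤ n = subst (ℚ._≤ seq y (N ℕ.+ n)) (ℚ.+-identityˡ c) (c≤y (ℕ.m≤m+n N n))
  0<y : ∀ n → 0ℚ ℚ.< seq y (N ℕ.+ n)
  0<y n = ℚ.<-≤-trans 0<c (c≤ n)

------------------------------------------------------------------------
-- Complex numbers

infix  4 _≈ᶜ_ _#_
infixl 6 _+ᶜ_ _-ᶜ_
infixl 7 _*ᶜ_
infix  8 -ᶜ_
infixr 8 _^_
infix  5 _+i_

record ℂ : Set where
  constructor _+i_
  field
    re im : ℝ

open ℂ

fromℝ : ℝ → ℂ
fromℝ x = x +i 0ℝ

0ℂ 1ℂ : ℂ
0ℂ = fromℝ 0ℝ
1ℂ = fromℝ 1ℝ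

_+ᶜ_ _*ᶜ_ _-ᶜ_ : ℂ → ℂ → ℂ
z +ᶜ w = re z + re w +i im z + im w
z *ᶜ w = re z * re w - im z * im w +i re z * im w + im z * re w
z -ᶜ w = re z - re w +i im z - im w

-ᶜ_ : ℂ → ℂ
-ᶜ z = - re z +i - im z

_^_ : ℂ → ℕ → ℂ
z ^ zero  = 1ℂ
z ^ suc k = z *ᶜ z ^ k

∣_∣ : ℂ → ℝ
∣ z ∣ = √ (re z * re z + im z * im z)

_≈ᶜ_ : ℂ → ℂ → Set
z ≈ᶜ w = re z ≈ re w × im z ≈ im w

-- Apartness, the positive form of z ≠ w.
_#_ : ℂ → ℂ → Set
z # w = re z #ℝ re w ⊎ im z #ℝ im w

------------------------------------------------------------------------
-- Series and complex powers

partialSum : (ℕ → ℂ) → ℕ → ℂ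
partialSum a zero    = 0ℂ
partialSum a (suc n) = partialSum a n +ᶜ a n

HasSum : (ℕ → ℂ) → ℂ → Set
HasSum a s = ∀ ε → 0ℚ ℚ.< ε →
  ∃[ N ] (∀ {n} → N ℕ.≤ n → ∣ partialSum a n -ᶜ s ∣ < fromℚ ε)

-- IsExp z w: w is eᶻ.
IsExp : ℂ → ℂ → Set
IsExp z = HasSum (λ k → fromℝ (fromℚ ((+ 1 ℚ./ k !) {{ℕ._!≢0 k}})) *ᶜ z ^ k)

-- IsLog x l: l is the natural logarithm of x.
IsLog : ℝ → ℝ → Set
IsLog x l = IsExp (fromℝ l) (fromℝ x)

-- IsPower x s w: w is xˢ = exp (s log x).
IsPower : ℝ → ℂ → ℂ → Set
IsPower x s w = Σ[ l ∈ ℝ ] IsLog x l × IsExp (s *ᶜ fromℝ l) w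

------------------------------------------------------------------------
-- The Riemann zeta function

-- The compact sets InCompact 0 ⊆ InCompact 1 ⊆ … exhaust ℂ ∖ {1}.
InCompact : ℕ → ℂ → Set
InCompact n z = ∣ z ∣ ≤ fromℚ (fromℕ n) × fromℚ (mesh n) ≤ ∣ z -ᶜ 1ℂ ∣

-- Complex differentiability on ℂ ∖ {1}, in Bishop's constructive form:
-- the difference quotients converge uniformly on compact sets.  (Classically
-- this is equivalent to complex differentiability at every point.)
record Holomorphic (f : (z : ℂ) → z # 1ℂ → ℂ) : Set where
  field
    derivative     : (z : ℂ) → z # 1ℂ → ℂ
    differentiable : ∀ n ε → 0ℚ ℚ.< ε → Σ[ δ ∈ ℚ ] 0ℚ ℚ.< δ ×
      (∀ z w (z#1 : z # 1ℂ) (w#1 : w # 1ℂ) → InCompact n z → InCompact n w →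
       ∣ w -ᶜ z ∣ ≤ fromℚ δ →
       ∣ f w w#1 -ᶜ f z z#1 -ᶜ derivative z z#1 *ᶜ (w -ᶜ z) ∣ ≤ fromℚ ε * ∣ w -ᶜ z ∣)

-- ζ is the holomorphic function on ℂ ∖ {1} with ζ(s) = Σ_{n≥1} n⁻ˢ for Re s > 1;
-- the identity theorem makes these properties characteristic.
record IsRiemannZeta (ζ : (s : ℂ) → s # 1ℂ → ℂ) : Set where
  field
    ζ-cong      : ∀ {s s′} (p : s # 1ℂ) (p′ : s′ # 1ℂ) → s ≈ᶜ s′ → ζ s p ≈ᶜ ζ s′ p′
    holomorphic : Holomorphic ζ
    dirichlet   : ∀ s (s#1 : s # 1ℂ) → 1ℝ < re s →
      Σ[ a ∈ (ℕ → ℂ) ] (∀ n → IsPower (fromℚ (fromℕ (suc n))) (-ᶜ s) (a n)) × HasSum a (ζ s s#1)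

2≤⇒0< : ∀ t → 2ℝ ≤ t → 0ℝ < t
2≤⇒0< t 2≤t = split (ℚ.≤-total 1ℚ (seq t N))
  where
  open RationalLemmas using (half-above; half-below)
  0<½ : 0ℚ ℚ.< ½
  0<½ = ℚ.positive⁻¹ ½
  near = isCauchy t ½ 0<½
  N = proj₁ near
  split : 1ℚ ℚ.≤ seq t N ⊎ seq t N ℚ.≤ 1ℚ → 0ℝ < t
  split (inj₁ 1≤t) = mk< ½ 0<½ N λ {n} N≤n →
    half-above (seq t N) (seq t n) (proj₂ near ℕ.≤-refl N≤n) 1≤t
  split (inj₂ t≤1) = contradiction
    (mk< ½ 0<½ N λ {n} N≤n → half-below (seq t n) (seq t N) (proj₂ near N≤n ℕ.≤-refl) t≤1)
    2≤t

-- σ + it ≠ 1 when t ≥ 2.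
2≤im⇒#1 : ∀ {σ t} → 2ℝ ≤ t → (σ +i t) # 1ℂ
2≤im⇒#1 {t = t} 2≤t = inj₂ (inj₂ (2≤⇒0< t 2≤t))

{-# OPTIONS --safe #-}

-- Let F n s = Σ_{k ≤ n} k⁻ˢ + (n + 1)⁻ˢ / 2 + (n + 1)¹⁻ˢ / (s - 1).  The trapezoidal rule for ∫ s x⁻ˢ⁻¹ (x - k - 1/2) dx
-- gives σ |F n s - F m s| ≤ (|s| / 2) ((m + 1)^(-σ) - (n + 1)^(-σ)) for m ≤ n and σ = Re s > 0.  With m = 0 this is
-- |F n s| ≤ 1/2 + 1/|s - 1| + |s|/(2σ), which is at most 1 + t/σ in the range considered, so it is enough that F n s → ζ(s).
-- For σ ≥ 5/4 that follows from the Dirichlet series, with error O(1/n).  To reach σ > 0 no contour integrals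
-- are needed: Q = (s - 1)(ζ - F n) is multiplied by W = exp (Λ (u + u²)), u = s - s₀ for the point s₀ in question, and a
-- maximum principle up to a constant is applied on a rectangle around s₀ that extends beyond σ = 5/4.  On the part of its
-- boundary with σ ≤ 5/4, Q is bounded and W is small when Λ is large; on the rest Q is small when n is large.
-- The maximum principle comes from the sums Σ f(r p k) (p (k + 1) - p k) / p k along the boundary vertices p k: as r runs
-- from 0 to 1 they hardly change, since their radial derivative is a Riemann sum of f′ along a closed polygon.

module Submission where

import Defs as D
open import Algebra.Bundles using (CommutativeRing)
import Algebra.Solver.Ring
open import Algebra.Solver.Ring.AlmostCommutativeRing using (fromCommutativeRing; _-Raw-AlmostCommutative⟶_)
open import Algebra.Structures using (IsCommutativeRing)
open import Data.Fin.Base using (Fin; zero; suc)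
open import Data.Fin.Patterns using (0F; 1F; 2F; 3F)
import Data.Integer.Base as ℤ
import Data.Integer.Properties as ℤ
open import Data.Maybe.Base as Maybe using (Maybe)
open import Data.Nat.Base as ℕ using (ℕ; zero; suc; _!)
import Data.Nat.Properties as ℕ
open import Data.Product.Base using (∃-syntax; _×_; _,_; proj₁; proj₂; Σ-syntax)
open import Data.Rational.Base as ℚ using (ℚ; 0ℚ; 1ℚ; ½)
import Data.Rational.Properties as ℚ
open import Data.Rational.Solver using (module +-*-Solver)
import Data.Rational.Unnormalised.Base as ℚᵘ
import Data.Rational.Unnormalised.Properties as ℚᵘ
open import Data.Sum.Base using (inj₁; inj₂)
open import Relation.Binary.Bundles using (Poset)
open import Relation.Binary.Definitions using (tri<; tri≈; tri>)
open import Relation.Binary.PropositionalEquality as ≡ using (_≡_; refl; sym; trans; cong; cong₂; subst; subst₂)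
import Relation.Binary.Reasoning.PartialOrder
import Relation.Binary.Reasoning.Setoid
open import Relation.Nullary.Decidable.Core using (dec⇒maybe; Dec; yes; no)
open import Relation.Nullary.Negation.Core using (¬_; contradiction)
open +-*-Solver using (solve; _:=_; _:+_; _:*_; _:-_; :-_; con)

-- For 0 < σ ≤ 1 the hypotheses give no formula for ζ, only that it is holomorphic, so the
-- convergence F n s → ζ(s) has to be carried over from the half-plane σ > 1; the weighted maximum
-- principle is a quantitative form of the identity theorem. The exponent u + u² is chosen for its
-- real part x + x² - y²: this is 0 at the centre, at most -a/2 on the left side x = -a, and
-- negative on the horizontal sides as long as x ≤ 5/4, where the Dirichlet series takes over. A
-- maximum principle that loses a constant factor is enough, because the bound on the boundary is
-- driven to 0 anyway. Λ is fixed before n, since on the right W may be as large as exp (8Λ). The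
-- order `_≤_` on the reals is a negation, so an inequality may be proved by comparing two reals
-- although that comparison is undecidable; strict positivity, in contrast, needs a witness and is
-- carried along as a positive rational lower bound.

-- Rational estimates: moduli, approximate roots, geometric and factorial bounds.

module Rat where

  open import Data.Rational.Base
  open import Data.Rational.Properties
  open D using (module RationalLemmas)
  open RationalLemmas public using (fromℕ; fromℕ-suc; fromℕ-nonNeg; fromℕ-pos; fromℕ-mono; bound; archimedean;
    mesh; mesh-small; recip; recip-pos; recip-inverse; 0<1; half-pos; p≤∣p∣; ∣p-q∣≡∣q-p∣)
  open RationalLemmas using (*-pos)

  p≤q⇒0≤q-p : ∀ {p q} → p ≤ q → 0ℚ ≤ q - p
  p≤q⇒0≤q-p {p} {q} p≤q = subst (_≤ q - p) (+-inverseʳ p) (+-monoˡ-≤ (- p) p≤q)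

  -- The pattern of most inequalities below, here and later for reals: the difference is written as
  -- a visibly nonnegative expression `e`, and the ring solver checks the identity.
  ≤-by : ∀ {p q} e → 0ℚ ≤ e → q - p ≡ e → p ≤ q
  ≤-by {p} {q} e 0≤e eq = subst₂ _≤_ (+-identityʳ p)
    (trans (cong (p +_) (sym eq)) (solve 2 (λ p q → p :+ (q :- p) := q) refl p q)) (+-monoʳ-≤ p 0≤e)

  +-nonNeg : ∀ {p q} → 0ℚ ≤ p → 0ℚ ≤ q → 0ℚ ≤ p + q
  +-nonNeg {p} {q} 0≤p 0≤q = +-mono-≤ 0≤p 0≤q

  *-nonNeg : ∀ {p q} → 0ℚ ≤ p → 0ℚ ≤ q → 0ℚ ≤ p * q
  *-nonNeg {p} {q} 0≤p 0≤q = nonNegative⁻¹ (p * q)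
    {{nonNeg*nonNeg⇒nonNeg p {{nonNegative 0≤p}} q {{nonNegative 0≤q}}}}

  *-monoʳ-≤ : ∀ {r p q} → 0ℚ ≤ r → p ≤ q → r * p ≤ r * q
  *-monoʳ-≤ {r} 0≤r = *-monoˡ-≤-nonNeg r {{nonNegative 0≤r}}

  square-nonNeg : ∀ p → 0ℚ ≤ p * p
  square-nonNeg p with ≤-total 0ℚ p
  ... | inj₁ 0≤p = *-nonNeg 0≤p 0≤p
  ... | inj₂ p≤0 = subst (0ℚ ≤_) (solve 1 (λ p → :- p :* :- p := p :* p) refl p) (*-nonNeg 0≤-p 0≤-p)
    where 0≤-p = subst (0ℚ ≤_) (+-identityˡ (- p)) (p≤q⇒0≤q-p p≤0)

  -p≤∣p∣ : ∀ p → - p ≤ ∣ p ∣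
  -p≤∣p∣ p = subst (- p ≤_) (∣-p∣≡∣p∣ p) (p≤∣p∣ (- p))

  ∣p∣≤q : ∀ {p q} → p ≤ q → - p ≤ q → ∣ p ∣ ≤ q
  ∣p∣≤q {p} p≤q -p≤q with ∣p∣≡p∨∣p∣≡-p p
  ... | inj₁ eq = subst (_≤ _) (sym eq) p≤q
  ... | inj₂ eq = subst (_≤ _) (sym eq) -p≤q

  half+half : ∀ ε → ½ * ε + ½ * ε ≡ ε
  half+half = solve 1 (λ e → con ½ :* e :+ con ½ :* e := e) refl

  half< : ∀ {ε} → 0ℚ < ε → ½ * ε < ε
  half< {ε} 0<ε = subst₂ _<_ (+-identityʳ (½ * ε)) (half+half ε) (+-monoʳ-< (½ * ε) (half-pos 0<ε))

  -- The radius ε/(C + 1) turns a bound C·δ into a bound below ε.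
  shrink : ∀ {C ε} → 0ℚ ≤ C → 0ℚ < ε → ∃[ δ ] 0ℚ < δ × C * δ ≤ ε
  shrink {C} {ε} 0≤C 0<ε = recip 0<C+1 * ε , *-pos (recip-pos 0<C+1) 0<ε ,
    ≤-by (recip 0<C+1 * ε) (<⇒≤ (*-pos (recip-pos 0<C+1) 0<ε))
      (trans (cong (λ z → z - C * (recip 0<C+1 * ε)) (trans (sym (*-identityˡ ε)) (cong (_* ε) (sym (recip-inverse 0<C+1)))))
        (solve 3 (λ C r e → (C :+ con 1ℚ) :* r :* e :- C :* (r :* e) := r :* e) refl C (recip 0<C+1) ε))
    where
    0<C+1 : 0ℚ < C + 1ℚ
    0<C+1 = +-mono-≤-< 0≤C 0<1

  fromℕ-+ : ∀ m n → fromℕ (m ℕ.+ n) ≡ fromℕ m + fromℕ n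
  fromℕ-+ zero    n = sym (+-identityˡ (fromℕ n))
  fromℕ-+ (suc m) n = trans (fromℕ-suc (m ℕ.+ n)) (trans (cong (1ℚ +_) (fromℕ-+ m n))
    (trans (sym (+-assoc 1ℚ (fromℕ m) (fromℕ n))) (cong (_+ fromℕ n) (sym (fromℕ-suc m)))))

  fromℕ-* : ∀ m n → fromℕ (m ℕ.* n) ≡ fromℕ m * fromℕ n
  fromℕ-* zero    n = sym (*-zeroˡ (fromℕ n))
  fromℕ-* (suc m) n = trans (fromℕ-+ n (m ℕ.* n)) (trans (cong (fromℕ n +_) (fromℕ-* m n))
    (trans (sym (trans (*-distribʳ-+ (fromℕ n) 1ℚ (fromℕ m)) (cong (_+ fromℕ m * fromℕ n) (*-identityˡ (fromℕ n)))))
      (cong (_* fromℕ n) (sym (fromℕ-suc m)))))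

  private
    below-one : ∀ C e d → e * 1ℚ - e * d ≡ (e - (C + e) * d) + C * d
    below-one = solve 3 (λ C e d → e :* con 1ℚ :- e :* d := (e :- (C :+ e) :* d) :+ C :* d) refl

    drop-ε : ∀ C e d → e - C * d ≡ (e - (C + e) * d) + e * d
    drop-ε = solve 3 (λ C e d → e :- C :* d := (e :- (C :+ e) :* d) :+ e :* d) refl

  -- `shrink` is applied to C + ε instead of C: from (C + ε) δ ≤ ε follow both C δ ≤ ε and, after
  -- cancelling ε, δ ≤ 1.
  shrink₁ : ∀ {C ε} → 0ℚ ≤ C → 0ℚ < ε → ∃[ δ ] 0ℚ < δ × δ ≤ 1ℚ × C * δ ≤ ε
  shrink₁ {C} {ε} 0≤C 0<ε = below (shrink (+-nonNeg 0≤C (<⇒≤ 0<ε)) 0<ε)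
    where
    below : ∃[ δ ] 0ℚ < δ × (C + ε) * δ ≤ ε → ∃[ δ ] 0ℚ < δ × δ ≤ 1ℚ × C * δ ≤ ε
    below (δ , 0<δ , h) = δ , 0<δ ,
      *-cancelˡ-≤-pos ε {{positive 0<ε}} (≤-by _ (+-nonNeg (p≤q⇒0≤q-p h) (*-nonNeg 0≤C (<⇒≤ 0<δ))) (below-one C ε δ)) ,
      ≤-by _ (+-nonNeg (p≤q⇒0≤q-p h) (*-nonNeg (<⇒≤ 0<ε) (<⇒≤ 0<δ))) (drop-ε C ε δ)

  open RationalLemmas public using (IsRoot)

  private
    root-above : ∀ r q h B η ε → ε - - (r * r - q) ≡ ((r + h) * (r + h) - q)
      + h * ((B - r) + (B - r)) + h * (1ℚ - h) + (B + B + 1ℚ) * (η - h) + (ε - (B + B + 1ℚ) * η)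
    root-above = solve 6 (λ r q h B d e → e :- :- (r :* r :- q) := ((r :+ h) :* (r :+ h) :- q)
      :+ h :* ((B :- r) :+ (B :- r)) :+ h :* (con 1ℚ :- h)
      :+ (B :+ B :+ con 1ℚ) :* (d :- h) :+ (e :- (B :+ B :+ con 1ℚ) :* d)) refl

    root-below : ∀ r q ε → ε - (r * r - q) ≡ (q - r * r) + ε
    root-below = solve 3 (λ r q e → e :- (r :* r :- q) := (q :- r :* r) :+ e) refl

    root-zero : ∀ q ε → ε - (0ℚ * 0ℚ - q) ≡ q + ε - 0ℚ
    root-zero = solve 2 (λ q e → e :- (con 0ℚ :* con 0ℚ :- q) := q :+ e :- con 0ℚ) refl

  -- From q < (r + h)² one gets q - r² ≤ 2 r h + h² ≤ (2B + 1) η. In the other direction r² ≤ q can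
  -- fail only for r = 0, and there 0 ≤ q + ε takes over: approximants of a nonnegative real may be
  -- slightly negative.
  isRoot-error : ∀ {h q r B η ε} → IsRoot h q r → 0ℚ ≤ h → h ≤ η → η ≤ 1ℚ → r ≤ B → 0ℚ ≤ B →
                 0ℚ ≤ ε → (B + B + 1ℚ) * η ≤ ε → 0ℚ ≤ q + ε → ∣ r * r - q ∣ ≤ ε
  isRoot-error {h} {q} {r} {B} {η} {ε} R 0≤h h≤η η≤1 r≤B 0≤B 0≤ε Cη≤ε 0≤q+ε = ∣p∣≤q (below (IsRoot.lower R))
    (≤-by _ (+-nonNeg (+-nonNeg (+-nonNeg (+-nonNeg
        (p≤q⇒0≤q-p (<⇒≤ (IsRoot.upper R)))
        (*-nonNeg 0≤h (+-nonNeg 0≤B-r 0≤B-r)))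
        (*-nonNeg 0≤h (p≤q⇒0≤q-p (≤-trans h≤η η≤1))))
        (*-nonNeg (+-nonNeg (+-nonNeg 0≤B 0≤B) (<⇒≤ 0<1)) (p≤q⇒0≤q-p h≤η)))
        (p≤q⇒0≤q-p Cη≤ε))
      (root-above r q h B η ε))
    where
    0≤B-r = p≤q⇒0≤q-p r≤B
    below : _ → r * r - q ≤ ε
    below (inj₁ refl)  = ≤-by _ (p≤q⇒0≤q-p 0≤q+ε) (root-zero q ε)
    below (inj₂ r²≤q) = ≤-by _ (+-nonNeg (p≤q⇒0≤q-p r²≤q) 0≤ε) (root-below r q ε)

  private
    product-identity : ∀ x y h A B e → x * y + e - 0ℚ ≡
      (x + h) * (y + h) + h * (A - x) + h * (B - y) + h * (1ℚ - h) + (e - (A + B + 1ℚ) * h)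
    product-identity = solve 6 (λ x y h A B e → x :* y :+ e :- con 0ℚ
      := (x :+ h) :* (y :+ h) :+ h :* (A :- x) :+ h :* (B :- y) :+ h :* (con 1ℚ :- h)
         :+ (e :- (A :+ B :+ con 1ℚ) :* h)) refl

  -- The approximants of nonnegative reals are only known to be at least -η. Expanding (x + η)(y +
  -- η) ≥ 0 costs η (x + y + η), which is at most (A + B + 1) η.
  almost-nonNeg-product : ∀ {x y η A B ε} → 0ℚ ≤ η → η ≤ 1ℚ → (A + B + 1ℚ) * η ≤ ε →
    0ℚ ≤ x + η → 0ℚ ≤ y + η → x ≤ A → y ≤ B → 0ℚ ≤ x * y + ε
  almost-nonNeg-product {x} {y} {η} {A} {B} {ε} 0≤η η≤1 Cη≤ε p q x≤A y≤B = ≤-by _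
    (+-nonNeg (+-nonNeg (+-nonNeg (+-nonNeg (*-nonNeg p q)
      (*-nonNeg 0≤η (p≤q⇒0≤q-p x≤A))) (*-nonNeg 0≤η (p≤q⇒0≤q-p y≤B)))
      (*-nonNeg 0≤η (p≤q⇒0≤q-p η≤1))) (p≤q⇒0≤q-p Cη≤ε))
    (product-identity x y η A B ε)

  opaque
    -- An opaque copy of `fromℕ`: the laws exported with it are all that is used, and goals keep
    -- `nat n` as an atom for the solvers.
    nat : ℕ → ℚ
    nat = fromℕ

    nat≡fromℕ : ∀ n → nat n ≡ fromℕ n
    nat≡fromℕ n = refl

    nat-0 : nat 0 ≡ 0ℚ
    nat-0 = refl

    nat-1 : nat 1 ≡ 1ℚ
    nat-1 = refl

    nat-suc : ∀ n → nat (suc n) ≡ 1ℚ + nat n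
    nat-suc = fromℕ-suc

    nat-nonNeg : ∀ n → 0ℚ ≤ nat n
    nat-nonNeg = fromℕ-nonNeg

    nat-mono : ∀ {m n} → m ℕ.≤ n → nat m ≤ nat n
    nat-mono = fromℕ-mono

    nat-+ : ∀ m n → nat (m ℕ.+ n) ≡ nat m + nat n
    nat-+ = fromℕ-+

    nat-* : ∀ m n → nat (m ℕ.* n) ≡ nat m * nat n
    nat-* = fromℕ-*

    nat-bound : ∀ p → p ≤ nat (bound p)
    nat-bound = archimedean

    -- 1/(n + 1)
    inv : ℕ → ℚ
    inv = mesh

    inv≡mesh : ∀ n → inv n ≡ mesh n
    inv≡mesh n = refl

    inv-pos : ∀ n → 0ℚ < inv n
    inv-pos n = recip-pos (fromℕ-pos n)

    nat*inv : ∀ n → nat (suc n) * inv n ≡ 1ℚ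
    nat*inv n = recip-inverse (fromℕ-pos n)

    inv-small : ∀ ε → 0ℚ < ε → ∃[ N ] (∀ n → N ℕ.≤ n → inv n ≤ ε)
    inv-small ε 0<ε = proj₁ (mesh-small ε 0<ε) , λ n N≤n → <⇒≤ (proj₂ (mesh-small ε 0<ε) {n} N≤n)

  inv-nonNeg : ∀ n → 0ℚ ≤ inv n
  inv-nonNeg n = <⇒≤ (inv-pos n)

  ≤inv : ∀ {p n} → p * nat (suc n) ≤ 1ℚ → p ≤ inv n
  ≤inv {p} {n} h = subst₂ _≤_ (trans (*-assoc p (nat (suc n)) (inv n)) (trans (cong (p *_) (nat*inv n)) (*-identityʳ p)))
    (*-identityˡ (inv n)) (*-monoʳ-≤-nonNeg (inv n) {{nonNegative (inv-nonNeg n)}} h)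

  inv≤ : ∀ {p n} → 1ℚ ≤ p * nat (suc n) → inv n ≤ p
  inv≤ {p} {n} h = subst₂ _≤_ (*-identityˡ (inv n))
    (trans (*-assoc p (nat (suc n)) (inv n)) (trans (cong (p *_) (nat*inv n)) (*-identityʳ p)))
    (*-monoʳ-≤-nonNeg (inv n) {{nonNegative (inv-nonNeg n)}} h)

  ¼ : ℚ
  ¼ = ½ * ½

  quarters : ℕ → ℚ
  quarters zero    = 1ℚ
  quarters (suc k) = ¼ * quarters k

  halves : ℕ → ℚ
  halves zero    = 1ℚ
  halves (suc k) = ½ * halves k

  quarters-nonNeg : ∀ k → 0ℚ ≤ quarters k
  quarters-nonNeg zero    = <⇒≤ 0<1
  quarters-nonNeg (suc k) = *-nonNeg (<⇒≤ (positive⁻¹ ¼)) (quarters-nonNeg k)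

  halves-nonNeg : ∀ k → 0ℚ ≤ halves k
  halves-nonNeg zero    = <⇒≤ 0<1
  halves-nonNeg (suc k) = *-nonNeg (<⇒≤ (positive⁻¹ ½)) (halves-nonNeg k)

  private
    sq-step : ∀ n q → 1ℚ - (1ℚ + (1ℚ + n)) * ((1ℚ + (1ℚ + n)) * (¼ * q)) ≡
      (1ℚ - (1ℚ + n) * ((1ℚ + n) * q)) + q * n * (1ℚ + (½ + ¼) * n)
    sq-step = solve 2 (λ n q → con 1ℚ :- (con 1ℚ :+ (con 1ℚ :+ n)) :* ((con 1ℚ :+ (con 1ℚ :+ n)) :* (con ¼ :* q)) :=
      (con 1ℚ :- (con 1ℚ :+ n) :* ((con 1ℚ :+ n) :* q)) :+ q :* n :* (con 1ℚ :+ (con ½ :+ con ¼) :* n)) refl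

  -- Induction from (k + 2)²/4 ≤ (k + 1)². The square is there so that (k + 1) 4⁻ᵏ still tends to 0
  -- at the rate 1/(k + 1), which absorbs the factor lost in `mertens`.
  square*quarters≤1 : ∀ k → nat (suc k) * (nat (suc k) * quarters k) ≤ 1ℚ
  square*quarters≤1 zero rewrite nat-1 = ≤-refl
  square*quarters≤1 (suc k) = subst (λ n → n * (n * quarters (suc k)) ≤ 1ℚ)
    (sym (trans (nat-suc (suc k)) (cong (1ℚ +_) (nat-suc k))))
    (≤-by _ (+-nonNeg (p≤q⇒0≤q-p (subst (λ n → n * (n * quarters k) ≤ 1ℚ) (nat-suc k) (square*quarters≤1 k)))
        (*-nonNeg (*-nonNeg (quarters-nonNeg k) (nat-nonNeg k))
          (+-nonNeg (<⇒≤ 0<1) (*-nonNeg (<⇒≤ (positive⁻¹ (½ + ¼))) (nat-nonNeg k)))))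
      (sq-step (nat k) (quarters k)))

  nat*quarters≤inv : ∀ k → nat (suc k) * quarters k ≤ inv k
  nat*quarters≤inv k = ≤inv (subst (_≤ 1ℚ) (*-comm (nat (suc k)) (nat (suc k) * quarters k)) (square*quarters≤1 k))

  1≤nat : ∀ k → 1ℚ ≤ nat (suc k)
  1≤nat k = subst (_≤ nat (suc k)) nat-1 (nat-mono (ℕ.s≤s (ℕ.z≤n {k})))

  quarters≤inv : ∀ k → quarters k ≤ inv k
  quarters≤inv k = ≤-trans (subst₂ _≤_ (*-identityˡ (quarters k)) refl
    (*-monoʳ-≤-nonNeg (quarters k) {{nonNegative (quarters-nonNeg k)}}
      (subst (1ℚ ≤_) (sym (nat-suc k)) (≤-by (nat k) (nat-nonNeg k) (solve 1 (λ n → con 1ℚ :+ n :- con 1ℚ := n) refl (nat k))))))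
    (nat*quarters≤inv k)

  private
    four : ∀ C q → (¼ + ¼ + (¼ + ¼)) * C * q ≡ C * q
    four = solve 2 (λ C q → (con ¼ :+ con ¼ :+ (con ¼ :+ con ¼)) :* C :* q := C :* q) refl

    bound-suc : ∀ M C q → (M + fromℕ 4 * C) * (¼ * q) - C * q ≡ M * (¼ * q)
    bound-suc = solve 3 (λ M C q → (M :+ con (fromℕ 4) :* C) :* (con ¼ :* q) :- C :* q := M :* (con ¼ :* q)) refl

  -- The exceptional indices below m are peeled off one at a time. A bound C 4⁻ᵏ for the shifted
  -- sequence is 4C · 4⁻⁽ᵏ⁺¹⁾ for the original one, whence the new constant M 0 + 4C.
  dominated : ∀ m (M : ℕ → ℚ) → (∀ k → 0ℚ ≤ M k) → (∀ k → m ℕ.≤ k → M (suc k) ≤ ¼ * M k) →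
              ∃[ C ] 0ℚ ≤ C × (∀ k → M k ≤ C * quarters k)
  dominated zero M 0≤M h = M 0 , 0≤M 0 , go
    where
    go : ∀ k → M k ≤ M 0 * quarters k
    go zero    = ≤-reflexive (sym (*-identityʳ (M 0)))
    go (suc k) = ≤-trans (h k ℕ.z≤n) (subst (¼ * M k ≤_)
      (solve 3 (λ a m q → a :* (m :* q) := m :* (a :* q)) refl ¼ (M 0) (quarters k))
      (*-monoˡ-≤-nonNeg ¼ (go k)))
  dominated (suc m) M 0≤M h = extend (dominated m (λ k → M (suc k)) (λ k → 0≤M (suc k)) λ k m≤k → h (suc k) (ℕ.s≤s m≤k))
    where
    extend : ∃[ C ] 0ℚ ≤ C × (∀ k → M (suc k) ≤ C * quarters k) → ∃[ C ] 0ℚ ≤ C × (∀ k → M k ≤ C * quarters k)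
    extend (C , 0≤C , b) = M 0 + fromℕ 4 * C , +-nonNeg (0≤M 0) (*-nonNeg (<⇒≤ (positive⁻¹ (fromℕ 4))) 0≤C) , go
      where
      go : ∀ k → M k ≤ (M 0 + fromℕ 4 * C) * quarters k
      go zero    = ≤-by (fromℕ 4 * C) (*-nonNeg (<⇒≤ (positive⁻¹ (fromℕ 4))) 0≤C)
        (solve 2 (λ m c → (m :+ c) :* con 1ℚ :- m := c) refl (M 0) (fromℕ 4 * C))
      go (suc k) = ≤-trans (b k) (≤-by _ (*-nonNeg (0≤M 0) (quarters-nonNeg (suc k))) (bound-suc (M 0) C (quarters k)))

  1/n*n : ∀ n .{{_ : ℕ.NonZero n}} → (ℤ.+ 1 / n) * fromℕ n ≡ 1ℚ
  1/n*n (suc n) = toℚᵘ-injective (ℚᵘ.≃-trans (toℚᵘ-homo-* (ℤ.+ 1 / suc n) (fromℕ (suc n)))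
    (ℚᵘ.≃-trans (ℚᵘ.*-cong (toℚᵘ-fromℚᵘ (ℚᵘ.mkℚᵘ (ℤ.+ 1) n)) (toℚᵘ-fromℚᵘ (ℚᵘ.mkℚᵘ (ℤ.+ suc n) 0)))
      (ℚᵘ.*≡* (trans (ℤ.*-identityʳ _) (trans (ℤ.*-identityˡ (ℤ.+ suc n))
        (sym (trans (ℤ.*-identityˡ (ℤ.+ (suc n ℕ.* 1))) (cong ℤ.+_ (ℕ.*-identityʳ (suc n))))))))))

  inverse-unique : ∀ {p q r} → p * r ≡ 1ℚ → q * r ≡ 1ℚ → p ≡ q
  inverse-unique {p} {q} {r} pr qr = trans (sym (*-identityʳ p)) (trans (cong (p *_) (sym qr))
    (trans (solve 3 (λ p q r → p :* (q :* r) := q :* (p :* r)) refl p q r) (trans (cong (q *_) pr) (*-identityʳ q))))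

  opaque
    unfolding inv

    inv-0 : inv 0 ≡ 1ℚ
    inv-0 = refl

    1/n! : ℕ → ℚ
    1/n! n = (ℤ.+ 1 / (n !)) {{n ℕ.!≢0}}

    1/n!≡ : ∀ n → 1/n! n ≡ (ℤ.+ 1 / (n !)) {{n ℕ.!≢0}}
    1/n!≡ n = refl

    1/0! : 1/n! 0 ≡ 1ℚ
    1/0! = refl

    1/suc! : ∀ n → 1/n! (suc n) ≡ inv n * 1/n! n
    1/suc! n = inverse-unique {r = fromℕ (suc n !)} (1/n*n (suc n !) {{suc n ℕ.!≢0}})
      (trans (cong (inv n * 1/n! n *_) (fromℕ-* (suc n) (n !)))
        (trans (solve 4 (λ a b c d → a :* b :* (c :* d) := (c :* a) :* (b :* d)) refl (inv n) (1/n! n) (fromℕ (suc n)) (fromℕ (n !)))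
          (trans (cong (_* (1/n! n * fromℕ (n !))) (nat*inv n)) (trans (*-identityˡ _) (1/n*n (n !) {{n ℕ.!≢0}})))))

  ⊓-pos : ∀ {p q} → 0ℚ < p → 0ℚ < q → 0ℚ < p ⊓ q
  ⊓-pos {p} {q} 0<p 0<q with ⊓-sel p q
  ... | inj₁ eq = subst (0ℚ <_) (sym eq) 0<p
  ... | inj₂ eq = subst (0ℚ <_) (sym eq) 0<q

-- Cauchy reals: ring structure, order, completeness, square roots and division.

module Real where

  open Rat using (mesh)
  open D public using (ℝ; _≈_)
  open D using (mkℝ; mk≈; mk<)
  open ℝ using (seq; isCauchy)

  infix  4 _≤_
  infixl 6 _+_ _-_
  infixl 7 _*_
  infix  8 -_

  Eventually : (ℕ → Set) → Set
  Eventually P = ∃[ N ] (∀ n → N ℕ.≤ n → P n)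

  eventually-map : ∀ {P Q : ℕ → Set} → (∀ n → P n → Q n) → Eventually P → Eventually Q
  eventually-map f (N , p) = N , λ n N≤n → f n (p n N≤n)

  eventually-map₂ : ∀ {P Q R : ℕ → Set} → (∀ n → P n → Q n → R n) →
                    Eventually P → Eventually Q → Eventually R
  eventually-map₂ f (M , p) (N , q) = M ℕ.⊔ N , λ n M⊔N≤n →
    f n (p n (ℕ.m⊔n≤o⇒m≤o M N M⊔N≤n)) (q n (ℕ.m⊔n≤o⇒n≤o M N M⊔N≤n))

  -- Opaque copies of the operations of Defs: the sequences inside a real never unfold.
  opaque
    _+_ _*_ : ℝ → ℝ → ℝ
    _+_ = D._+_
    _*_ = D._*_

    -_ : ℝ → ℝ
    -_ = D.-_

    ι : ℚ → ℝ
    ι = D.fromℚ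

    _≤_ : ℝ → ℝ → Set
    _≤_ = D._≤_

  _-_ : ℝ → ℝ → ℝ
  x - y = x + - y

  private
    close-gap : ∀ xk xn yk yn δ → xk ℚ.- xn ℚ.≤ δ → yn ℚ.- yk ℚ.≤ δ →
                yk ℚ.+ (δ ℚ.+ δ ℚ.+ δ) ℚ.≤ xk → yn ℚ.+ δ ℚ.≤ xn
    close-gap xk xn yk yn δ x≥ y≤ lt = Rat.≤-by _
      (Rat.+-nonNeg (Rat.+-nonNeg (Rat.p≤q⇒0≤q-p x≥) (Rat.p≤q⇒0≤q-p y≤)) (Rat.p≤q⇒0≤q-p lt))
      (solve 5 (λ xk xn yk yn d → xn :- (yn :+ d) := (d :- (xk :- xn)) :+ (d :- (yn :- yk)) :+ (xk :- (yk :+ (d :+ d :+ d))))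
        ≡.refl xk xn yk yn δ)

    close-elim : ∀ xk xn yk yn ε → let δ = ½ ℚ.* (½ ℚ.* (½ ℚ.* ε)) in 0ℚ ℚ.≤ δ →
                 xn ℚ.- xk ℚ.≤ δ → yk ℚ.- yn ℚ.≤ δ → xk ℚ.≤ yk ℚ.+ (δ ℚ.+ δ ℚ.+ δ) → xn ℚ.≤ yn ℚ.+ ε
    close-elim xk xn yk yn ε 0≤δ x≤ y≥ key = Rat.≤-by _
      (Rat.+-nonNeg (Rat.+-nonNeg (Rat.+-nonNeg (Rat.p≤q⇒0≤q-p x≤) (Rat.p≤q⇒0≤q-p y≥)) (Rat.p≤q⇒0≤q-p key))
        (Rat.+-nonNeg (Rat.+-nonNeg 0≤δ 0≤δ) 0≤δ))
      (solve 5 (λ xk xn yk yn e → let q = con ½ :* (con ½ :* (con ½ :* e)) in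
          yn :+ e :- xn := (q :- (xn :- xk)) :+ (q :- (yk :- yn)) :+ (yk :+ (q :+ q :+ q) :- xk) :+ (q :+ q :+ q))
        ≡.refl xk xn yk yn ε)

    pointwise : ∀ {x y} → (∀ n → seq x n ≡ seq y n) → x ≈ y
    pointwise {x} {y} eq = mk≈ λ ε 0<ε → 0 , λ {n} _ → ≡.subst (ℚ._< ε)
      (≡.sym (≡.trans (≡.cong (λ z → ℚ.∣ z ℚ.- seq y n ∣) (eq n)) (≡.cong ℚ.∣_∣ (ℚ.+-inverseʳ (seq y n))))) 0<ε

    near : ∀ {x y} → x ≈ y → ∀ {ε} → 0ℚ ℚ.< ε → Eventually λ n → ℚ.∣ seq x n ℚ.- seq y n ∣ ℚ.≤ ε
    near x≈y 0<ε with D._≈_.close x≈y _ 0<ε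
    ... | N , d = N , λ n N≤n → ℚ.<⇒≤ (d N≤n)

    from-near : ∀ {x y} → (∀ ε → 0ℚ ℚ.< ε → Eventually λ n → ℚ.∣ seq x n ℚ.- seq y n ∣ ℚ.≤ ε) → x ≈ y
    from-near h = mk≈ λ ε 0<ε → let (N , d) = h (½ ℚ.* ε) (Rat.half-pos 0<ε)
      in N , λ {n} N≤n → ℚ.≤-<-trans (d n N≤n) (Rat.half< 0<ε)

    bounded : ∀ x → ∃[ B ] 0ℚ ℚ.≤ B × Eventually λ n → ℚ.∣ seq x n ∣ ℚ.≤ B
    bounded x with D.CauchyLemmas.eventuallyBounded (seq x) (isCauchy x)
    ... | B , 0<B , N , b = B , ℚ.<⇒≤ 0<B , N , λ n N≤n → b N≤n

  ≈-refl : ∀ {x} → x ≈ x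
  ≈-refl = pointwise λ _ → ≡.refl

  ≈-sym : ∀ {x y} → x ≈ y → y ≈ x
  ≈-sym {x} {y} x≈y = from-near λ ε 0<ε →
    eventually-map (λ n → ≡.subst (ℚ._≤ ε) (Rat.∣p-q∣≡∣q-p∣ (seq x n) (seq y n))) (near x≈y 0<ε)

  private
    triangle : ∀ a b c {ε δ} → ℚ.∣ a ℚ.- b ∣ ℚ.≤ ε → ℚ.∣ b ℚ.- c ∣ ℚ.≤ δ → ℚ.∣ a ℚ.- c ∣ ℚ.≤ ε ℚ.+ δ
    triangle a b c p q = ℚ.≤-trans
      (≡.subst (λ z → ℚ.∣ z ∣ ℚ.≤ ℚ.∣ a ℚ.- b ∣ ℚ.+ ℚ.∣ b ℚ.- c ∣)
        (solve 3 (λ a b c → (a :- b) :+ (b :- c) := a :- c) ≡.refl a b c)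
        (ℚ.∣p+q∣≤∣p∣+∣q∣ (a ℚ.- b) (b ℚ.- c)))
      (ℚ.+-mono-≤ p q)

  ≈-trans : ∀ {x y z} → x ≈ y → y ≈ z → x ≈ z
  ≈-trans {x} {y} {z} x≈y y≈z = from-near λ ε 0<ε → eventually-map₂
    (λ n p q → ≡.subst (_ ℚ.≤_) (Rat.half+half ε) (triangle (seq x n) (seq y n) (seq z n) p q))
    (near x≈y (Rat.half-pos 0<ε)) (near y≈z (Rat.half-pos 0<ε))

  opaque
    unfolding _+_
    private
      +-cong : ∀ {x y u v} → x ≈ y → u ≈ v → x + u ≈ y + v
      +-cong {x} {y} {u} {v} x≈y u≈v = from-near λ ε 0<ε → eventually-map₂
        (λ n p q → ≡.subst₂ (λ z e → ℚ.∣ z ∣ ℚ.≤ e)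
          (solve 4 (λ a b c d → (a :- b) :+ (c :- d) := (a :+ c) :- (b :+ d)) ≡.refl (seq x n) (seq y n) (seq u n) (seq v n))
          (Rat.half+half ε)
          (ℚ.≤-trans (ℚ.∣p+q∣≤∣p∣+∣q∣ (seq x n ℚ.- seq y n) (seq u n ℚ.- seq v n)) (ℚ.+-mono-≤ p q)))
        (near x≈y (Rat.half-pos 0<ε)) (near u≈v (Rat.half-pos 0<ε))

      neg-cong : ∀ {x y} → x ≈ y → - x ≈ - y
      neg-cong {x} {y} x≈y = from-near λ ε 0<ε → eventually-map
        (λ n → ≡.subst (ℚ._≤ ε) (≡.trans (≡.sym (ℚ.∣-p∣≡∣p∣ (seq x n ℚ.- seq y n)))
          (≡.cong ℚ.∣_∣ (solve 2 (λ a b → :- (a :- b) := :- a :- :- b) ≡.refl (seq x n) (seq y n)))))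
        (near x≈y 0<ε)

      *-congˡ : ∀ {x y} z → x ≈ y → z * x ≈ z * y
      *-congˡ {x} {y} z x≈y with bounded z
      ... | B , 0≤B , z≤B = from-near λ ε 0<ε → let (δ , 0<δ , Bδ≤ε) = Rat.shrink 0≤B 0<ε in
        eventually-map₂ (λ n p q → ℚ.≤-trans (ℚ.≤-reflexive (≡.trans
            (≡.cong ℚ.∣_∣ (solve 3 (λ z a b → z :* a :- z :* b := z :* (a :- b)) ≡.refl (seq z n) (seq x n) (seq y n)))
            (ℚ.∣p*q∣≡∣p∣*∣q∣ (seq z n) (seq x n ℚ.- seq y n))))
          (ℚ.≤-trans (D.RationalLemmas.*-mono (ℚ.0≤∣p∣ _) 0≤B p q) Bδ≤ε)) z≤B (near x≈y 0<δ)

      *-comm : ∀ x y → x * y ≈ y * x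
      *-comm x y = pointwise λ n → ℚ.*-comm (seq x n) (seq y n)

      *-cong : ∀ {x y u v} → x ≈ y → u ≈ v → x * u ≈ y * v
      *-cong {x} {y} {u} {v} x≈y u≈v = ≈-trans (*-comm x u) (≈-trans (*-congˡ u x≈y)
        (≈-trans (*-comm u y) (*-congˡ y u≈v)))

    ℝ-isCommutativeRing : IsCommutativeRing _≈_ _+_ _*_ -_ (ι 0ℚ) (ι 1ℚ)
    ℝ-isCommutativeRing = record
        { isRing = record
          { +-isAbelianGroup = record
            { isGroup = record
              { isMonoid = record
                { isSemigroup = record
                  { isMagma = record
                    { isEquivalence = record { refl = ≈-refl ; sym = ≈-sym ; trans = ≈-trans }
                    ; ∙-cong = +-cong }
                  ; assoc = λ x y z → pointwise λ n → ℚ.+-assoc (seq x n) (seq y n) (seq z n) }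
                ; identity = (λ x → pointwise λ n → ℚ.+-identityˡ (seq x n)) , λ x → pointwise λ n → ℚ.+-identityʳ (seq x n) }
              ; inverse = (λ x → pointwise λ n → ℚ.+-inverseˡ (seq x n)) , λ x → pointwise λ n → ℚ.+-inverseʳ (seq x n)
              ; ⁻¹-cong = neg-cong }
            ; comm = λ x y → pointwise λ n → ℚ.+-comm (seq x n) (seq y n) }
          ; *-cong = *-cong
          ; *-assoc = λ x y z → pointwise λ n → ℚ.*-assoc (seq x n) (seq y n) (seq z n)
          ; *-identity = (λ x → pointwise λ n → ℚ.*-identityˡ (seq x n)) , λ x → pointwise λ n → ℚ.*-identityʳ (seq x n)
          ; distrib = (λ x y z → pointwise λ n → ℚ.*-distribˡ-+ (seq x n) (seq y n) (seq z n))
                    , λ x y z → pointwise λ n → ℚ.*-distribʳ-+ (seq x n) (seq y n) (seq z n) }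
        ; *-comm = *-comm }

    ι-+ : ∀ p q → ι (p ℚ.+ q) ≈ ι p + ι q
    ι-+ p q = pointwise λ _ → ≡.refl

    ι-* : ∀ p q → ι (p ℚ.* q) ≈ ι p * ι q
    ι-* p q = pointwise λ _ → ≡.refl

    ι-neg : ∀ p → ι (ℚ.- p) ≈ - ι p
    ι-neg p = pointwise λ _ → ≡.refl

    private
      ≤-intro : ∀ {x y} → (∀ ε → 0ℚ ℚ.< ε → Eventually λ n → seq x n ℚ.≤ seq y n ℚ.+ ε) → x ≤ y
      ≤-intro {x} {y} h (mk< g 0<g N sep) =
        let (M , p) = h (½ ℚ.* g) (Rat.half-pos 0<g)
            k = M ℕ.⊔ N
        in ℚ.<-irrefl ≡.refl (ℚ.<-≤-trans (ℚ.+-monoʳ-< (seq y k) (Rat.half< 0<g))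
             (ℚ.≤-trans (sep (ℕ.m≤n⊔m M N)) (p k (ℕ.m≤m⊔n M N))))

      -- No search is involved. From the index k on, both sequences vary by less than δ = ε/8, and
      -- at k the comparison of rationals is decidable: if x k exceeded y k by 3δ, an excess of δ
      -- would persist and witness y < x, which is refuted. Hence x n ≤ y n + 5δ for every later n.
      ≤-elim : ∀ {x y} → x ≤ y → ∀ ε → 0ℚ ℚ.< ε → Eventually λ n → seq x n ℚ.≤ seq y n ℚ.+ ε
      ≤-elim {x} {y} x≤y ε 0<ε = fromCauchy (isCauchy x δ 0<δ) (isCauchy y δ 0<δ)
        where
        δ : ℚ
        δ = ½ ℚ.* (½ ℚ.* (½ ℚ.* ε))
        0<δ : 0ℚ ℚ.< δ
        0<δ = Rat.half-pos (Rat.half-pos (Rat.half-pos 0<ε))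
        fromCauchy : ∃[ M ] (∀ {m n} → M ℕ.≤ m → M ℕ.≤ n → ℚ.∣ seq x m ℚ.- seq x n ∣ ℚ.< δ) →
                     ∃[ N ] (∀ {m n} → N ℕ.≤ m → N ℕ.≤ n → ℚ.∣ seq y m ℚ.- seq y n ∣ ℚ.< δ) →
                     Eventually λ n → seq x n ℚ.≤ seq y n ℚ.+ ε
        fromCauchy (M , dx) (N , dy) = M ℕ.⊔ N , λ n k≤n →
          close-elim (seq x k) (seq x n) (seq y k) (seq y n) ε (ℚ.<⇒≤ 0<δ)
            (ℚ.≤-trans (Rat.p≤∣p∣ _) (ℚ.<⇒≤ (dx (ℕ.≤-trans kM k≤n) kM)))
            (ℚ.≤-trans (Rat.p≤∣p∣ _) (ℚ.<⇒≤ (dy kN (ℕ.≤-trans kN k≤n)))) key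
          where
          k : ℕ
          k = M ℕ.⊔ N
          kM : M ℕ.≤ k
          kM = ℕ.m≤m⊔n M N
          kN : N ℕ.≤ k
          kN = ℕ.m≤n⊔m M N
          key : seq x k ℚ.≤ seq y k ℚ.+ (δ ℚ.+ δ ℚ.+ δ)
          key = ℚ.≮⇒≥ λ lt → x≤y (mk< δ 0<δ k λ {n} k≤n →
            close-gap (seq x k) (seq x n) (seq y k) (seq y n) δ
              (ℚ.≤-trans (Rat.p≤∣p∣ _) (ℚ.<⇒≤ (dx kM (ℕ.≤-trans kM k≤n))))
              (ℚ.≤-trans (Rat.p≤∣p∣ _) (ℚ.<⇒≤ (dy (ℕ.≤-trans kN k≤n) kN))) (ℚ.<⇒≤ lt))

      eventually-≤ : ∀ {x y} → Eventually (λ n → seq x n ℚ.≤ seq y n) → x ≤ y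
      eventually-≤ {x} {y} h = ≤-intro λ ε 0<ε → eventually-map
        (λ n p → ℚ.≤-trans p (≡.subst (ℚ._≤ seq y n ℚ.+ ε) (ℚ.+-identityʳ (seq y n)) (ℚ.+-monoʳ-≤ (seq y n) (ℚ.<⇒≤ 0<ε)))) h

    ≤-reflexive : ∀ {x y} → x ≈ y → x ≤ y
    ≤-reflexive {x} {y} x≈y = ≤-intro λ ε 0<ε → eventually-map
      (λ n p → Rat.≤-by _ (Rat.p≤q⇒0≤q-p (ℚ.≤-trans (Rat.p≤∣p∣ _) p))
        (solve 3 (λ a b e → b :+ e :- a := e :- (a :- b)) ≡.refl (seq x n) (seq y n) ε)) (near x≈y 0<ε)

    ≤-trans : ∀ {x y z} → x ≤ y → y ≤ z → x ≤ z
    ≤-trans {x} {y} {z} x≤y y≤z = ≤-intro λ ε 0<ε → eventually-map₂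
      (λ n p q → Rat.≤-by _ (Rat.+-nonNeg (Rat.p≤q⇒0≤q-p p) (Rat.p≤q⇒0≤q-p q))
        (solve 4 (λ a b c e → c :+ e :- a := (b :+ con ½ :* e :- a) :+ (c :+ con ½ :* e :- b))
          ≡.refl (seq x n) (seq y n) (seq z n) ε))
      (≤-elim x≤y _ (Rat.half-pos 0<ε)) (≤-elim y≤z _ (Rat.half-pos 0<ε))

    ≤-antisym : ∀ {x y} → x ≤ y → y ≤ x → x ≈ y
    ≤-antisym {x} {y} x≤y y≤x = from-near λ ε 0<ε → eventually-map₂
      (λ n p q → Rat.∣p∣≤q
        (Rat.≤-by _ (Rat.p≤q⇒0≤q-p p) (solve 3 (λ a b e → e :- (a :- b) := b :+ e :- a) ≡.refl (seq x n) (seq y n) ε))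
        (Rat.≤-by _ (Rat.p≤q⇒0≤q-p q) (solve 3 (λ a b e → e :- :- (a :- b) := a :+ e :- b) ≡.refl (seq x n) (seq y n) ε)))
      (≤-elim x≤y ε 0<ε) (≤-elim y≤x ε 0<ε)

    +-mono-≤ : ∀ {x y u v} → x ≤ y → u ≤ v → x + u ≤ y + v
    +-mono-≤ {x} {y} {u} {v} x≤y u≤v = ≤-intro λ ε 0<ε → eventually-map₂
      (λ n p q → Rat.≤-by _ (Rat.+-nonNeg (Rat.p≤q⇒0≤q-p p) (Rat.p≤q⇒0≤q-p q))
        (solve 5 (λ a b c d e → b :+ d :+ e :- (a :+ c) := (b :+ con ½ :* e :- a) :+ (d :+ con ½ :* e :- c))
          ≡.refl (seq x n) (seq y n) (seq u n) (seq v n) ε))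
      (≤-elim x≤y _ (Rat.half-pos 0<ε)) (≤-elim u≤v _ (Rat.half-pos 0<ε))

    *-nonNeg : ∀ {x y} → ι 0ℚ ≤ x → ι 0ℚ ≤ y → ι 0ℚ ≤ x * y
    *-nonNeg {x} {y} 0≤x 0≤y with bounded x | bounded y
    ... | A , 0≤A , x≤A | B , 0≤B , y≤B = ≤-intro λ ε 0<ε →
      choose ε (Rat.shrink₁ (Rat.+-nonNeg (Rat.+-nonNeg 0≤A 0≤B) (ℚ.<⇒≤ Rat.0<1)) 0<ε)
      where
      choose : ∀ ε → ∃[ η ] 0ℚ ℚ.< η × η ℚ.≤ 1ℚ × (A ℚ.+ B ℚ.+ 1ℚ) ℚ.* η ℚ.≤ ε →
               Eventually λ n → 0ℚ ℚ.≤ seq x n ℚ.* seq y n ℚ.+ ε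
      choose ε (η , 0<η , η≤1 , Cη≤ε) = eventually-map₂
        (λ n (p , x≤) (q , y≤) → Rat.almost-nonNeg-product (ℚ.<⇒≤ 0<η) η≤1 Cη≤ε p q x≤ y≤)
        (eventually-map₂ (λ n p q → p , ℚ.≤-trans (Rat.p≤∣p∣ _) q) (≤-elim 0≤x η 0<η) x≤A)
        (eventually-map₂ (λ n p q → p , ℚ.≤-trans (Rat.p≤∣p∣ _) q) (≤-elim 0≤y η 0<η) y≤B)

    ι-mono : ∀ {p q} → p ℚ.≤ q → ι p ≤ ι q
    ι-mono p≤q = eventually-≤ (0 , λ _ _ → p≤q)

    ι-cancel : ∀ {p q} → ι p ≤ ι q → p ℚ.≤ q
    ι-cancel {p} {q} ιp≤ιq = ℚ.≮⇒≥ λ q<p → ιp≤ιq (mk< (p ℚ.- q)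
      (≡.subst (ℚ._< p ℚ.- q) (ℚ.+-inverseʳ q) (ℚ.+-monoˡ-< (ℚ.- q) q<p)) 0
      λ _ → ℚ.≤-reflexive (solve 2 (λ p q → q :+ (p :- q) := p) ≡.refl p q))

    -- A strict inequality needs a witness, and the rational margin q - p provides it: one half
    -- becomes the gap, the other half absorbs the error of `≤-elim`.
    ≤⇒< : ∀ {p q x} → p ℚ.< q → ι q ≤ x → D.fromℚ p D.< x
    ≤⇒< {p} {q} {x} p<q q≤x = mk< (½ ℚ.* (q ℚ.- p)) 0<½ (proj₁ e) λ {n} h → Rat.≤-by _ (Rat.p≤q⇒0≤q-p (proj₂ e n h))
        (solve 3 (λ p q x → x :- (p :+ con ½ :* (q :- p)) := x :+ con ½ :* (q :- p) :- q) ≡.refl p q (seq x n))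
      where
      0<½ : 0ℚ ℚ.< ½ ℚ.* (q ℚ.- p)
      0<½ = Rat.half-pos (≡.subst (ℚ._< q ℚ.- p) (ℚ.+-inverseʳ p) (ℚ.+-monoˡ-< (ℚ.- p) p<q))
      e : Eventually λ n → q ℚ.≤ seq x n ℚ.+ ½ ℚ.* (q ℚ.- p)
      e = ≤-elim q≤x (½ ℚ.* (q ℚ.- p)) 0<½

    <⇒gap : ∀ {x} → D.0ℝ D.< x → ∃[ q ] 0ℚ ℚ.< q × ι q ≤ x
    <⇒gap {x} (mk< g 0<g M p) = g , 0<g , eventually-≤ (M , λ n M≤n → ≡.subst (ℚ._≤ seq x n) (ℚ.+-identityˡ g) (p M≤n))

    <⇒≤ : ∀ {x y} → x D.< y → x ≤ y
    <⇒≤ {x} {y} (mk< g 0<g M p) = eventually-≤ (M , λ n M≤n →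
      ℚ.≤-trans (ℚ.<⇒≤ (D.RationalLemmas.p<p+q (seq x n) 0<g)) (p M≤n))

    -- The order is a negative statement, so it may be proved by cases.
    ≤-cases : ∀ {x y u v} → (x ≤ y → u ≤ v) → (y ≤ x → u ≤ v) → u ≤ v
    ≤-cases f g v<u = f (λ y<x → g (λ x<y → asym y<x x<y) v<u) v<u
      where
      asym : ∀ {a b} → a D.< b → ¬ (b D.< a)
      asym {a} {b} (mk< g 0<g M p) (mk< h 0<h N q) = ℚ.<-irrefl ≡.refl
        (ℚ.<-≤-trans (D.RationalLemmas.p<p+q (seq a k) 0<g) (ℚ.≤-trans (p (ℕ.m≤m⊔n M N))
          (ℚ.≤-trans (ℚ.<⇒≤ (D.RationalLemmas.p<p+q (seq b k) 0<h)) (q (ℕ.m≤n⊔m M N)))))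
        where
        k : ℕ
        k = M ℕ.⊔ N

    ≤-limit : ∀ {x y} → (∀ ε → 0ℚ ℚ.< ε → x ≤ y + ι ε) → x ≤ y
    ≤-limit {x} {y} h = ≤-intro λ ε 0<ε → eventually-map
      (λ n → ≡.subst (seq x n ℚ.≤_) (≡.trans (ℚ.+-assoc (seq y n) (½ ℚ.* ε) (½ ℚ.* ε)) (≡.cong (seq y n ℚ.+_) (Rat.half+half ε))))
      (≤-elim (h _ (Rat.half-pos 0<ε)) _ (Rat.half-pos 0<ε))

    upperBound : ∀ x → ∃[ n ] x ≤ ι (Rat.nat n)
    upperBound x = choose (bounded x)
      where
      choose : ∃[ B ] 0ℚ ℚ.≤ B × Eventually (λ n → ℚ.∣ seq x n ∣ ℚ.≤ B) → ∃[ n ] x ≤ ι (Rat.nat n)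
      choose (B , _ , x≤B) = Rat.bound B , eventually-≤ (eventually-map
        (λ n p → ℚ.≤-trans (ℚ.≤-trans (Rat.p≤∣p∣ (seq x n)) p) (Rat.nat-bound B)) x≤B)

    private
      approximations : ∀ x ε → 0ℚ ℚ.< ε → ∃[ q ] x ≤ ι q + ι ε × ι q ≤ x + ι ε
      approximations x ε 0<ε =
        let (N , d) = isCauchy x ε 0<ε in seq x N ,
        eventually-≤ (N , λ n N≤n → Rat.≤-by _ (Rat.p≤q⇒0≤q-p (ℚ.≤-trans (Rat.p≤∣p∣ _) (ℚ.<⇒≤ (d N≤n ℕ.≤-refl))))
          (solve 3 (λ a b e → b :+ e :- a := e :- (a :- b)) ≡.refl (seq x n) (seq x N) ε)) ,
        eventually-≤ (N , λ n N≤n → Rat.≤-by _ (Rat.p≤q⇒0≤q-p (ℚ.≤-trans (Rat.p≤∣p∣ _) (ℚ.<⇒≤ (d ℕ.≤-refl N≤n))))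
          (solve 3 (λ a b e → b :+ e :- a := e :- (a :- b)) ≡.refl (seq x N) (seq x n) ε))

      fromSeq : ∀ (x : ℕ → ℚ) c N q ε → (∀ n → N ℕ.≤ n → ℚ.∣ x n ℚ.- q ∣ ℚ.≤ ε) →
                mkℝ x c ≤ ι q + ι ε × ι q ≤ mkℝ x c + ι ε
      fromSeq x c N q ε d =
        eventually-≤ (N , λ n N≤n → Rat.≤-by _ (Rat.p≤q⇒0≤q-p (ℚ.≤-trans (Rat.p≤∣p∣ _) (d n N≤n)))
          (solve 3 (λ a b e → b :+ e :- a := e :- (a :- b)) ≡.refl (x n) q ε)) ,
        eventually-≤ (N , λ n N≤n → Rat.≤-by _ (Rat.p≤q⇒0≤q-p (ℚ.≤-trans (Rat.-p≤∣p∣ _) (d n N≤n)))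
          (solve 3 (λ a b e → a :+ e :- b := e :- :- (a :- b)) ≡.refl (x n) q ε))

    private
      root-error : ∀ {x} → ι 0ℚ ≤ x → ∀ {B η ε} → (∃[ M ] (∀ {n} → M ℕ.≤ n → mesh n ℚ.< η)) →
        0ℚ ℚ.≤ B → (Eventually λ n → ℚ.∣ seq (D.√ x) n ∣ ℚ.≤ B) → η ℚ.≤ 1ℚ → (B ℚ.+ B ℚ.+ 1ℚ) ℚ.* η ℚ.≤ ε → 0ℚ ℚ.< ε →
        Eventually λ n → ℚ.∣ seq (D.√ x) n ℚ.* seq (D.√ x) n ℚ.- seq x n ∣ ℚ.≤ ε
      root-error {x} 0≤x {B} {η} {ε} (M , small) 0≤B r≤B η≤1 Cη≤ε 0<ε = eventually-map₂
        {P = λ n → ℚ.∣ seq (D.√ x) n ∣ ℚ.≤ B × mesh n ℚ.< η} {Q = λ n → 0ℚ ℚ.≤ seq x n ℚ.+ ε}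
        (λ n p x≥ → Rat.isRoot-error {h = mesh n} {q = seq x n} {r = seq (D.√ x) n} {B = B} {η = η} {ε = ε}
          (D.RationalLemmas.rootApprox-isRoot n (seq x n))
          (ℚ.<⇒≤ (Rat.recip-pos (Rat.fromℕ-pos n))) (ℚ.<⇒≤ (proj₂ p)) η≤1
          (ℚ.≤-trans (Rat.p≤∣p∣ _) (proj₁ p)) 0≤B (ℚ.<⇒≤ 0<ε) Cη≤ε x≥)
        (eventually-map₂ (λ n p q → p , q) r≤B (M , λ n M≤n → small {n} M≤n))
        (≤-elim 0≤x ε 0<ε)

    root-square : ∀ {x} → ι 0ℚ ≤ x → D.√ x * D.√ x ≈ x
    root-square {x} 0≤x = choose (bounded (D.√ x))
      where
      choose : ∃[ B ] 0ℚ ℚ.≤ B × Eventually (λ n → ℚ.∣ seq (D.√ x) n ∣ ℚ.≤ B) → D.√ x * D.√ x ≈ x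
      choose (B , 0≤B , r≤B) = from-near λ ε 0<ε →
        let (η , 0<η , η≤1 , Cη≤ε) = Rat.shrink₁ (Rat.+-nonNeg (Rat.+-nonNeg 0≤B 0≤B) (ℚ.<⇒≤ Rat.0<1)) 0<ε
        in root-error 0≤x (Rat.mesh-small η 0<η) 0≤B r≤B η≤1 Cη≤ε 0<ε

    root-nonNeg : ∀ x → ι 0ℚ ≤ D.√ x
    root-nonNeg x = eventually-≤ (0 , λ n _ →
      D.RationalLemmas.IsRoot.nonNeg (D.RationalLemmas.rootApprox-isRoot n (seq x n)))

  -- One-sided, because m and n may be exchanged.
  ℝ-cauchy : (ℕ → ℝ) → Set
  ℝ-cauchy x = ∀ ε → 0ℚ ℚ.< ε → ∃[ N ] (∀ m n → N ℕ.≤ m → N ℕ.≤ n → x m ≤ x n + ι ε)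

  ConvergesTo : (ℕ → ℝ) → ℝ → Set
  ConvergesTo x l = ∀ ε → 0ℚ ℚ.< ε → Eventually λ n → x n ≤ l + ι ε × l ≤ x n + ι ε

  ℝ-commutativeRing : CommutativeRing _ _
  ℝ-commutativeRing = record { isCommutativeRing = ℝ-isCommutativeRing }

  private
    coefficients : CommutativeRing.rawRing ℚ.+-*-commutativeRing -Raw-AlmostCommutative⟶ fromCommutativeRing ℝ-commutativeRing
    coefficients = record { ⟦_⟧ = ι ; +-homo = ι-+ ; *-homo = ι-* ; -‿homo = ι-neg ; 0-homo = ≈-refl ; 1-homo = ≈-refl }

    coefficient≟ : ∀ p q → Maybe (ι p ≈ ι q)
    coefficient≟ p q = Maybe.map (λ { ≡.refl → ≈-refl }) (dec⇒maybe (p ℚ.≟ q))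

  -- Coefficients are rationals, compared by their decidable equality and embedded by `ι`, so that
  -- identities containing 1/2 or 1/4 normalise as well.
  module ℝ-Solver = Algebra.Solver.Ring (CommutativeRing.rawRing ℚ.+-*-commutativeRing)
    (fromCommutativeRing ℝ-commutativeRing) coefficients coefficient≟

  module R = CommutativeRing ℝ-commutativeRing

  open ℝ-Solver using () renaming (_:=_ to _⊜_; _:+_ to _⊕_; _:*_ to _⊗_; _:-_ to _⊖_; :-_ to ⊝_; con to κ)

  0≤1 : ι 0ℚ ≤ ι 1ℚ
  0≤1 = ι-mono (ℚ.<⇒≤ Rat.0<1)

  ≤-refl : ∀ {x} → x ≤ x
  ≤-refl = ≤-reflexive ≈-refl

  ≤-respˡ : ∀ {x y z} → x ≈ y → x ≤ z → y ≤ z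
  ≤-respˡ x≈y = ≤-trans (≤-reflexive (≈-sym x≈y))

  ≤-respʳ : ∀ {x y z} → x ≈ y → z ≤ x → z ≤ y
  ≤-respʳ x≈y z≤x = ≤-trans z≤x (≤-reflexive x≈y)

  x≤y⇒0≤y-x : ∀ {x y} → x ≤ y → ι 0ℚ ≤ y - x
  x≤y⇒0≤y-x {x} x≤y = ≤-respˡ (R.-‿inverseʳ x) (+-mono-≤ x≤y ≤-refl)

  ≤-by : ∀ {x y} e → ι 0ℚ ≤ e → y - x ≈ e → x ≤ y
  ≤-by {x} {y} e 0≤e eq = ≤-respˡ (R.+-identityˡ x) (≤-respʳ
    (ℝ-Solver.solve 2 (λ x y → (y ⊖ x) ⊕ x ⊜ y) ≈-refl x y)
    (+-mono-≤ (≤-respʳ (≈-sym eq) 0≤e) ≤-refl))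

  +-nonNeg : ∀ {x y} → ι 0ℚ ≤ x → ι 0ℚ ≤ y → ι 0ℚ ≤ x + y
  +-nonNeg 0≤x 0≤y = ≤-respˡ (R.+-identityˡ (ι 0ℚ)) (+-mono-≤ 0≤x 0≤y)

  private
    chain : ∀ {x y z a b} → x ≤ y + a → y ≤ z + b → x ≤ z + (a + b)
    chain {x} {y} {z} {a} {b} p q = ≤-trans p (≤-respʳ
      (ℝ-Solver.solve 3 (λ z a b → z ⊕ b ⊕ a ⊜ z ⊕ (a ⊕ b)) ≈-refl z a b) (+-mono-≤ q ≤-refl))

    ι-chain : ∀ {x y z} ε δ → x ≤ y + ι ε → y ≤ z + ι δ → x ≤ z + ι (ε ℚ.+ δ)
    ι-chain ε δ p q = ≤-respʳ (R.+-congˡ (≈-sym (ι-+ ε δ))) (chain p q)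

    close : ∀ {p q ε} → ι p ≤ ι q + ι ε → p ℚ.- q ℚ.≤ ε
    close {p} {q} {ε} h = Rat.≤-by _ (Rat.p≤q⇒0≤q-p (ι-cancel (≤-respʳ (≈-sym (ι-+ q ε)) h)))
      (solve 3 (λ p q e → e :- (p :- q) := q :+ e :- p) ≡.refl p q ε)

  private
    abs< : ∀ {p ε} → p ℚ.< ε → ℚ.- p ℚ.< ε → ℚ.∣ p ∣ ℚ.< ε
    abs< {p} p< -p< with ℚ.∣p∣≡p∨∣p∣≡-p p
    ... | inj₁ eq = ≡.subst (ℚ._< _) (≡.sym eq) p<
    ... | inj₂ eq = ≡.subst (ℚ._< _) (≡.sym eq) -p<

    quarter : ℚ → ℚ
    quarter ε = ½ ℚ.* (½ ℚ.* ε)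

    four-quarters : ∀ ε → (quarter ε ℚ.+ quarter ε) ℚ.+ (quarter ε ℚ.+ quarter ε) ≡ ε
    four-quarters = solve 1 (λ e → (con ½ :* (con ½ :* e) :+ con ½ :* (con ½ :* e))
      :+ (con ½ :* (con ½ :* e) :+ con ½ :* (con ½ :* e)) := e) ≡.refl

    two-quarters : ∀ ε → (quarter ε ℚ.+ quarter ε) ℚ.+ ½ ℚ.* ε ≡ ε
    two-quarters = solve 1 (λ e → (con ½ :* (con ½ :* e) :+ con ½ :* (con ½ :* e)) :+ con ½ :* e := e) ≡.refl

    swap-- : ∀ p q → ℚ.- (p ℚ.- q) ≡ q ℚ.- p
    swap-- = solve 2 (λ p q → :- (p :- q) := q :- p) ≡.refl

    -- A diagonal sequence: `l k` is a rational within μ k of the term of x at an index beyond which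
    -- x varies by at most μ k, so it stays within 2 μ k of all later terms.
    module Limit (x : ℕ → ℝ) (c : ℝ-cauchy x) (μ : ℕ → ℚ) (0<μ : ∀ k → 0ℚ ℚ.< μ k)
                 (μ-small : ∀ ε → 0ℚ ℚ.< ε → ∃[ N ] (∀ {n} → N ℕ.≤ n → μ n ℚ.< ε)) where

      index : ℕ → ℕ
      index k = proj₁ (c (μ k) (0<μ k))

      approximation : ∀ k → ∃[ q ] x (index k) ≤ ι q + ι (μ k) × ι q ≤ x (index k) + ι (μ k)
      approximation k = approximations (x (index k)) (μ k) (0<μ k)

      l : ℕ → ℚ
      l k = proj₁ (approximation k)

      above : ∀ k n → index k ℕ.≤ n → x n ≤ ι (l k) + ι (μ k ℚ.+ μ k)
      above k n h = ι-chain (μ k) (μ k) (proj₂ (c (μ k) (0<μ k)) n (index k) h ℕ.≤-refl)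
        (proj₁ (proj₂ (approximation k)))

      below : ∀ k n → index k ℕ.≤ n → ι (l k) ≤ x n + ι (μ k ℚ.+ μ k)
      below k n h = ι-chain (μ k) (μ k) (proj₂ (proj₂ (approximation k)))
        (proj₂ (c (μ k) (0<μ k)) (index k) n ℕ.≤-refl h)

      l-close : ∀ j k → l j ℚ.- l k ℚ.≤ (μ j ℚ.+ μ j) ℚ.+ (μ k ℚ.+ μ k)
      l-close j k = close (ι-chain (μ j ℚ.+ μ j) (μ k ℚ.+ μ k)
        (below j (index j ℕ.⊔ index k) (ℕ.m≤m⊔n (index j) (index k)))
        (above k (index j ℕ.⊔ index k) (ℕ.m≤n⊔m (index j) (index k))))

      l-near : ∀ ε → 0ℚ ℚ.< ε → ∃[ K ] (∀ {j k} → K ℕ.≤ j → K ℕ.≤ k → ℚ.∣ l j ℚ.- l k ∣ ℚ.< ε)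
      l-near ε 0<ε = K , λ {j} {k} K≤j K≤k → abs< (near< j k (s {j} K≤j) (s {k} K≤k))
          (≡.subst (ℚ._< ε) (≡.sym (swap-- (l j) (l k))) (near< k j (s {k} K≤k) (s {j} K≤j)))
        where
        small : ∃[ N ] (∀ {n} → N ℕ.≤ n → μ n ℚ.< quarter ε)
        small = μ-small (quarter ε) (Rat.half-pos (Rat.half-pos 0<ε))
        K : ℕ
        K = proj₁ small
        s : ∀ {n} → K ℕ.≤ n → μ n ℚ.< quarter ε
        s = proj₂ small
        near< : ∀ j k → μ j ℚ.< quarter ε → μ k ℚ.< quarter ε → l j ℚ.- l k ℚ.< ε
        near< j k a b = ℚ.≤-<-trans (l-close j k) (≡.subst (_ ℚ.<_) (four-quarters ε)
          (ℚ.+-mono-< (ℚ.+-mono-< a a) (ℚ.+-mono-< b b)))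

      limit : ℝ
      limit = mkℝ l l-near

      converges : ConvergesTo x limit
      converges ε 0<ε = index k , λ n h →
        widen (ι-chain (μ k ℚ.+ μ k) (½ ℚ.* ε) (above k n h) (proj₂ near-limit)) ,
        widen (≤-respʳ (R.+-congˡ (R.reflexive (≡.cong ι (ℚ.+-comm (½ ℚ.* ε) (μ k ℚ.+ μ k)))))
          (ι-chain (½ ℚ.* ε) (μ k ℚ.+ μ k) (proj₁ near-limit) (below k n h)))
        where
        small : ∃[ N ] (∀ {n} → N ℕ.≤ n → μ n ℚ.< quarter ε)
        small = μ-small (quarter ε) (Rat.half-pos (Rat.half-pos 0<ε))
        near′ : ∃[ K ] (∀ {j k} → K ℕ.≤ j → K ℕ.≤ k → ℚ.∣ l j ℚ.- l k ∣ ℚ.< ½ ℚ.* ε)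
        near′ = l-near (½ ℚ.* ε) (Rat.half-pos 0<ε)
        k : ℕ
        k = proj₁ small ℕ.⊔ proj₁ near′
        μ≤ : μ k ℚ.≤ quarter ε
        μ≤ = ℚ.<⇒≤ (proj₂ small {k} (ℕ.m≤m⊔n _ _))
        widen : ∀ {y z} → y ≤ z + ι ((μ k ℚ.+ μ k) ℚ.+ ½ ℚ.* ε) → y ≤ z + ι ε
        widen p = ≤-trans p (+-mono-≤ ≤-refl (ι-mono (≡.subst ((μ k ℚ.+ μ k) ℚ.+ ½ ℚ.* ε ℚ.≤_) (two-quarters ε)
          (ℚ.+-monoˡ-≤ (½ ℚ.* ε) (ℚ.+-mono-≤ μ≤ μ≤)))))
        near-limit : limit ≤ ι (l k) + ι (½ ℚ.* ε) × ι (l k) ≤ limit + ι (½ ℚ.* ε)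
        near-limit = fromSeq l l-near (proj₁ near′) (l k) (½ ℚ.* ε)
          λ n K≤n → ℚ.<⇒≤ (proj₂ near′ {n} {k} K≤n (ℕ.m≤n⊔m (proj₁ small) (proj₁ near′)))

  ℝ-complete : ∀ x → ℝ-cauchy x → ∃[ l ] ConvergesTo x l
  ℝ-complete x c = limit , converges
    where open Limit x c mesh (λ k → Rat.recip-pos (Rat.fromℕ-pos k)) Rat.mesh-small

  opaque
    unfolding _+_

    private
      cancel-error : ∀ {a A r C y y′ δ ε} → ℚ.∣ a ∣ ℚ.≤ A → 0ℚ ℚ.≤ A → 0ℚ ℚ.≤ r → r ℚ.≤ C → r ℚ.* y′ ≡ 1ℚ →
        ℚ.∣ y ℚ.- y′ ∣ ℚ.≤ δ → (A ℚ.* C) ℚ.* δ ℚ.≤ ε → ℚ.∣ a ℚ.* r ℚ.* y ℚ.- a ∣ ℚ.≤ ε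
      cancel-error {a} {A} {r} {C} {y} {y′} a≤A 0≤A 0≤r r≤C ry′≡1 d h = ℚ.≤-trans (ℚ.≤-reflexive (≡.trans
          (≡.cong ℚ.∣_∣ (≡.trans (≡.cong (λ z → a ℚ.* r ℚ.* y ℚ.- z) (≡.trans (≡.sym (ℚ.*-identityʳ a)) (≡.cong (a ℚ.*_) (≡.sym ry′≡1))))
            (solve 4 (λ a r y z → a :* r :* y :- a :* (r :* z) := a :* r :* (y :- z)) ≡.refl a r y y′)))
          (≡.trans (ℚ.∣p*q∣≡∣p∣*∣q∣ (a ℚ.* r) (y ℚ.- y′)) (≡.cong (ℚ._* ℚ.∣ y ℚ.- y′ ∣)
            (≡.trans (ℚ.∣p*q∣≡∣p∣*∣q∣ a r) (≡.cong (ℚ.∣ a ∣ ℚ.*_) (ℚ.0≤p⇒∣p∣≡p 0≤r)))))))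
        (ℚ.≤-trans (D.RationalLemmas.*-mono (ℚ.0≤∣p∣ _) (Rat.*-nonNeg 0≤A (ℚ.≤-trans 0≤r r≤C))
          (D.RationalLemmas.*-mono 0≤r 0≤A a≤A r≤C) d) h)

    -- Division inverts the shifted sequence y (N + n), so the product with y is not x term by term.
    -- The error x n · r n · (y n - y (N + n)) tends to 0 because y is Cauchy and the reciprocals r
    -- n are bounded by 1/c.
    /-cancel : ∀ x y (0<y : D.0ℝ D.< y) → x D./ y [ 0<y ] * y ≈ x
    /-cancel x y (mk< c 0<c N c≤y) = choose (bounded x)
      where
      c≤ : ∀ n → c ℚ.≤ seq y (N ℕ.+ n)
      c≤ n = ≡.subst (ℚ._≤ seq y (N ℕ.+ n)) (ℚ.+-identityˡ c) (c≤y (ℕ.m≤m+n N n))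
      0<yₙ : ∀ n → 0ℚ ℚ.< seq y (N ℕ.+ n)
      0<yₙ n = ℚ.<-≤-trans 0<c (c≤ n)
      choose : ∃[ A ] 0ℚ ℚ.≤ A × Eventually (λ n → ℚ.∣ seq x n ∣ ℚ.≤ A) →
               x D./ y [ mk< c 0<c N c≤y ] * y ≈ x
      choose (A , 0≤A , M , x≤A) = from-near λ ε 0<ε →
        let (δ , 0<δ , h) = Rat.shrink (Rat.*-nonNeg 0≤A (ℚ.<⇒≤ (Rat.recip-pos 0<c))) 0<ε
            (L , d) = isCauchy y δ 0<δ
        in M ℕ.⊔ L , λ n k≤n → cancel-error {a = seq x n} {y = seq y n} {y′ = seq y (N ℕ.+ n)} (x≤A n (ℕ.m⊔n≤o⇒m≤o M L k≤n)) 0≤A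
             (ℚ.<⇒≤ (Rat.recip-pos (0<yₙ n))) (D.RationalLemmas.recip-antimono 0<c (0<yₙ n) (c≤ n))
             (≡.trans (ℚ.*-comm (Rat.recip (0<yₙ n)) _) (Rat.recip-inverse (0<yₙ n)))
             (ℚ.<⇒≤ (d (ℕ.m⊔n≤o⇒n≤o M L k≤n) (ℕ.≤-trans (ℕ.m⊔n≤o⇒n≤o M L k≤n) (ℕ.m≤n+m n N)))) h

-- Complex numbers: ring solver, modulus, limits and completeness.

module Complex where

  open Real
  open D using (ℂ; _+i_) public
  open ℂ using (re; im) public
  open ℝ-Solver public using () renaming
    (solve to solveᴿ; _:=_ to _⊜_; _:+_ to _⊕_; _:*_ to _⊗_; _:-_ to _⊖_; :-_ to ⊝_; con to κ)

  ≤-poset : Poset _ _ _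
  ≤-poset = record
    { Carrier = ℝ ; _≈_ = _≈_ ; _≤_ = _≤_
    ; isPartialOrder = record
      { isPreorder = record { isEquivalence = R.isEquivalence ; reflexive = ≤-reflexive ; trans = ≤-trans }
      ; antisym = ≤-antisym } }

  module ≤-Reasoning = Relation.Binary.Reasoning.PartialOrder ≤-poset

  *-monoˡ-≤ : ∀ {x y z} → ι 0ℚ ≤ z → x ≤ y → z * x ≤ z * y
  *-monoˡ-≤ {x} {y} {z} 0≤z x≤y = ≤-by _ (*-nonNeg 0≤z (x≤y⇒0≤y-x x≤y))
    (solveᴿ 3 (λ x y z → z ⊗ y ⊖ z ⊗ x ⊜ z ⊗ (y ⊖ x)) ≈-refl x y z)

  *-monoʳ-≤ : ∀ {x y z} → ι 0ℚ ≤ z → x ≤ y → x * z ≤ y * z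
  *-monoʳ-≤ {x} {y} {z} 0≤z x≤y = ≤-respˡ (R.*-comm z x) (≤-respʳ (R.*-comm z y) (*-monoˡ-≤ 0≤z x≤y))

  *-mono-≤ : ∀ {x y u v} → ι 0ℚ ≤ x → ι 0ℚ ≤ v → x ≤ y → u ≤ v → x * u ≤ y * v
  *-mono-≤ 0≤x 0≤v x≤y u≤v = ≤-trans (*-monoˡ-≤ 0≤x u≤v) (*-monoʳ-≤ 0≤v x≤y)

  square-nonNeg : ∀ x → ι 0ℚ ≤ x * x
  square-nonNeg x = ≤-cases {ι 0ℚ} {x} (λ 0≤x → *-nonNeg 0≤x 0≤x) λ x≤0 →
    let 0≤-x = ≤-by {ι 0ℚ} { - x} _ (x≤y⇒0≤y-x x≤0) (solveᴿ 1 (λ x → ⊝ x ⊖ κ 0ℚ ⊜ κ 0ℚ ⊖ x) ≈-refl x)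
    in ≤-respʳ (solveᴿ 1 (λ x → ⊝ x ⊗ ⊝ x ⊜ x ⊗ x) ≈-refl x) (*-nonNeg 0≤-x 0≤-x)

  ≰-elim : ∀ {p q} → q ℚ.< p → ι p ≤ ι q → ∀ {x y} → x ≤ y
  ≰-elim q<p ιp≤ιq = contradiction (ℚ.<-≤-trans q<p (ι-cancel ιp≤ιq)) (ℚ.<-irrefl ≡.refl)

  -- In the case y + ε ≤ x the squares would differ by at least ε² > 0. `≤-limit` provides the ε and
  -- `≤-cases` the case distinction, which the negative order allows.
  ≤-square : ∀ {x y} → ι 0ℚ ≤ y → x * x ≤ y * y → x ≤ y
  ≤-square {x} {y} 0≤y x²≤y² = ≤-limit λ ε 0<ε →
    let 0≤ε = ι-mono (ℚ.<⇒≤ 0<ε) in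
    ≤-cases {x} {y + ι ε} (λ h → h) λ y+ε≤x →
      ≰-elim {ε ℚ.* ε} {0ℚ} (D.RationalLemmas.*-pos 0<ε 0<ε) (≤-respˡ (≈-sym (ι-* ε ε)) (≤-by _
        (+-nonNeg (+-nonNeg (+-nonNeg (x≤y⇒0≤y-x x²≤y²) (*-nonNeg 0≤y 0≤ε)) (*-nonNeg 0≤y 0≤ε))
          (*-nonNeg (x≤y⇒0≤y-x y+ε≤x) (+-nonNeg (+-nonNeg (x≤y⇒0≤y-x y+ε≤x) (+-nonNeg 0≤y 0≤ε)) (+-nonNeg 0≤y 0≤ε))))
        (solveᴿ 3 (λ x y e → κ 0ℚ ⊖ e ⊗ e ⊜ (((y ⊗ y ⊖ x ⊗ x) ⊕ y ⊗ e) ⊕ y ⊗ e) ⊕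
            (x ⊖ (y ⊕ e)) ⊗ (((x ⊖ (y ⊕ e)) ⊕ (y ⊕ e)) ⊕ (y ⊕ e))) ≈-refl x y (ι ε))))

  -- If y ≤ x, then (c - q)(x - y) ≥ 0 and c y - c x ≥ 0 add up to q (y - x) ≥ 0, and the rational q
  -- can be inverted. Thus c itself is never divided by.
  *-cancelˡ-≤ : ∀ {x y c q} → 0ℚ ℚ.< q → ι q ≤ c → c * x ≤ c * y → x ≤ y
  *-cancelˡ-≤ {x} {y} {c} {q} 0<q q≤c cx≤cy = ≤-cases {x} {y} (λ h → h) λ y≤x →
    ≤-by _ (*-nonNeg (ι-mono (ℚ.<⇒≤ (Rat.recip-pos 0<q)))
        (+-nonNeg (*-nonNeg (x≤y⇒0≤y-x q≤c) (x≤y⇒0≤y-x y≤x)) (x≤y⇒0≤y-x cx≤cy)))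
      (R.trans (R.trans (R.sym (R.*-identityˡ (y - x)))
          (R.*-congʳ (R.trans (R.reflexive (≡.cong ι (≡.sym (Rat.recip-inverse 0<q)))) (ι-* q (Rat.recip 0<q)))))
        (solveᴿ 5 (λ x y c q r → q ⊗ r ⊗ (y ⊖ x) ⊜ r ⊗ ((c ⊖ q) ⊗ (x ⊖ y) ⊕ (c ⊗ y ⊖ c ⊗ x)))
          ≈-refl x y c (ι q) (ι (Rat.recip 0<q))))

  infix  4 _≈ᶜ_ _⟶_
  infixl 6 _+ᶜ_ _-ᶜ_
  infixl 7 _*ᶜ_
  infix  8 -ᶜ_

  record _≈ᶜ_ (z w : ℂ) : Set where
    constructor _&_
    field
      re-≈ : re z ≈ re w
      im-≈ : im z ≈ im w
  open _≈ᶜ_ public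

  ρ : ℝ → ℂ
  ρ x = x +i ι 0ℚ

  ιᶜ : ℚ → ℂ
  ιᶜ q = ρ (ι q)

  opaque
    _+ᶜ_ _*ᶜ_ : ℂ → ℂ → ℂ
    z +ᶜ w = (re z + re w) +i (im z + im w)
    z *ᶜ w = (re z * re w - im z * im w) +i (re z * im w + im z * re w)

    -ᶜ_ : ℂ → ℂ
    -ᶜ z = (- re z) +i (- im z)

    conj : ℂ → ℂ
    conj z = re z +i (- im z)

  _-ᶜ_ : ℂ → ℂ → ℂ
  z -ᶜ w = z +ᶜ -ᶜ w

  opaque
    unfolding _+ᶜ_

    re-+ : ∀ z w → re (z +ᶜ w) ≈ re z + re w
    re-+ z w = ≈-refl

    im-+ : ∀ z w → im (z +ᶜ w) ≈ im z + im w
    im-+ z w = ≈-refl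

    re-* : ∀ z w → re (z *ᶜ w) ≈ re z * re w - im z * im w
    re-* z w = ≈-refl

    im-* : ∀ z w → im (z *ᶜ w) ≈ re z * im w + im z * re w
    im-* z w = ≈-refl

    re-neg : ∀ z → re (-ᶜ z) ≈ - re z
    re-neg z = ≈-refl

    im-neg : ∀ z → im (-ᶜ z) ≈ - im z
    im-neg z = ≈-refl

    re-conj : ∀ z → re (conj z) ≈ re z
    re-conj z = ≈-refl

    im-conj : ∀ z → im (conj z) ≈ - im z
    im-conj z = ≈-refl

    ℂ-isCommutativeRing : IsCommutativeRing _≈ᶜ_ _+ᶜ_ _*ᶜ_ -ᶜ_ (ιᶜ 0ℚ) (ιᶜ 1ℚ)
    ℂ-isCommutativeRing = record
        { isRing = record
          { +-isAbelianGroup = record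
            { isGroup = record
              { isMonoid = record
                { isSemigroup = record
                  { isMagma = record
                    { isEquivalence = record
                      { refl = ≈-refl & ≈-refl
                      ; sym = λ (p & q) → ≈-sym p & ≈-sym q
                      ; trans = λ (p & q) (r & s) → ≈-trans p r & ≈-trans q s }
                    ; ∙-cong = λ (p & q) (r & s) → R.+-cong p r & R.+-cong q s }
                  ; assoc = λ x y z → R.+-assoc _ _ _ & R.+-assoc _ _ _ }
                ; identity = (λ x → R.+-identityˡ _ & R.+-identityˡ _) , λ x → R.+-identityʳ _ & R.+-identityʳ _ }
              ; inverse = (λ x → R.-‿inverseˡ _ & R.-‿inverseˡ _) , λ x → R.-‿inverseʳ _ & R.-‿inverseʳ _
              ; ⁻¹-cong = λ (p & q) → R.-‿cong p & R.-‿cong q }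
            ; comm = λ x y → R.+-comm _ _ & R.+-comm _ _ }
          ; *-cong = λ (p & q) (r & s) →
              R.+-cong (R.*-cong p r) (R.-‿cong (R.*-cong q s)) & R.+-cong (R.*-cong p s) (R.*-cong q r)
          ; *-assoc = λ x y z →
              solveᴿ 6 (λ a b c d e f → (a ⊗ c ⊖ b ⊗ d) ⊗ e ⊖ (a ⊗ d ⊕ b ⊗ c) ⊗ f ⊜ a ⊗ (c ⊗ e ⊖ d ⊗ f) ⊖ b ⊗ (c ⊗ f ⊕ d ⊗ e))
                ≈-refl (re x) (im x) (re y) (im y) (re z) (im z)
              & solveᴿ 6 (λ a b c d e f → (a ⊗ c ⊖ b ⊗ d) ⊗ f ⊕ (a ⊗ d ⊕ b ⊗ c) ⊗ e ⊜ a ⊗ (c ⊗ f ⊕ d ⊗ e) ⊕ b ⊗ (c ⊗ e ⊖ d ⊗ f))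
                ≈-refl (re x) (im x) (re y) (im y) (re z) (im z)
          ; *-identity =
              (λ x → solveᴿ 2 (λ a b → κ 1ℚ ⊗ a ⊖ κ 0ℚ ⊗ b ⊜ a) ≈-refl (re x) (im x)
                   & solveᴿ 2 (λ a b → κ 1ℚ ⊗ b ⊕ κ 0ℚ ⊗ a ⊜ b) ≈-refl (re x) (im x))
            , (λ x → solveᴿ 2 (λ a b → a ⊗ κ 1ℚ ⊖ b ⊗ κ 0ℚ ⊜ a) ≈-refl (re x) (im x)
                   & solveᴿ 2 (λ a b → a ⊗ κ 0ℚ ⊕ b ⊗ κ 1ℚ ⊜ b) ≈-refl (re x) (im x))
          ; distrib =
              (λ x y z → solveᴿ 6 (λ a b c d e f → a ⊗ (c ⊕ e) ⊖ b ⊗ (d ⊕ f) ⊜ (a ⊗ c ⊖ b ⊗ d) ⊕ (a ⊗ e ⊖ b ⊗ f))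
                  ≈-refl (re x) (im x) (re y) (im y) (re z) (im z)
                & solveᴿ 6 (λ a b c d e f → a ⊗ (d ⊕ f) ⊕ b ⊗ (c ⊕ e) ⊜ (a ⊗ d ⊕ b ⊗ c) ⊕ (a ⊗ f ⊕ b ⊗ e))
                  ≈-refl (re x) (im x) (re y) (im y) (re z) (im z))
            , (λ x y z → solveᴿ 6 (λ a b c d e f → (c ⊕ e) ⊗ a ⊖ (d ⊕ f) ⊗ b ⊜ (c ⊗ a ⊖ d ⊗ b) ⊕ (e ⊗ a ⊖ f ⊗ b))
                  ≈-refl (re x) (im x) (re y) (im y) (re z) (im z)
                & solveᴿ 6 (λ a b c d e f → (c ⊕ e) ⊗ b ⊕ (d ⊕ f) ⊗ a ⊜ (c ⊗ b ⊕ d ⊗ a) ⊕ (e ⊗ b ⊕ f ⊗ a))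
                  ≈-refl (re x) (im x) (re y) (im y) (re z) (im z)) }
        ; *-comm = λ x y →
            solveᴿ 4 (λ a b c d → a ⊗ c ⊖ b ⊗ d ⊜ c ⊗ a ⊖ d ⊗ b) ≈-refl (re x) (im x) (re y) (im y)
            & solveᴿ 4 (λ a b c d → a ⊗ d ⊕ b ⊗ c ⊜ c ⊗ b ⊕ d ⊗ a) ≈-refl (re x) (im x) (re y) (im y) }

    ρ-+ : ∀ x y → ρ (x + y) ≈ᶜ ρ x +ᶜ ρ y
    ρ-+ x y = ≈-refl & ≈-sym (R.+-identityˡ (ι 0ℚ))

    ρ-* : ∀ x y → ρ (x * y) ≈ᶜ ρ x *ᶜ ρ y
    ρ-* x y = solveᴿ 2 (λ x y → x ⊗ y ⊜ x ⊗ y ⊖ κ 0ℚ ⊗ κ 0ℚ) ≈-refl x y & solveᴿ 2 (λ x y → κ 0ℚ ⊜ x ⊗ κ 0ℚ ⊕ κ 0ℚ ⊗ y) ≈-refl x y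

    ρ-neg : ∀ x → ρ (- x) ≈ᶜ -ᶜ ρ x
    ρ-neg x = ≈-refl & solveᴿ 0 (κ 0ℚ ⊜ ⊝ κ 0ℚ) ≈-refl

    conj-+ : ∀ z w → conj (z +ᶜ w) ≈ᶜ conj z +ᶜ conj w
    conj-+ z w = ≈-refl & solveᴿ 2 (λ a b → ⊝ (a ⊕ b) ⊜ ⊝ a ⊕ ⊝ b) ≈-refl (im z) (im w)

    conj-* : ∀ z w → conj (z *ᶜ w) ≈ᶜ conj z *ᶜ conj w
    conj-* z w = solveᴿ 4 (λ a b c d → a ⊗ c ⊖ b ⊗ d ⊜ a ⊗ c ⊖ ⊝ b ⊗ ⊝ d) ≈-refl (re z) (im z) (re w) (im w)
      & solveᴿ 4 (λ a b c d → ⊝ (a ⊗ d ⊕ b ⊗ c) ⊜ a ⊗ ⊝ d ⊕ ⊝ b ⊗ c) ≈-refl (re z) (im z) (re w) (im w)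

    conj-ρ : ∀ x → conj (ρ x) ≈ᶜ ρ x
    conj-ρ x = ≈-refl & solveᴿ 0 (⊝ κ 0ℚ ⊜ κ 0ℚ) ≈-refl

    z*conj-z : ∀ z → z *ᶜ conj z ≈ᶜ ρ (re z * re z + im z * im z)
    z*conj-z z = solveᴿ 2 (λ a b → a ⊗ a ⊖ b ⊗ ⊝ b ⊜ a ⊗ a ⊕ b ⊗ b) ≈-refl (re z) (im z)
      & solveᴿ 2 (λ a b → a ⊗ ⊝ b ⊕ b ⊗ a ⊜ κ 0ℚ) ≈-refl (re z) (im z)

    z+conj-z : ∀ z → z +ᶜ conj z ≈ᶜ ρ (re z + re z)
    z+conj-z z = ≈-refl & R.-‿inverseʳ (im z)

  ℂ-commutativeRing : CommutativeRing _ _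
  ℂ-commutativeRing = record { isCommutativeRing = ℂ-isCommutativeRing }

  module C = CommutativeRing ℂ-commutativeRing

  ρ-cong : ∀ {x y} → x ≈ y → ρ x ≈ᶜ ρ y
  ρ-cong x≈y = x≈y & ≈-refl

  conj-cong : ∀ {z w} → z ≈ᶜ w → conj z ≈ᶜ conj w
  conj-cong {z} {w} (p & q) = R.trans (re-conj z) (R.trans p (R.sym (re-conj w)))
    & R.trans (im-conj z) (R.trans (R.-‿cong q) (R.sym (im-conj w)))

  private
    coefficients : CommutativeRing.rawRing ℚ.+-*-commutativeRing -Raw-AlmostCommutative⟶ fromCommutativeRing ℂ-commutativeRing
    coefficients = record
      { ⟦_⟧ = ιᶜ
      ; +-homo = λ p q → C.trans (ρ-cong (ι-+ p q)) (ρ-+ (ι p) (ι q))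
      ; *-homo = λ p q → C.trans (ρ-cong (ι-* p q)) (ρ-* (ι p) (ι q))
      ; -‿homo = λ p → C.trans (ρ-cong (ι-neg p)) (ρ-neg (ι p))
      ; 0-homo = C.refl ; 1-homo = C.refl }

    coefficient≟ : ∀ p q → Maybe (ιᶜ p ≈ᶜ ιᶜ q)
    coefficient≟ p q = Maybe.map (λ { ≡.refl → C.refl }) (dec⇒maybe (p ℚ.≟ q))

  module ℂ-Solver = Algebra.Solver.Ring (CommutativeRing.rawRing ℚ.+-*-commutativeRing)
    (fromCommutativeRing ℂ-commutativeRing) coefficients coefficient≟

  open ℂ-Solver public using () renaming
    (solve to solveᶜ; _:=_ to _≋_; _:+_ to _⊞_; _:*_ to _⊠_; _:-_ to _⊟_; :-_ to ⊟_; con to κᶜ)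

  opaque
    unfolding _+_ _+ᶜ_

    ∣_∣ : ℂ → ℝ
    ∣_∣ = D.∣_∣

    ∣z∣-nonNeg : ∀ z → ι 0ℚ ≤ ∣ z ∣
    ∣z∣-nonNeg z = root-nonNeg _

    ∣z∣² : ∀ z → ∣ z ∣ * ∣ z ∣ ≈ re z * re z + im z * im z
    ∣z∣² z = root-square (+-nonNeg (square-nonNeg (re z)) (square-nonNeg (im z)))

    ≡ᶜ-+ : ∀ z w → z D.+ᶜ w ≡ z +ᶜ w
    ≡ᶜ-+ z w = ≡.refl

    ≡ᶜ-- : ∀ z w → z D.-ᶜ w ≡ z -ᶜ w
    ≡ᶜ-- z w = ≡.refl

    ≡ᶜ-neg : ∀ z → D.-ᶜ z ≡ -ᶜ z
    ≡ᶜ-neg z = ≡.refl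

    ≡ᶜ-* : ∀ z w → z D.*ᶜ w ≡ z *ᶜ w
    ≡ᶜ-* z w = ≡.refl

    ≡-∣∣ : ∀ z → D.∣ z ∣ ≡ ∣ z ∣
    ≡-∣∣ z = ≡.refl

    ≡-ι : ∀ q → D.fromℚ q ≡ ι q
    ≡-ι q = ≡.refl

    ≡-0ℂ : D.0ℂ ≡ ιᶜ 0ℚ
    ≡-0ℂ = ≡.refl

    ≡-1ℂ : D.1ℂ ≡ ιᶜ 1ℚ
    ≡-1ℂ = ≡.refl

    ≡-ρ : ∀ x → D.fromℝ x ≡ ρ x
    ≡-ρ x = ≡.refl

    ≡-+ : ∀ x y → x D.+ y ≡ x + y
    ≡-+ x y = ≡.refl

    ≡-* : ∀ x y → x D.* y ≡ x * y
    ≡-* x y = ≡.refl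

    ≤⇒D≤ : ∀ {x y} → x ≤ y → x D.≤ y
    ≤⇒D≤ x≤y = x≤y

    D≤⇒≤ : ∀ {x y} → x D.≤ y → x ≤ y
    D≤⇒≤ x≤y = x≤y

  ∣z∣≤ : ∀ z {b} → ι 0ℚ ≤ b → re z * re z + im z * im z ≤ b * b → ∣ z ∣ ≤ b
  ∣z∣≤ z 0≤b h = ≤-square 0≤b (≤-respˡ (R.sym (∣z∣² z)) h)

  ≤∣z∣ : ∀ z {b} → b * b ≤ re z * re z + im z * im z → b ≤ ∣ z ∣
  ≤∣z∣ z h = ≤-square (∣z∣-nonNeg z) (≤-respʳ (R.sym (∣z∣² z)) h)

  ∣∣-cong : ∀ {z w} → z ≈ᶜ w → ∣ z ∣ ≈ ∣ w ∣
  ∣∣-cong {z} {w} (p & q) = ≤-antisym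
    (∣z∣≤ z (∣z∣-nonNeg w) (≤-reflexive (R.trans eq (R.sym (∣z∣² w)))))
    (∣z∣≤ w (∣z∣-nonNeg z) (≤-reflexive (R.trans (R.sym eq) (R.sym (∣z∣² z)))))
    where
    eq : re z * re z + im z * im z ≈ re w * re w + im w * im w
    eq = R.+-cong (R.*-cong p p) (R.*-cong q q)

  re≤∣z∣ : ∀ z → re z ≤ ∣ z ∣
  re≤∣z∣ z = ≤∣z∣ z (≤-by _ (square-nonNeg (im z))
    (solveᴿ 2 (λ a b → a ⊗ a ⊕ b ⊗ b ⊖ a ⊗ a ⊜ b ⊗ b) ≈-refl (re z) (im z)))

  im≤∣z∣ : ∀ z → im z ≤ ∣ z ∣
  im≤∣z∣ z = ≤∣z∣ z (≤-by _ (square-nonNeg (re z))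
    (solveᴿ 2 (λ a b → a ⊗ a ⊕ b ⊗ b ⊖ b ⊗ b ⊜ a ⊗ a) ≈-refl (re z) (im z)))

  private
    square-unique : ∀ {x y} → ι 0ℚ ≤ x → ι 0ℚ ≤ y → x * x ≈ y * y → x ≈ y
    square-unique 0≤x 0≤y eq = ≤-antisym (≤-square 0≤y (≤-reflexive eq)) (≤-square 0≤x (≤-reflexive (R.sym eq)))

  ∣∣-* : ∀ z w → ∣ z *ᶜ w ∣ ≈ ∣ z ∣ * ∣ w ∣
  ∣∣-* z w = square-unique (∣z∣-nonNeg (z *ᶜ w)) (*-nonNeg (∣z∣-nonNeg z) (∣z∣-nonNeg w))
    (R.trans (∣z∣² (z *ᶜ w)) (R.trans (R.+-cong (R.*-cong (re-* z w) (re-* z w)) (R.*-cong (im-* z w) (im-* z w)))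
      (R.trans (solveᴿ 4 (λ a b c d → (a ⊗ c ⊖ b ⊗ d) ⊗ (a ⊗ c ⊖ b ⊗ d) ⊕ (a ⊗ d ⊕ b ⊗ c) ⊗ (a ⊗ d ⊕ b ⊗ c)
          ⊜ (a ⊗ a ⊕ b ⊗ b) ⊗ (c ⊗ c ⊕ d ⊗ d)) ≈-refl (re z) (im z) (re w) (im w))
        (R.trans (R.sym (R.*-cong (∣z∣² z) (∣z∣² w)))
          (solveᴿ 2 (λ x y → (x ⊗ x) ⊗ (y ⊗ y) ⊜ (x ⊗ y) ⊗ (x ⊗ y)) ≈-refl ∣ z ∣ ∣ w ∣)))))

  ∣ρ∣ : ∀ {x} → ι 0ℚ ≤ x → ∣ ρ x ∣ ≈ x
  ∣ρ∣ {x} 0≤x = square-unique (∣z∣-nonNeg (ρ x)) 0≤x (R.trans (∣z∣² (ρ x))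
    (solveᴿ 1 (λ x → x ⊗ x ⊕ κ 0ℚ ⊗ κ 0ℚ ⊜ x ⊗ x) ≈-refl x))

  ∣-z∣ : ∀ z → ∣ -ᶜ z ∣ ≈ ∣ z ∣
  ∣-z∣ z = square-unique (∣z∣-nonNeg (-ᶜ z)) (∣z∣-nonNeg z) (R.trans (∣z∣² (-ᶜ z))
    (R.trans (R.+-cong (R.*-cong (re-neg z) (re-neg z)) (R.*-cong (im-neg z) (im-neg z)))
      (R.trans (solveᴿ 2 (λ a b → ⊝ a ⊗ ⊝ a ⊕ ⊝ b ⊗ ⊝ b ⊜ a ⊗ a ⊕ b ⊗ b) ≈-refl (re z) (im z)) (R.sym (∣z∣² z)))))

  ∣z+w∣≤ : ∀ z w → ∣ z +ᶜ w ∣ ≤ ∣ z ∣ + ∣ w ∣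
  ∣z+w∣≤ z w = ∣z∣≤ (z +ᶜ w) (+-nonNeg (∣z∣-nonNeg z) (∣z∣-nonNeg w)) (begin
    re (z +ᶜ w) * re (z +ᶜ w) + im (z +ᶜ w) * im (z +ᶜ w)
      ≈⟨ R.+-cong (R.*-cong (re-+ z w) (re-+ z w)) (R.*-cong (im-+ z w) (im-+ z w)) ⟩
    (a + c) * (a + c) + (b + d) * (b + d)
      ≈⟨ solveᴿ 4 (λ a b c d → (a ⊕ c) ⊗ (a ⊕ c) ⊕ (b ⊕ d) ⊗ (b ⊕ d)
          ⊜ (a ⊗ a ⊕ b ⊗ b) ⊕ (c ⊗ c ⊕ d ⊗ d) ⊕ ((a ⊗ c ⊕ b ⊗ d) ⊕ (a ⊗ c ⊕ b ⊗ d))) ≈-refl a b c d ⟩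
    (a * a + b * b) + (c * c + d * d) + ((a * c + b * d) + (a * c + b * d))
      ≤⟨ +-mono-≤ (≤-reflexive (R.sym (R.+-cong (∣z∣² z) (∣z∣² w)))) (+-mono-≤ cauchy-schwarz cauchy-schwarz) ⟩
    ∣ z ∣ * ∣ z ∣ + ∣ w ∣ * ∣ w ∣ + (∣ z ∣ * ∣ w ∣ + ∣ z ∣ * ∣ w ∣)
      ≈⟨ solveᴿ 2 (λ x y → x ⊗ x ⊕ y ⊗ y ⊕ (x ⊗ y ⊕ x ⊗ y) ⊜ (x ⊕ y) ⊗ (x ⊕ y)) ≈-refl ∣ z ∣ ∣ w ∣ ⟩
    (∣ z ∣ + ∣ w ∣) * (∣ z ∣ + ∣ w ∣) ∎)
    where
    open ≤-Reasoning
    a = re z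
    b = im z
    c = re w
    d = im w
    cauchy-schwarz : a * c + b * d ≤ ∣ z ∣ * ∣ w ∣
    cauchy-schwarz = ≤-square (*-nonNeg (∣z∣-nonNeg z) (∣z∣-nonNeg w)) (≤-respʳ
      (R.trans (R.sym (R.*-cong (∣z∣² z) (∣z∣² w)))
        (solveᴿ 2 (λ x y → (x ⊗ x) ⊗ (y ⊗ y) ⊜ (x ⊗ y) ⊗ (x ⊗ y)) ≈-refl ∣ z ∣ ∣ w ∣))
      -- Lagrange's identity: the product of the two sums of squares exceeds (ac + bd)² by (ad -
      -- bc)².
      (≤-by _ (square-nonNeg (a * d - b * c))
        (solveᴿ 4 (λ a b c d → (a ⊗ a ⊕ b ⊗ b) ⊗ (c ⊗ c ⊕ d ⊗ d) ⊖ (a ⊗ c ⊕ b ⊗ d) ⊗ (a ⊗ c ⊕ b ⊗ d)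
          ⊜ (a ⊗ d ⊖ b ⊗ c) ⊗ (a ⊗ d ⊖ b ⊗ c)) ≈-refl a b c d)))

  ∣z-w∣≤ : ∀ z w → ∣ z -ᶜ w ∣ ≤ ∣ z ∣ + ∣ w ∣
  ∣z-w∣≤ z w = ≤-respʳ (R.+-congˡ (∣-z∣ w)) (∣z+w∣≤ z (-ᶜ w))

  ∣z-w∣≈∣w-z∣ : ∀ z w → ∣ z -ᶜ w ∣ ≈ ∣ w -ᶜ z ∣
  ∣z-w∣≈∣w-z∣ z w = R.trans (∣∣-cong (solveᶜ 2 (λ z w → z ⊟ w ≋ ⊟ (w ⊟ z)) C.refl z w)) (∣-z∣ (w -ᶜ z))

  ∣z∣≤0⇒z≈0 : ∀ {z} → (∀ ε → 0ℚ ℚ.< ε → ∣ z ∣ ≤ ι ε) → z ≈ᶜ ιᶜ 0ℚ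
  ∣z∣≤0⇒z≈0 {z} h = zero-of (re z) (re≤∣z∣ z) (≤-trans (≤-reflexive (R.sym (re-neg z))) (neg re≤∣z∣))
    & zero-of (im z) (im≤∣z∣ z) (≤-trans (≤-reflexive (R.sym (im-neg z))) (neg im≤∣z∣))
    where
    neg : ∀ {f : ℂ → ℝ} → (∀ w → f w ≤ ∣ w ∣) → f (-ᶜ z) ≤ ∣ z ∣
    neg f≤ = ≤-respʳ (∣-z∣ z) (f≤ (-ᶜ z))
    ∣z∣≤0 : ∣ z ∣ ≤ ι 0ℚ
    ∣z∣≤0 = ≤-limit λ ε 0<ε → ≤-respʳ (R.sym (R.+-identityˡ (ι ε))) (h ε 0<ε)
    zero-of : ∀ x → x ≤ ∣ z ∣ → - x ≤ ∣ z ∣ → x ≈ ι 0ℚ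
    zero-of x p q = ≤-antisym (≤-trans p ∣z∣≤0) (≤-by _ (x≤y⇒0≤y-x (≤-trans q ∣z∣≤0))
      (solveᴿ 1 (λ x → x ⊖ κ 0ℚ ⊜ κ 0ℚ ⊖ ⊝ x) ≈-refl x))

  _⟶_ : (ℕ → ℂ) → ℂ → Set
  a ⟶ l = ∀ ε → 0ℚ ℚ.< ε → Eventually λ n → ∣ a n -ᶜ l ∣ ≤ ι ε

  ℂ-cauchy : (ℕ → ℂ) → Set
  ℂ-cauchy a = ∀ ε → 0ℚ ℚ.< ε → ∃[ N ] (∀ m n → N ℕ.≤ m → N ℕ.≤ n → ∣ a m -ᶜ a n ∣ ≤ ι ε)

  private
    part-cauchy : ∀ {a} (f : ℂ → ℝ) → (∀ z w → f (z -ᶜ w) ≈ f z - f w) → (∀ z → f z ≤ ∣ z ∣) →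
                  ℂ-cauchy a → ℝ-cauchy (λ n → f (a n))
    part-cauchy {a} f f-- f≤ c ε 0<ε = proj₁ (c ε 0<ε) , λ m n hm hn →
      ≤-by _ (x≤y⇒0≤y-x (≤-trans (≤-respˡ (f-- (a m) (a n)) (f≤ (a m -ᶜ a n))) (proj₂ (c ε 0<ε) m n hm hn)))
        (solveᴿ 3 (λ x y e → y ⊕ e ⊖ x ⊜ e ⊖ (x ⊖ y)) ≈-refl (f (a m)) (f (a n)) (ι ε))

    re-- : ∀ z w → re (z -ᶜ w) ≈ re z - re w
    re-- z w = R.trans (re-+ z (-ᶜ w)) (R.+-congˡ (re-neg w))

    im-- : ∀ z w → im (z -ᶜ w) ≈ im z - im w
    im-- z w = R.trans (im-+ z (-ᶜ w)) (R.+-congˡ (im-neg w))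

    -- With h = ε/2, the two inequalities for a coordinate multiply to h² - d² ≥ 0, where d is the
    -- difference in that coordinate; this avoids absolute values. The sum of the two squares is at
    -- most 2h² = ε²/2.
    half-bound : ∀ {z w ε} → ι 0ℚ ≤ ι ε →
      re z ≤ re w + ι (½ ℚ.* ε) × re w ≤ re z + ι (½ ℚ.* ε) → im z ≤ im w + ι (½ ℚ.* ε) × im w ≤ im z + ι (½ ℚ.* ε) →
      ∣ z -ᶜ w ∣ ≤ ι ε
    half-bound {z} {w} {ε} 0≤ε (p , q) (r , s) = ∣z∣≤ (z -ᶜ w) 0≤ε (≤-respˡ
      (R.sym (R.+-cong (R.*-cong (re-- z w) (re-- z w)) (R.*-cong (im-- z w) (im-- z w))))
      (≤-by _ (+-nonNeg (+-nonNeg (*-nonNeg (x≤y⇒0≤y-x p) (x≤y⇒0≤y-x q)) (*-nonNeg (x≤y⇒0≤y-x r) (x≤y⇒0≤y-x s)))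
          (*-nonNeg (*-nonNeg (ι-mono (ℚ.<⇒≤ (ℚ.positive⁻¹ ½))) 0≤ε) 0≤ε))
        (R.trans (solveᴿ 6 (λ a b c d e h → e ⊗ e ⊖ ((a ⊖ c) ⊗ (a ⊖ c) ⊕ (b ⊖ d) ⊗ (b ⊖ d)) ⊜
             ((c ⊕ h ⊖ a) ⊗ (a ⊕ h ⊖ c) ⊕ (d ⊕ h ⊖ b) ⊗ (b ⊕ h ⊖ d)) ⊕ (e ⊗ e ⊖ (h ⊗ h ⊕ h ⊗ h)))
             ≈-refl (re z) (im z) (re w) (im w) (ι ε) (ι (½ ℚ.* ε)))
          (R.+-congˡ (R.trans (R.+-congˡ (R.-‿cong (R.+-cong (R.*-cong ½ε ½ε) (R.*-cong ½ε ½ε))))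
            (solveᴿ 1 (λ e → e ⊗ e ⊖ ((κ ½ ⊗ e) ⊗ (κ ½ ⊗ e) ⊕ (κ ½ ⊗ e) ⊗ (κ ½ ⊗ e)) ⊜ κ ½ ⊗ e ⊗ e) ≈-refl (ι ε)))))))
      where
      ½ε : ι (½ ℚ.* ε) ≈ ι ½ * ι ε
      ½ε = ι-* ½ ε

  ℂ-complete : ∀ a → ℂ-cauchy a → ∃[ l ] a ⟶ l
  ℂ-complete a c = (proj₁ re-limit +i proj₁ im-limit) , λ ε 0<ε →
    eventually-map₂ (λ n → half-bound (ι-mono (ℚ.<⇒≤ 0<ε)))
      (proj₂ re-limit _ (Rat.half-pos 0<ε)) (proj₂ im-limit _ (Rat.half-pos 0<ε))
    where
    re-limit = ℝ-complete (λ n → re (a n)) (part-cauchy re re-- re≤∣z∣ c)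
    im-limit = ℝ-complete (λ n → im (a n)) (part-cauchy im im-- im≤∣z∣ c)

  ⟶-unique : ∀ {a l l′} → a ⟶ l → a ⟶ l′ → l ≈ᶜ l′
  ⟶-unique {a} {l} {l′} p q = C.trans (solveᶜ 2 (λ l m → l ≋ (l ⊟ m) ⊞ m) C.refl l l′)
    (C.trans (C.+-congʳ (∣z∣≤0⇒z≈0 λ ε 0<ε → both (p _ (Rat.half-pos 0<ε)) (q _ (Rat.half-pos 0<ε)))) (C.+-identityˡ l′))
    where
    both : ∀ {ε} → Eventually (λ n → ∣ a n -ᶜ l ∣ ≤ ι (½ ℚ.* ε)) → Eventually (λ n → ∣ a n -ᶜ l′ ∣ ≤ ι (½ ℚ.* ε)) →
           ∣ l -ᶜ l′ ∣ ≤ ι ε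
    both {ε} (M , p) (N , q) = begin
      ∣ l -ᶜ l′ ∣ ≈⟨ ∣∣-cong (solveᶜ 3 (λ l m a → l ⊟ m ≋ (a ⊟ m) ⊟ (a ⊟ l)) C.refl l l′ (a k)) ⟩
      ∣ (a k -ᶜ l′) -ᶜ (a k -ᶜ l) ∣ ≤⟨ ∣z-w∣≤ _ _ ⟩
      ∣ a k -ᶜ l′ ∣ + ∣ a k -ᶜ l ∣ ≤⟨ +-mono-≤ (q k (ℕ.m≤n⊔m M N)) (p k (ℕ.m≤m⊔n M N)) ⟩
      ι (½ ℚ.* ε) + ι (½ ℚ.* ε) ≈⟨ ι-+ _ _ ⟨
      ι (½ ℚ.* ε ℚ.+ ½ ℚ.* ε) ≡⟨ ≡.cong ι (Rat.half+half ε) ⟩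
      ι ε ∎
      where
      open ≤-Reasoning
      k = M ℕ.⊔ N

-- The complex exponential series and its addition theorem.

module Exp where

  open Rat using (nat; inv; quarters; ¼)
  open Real
  open Complex

  module ≈ᶜ-Reasoning = Relation.Binary.Reasoning.Setoid C.setoid

  0ᶜ 1ᶜ : ℂ
  0ᶜ = ιᶜ 0ℚ
  1ᶜ = ιᶜ 1ℚ

  ∑ : (ℕ → ℂ) → ℕ → ℂ
  ∑ a zero    = 0ᶜ
  ∑ a (suc n) = ∑ a n +ᶜ a n

  ∑-cong : ∀ {a b} → (∀ k → a k ≈ᶜ b k) → ∀ n → ∑ a n ≈ᶜ ∑ b n
  ∑-cong a≈b zero    = C.refl
  ∑-cong a≈b (suc n) = C.+-cong (∑-cong a≈b n) (a≈b n)

  ∑-suc : ∀ a n → ∑ a (suc n) ≈ᶜ a 0 +ᶜ ∑ (λ k → a (suc k)) n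
  ∑-suc a zero    = C.+-comm _ _
  ∑-suc a (suc n) = C.trans (C.+-congʳ (∑-suc a n)) (C.+-assoc _ _ _)

  ∣0ᶜ∣ : ∀ {z} → z ≈ᶜ 0ᶜ → ∣ z ∣ ≈ ι 0ℚ
  ∣0ᶜ∣ z≈0 = R.trans (∣∣-cong z≈0) (∣ρ∣ ≤-refl)

  ⟶-≤ : ∀ {a l z b} → a ⟶ l → Eventually (λ n → ∣ a n -ᶜ z ∣ ≤ b) → ∣ l -ᶜ z ∣ ≤ b
  ⟶-≤ {a} {l} {z} {b} a⟶l bounded = ≤-limit λ ε 0<ε → witness (eventually-map₂
    (λ n p q → ≤-trans (≤-respˡ (∣∣-cong (solveᶜ 3 (λ a l z → (a ⊟ z) ⊟ (a ⊟ l) ≋ l ⊟ z) C.refl (a n) l z)) (∣z-w∣≤ _ _))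
      (+-mono-≤ p q)) bounded (a⟶l ε 0<ε))
    where
    witness : ∀ {ε} → Eventually (λ n → ∣ l -ᶜ z ∣ ≤ b + ι ε) → ∣ l -ᶜ z ∣ ≤ b + ι ε
    witness (N , h) = h N ℕ.≤-refl

  ⟶-cong : ∀ {a b l} → (∀ n → a n ≈ᶜ b n) → a ⟶ l → b ⟶ l
  ⟶-cong a≈b a⟶l ε 0<ε = eventually-map (λ n → ≤-respˡ (∣∣-cong (C.+-congʳ (a≈b n)))) (a⟶l ε 0<ε)

  ⟶-suc : ∀ {a l} → a ⟶ l → (λ n → a (suc n)) ⟶ l
  ⟶-suc a⟶l ε 0<ε = proj₁ (a⟶l ε 0<ε) , λ n h → proj₂ (a⟶l ε 0<ε) (suc n) (ℕ.m≤n⇒m≤1+n h)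

  -- Sequences dominated by a geometric one of ratio 1/4

  module _ {a : ℕ → ℂ} {C : ℚ} (0≤C : 0ℚ ℚ.≤ C) (h : ∀ k → ∣ a k ∣ ≤ ι (C ℚ.* quarters k)) where

    private
      step : ∀ C p q → (C ℚ.+ C) ℚ.* (p ℚ.- ¼ ℚ.* q) ≡ (C ℚ.+ C) ℚ.* (p ℚ.- q) ℚ.+ C ℚ.* q ℚ.+ ½ ℚ.* C ℚ.* q
      step = solve 3 (λ C p q → (C :+ C) :* (p :- con ¼ :* q) := (C :+ C) :* (p :- q) :+ C :* q :+ con ½ :* C :* q) ≡.refl

      -- The bound is itself telescoping: it grows by (3/2) C 4⁻ⁿ when the term of index n is added,
      -- which is more than the C 4⁻ⁿ that this term can contribute.
      block : ∀ m j → ∣ ∑ a (m ℕ.+ j) -ᶜ ∑ a m ∣ ≤ ι ((C ℚ.+ C) ℚ.* (quarters m ℚ.- quarters (m ℕ.+ j)))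
      block m zero rewrite ℕ.+-identityʳ m = ≤-trans (≤-reflexive (∣0ᶜ∣ (C.-‿inverseʳ _)))
        (ι-mono (ℚ.≤-reflexive (solve 2 (λ c q → con 0ℚ := (c :+ c) :* (q :- q)) ≡.refl C (quarters m))))
      block m (suc j) rewrite ℕ.+-suc m j = begin
        ∣ (∑ a n +ᶜ a n) -ᶜ ∑ a m ∣
          ≈⟨ ∣∣-cong (solveᶜ 3 (λ s t u → (s ⊞ t) ⊟ u ≋ (s ⊟ u) ⊞ t) C.refl (∑ a n) (a n) (∑ a m)) ⟩
        ∣ (∑ a n -ᶜ ∑ a m) +ᶜ a n ∣ ≤⟨ ∣z+w∣≤ _ _ ⟩
        ∣ ∑ a n -ᶜ ∑ a m ∣ + ∣ a n ∣ ≤⟨ +-mono-≤ (block m j) (h n) ⟩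
        ι ((C ℚ.+ C) ℚ.* (quarters m ℚ.- quarters n)) + ι (C ℚ.* quarters n) ≈⟨ ι-+ _ _ ⟨
        ι ((C ℚ.+ C) ℚ.* (quarters m ℚ.- quarters n) ℚ.+ C ℚ.* quarters n)
          ≤⟨ ι-mono (≡.subst ((C ℚ.+ C) ℚ.* (quarters m ℚ.- quarters n) ℚ.+ C ℚ.* quarters n ℚ.≤_)
               (≡.sym (step C (quarters m) (quarters n)))
               (Rat.≤-by _ (Rat.*-nonNeg (Rat.*-nonNeg (ℚ.<⇒≤ (ℚ.positive⁻¹ ½)) 0≤C) (Rat.quarters-nonNeg n))
                 (solve 2 (λ x y → x :+ y :- x := y) ≡.refl ((C ℚ.+ C) ℚ.* (quarters m ℚ.- quarters n) ℚ.+ C ℚ.* quarters n)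
                   (½ ℚ.* C ℚ.* quarters n)))) ⟩
        ι ((C ℚ.+ C) ℚ.* (quarters m ℚ.- quarters (suc n))) ∎
        where
        open ≤-Reasoning
        n = m ℕ.+ j

    ∑-tail : ∀ m n → m ℕ.≤ n → ∣ ∑ a n -ᶜ ∑ a m ∣ ≤ ι ((C ℚ.+ C) ℚ.* quarters m)
    ∑-tail m n m≤n = ≡.subst (λ n → ∣ ∑ a n -ᶜ ∑ a m ∣ ≤ ι ((C ℚ.+ C) ℚ.* quarters m)) (ℕ.m+[n∸m]≡n m≤n)
      (≤-trans (block m (n ℕ.∸ m)) (ι-mono (Rat.≤-by _
        (Rat.*-nonNeg (Rat.+-nonNeg 0≤C 0≤C) (Rat.quarters-nonNeg (m ℕ.+ (n ℕ.∸ m))))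
        (solve 3 (λ c p q → c :* p :- c :* (p :- q) := c :* q) ≡.refl (C ℚ.+ C) (quarters m) (quarters (m ℕ.+ (n ℕ.∸ m)))))))

    ∑-cauchy : ℂ-cauchy (∑ a)
    ∑-cauchy ε 0<ε = choose (Rat.shrink (Rat.+-nonNeg 2C 2C) 0<ε)
      where
      2C : 0ℚ ℚ.≤ C ℚ.+ C
      2C = Rat.+-nonNeg 0≤C 0≤C
      choose : ∃[ δ ] 0ℚ ℚ.< δ × (C ℚ.+ C ℚ.+ (C ℚ.+ C)) ℚ.* δ ℚ.≤ ε →
               ∃[ N ] (∀ m n → N ℕ.≤ m → N ℕ.≤ n → ∣ ∑ a m -ᶜ ∑ a n ∣ ≤ ι ε)
      choose (δ , 0<δ , Cδ≤ε) = N , λ m n hm hn → begin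
        ∣ ∑ a m -ᶜ ∑ a n ∣
          ≈⟨ ∣∣-cong (solveᶜ 3 (λ s t u → s ⊟ t ≋ (s ⊟ u) ⊟ (t ⊟ u)) C.refl (∑ a m) (∑ a n) (∑ a N)) ⟩
        ∣ (∑ a m -ᶜ ∑ a N) -ᶜ (∑ a n -ᶜ ∑ a N) ∣ ≤⟨ ∣z-w∣≤ _ _ ⟩
        ∣ ∑ a m -ᶜ ∑ a N ∣ + ∣ ∑ a n -ᶜ ∑ a N ∣ ≤⟨ +-mono-≤ (∑-tail N m hm) (∑-tail N n hn) ⟩
        ι ((C ℚ.+ C) ℚ.* quarters N) + ι ((C ℚ.+ C) ℚ.* quarters N) ≈⟨ ι-+ _ _ ⟨
        ι ((C ℚ.+ C) ℚ.* quarters N ℚ.+ (C ℚ.+ C) ℚ.* quarters N)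
          ≤⟨ ι-mono (ℚ.≤-trans (ℚ.≤-trans (ℚ.≤-reflexive (≡.sym (ℚ.*-distribʳ-+ (quarters N) (C ℚ.+ C) (C ℚ.+ C))))
               (D.RationalLemmas.*-monoʳ (Rat.+-nonNeg 2C 2C) (ℚ.≤-trans (Rat.quarters≤inv N) (proj₂ small N ℕ.≤-refl)))) Cδ≤ε) ⟩
        ι ε ∎
        where
        open ≤-Reasoning
        small : ∃[ N ] (∀ n → N ℕ.≤ n → inv n ℚ.≤ δ)
        small = Rat.inv-small δ 0<δ
        N : ℕ
        N = proj₁ small

  -- Cauchy products

  _⋆_ : (ℕ → ℂ) → (ℕ → ℂ) → ℕ → ℂ
  (a ⋆ b) zero    = a 0 *ᶜ b 0
  (a ⋆ b) (suc k) = a 0 *ᶜ b (suc k) +ᶜ ((λ i → a (suc i)) ⋆ b) k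

  ⋆-cong : ∀ {a a′ b b′} → (∀ k → a k ≈ᶜ a′ k) → (∀ k → b k ≈ᶜ b′ k) → ∀ k → (a ⋆ b) k ≈ᶜ (a′ ⋆ b′) k
  ⋆-cong p q zero    = C.*-cong (p 0) (q 0)
  ⋆-cong p q (suc k) = C.+-cong (C.*-cong (p 0) (q (suc k))) (⋆-cong (λ i → p (suc i)) q k)

  ⋆-addˡ : ∀ a a′ b k → ((λ i → a i +ᶜ a′ i) ⋆ b) k ≈ᶜ (a ⋆ b) k +ᶜ (a′ ⋆ b) k
  ⋆-addˡ a a′ b zero    = C.distribʳ _ _ _
  ⋆-addˡ a a′ b (suc k) = C.trans (C.+-congˡ (⋆-addˡ (λ i → a (suc i)) (λ i → a′ (suc i)) b k))
    (solveᶜ 5 (λ x y z u v → (x ⊞ y) ⊠ z ⊞ (u ⊞ v) ≋ (x ⊠ z ⊞ u) ⊞ (y ⊠ z ⊞ v)) C.refl _ _ _ _ _)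

  ⋆-scaleˡ : ∀ c a b k → ((λ i → c *ᶜ a i) ⋆ b) k ≈ᶜ c *ᶜ (a ⋆ b) k
  ⋆-scaleˡ c a b zero    = C.*-assoc _ _ _
  ⋆-scaleˡ c a b (suc k) = C.trans (C.+-congˡ (⋆-scaleˡ c (λ i → a (suc i)) b k))
    (solveᶜ 4 (λ c x y z → (c ⊠ x) ⊠ y ⊞ c ⊠ z ≋ c ⊠ (x ⊠ y ⊞ z)) C.refl _ _ _ _)

  ⋆-scaleʳ : ∀ c a b k → (a ⋆ (λ i → c *ᶜ b i)) k ≈ᶜ c *ᶜ (a ⋆ b) k
  ⋆-scaleʳ c a b zero    = solveᶜ 3 (λ c x y → x ⊠ (c ⊠ y) ≋ c ⊠ (x ⊠ y)) C.refl _ _ _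
  ⋆-scaleʳ c a b (suc k) = C.trans (C.+-congˡ (⋆-scaleʳ c (λ i → a (suc i)) b k))
    (solveᶜ 4 (λ c x y z → x ⊠ (c ⊠ y) ⊞ c ⊠ z ≋ c ⊠ (x ⊠ y ⊞ z)) C.refl _ _ _ _)

  natᶜ : ℕ → ℂ
  natᶜ n = ιᶜ (nat n)

  natᶜ-suc : ∀ n → natᶜ (suc n) ≈ᶜ 1ᶜ +ᶜ natᶜ n
  natᶜ-suc n = C.trans (ρ-cong (R.trans (R.reflexive (≡.cong ι (Rat.nat-suc n))) (ι-+ 1ℚ (nat n)))) (ρ-+ _ _)

  -- Formal derivative of the power series with coefficients a.
  deriv : (ℕ → ℂ) → ℕ → ℂ
  deriv a k = natᶜ (suc k) *ᶜ a (suc k)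

  -- The product rule for formal power series, which replaces the binomial theorem in `term-+`. In
  -- the induction on the first factor, k + 2 splits as 1 + (k + 1); the 1 contributes the summand
  -- by which the shifted derivative of a exceeds the derivative of the shifted a.
  leibniz : ∀ a b k → natᶜ (suc k) *ᶜ (a ⋆ b) (suc k) ≈ᶜ (deriv a ⋆ b) k +ᶜ (a ⋆ deriv b) k
  leibniz a b zero = solveᶜ 5 (λ n x y u v → n ⊠ (x ⊠ y ⊞ u ⊠ v) ≋ (n ⊠ u) ⊠ v ⊞ x ⊠ (n ⊠ y)) C.refl
    (natᶜ 1) (a 0) (b 1) (a 1) (b 0)
  leibniz a b (suc k) = begin
    n″ *ᶜ (a 0 *ᶜ b (suc (suc k)) +ᶜ (a′ ⋆ b) (suc k))
      ≈⟨ C.distribˡ _ _ _ ⟩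
    n″ *ᶜ (a 0 *ᶜ b (suc (suc k))) +ᶜ n″ *ᶜ (a′ ⋆ b) (suc k)
      ≈⟨ C.+-congˡ (C.trans (C.*-congʳ (natᶜ-suc (suc k))) (C.trans (C.distribʳ _ _ _)
           (C.+-cong (C.*-identityˡ _) (leibniz a′ b k)))) ⟩
    n″ *ᶜ (a 0 *ᶜ b (suc (suc k))) +ᶜ ((a 1 *ᶜ b (suc k) +ᶜ (a″ ⋆ b) k) +ᶜ ((deriv a′ ⋆ b) k +ᶜ (a′ ⋆ deriv b) k))
      ≈⟨ solveᶜ 8 (λ n x y z w u v t → n ⊠ (x ⊠ y) ⊞ ((z ⊠ w ⊞ u) ⊞ (v ⊞ t)) ≋ (z ⊠ w ⊞ (u ⊞ v)) ⊞ (x ⊠ (n ⊠ y) ⊞ t)) C.refl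
           n″ (a 0) (b (suc (suc k))) (a 1) (b (suc k)) ((a″ ⋆ b) k) ((deriv a′ ⋆ b) k) ((a′ ⋆ deriv b) k) ⟩
    (a 1 *ᶜ b (suc k) +ᶜ ((a″ ⋆ b) k +ᶜ (deriv a′ ⋆ b) k)) +ᶜ (a 0 *ᶜ deriv b (suc k) +ᶜ (a′ ⋆ deriv b) k)
      ≈⟨ C.+-congʳ (C.+-cong (C.*-congʳ (C.sym (C.trans (C.*-congʳ nat1) (C.*-identityˡ _))))
           (C.trans (C.sym (⋆-addˡ a″ (deriv a′) b k)) (⋆-cong shifted (λ _ → C.refl) k))) ⟩
    (deriv a 0 *ᶜ b (suc k) +ᶜ ((λ i → deriv a (suc i)) ⋆ b) k) +ᶜ (a 0 *ᶜ deriv b (suc k) +ᶜ (a′ ⋆ deriv b) k) ∎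
    where
    open ≈ᶜ-Reasoning
    n″ = natᶜ (suc (suc k))
    a′ a″ : ℕ → ℂ
    a′ i = a (suc i)
    a″ i = a (suc (suc i))
    nat1 : natᶜ 1 ≈ᶜ 1ᶜ
    nat1 = C.reflexive (≡.cong ιᶜ Rat.nat-1)
    shifted : ∀ i → a″ i +ᶜ deriv a′ i ≈ᶜ deriv a (suc i)
    shifted i = C.trans (C.+-congʳ (C.sym (C.*-identityˡ _))) (C.trans (C.sym (C.distribʳ _ _ _))
      (C.*-congʳ (C.sym (natᶜ-suc (suc i)))))

  ∑-⋆ : ∀ a b n → ∑ (a ⋆ b) (suc n) ≈ᶜ a 0 *ᶜ ∑ b (suc n) +ᶜ ∑ ((λ i → a (suc i)) ⋆ b) n
  ∑-⋆ a b n = C.trans (∑-suc (a ⋆ b) n) (C.trans (C.+-congˡ (sum n))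
    (C.trans (solveᶜ 4 (λ x y z w → x ⊠ y ⊞ (x ⊠ z ⊞ w) ≋ x ⊠ (y ⊞ z) ⊞ w) C.refl _ _ _ _)
      (C.+-congʳ (C.*-congˡ (C.sym (∑-suc b n))))))
    where
    sum : ∀ n → ∑ (λ k → a 0 *ᶜ b (suc k) +ᶜ ((λ i → a (suc i)) ⋆ b) k) n ≈ᶜ
                a 0 *ᶜ ∑ (λ k → b (suc k)) n +ᶜ ∑ ((λ i → a (suc i)) ⋆ b) n
    sum zero    = solveᶜ 1 (λ x → κᶜ 0ℚ ≋ x ⊠ κᶜ 0ℚ ⊞ κᶜ 0ℚ) C.refl (a 0)
    sum (suc n) = C.trans (C.+-congʳ (sum n))
      (solveᶜ 5 (λ x y z u v → (x ⊠ y ⊞ z) ⊞ (x ⊠ u ⊞ v) ≋ x ⊠ (y ⊞ u) ⊞ (z ⊞ v)) C.refl _ _ _ _ _)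

  private
    mertens-step : ∀ A T q n → (A ℚ.* 1ℚ) ℚ.* (T ℚ.* (¼ ℚ.* q)) ℚ.+ n ℚ.* ((¼ ℚ.* A) ℚ.* T ℚ.* q) ≡
      (1ℚ ℚ.+ n) ℚ.* (A ℚ.* T ℚ.* (¼ ℚ.* q))
    mertens-step = solve 4 (λ A T q n → (A :* con 1ℚ) :* (T :* (con ¼ :* q)) :+ n :* ((con ¼ :* A) :* T :* q)
      := (con 1ℚ :+ n) :* (A :* T :* (con ¼ :* q))) ≡.refl

  -- Peeling off a 0 leaves a 0 times a tail of b, at most A T 4⁻⁽ⁿ⁺¹⁾, and the same problem for the
  -- shifted a with constant A/4. Each of the n rounds thus costs A T 4⁻ⁿ, whence the factor n.
  mertens : ∀ {T b β} → 0ℚ ℚ.≤ T → (∀ n → ∣ ∑ b n -ᶜ β ∣ ≤ ι (T ℚ.* quarters n)) →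
    ∀ n {A a} → 0ℚ ℚ.≤ A → (∀ k → ∣ a k ∣ ≤ ι (A ℚ.* quarters k)) →
    ∣ ∑ (a ⋆ b) n -ᶜ ∑ a n *ᶜ β ∣ ≤ ι (nat n ℚ.* (A ℚ.* T ℚ.* quarters n))
  mertens {T} {b} {β} 0≤T tail zero {A} {a} 0≤A h = ≤-trans
    (≤-reflexive (∣0ᶜ∣ (solveᶜ 1 (λ β → κᶜ 0ℚ ⊟ κᶜ 0ℚ ⊠ β ≋ κᶜ 0ℚ) C.refl β)))
    (ι-mono (Rat.*-nonNeg (Rat.nat-nonNeg 0) (Rat.*-nonNeg (Rat.*-nonNeg 0≤A 0≤T) (Rat.quarters-nonNeg 0))))
  mertens {T} {b} {β} 0≤T tail (suc n) {A} {a} 0≤A h = begin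
    ∣ ∑ (a ⋆ b) (suc n) -ᶜ ∑ a (suc n) *ᶜ β ∣
      ≈⟨ ∣∣-cong (C.trans (C.+-cong (∑-⋆ a b n) (C.-‿cong (C.*-congʳ (∑-suc a n))))
           (solveᶜ 5 (λ x B D A β → (x ⊠ B ⊞ D) ⊟ (x ⊞ A) ⊠ β ≋ x ⊠ (B ⊟ β) ⊞ (D ⊟ A ⊠ β)) C.refl
             (a 0) (∑ b (suc n)) (∑ (a′ ⋆ b) n) (∑ a′ n) β)) ⟩
    ∣ a 0 *ᶜ (∑ b (suc n) -ᶜ β) +ᶜ (∑ (a′ ⋆ b) n -ᶜ ∑ a′ n *ᶜ β) ∣ ≤⟨ ∣z+w∣≤ _ _ ⟩
    ∣ a 0 *ᶜ (∑ b (suc n) -ᶜ β) ∣ + ∣ ∑ (a′ ⋆ b) n -ᶜ ∑ a′ n *ᶜ β ∣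
      ≤⟨ +-mono-≤ (≤-trans (≤-reflexive (∣∣-* _ _))
           (*-mono-≤ (∣z∣-nonNeg _) (ι-mono (Rat.*-nonNeg 0≤T (Rat.quarters-nonNeg (suc n)))) (h 0) (tail (suc n))))
           (mertens 0≤T tail n (Rat.*-nonNeg (ℚ.<⇒≤ (ℚ.positive⁻¹ ¼)) 0≤A) h′) ⟩
    ι (A ℚ.* 1ℚ) * ι (T ℚ.* quarters (suc n)) + ι (nat n ℚ.* ((¼ ℚ.* A) ℚ.* T ℚ.* quarters n))
      ≈⟨ R.trans (ι-+ _ _) (R.+-congʳ (ι-* _ _)) ⟨
    ι ((A ℚ.* 1ℚ) ℚ.* (T ℚ.* quarters (suc n)) ℚ.+ nat n ℚ.* ((¼ ℚ.* A) ℚ.* T ℚ.* quarters n))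
      ≡⟨ ≡.cong ι (≡.trans (mertens-step A T (quarters n) (nat n)) (≡.cong (ℚ._* (A ℚ.* T ℚ.* quarters (suc n))) (≡.sym (Rat.nat-suc n)))) ⟩
    ι (nat (suc n) ℚ.* (A ℚ.* T ℚ.* quarters (suc n))) ∎
    where
    open ≤-Reasoning
    a′ : ℕ → ℂ
    a′ i = a (suc i)
    h′ : ∀ k → ∣ a′ k ∣ ≤ ι ((¼ ℚ.* A) ℚ.* quarters k)
    h′ k = ≤-trans (h (suc k)) (≤-reflexive (R.reflexive (≡.cong ι
      (solve 3 (λ A f q → A :* (f :* q) := (f :* A) :* q) ≡.refl A ¼ (quarters k)))))

  -- The exponential series

  term : ℂ → ℕ → ℂ
  term z zero    = 1ᶜ
  term z (suc k) = ιᶜ (inv k) *ᶜ (z *ᶜ term z k)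

  term-cong : ∀ {z w} → z ≈ᶜ w → ∀ k → term z k ≈ᶜ term w k
  term-cong z≈w zero    = C.refl
  term-cong z≈w (suc k) = C.*-congˡ (C.*-cong z≈w (term-cong z≈w k))

  nat*invᶜ : ∀ k → natᶜ (suc k) *ᶜ ιᶜ (inv k) ≈ᶜ 1ᶜ
  nat*invᶜ k = C.trans (C.sym (ρ-* _ _)) (ρ-cong (R.trans (R.sym (ι-* _ _)) (R.reflexive (≡.cong ι (Rat.nat*inv k)))))

  deriv-term : ∀ z k → deriv (term z) k ≈ᶜ z *ᶜ term z k
  deriv-term z k = C.trans (C.sym (C.*-assoc _ _ _)) (C.trans (C.*-congʳ (nat*invᶜ k)) (C.*-identityˡ _))

  -- Both sides satisfy the recursion (k + 1) c (k + 1) = (z + w) c k, the formal version of the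
  -- differential equation of exp. For the right side it is `leibniz` together with `deriv-term`.
  term-+ : ∀ z w k → term (z +ᶜ w) k ≈ᶜ (term z ⋆ term w) k
  term-+ z w zero    = C.sym (C.*-identityˡ _)
  term-+ z w (suc k) = begin
    ιᶜ (inv k) *ᶜ ((z +ᶜ w) *ᶜ term (z +ᶜ w) k) ≈⟨ C.*-congˡ (C.*-congˡ (term-+ z w k)) ⟩
    ιᶜ (inv k) *ᶜ ((z +ᶜ w) *ᶜ t) ≈⟨ C.*-congˡ (C.trans (C.distribʳ _ _ _) (C.sym (C.+-cong
        (C.trans (⋆-cong (deriv-term z) (λ _ → C.refl) k) (⋆-scaleˡ z (term z) (term w) k))
        (C.trans (⋆-cong (λ _ → C.refl) (deriv-term w) k) (⋆-scaleʳ w (term z) (term w) k))))) ⟩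
    ιᶜ (inv k) *ᶜ ((deriv (term z) ⋆ term w) k +ᶜ (term z ⋆ deriv (term w)) k)
      ≈⟨ C.*-congˡ (C.sym (leibniz (term z) (term w) k)) ⟩
    ιᶜ (inv k) *ᶜ (natᶜ (suc k) *ᶜ (term z ⋆ term w) (suc k))
      ≈⟨ C.trans (C.sym (C.*-assoc _ _ _)) (C.trans (C.*-congʳ (C.trans (C.*-comm _ _) (nat*invᶜ k))) (C.*-identityˡ _)) ⟩
    (term z ⋆ term w) (suc k) ∎
    where
    open ≈ᶜ-Reasoning
    t = (term z ⋆ term w) k

  private
    majorant : ℚ → ℕ → ℚ
    majorant r zero    = 1ℚ
    majorant r (suc k) = inv k ℚ.* (r ℚ.* majorant r k)

    majorant-nonNeg : ∀ {r} → 0ℚ ℚ.≤ r → ∀ k → 0ℚ ℚ.≤ majorant r k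
    majorant-nonNeg 0≤r zero    = ℚ.<⇒≤ Rat.0<1
    majorant-nonNeg 0≤r (suc k) = Rat.*-nonNeg (Rat.inv-nonNeg k) (Rat.*-nonNeg 0≤r (majorant-nonNeg 0≤r k))

    ∣term∣≤ : ∀ {z r} → ∣ z ∣ ≤ ι r → 0ℚ ℚ.≤ r → ∀ k → ∣ term z k ∣ ≤ ι (majorant r k)
    ∣term∣≤ z≤r 0≤r zero    = ≤-reflexive (∣ρ∣ 0≤1)
    ∣term∣≤ {z} {r} z≤r 0≤r (suc k) = begin
      ∣ ιᶜ (inv k) *ᶜ (z *ᶜ term z k) ∣ ≈⟨ R.trans (∣∣-* _ _) (R.*-cong (∣ρ∣ (ι-mono (Rat.inv-nonNeg k))) (∣∣-* _ _)) ⟩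
      ι (inv k) * (∣ z ∣ * ∣ term z k ∣)
        ≤⟨ *-monoˡ-≤ (ι-mono (Rat.inv-nonNeg k)) (*-mono-≤ (∣z∣-nonNeg z) (ι-mono (majorant-nonNeg 0≤r k)) z≤r (∣term∣≤ z≤r 0≤r k)) ⟩
      ι (inv k) * (ι r * ι (majorant r k)) ≈⟨ R.trans (ι-* _ _) (R.*-congˡ (ι-* _ _)) ⟨
      ι (inv k ℚ.* (r ℚ.* majorant r k)) ∎
      where open ≤-Reasoning

    -- The quotient of consecutive terms is n/(k + 1), which is at most 1/4 once k ≥ 4n.
    majorant-ratio : ∀ n k → 4 ℕ.* n ℕ.≤ k → majorant (nat n) (suc k) ℚ.≤ ¼ ℚ.* majorant (nat n) k
    majorant-ratio n k 4n≤k = ≡.subst (ℚ._≤ ¼ ℚ.* majorant (nat n) k) (ℚ.*-assoc (inv k) (nat n) (majorant (nat n) k))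
      (D.RationalLemmas.*-monoˡ (majorant-nonNeg (Rat.nat-nonNeg n) k) ratio)
      where
      4nat : nat (4 ℕ.* n) ≡ (¼ ℚ.+ ¼ ℚ.+ (¼ ℚ.+ ¼)) ℚ.* (nat n ℚ.+ (nat n ℚ.+ (nat n ℚ.+ nat n)))
      4nat = ≡.trans (≡.trans (≡.cong (λ m → nat (n ℕ.+ (n ℕ.+ (n ℕ.+ m)))) (ℕ.+-identityʳ n))
        (≡.trans (Rat.nat-+ n _) (≡.cong (nat n ℚ.+_) (≡.trans (Rat.nat-+ n _) (≡.cong (nat n ℚ.+_) (Rat.nat-+ n n))))))
        (≡.sym (ℚ.*-identityˡ _))
      ratio : inv k ℚ.* nat n ℚ.≤ ¼
      ratio = ≡.subst₂ ℚ._≤_ (≡.trans (≡.cong (λ z → inv k ℚ.* (¼ ℚ.* z)) 4nat)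
          (solve 2 (λ i n → i :* (con ¼ :* ((con ¼ :+ con ¼ :+ (con ¼ :+ con ¼)) :* (n :+ (n :+ (n :+ n))))) := i :* n) ≡.refl (inv k) (nat n)))
        (≡.trans (≡.cong (inv k ℚ.*_) (ℚ.*-comm ¼ (nat (suc k)))) (≡.trans (≡.sym (ℚ.*-assoc (inv k) (nat (suc k)) ¼))
          (≡.trans (≡.cong (ℚ._* ¼) (≡.trans (ℚ.*-comm (inv k) (nat (suc k))) (Rat.nat*inv k))) (ℚ.*-identityˡ ¼))))
        (D.RationalLemmas.*-monoʳ (Rat.inv-nonNeg k) (D.RationalLemmas.*-monoʳ (ℚ.<⇒≤ (ℚ.positive⁻¹ ¼))
          (Rat.nat-mono (ℕ.m≤n⇒m≤1+n 4n≤k))))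

  term-dominated : ∀ z → ∃[ C ] 0ℚ ℚ.≤ C × (∀ k → ∣ term z k ∣ ≤ ι (C ℚ.* quarters k))
  term-dominated z = choose (upperBound ∣ z ∣)
    where
    choose : ∃[ n ] ∣ z ∣ ≤ ι (nat n) → ∃[ C ] 0ℚ ℚ.≤ C × (∀ k → ∣ term z k ∣ ≤ ι (C ℚ.* quarters k))
    choose (n , z≤n) = C , 0≤C , λ k → ≤-trans
      (∣term∣≤ z≤n (Rat.nat-nonNeg n) k) (ι-mono (b k))
      where
      d : ∃[ C ] 0ℚ ℚ.≤ C × (∀ k → majorant (nat n) k ℚ.≤ C ℚ.* quarters k)
      d = Rat.dominated (4 ℕ.* n) (majorant (nat n)) (majorant-nonNeg (Rat.nat-nonNeg n)) (majorant-ratio n)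
      C : ℚ
      C = proj₁ d
      0≤C : 0ℚ ℚ.≤ C
      0≤C = proj₁ (proj₂ d)
      b : ∀ k → majorant (nat n) k ℚ.≤ C ℚ.* quarters k
      b = proj₂ (proj₂ d)

  opaque
    exp-limit : ∀ z → ∃[ l ] ∑ (term z) ⟶ l
    exp-limit z = choose (term-dominated z)
      where
      choose : ∃[ C ] 0ℚ ℚ.≤ C × (∀ k → ∣ term z k ∣ ≤ ι (C ℚ.* quarters k)) → ∃[ l ] ∑ (term z) ⟶ l
      choose (C , 0≤C , h) = ℂ-complete (∑ (term z)) (∑-cauchy {term z} {C} 0≤C h)

  exp : ℂ → ℂ
  exp z = proj₁ (exp-limit z)

  exp-series : ∀ z → ∑ (term z) ⟶ exp z
  exp-series z = proj₂ (exp-limit z)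

  exp-cong : ∀ {z w} → z ≈ᶜ w → exp z ≈ᶜ exp w
  exp-cong {z} {w} z≈w = ⟶-unique (exp-series z) (⟶-cong (∑-cong (term-cong (C.sym z≈w))) (exp-series w))

  exp-tail : ∀ {w C} → 0ℚ ℚ.≤ C → (∀ k → ∣ term w k ∣ ≤ ι (C ℚ.* quarters k)) →
             ∀ n → ∣ ∑ (term w) n -ᶜ exp w ∣ ≤ ι ((C ℚ.+ C) ℚ.* quarters n)
  exp-tail {w} 0≤C h n = ≤-respˡ (∣z-w∣≈∣w-z∣ _ _) (⟶-≤ (exp-series w) (n , λ m n≤m → ∑-tail 0≤C h n m n≤m))

  -- The partial sums of the Cauchy product have both sides as limit: one by `term-+`, the other by
  -- `mertens`, whose factor n + 1 is absorbed by (n + 1) 4⁻ⁿ ≤ 1/(n + 1).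
  exp-+ : ∀ z w → exp (z +ᶜ w) ≈ᶜ exp z *ᶜ exp w
  exp-+ z w = ⟶-unique (⟶-suc (⟶-cong (∑-cong (term-+ z w)) (exp-series (z +ᶜ w)))) (products (term-dominated z) (term-dominated w))
    where
    a b : ℕ → ℂ
    a = term z
    b = term w
    products : ∃[ A ] 0ℚ ℚ.≤ A × (∀ k → ∣ a k ∣ ≤ ι (A ℚ.* quarters k)) →
               ∃[ B ] 0ℚ ℚ.≤ B × (∀ k → ∣ b k ∣ ≤ ι (B ℚ.* quarters k)) →
               (λ n → ∑ (a ⋆ b) (suc n)) ⟶ exp z *ᶜ exp w
    products (A , 0≤A , ha) (B , 0≤B , hb) ε 0<ε = choose (upperBound ∣ exp w ∣)
      where
      T : ℚ
      T = B ℚ.+ B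
      0≤T : 0ℚ ℚ.≤ T
      0≤T = Rat.+-nonNeg 0≤B 0≤B
      0≤AT : 0ℚ ℚ.≤ A ℚ.* T
      0≤AT = Rat.*-nonNeg 0≤A 0≤T
      choose : ∃[ n ] ∣ exp w ∣ ≤ ι (nat n) → Eventually λ n → ∣ ∑ (a ⋆ b) (suc n) -ᶜ exp z *ᶜ exp w ∣ ≤ ι ε
      choose (r , w≤r) = N , λ n N≤n → begin
        ∣ ∑ (a ⋆ b) (suc n) -ᶜ exp z *ᶜ exp w ∣
          ≈⟨ ∣∣-cong (solveᶜ 4 (λ P S x y → P ⊟ x ⊠ y ≋ (P ⊟ S ⊠ y) ⊞ (S ⊟ x) ⊠ y) C.refl (∑ (a ⋆ b) (suc n)) (∑ a (suc n)) (exp z) (exp w)) ⟩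
        ∣ (∑ (a ⋆ b) (suc n) -ᶜ ∑ a (suc n) *ᶜ exp w) +ᶜ (∑ a (suc n) -ᶜ exp z) *ᶜ exp w ∣
          ≤⟨ ≤-trans (∣z+w∣≤ _ _) (+-mono-≤ ≤-refl (≤-reflexive (∣∣-* _ _))) ⟩
        ∣ ∑ (a ⋆ b) (suc n) -ᶜ ∑ a (suc n) *ᶜ exp w ∣ + ∣ ∑ a (suc n) -ᶜ exp z ∣ * ∣ exp w ∣
          ≤⟨ +-mono-≤ (mertens 0≤T (exp-tail 0≤B hb) (suc n) 0≤A ha)
               (*-mono-≤ (∣z∣-nonNeg _) (ι-mono (Rat.nat-nonNeg r)) (exp-tail 0≤A ha (suc n)) w≤r) ⟩
        ι (nat (suc n) ℚ.* (A ℚ.* T ℚ.* quarters (suc n))) + ι ((A ℚ.+ A) ℚ.* quarters (suc n)) * ι ρr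
          ≈⟨ R.trans (ι-+ _ _) (R.+-congˡ (ι-* _ _)) ⟨
        ι (nat (suc n) ℚ.* (A ℚ.* T ℚ.* quarters (suc n)) ℚ.+ (A ℚ.+ A) ℚ.* quarters (suc n) ℚ.* ρr)
          ≤⟨ ι-mono (ℚ.≤-trans (error (nat (suc n)) (quarters n) (inv n) (Rat.nat*quarters≤inv n) (Rat.quarters≤inv n) (Rat.quarters-nonNeg n) (Rat.nat-nonNeg (suc n)))
               (ℚ.≤-trans (D.RationalLemmas.*-monoʳ 0≤K (proj₂ small n N≤n)) Kδ≤ε)) ⟩
        ι ε ∎
        where
        open ≤-Reasoning
        ρr K : ℚ
        ρr = nat r
        K = A ℚ.* T ℚ.+ (A ℚ.+ A) ℚ.* ρr
        0≤Aρ : 0ℚ ℚ.≤ (A ℚ.+ A) ℚ.* ρr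
        0≤Aρ = Rat.*-nonNeg (Rat.+-nonNeg 0≤A 0≤A) (Rat.nat-nonNeg r)
        0≤K : 0ℚ ℚ.≤ K
        0≤K = Rat.+-nonNeg 0≤AT 0≤Aρ
        shrunk : ∃[ δ ] 0ℚ ℚ.< δ × K ℚ.* δ ℚ.≤ ε
        shrunk = Rat.shrink 0≤K 0<ε
        Kδ≤ε : K ℚ.* proj₁ shrunk ℚ.≤ ε
        Kδ≤ε = proj₂ (proj₂ shrunk)
        small : ∃[ N ] (∀ n → N ℕ.≤ n → inv n ℚ.≤ proj₁ shrunk)
        small = Rat.inv-small (proj₁ shrunk) (proj₁ (proj₂ shrunk))
        N : ℕ
        N = proj₁ small
        identity : ∀ P Q n q i → (P ℚ.+ Q) ℚ.* i ℚ.- (n ℚ.* (P ℚ.* (¼ ℚ.* q)) ℚ.+ Q ℚ.* (¼ ℚ.* q)) ≡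
          P ℚ.* (i ℚ.- n ℚ.* q) ℚ.+ Q ℚ.* (i ℚ.- q) ℚ.+ (½ ℚ.+ ¼) ℚ.* (P ℚ.* (n ℚ.* q) ℚ.+ Q ℚ.* q)
        identity = solve 5 (λ P Q n q i → (P :+ Q) :* i :- (n :* (P :* (con ¼ :* q)) :+ Q :* (con ¼ :* q)) :=
          P :* (i :- n :* q) :+ Q :* (i :- q) :+ (con ½ :+ con ¼) :* (P :* (n :* q) :+ Q :* q)) ≡.refl
        error : ∀ n q i → n ℚ.* q ℚ.≤ i → q ℚ.≤ i → 0ℚ ℚ.≤ q → 0ℚ ℚ.≤ n →
          n ℚ.* (A ℚ.* T ℚ.* (¼ ℚ.* q)) ℚ.+ (A ℚ.+ A) ℚ.* (¼ ℚ.* q) ℚ.* ρr ℚ.≤ K ℚ.* i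
        error n q i nq≤i q≤i 0≤q 0≤n = ≡.subst (λ z → n ℚ.* (A ℚ.* T ℚ.* (¼ ℚ.* q)) ℚ.+ z ℚ.≤ K ℚ.* i)
          (solve 3 (λ A f r → A :* r :* f := A :* f :* r) ≡.refl (A ℚ.+ A) (¼ ℚ.* q) ρr)
          (Rat.≤-by _ (Rat.+-nonNeg (Rat.+-nonNeg (Rat.*-nonNeg 0≤AT (Rat.p≤q⇒0≤q-p nq≤i)) (Rat.*-nonNeg 0≤Aρ (Rat.p≤q⇒0≤q-p q≤i)))
            (Rat.*-nonNeg (ℚ.<⇒≤ (ℚ.positive⁻¹ (½ ℚ.+ ¼))) (Rat.+-nonNeg (Rat.*-nonNeg 0≤AT (Rat.*-nonNeg 0≤n 0≤q)) (Rat.*-nonNeg 0≤Aρ 0≤q))))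
            (identity (A ℚ.* T) ((A ℚ.+ A) ℚ.* ρr) n q i))

-- Modulus and growth of exp, the real exponential, agreement with the given definition.

module ExpProperties where

  open Rat using (nat; inv; halves; 1/n!)
  open Real
  open Complex
  open Exp

  exp-0 : exp 0ᶜ ≈ᶜ 1ᶜ
  exp-0 = ⟶-unique (⟶-suc (exp-series 0ᶜ)) λ ε 0<ε → 0 , λ n _ →
    ≤-trans (≤-reflexive (∣0ᶜ∣ (C.trans (C.+-congʳ (sum n)) (C.-‿inverseʳ 1ᶜ)))) (ι-mono (ℚ.<⇒≤ 0<ε))
    where
    sum : ∀ n → ∑ (term 0ᶜ) (suc n) ≈ᶜ 1ᶜ
    sum zero    = C.+-identityˡ 1ᶜ
    sum (suc n) = C.trans (C.+-cong (sum n)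
      (solveᶜ 2 (λ i t → i ⊠ (κᶜ 0ℚ ⊠ t) ≋ κᶜ 0ℚ) C.refl (ιᶜ (inv n)) (term 0ᶜ n))) (C.+-identityʳ 1ᶜ)

  ∣conj∣ : ∀ z → ∣ conj z ∣ ≈ ∣ z ∣
  ∣conj∣ z = ≤-antisym (≤-square (∣z∣-nonNeg z) (≤-reflexive eq)) (≤-square (∣z∣-nonNeg (conj z)) (≤-reflexive (R.sym eq)))
    where
    eq : ∣ conj z ∣ * ∣ conj z ∣ ≈ ∣ z ∣ * ∣ z ∣
    eq = R.trans (∣z∣² (conj z)) (R.trans (R.+-cong (R.*-cong (re-conj z) (re-conj z)) (R.*-cong (im-conj z) (im-conj z)))
      (R.trans (solveᴿ 2 (λ a b → a ⊗ a ⊕ ⊝ b ⊗ ⊝ b ⊜ a ⊗ a ⊕ b ⊗ b) ≈-refl (re z) (im z)) (R.sym (∣z∣² z))))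

  conj-neg : ∀ z → conj (-ᶜ z) ≈ᶜ -ᶜ conj z
  conj-neg z = C.trans (conj-cong (solveᶜ 1 (λ z → ⊟ z ≋ ⊟ κᶜ 1ℚ ⊠ z) C.refl z)) (C.trans (conj-* _ _)
    (C.trans (C.*-congʳ (C.trans (conj-cong (C.sym (ρ-neg (ι 1ℚ)))) (C.trans (conj-ρ _) (ρ-neg (ι 1ℚ)))))
      (solveᶜ 1 (λ z → ⊟ κᶜ 1ℚ ⊠ z ≋ ⊟ z) C.refl (conj z))))

  exp-conj : ∀ z → conj (exp z) ≈ᶜ exp (conj z)
  exp-conj z = ⟶-unique {a = λ n → conj (∑ (term z) n)}
    (λ ε 0<ε → eventually-map (λ n → ≤-respˡ (R.trans (R.sym (∣conj∣ _)) (∣∣-cong (C.trans (conj-+ _ _) (C.+-congˡ (conj-neg _))))))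
      (exp-series z ε 0<ε))
    (⟶-cong (λ n → C.sym (sums n)) (exp-series (conj z)))
    where
    terms : ∀ k → conj (term z k) ≈ᶜ term (conj z) k
    terms zero    = conj-ρ _
    terms (suc k) = C.trans (conj-* _ _) (C.*-cong (conj-ρ _) (C.trans (conj-* _ _) (C.*-congˡ (terms k))))
    sums : ∀ n → conj (∑ (term z) n) ≈ᶜ ∑ (term (conj z)) n
    sums zero    = conj-ρ _
    sums (suc n) = C.trans (conj-+ _ _) (C.+-cong (sums n) (terms n))

  private
    inv≤½ : ∀ k → inv (suc k) ℚ.≤ ½
    inv≤½ k = Rat.inv≤ (≡.subst (λ n → 1ℚ ℚ.≤ ½ ℚ.* n) (≡.sym (≡.trans (Rat.nat-suc (suc k)) (≡.cong (1ℚ ℚ.+_) (Rat.nat-suc k))))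
      (Rat.≤-by _ (Rat.*-nonNeg (ℚ.<⇒≤ (ℚ.positive⁻¹ ½)) (Rat.nat-nonNeg k))
        (solve 1 (λ n → con ½ :* (con 1ℚ :+ (con 1ℚ :+ n)) :- con 1ℚ := con ½ :* n) ≡.refl (nat k))))

  ∣term∣≤halves : ∀ {h} → ∣ h ∣ ≤ ι 1ℚ → ∀ k → ∣ term h (suc (suc k)) ∣ ≤ ι (halves (suc k)) * (∣ h ∣ * ∣ h ∣)
  ∣term∣≤halves {h} h≤1 k = begin
    ∣ ιᶜ (inv (suc k)) *ᶜ (h *ᶜ term h (suc k)) ∣ ≈⟨ R.trans (∣∣-* _ _) (R.*-cong (∣ρ∣ (ι-mono (Rat.inv-nonNeg _))) (∣∣-* _ _)) ⟩
    ι (inv (suc k)) * (∣ h ∣ * ∣ term h (suc k) ∣)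
      ≤⟨ *-mono-≤ (ι-mono (Rat.inv-nonNeg _)) (*-nonNeg 0≤h (*-nonNeg (ι-mono (Rat.halves-nonNeg k)) 0≤h))
           (ι-mono (inv≤½ k)) (*-monoˡ-≤ 0≤h (first k)) ⟩
    ι ½ * (∣ h ∣ * (ι (halves k) * ∣ h ∣))
      ≈⟨ R.trans (R.*-congʳ (ι-* ½ (halves k))) (solveᴿ 3 (λ a q h → (a ⊗ q) ⊗ (h ⊗ h) ⊜ a ⊗ (h ⊗ (q ⊗ h))) ≈-refl (ι ½) (ι (halves k)) ∣ h ∣) ⟨
    ι (halves (suc k)) * (∣ h ∣ * ∣ h ∣) ∎
    where
    open ≤-Reasoning
    0≤h = ∣z∣-nonNeg h
    first : ∀ k → ∣ term h (suc k) ∣ ≤ ι (halves k) * ∣ h ∣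
    first zero    = ≤-reflexive (R.trans (∣∣-cong (C.trans (C.*-cong (C.reflexive (≡.cong ιᶜ Rat.inv-0)) (C.*-identityʳ h)) (C.*-identityˡ h)))
      (R.sym (R.*-identityˡ ∣ h ∣)))
    first (suc k) = ≤-trans (∣term∣≤halves h≤1 k) (*-monoˡ-≤ (ι-mono (Rat.halves-nonNeg (suc k)))
      (≤-respʳ (R.*-identityˡ ∣ h ∣) (*-monoʳ-≤ 0≤h h≤1)))

  -- Each term after 1 + h gains a factor of at most 1/2, so the terms are bounded by |h|²/2,
  -- |h|²/4, ... with sum |h|². Both the trapezoidal estimate and the chain rule for exp rest on
  -- this quadratic error.
  exp-near : ∀ {h} → ∣ h ∣ ≤ ι 1ℚ → ∣ exp h -ᶜ (1ᶜ +ᶜ h) ∣ ≤ ∣ h ∣ * ∣ h ∣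
  exp-near {h} h≤1 = ⟶-≤ (⟶-suc (⟶-suc (exp-series h))) (0 , λ n _ → ≤-trans (partial n)
    (≤-respʳ (R.*-identityˡ _) (*-monoʳ-≤ 0≤h² (ι-mono (Rat.≤-by _ (Rat.halves-nonNeg n)
      (solve 1 (λ q → con 1ℚ :- (con 1ℚ :- q) := q) ≡.refl (halves n)))))))
    where
    open ≤-Reasoning
    0≤h² = *-nonNeg (∣z∣-nonNeg h) (∣z∣-nonNeg h)
    h² = ∣ h ∣ * ∣ h ∣
    partial : ∀ n → ∣ ∑ (term h) (suc (suc n)) -ᶜ (1ᶜ +ᶜ h) ∣ ≤ ι (1ℚ ℚ.- halves n) * h²
    partial zero = ≤-trans (≤-reflexive (∣0ᶜ∣ (C.trans
        (C.+-congʳ (C.+-congˡ (C.trans (C.*-cong (C.reflexive (≡.cong ιᶜ Rat.inv-0)) (C.*-identityʳ h)) (C.*-identityˡ h))))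
        (solveᶜ 1 (λ h → ((κᶜ 0ℚ ⊞ κᶜ 1ℚ) ⊞ h) ⊟ (κᶜ 1ℚ ⊞ h) ≋ κᶜ 0ℚ) C.refl h))))
      (*-nonNeg ≤-refl 0≤h²)
    partial (suc n) = begin
      ∣ (S +ᶜ t) -ᶜ (1ᶜ +ᶜ h) ∣ ≈⟨ ∣∣-cong (solveᶜ 3 (λ S t u → (S ⊞ t) ⊟ u ≋ (S ⊟ u) ⊞ t) C.refl S t (1ᶜ +ᶜ h)) ⟩
      ∣ (S -ᶜ (1ᶜ +ᶜ h)) +ᶜ t ∣ ≤⟨ ∣z+w∣≤ _ _ ⟩
      ∣ S -ᶜ (1ᶜ +ᶜ h) ∣ + ∣ t ∣ ≤⟨ +-mono-≤ (partial n) (∣term∣≤halves h≤1 n) ⟩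
      ι (1ℚ ℚ.- halves n) * h² + ι (½ ℚ.* halves n) * h² ≈⟨ R.distribʳ h² _ _ ⟨
      (ι (1ℚ ℚ.- halves n) + ι (½ ℚ.* halves n)) * h² ≈⟨ R.*-congʳ (R.trans (R.sym (ι-+ _ _)) (R.reflexive (≡.cong ι
        (solve 1 (λ q → con 1ℚ :- q :+ con ½ :* q := con 1ℚ :- con ½ :* q) ≡.refl (halves n))))) ⟩
      ι (1ℚ ℚ.- halves (suc n)) * h² ∎
      where
      S = ∑ (term h) (suc (suc n))
      t = term h (suc (suc n))

  -- The real exponential

  expᴿ : ℝ → ℝ
  expᴿ x = re (exp (ρ x))

  exp-ρ : ∀ x → exp (ρ x) ≈ᶜ ρ (expᴿ x)
  exp-ρ x = ≈-refl & zero-im (R.trans (im-≈ (C.sym (C.trans (exp-conj (ρ x)) (exp-cong (conj-ρ x))))) (im-conj (exp (ρ x))))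
    where
    zero-im : ∀ {y} → y ≈ - y → y ≈ ι 0ℚ
    zero-im {y} eq = R.trans (solveᴿ 1 (λ y → y ⊜ κ ½ ⊗ (y ⊕ y)) ≈-refl y)
      (R.trans (R.*-congˡ (R.trans (R.+-congˡ eq) (R.-‿inverseʳ y))) (R.zeroʳ (ι ½)))

  expᴿ-cong : ∀ {x y} → x ≈ y → expᴿ x ≈ expᴿ y
  expᴿ-cong x≈y = re-≈ (exp-cong (ρ-cong x≈y))

  expᴿ-+ : ∀ x y → expᴿ (x + y) ≈ expᴿ x * expᴿ y
  expᴿ-+ x y = re-≈ (C.trans (exp-cong (ρ-+ x y)) (C.trans (exp-+ _ _) (C.trans (C.*-cong (exp-ρ x) (exp-ρ y)) (C.sym (ρ-* _ _)))))

  expᴿ-0 : expᴿ (ι 0ℚ) ≈ ι 1ℚ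
  expᴿ-0 = re-≈ exp-0

  expᴿ-nonNeg : ∀ x → ι 0ℚ ≤ expᴿ x
  expᴿ-nonNeg x = ≤-respʳ (R.trans (R.sym (expᴿ-+ (ι ½ * x) (ι ½ * x)))
      (expᴿ-cong (solveᴿ 1 (λ x → κ ½ ⊗ x ⊕ κ ½ ⊗ x ⊜ x) ≈-refl x))) (square-nonNeg (expᴿ (ι ½ * x)))

  expᴿ-inverse : ∀ x → expᴿ x * expᴿ (- x) ≈ ι 1ℚ
  expᴿ-inverse x = R.trans (R.sym (expᴿ-+ x (- x))) (R.trans (expᴿ-cong (R.-‿inverseʳ x)) expᴿ-0)

  -- |exp z|² is exp z times its conjugate exp (conj z), that is exp (z + conj z) = exp (2 Re z).
  ∣exp∣ : ∀ z → ∣ exp z ∣ ≈ expᴿ (re z)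
  ∣exp∣ z = ≤-antisym (≤-square (expᴿ-nonNeg _) (≤-reflexive eq)) (≤-square (∣z∣-nonNeg _) (≤-reflexive (R.sym eq)))
    where
    eq : ∣ exp z ∣ * ∣ exp z ∣ ≈ expᴿ (re z) * expᴿ (re z)
    eq = R.trans (∣z∣² (exp z)) (re-≈ (C.trans (C.sym (z*conj-z (exp z))) (C.trans (C.*-congˡ (exp-conj z))
      (C.trans (C.sym (exp-+ z (conj z))) (C.trans (exp-cong (z+conj-z z)) (C.trans (exp-ρ _) (ρ-cong (expᴿ-+ (re z) (re z)))))))))

  1+x≤expᴿ : ∀ {x} → ι 0ℚ ≤ x → ι 1ℚ + x ≤ expᴿ x
  1+x≤expᴿ {x} 0≤x = ≤-limit λ ε 0<ε → pick (⟶-suc (⟶-suc (exp-series (ρ x))) ε 0<ε)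
    where
    t : ℕ → ℝ
    t zero    = ι 1ℚ
    t (suc k) = ι (inv k) * (x * t k)
    0≤t : ∀ k → ι 0ℚ ≤ t k
    0≤t zero    = 0≤1
    0≤t (suc k) = *-nonNeg (ι-mono (Rat.inv-nonNeg k)) (*-nonNeg 0≤x (0≤t k))
    term≈ : ∀ k → term (ρ x) k ≈ᶜ ρ (t k)
    term≈ zero    = C.refl
    term≈ (suc k) = C.trans (C.*-congˡ (C.trans (C.*-congˡ (term≈ k)) (C.sym (ρ-* _ _)))) (C.sym (ρ-* _ _))
    S : ℕ → ℂ
    S n = ∑ (term (ρ x)) (suc (suc n))
    partial : ∀ n → ι 1ℚ + x ≤ re (S n)
    partial zero = ≤-reflexive (R.sym (R.trans (re-+ _ _) (R.+-cong (R.trans (re-+ _ _) (R.+-identityˡ (ι 1ℚ)))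
      (R.trans (re-≈ (term≈ 1)) (R.trans (R.*-congʳ (R.reflexive (≡.cong ι Rat.inv-0))) (R.trans (R.*-identityˡ _) (R.*-identityʳ x)))))))
    partial (suc n) = ≤-respʳ (R.sym (re-+ _ _)) (≤-respˡ (R.+-identityʳ _)
      (+-mono-≤ (partial n) (≤-respʳ (R.sym (re-≈ (term≈ (suc (suc n))))) (0≤t (suc (suc n))))))
    pick : ∀ {ε} → Eventually (λ n → ∣ S n -ᶜ exp (ρ x) ∣ ≤ ι ε) → ι 1ℚ + x ≤ expᴿ x + ι ε
    pick {ε} (N , h) = ≤-trans (partial N) (≤-by _
      (x≤y⇒0≤y-x (≤-trans (≤-respˡ (R.trans (re-+ (S N) (-ᶜ exp (ρ x))) (R.+-congˡ (re-neg (exp (ρ x))))) (re≤∣z∣ _)) (h N ℕ.≤-refl)))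
      (solveᴿ 3 (λ s e d → (e ⊕ d) ⊖ s ⊜ d ⊖ (s ⊖ e)) ≈-refl (re (S N)) (expᴿ x) (ι ε)))

  expᴿ-mono : ∀ {x y} → x ≤ y → expᴿ x ≤ expᴿ y
  expᴿ-mono {x} {y} x≤y = ≤-respˡ (R.*-identityʳ _) (≤-respʳ
    (R.trans (R.sym (expᴿ-+ x (y - x))) (expᴿ-cong (solveᴿ 2 (λ x y → x ⊕ (y ⊖ x) ⊜ y) ≈-refl x y)))
    (*-monoˡ-≤ (expᴿ-nonNeg x) (≤-trans (≤-by _ 0≤y-x (solveᴿ 1 (λ d → (κ 1ℚ ⊕ d) ⊖ κ 1ℚ ⊜ d) ≈-refl (y - x))) (1+x≤expᴿ 0≤y-x))))
    where 0≤y-x = x≤y⇒0≤y-x x≤y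

  -- In the case y ≤ x, multiplying the hypothesis by exp (-y) gives 1 - exp (x - y) ≥ 0, whereas
  -- exp (x - y) ≥ 1 + (x - y); the sum of the two is y - x ≥ 0. This makes logarithms unique and
  -- comparable.
  expᴿ-cancel : ∀ {x y} → expᴿ x ≤ expᴿ y → x ≤ y
  expᴿ-cancel {x} {y} ex≤ey = ≤-cases {x} {y} (λ h → h) λ y≤x →
    ≤-by _ (+-nonNeg (*-nonNeg (expᴿ-nonNeg (- y)) (x≤y⇒0≤y-x ex≤ey))
        (x≤y⇒0≤y-x (1+x≤expᴿ (x≤y⇒0≤y-x y≤x))))
      (R.sym (R.trans (R.+-cong (R.trans (R.distribˡ _ _ _) (R.+-cong (R.trans (R.*-comm _ _) (expᴿ-inverse y))
          (R.trans (solveᴿ 2 (λ a b → a ⊗ ⊝ b ⊜ ⊝ (b ⊗ a)) ≈-refl (expᴿ (- y)) (expᴿ x))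
            (R.-‿cong (R.sym (expᴿ-+ x (- y))))))) R.refl)
        (solveᴿ 3 (λ x y e → (κ 1ℚ ⊖ e) ⊕ (e ⊖ (κ 1ℚ ⊕ (x ⊖ y))) ⊜ y ⊖ x) ≈-refl x y (expᴿ (x - y)))))

  expᴿ-injective : ∀ {x y} → expᴿ x ≈ expᴿ y → x ≈ y
  expᴿ-injective eq = ≤-antisym (expᴿ-cancel (≤-reflexive eq)) (expᴿ-cancel (≤-reflexive (R.sym eq)))

  expᴿ-decay : ∀ {x} → ι 0ℚ ≤ x → expᴿ (- x) * (ι 1ℚ + x) ≤ ι 1ℚ
  expᴿ-decay {x} 0≤x = ≤-trans (*-monoˡ-≤ (expᴿ-nonNeg (- x)) (1+x≤expᴿ 0≤x))
    (≤-reflexive (R.trans (R.*-comm _ _) (expᴿ-inverse x)))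

  expᴿ-neg≤1 : ∀ {x} → ι 0ℚ ≤ x → expᴿ (- x) ≤ ι 1ℚ
  expᴿ-neg≤1 {x} 0≤x = ≤-respʳ expᴿ-0 (expᴿ-mono (≤-by _ 0≤x (solveᴿ 1 (λ x → κ 0ℚ ⊖ ⊝ x ⊜ x) ≈-refl x)))

  -- `exp-near` at -x. It bounds from below how much x^(-σ) drops over a small step, which is what
  -- the error of the trapezoidal rule is paid with.
  x-x²≤1-expᴿ-neg : ∀ {x} → ι 0ℚ ≤ x → x ≤ ι 1ℚ → x - x * x ≤ ι 1ℚ - expᴿ (- x)
  x-x²≤1-expᴿ-neg {x} 0≤x x≤1 = ≤-by _ (x≤y⇒0≤y-x bound)
    (solveᴿ 2 (λ x e → (κ 1ℚ ⊖ e) ⊖ (x ⊖ x ⊗ x) ⊜ x ⊗ x ⊖ (e ⊖ (κ 1ℚ ⊕ ⊝ x))) ≈-refl x (expᴿ (- x)))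
    where
    ∣-x∣ : ∣ ρ (- x) ∣ ≈ x
    ∣-x∣ = R.trans (∣∣-cong (ρ-neg x)) (R.trans (∣-z∣ _) (∣ρ∣ 0≤x))
    bound : expᴿ (- x) - (ι 1ℚ + - x) ≤ x * x
    bound = ≤-trans (≤-respˡ (R.trans (re-+ _ _) (R.+-congˡ (R.trans (re-neg _) (R.-‿cong (re-+ _ _))))) (re≤∣z∣ _))
      (≤-trans (exp-near (≤-respˡ (R.sym ∣-x∣) x≤1)) (≤-reflexive (R.*-cong ∣-x∣ ∣-x∣)))

  -- The exponential of Defs

  partialSum≈∑ : ∀ {a b} → (∀ k → a k ≈ᶜ b k) → ∀ n → D.partialSum a n ≈ᶜ ∑ b n
  partialSum≈∑ a≈b zero    = C.reflexive ≡-0ℂ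
  partialSum≈∑ a≈b (suc n) = C.trans (C.reflexive (≡ᶜ-+ _ _)) (C.+-cong (partialSum≈∑ a≈b n) (a≈b n))

  hasSum : ∀ {a b s} → (∀ k → a k ≈ᶜ b k) → D.HasSum a s → ∑ b ⟶ s
  hasSum {a} {b} {s} a≈b h ε 0<ε = proj₁ (h ε 0<ε) , λ n N≤n → ≡.subst₂ _≤_ ≡.refl (≡-ι ε)
    (≤-trans (≤-reflexive (R.trans (∣∣-cong (C.sym (C.trans (C.reflexive (≡ᶜ-- _ _)) (C.+-congʳ (partialSum≈∑ a≈b n)))))
        (R.reflexive (≡.sym (≡-∣∣ _)))))
      (<⇒≤ (proj₂ (h ε 0<ε) N≤n)))

  isExp : ∀ {z w} → D.IsExp z w → w ≈ᶜ exp z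
  isExp {z} {w} h = ⟶-unique (hasSum same h) (exp-series z)
    where
    coefficient : ∀ k → D.fromℝ (D.fromℚ ((ℤ.+ 1 ℚ./ k !) {{k ℕ.!≢0}})) ≈ᶜ ιᶜ (1/n! k)
    coefficient k = C.trans (C.reflexive (≡-ρ _)) (ρ-cong (R.reflexive (≡.trans (≡-ι _) (≡.cong ι (≡.sym (Rat.1/n!≡ k))))))
    powers : ∀ k → ιᶜ (1/n! k) *ᶜ (z D.^ k) ≈ᶜ term z k
    powers zero    = C.trans (C.*-cong (C.reflexive (≡.cong ιᶜ Rat.1/0!)) (C.reflexive ≡-1ℂ)) (C.*-identityˡ 1ᶜ)
    powers (suc k) = C.trans (C.*-cong (C.trans (C.reflexive (≡.cong ιᶜ (Rat.1/suc! k))) (C.trans (ρ-cong (ι-* _ _)) (ρ-* _ _)))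
        (C.reflexive (≡ᶜ-* _ _)))
      (C.trans (solveᶜ 4 (λ i c z p → (i ⊠ c) ⊠ (z ⊠ p) ≋ i ⊠ (z ⊠ (c ⊠ p))) C.refl (ιᶜ (inv k)) (ιᶜ (1/n! k)) z (z D.^ k))
        (C.*-congˡ (C.*-congˡ (powers k))))
    same : ∀ k → D.fromℝ (D.fromℚ ((ℤ.+ 1 ℚ./ k !) {{k ℕ.!≢0}})) D.*ᶜ z D.^ k ≈ᶜ term z k
    same k = C.trans (C.reflexive (≡ᶜ-* _ _)) (C.trans (C.*-congʳ (coefficient k)) (powers k))

-- The trapezoidal rule for sums of n⁻ˢ.

module Trapezoidal where

  open Rat using (nat; inv)
  open Real
  open Complex
  open Exp
  open ExpProperties

  ∣ρ∣≤ : ∀ {x b} → x ≤ b → - x ≤ b → ∣ ρ x ∣ ≤ b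
  ∣ρ∣≤ {x} x≤b -x≤b = ≤-cases {ι 0ℚ} {x} (λ 0≤x → ≤-respˡ (R.sym (∣ρ∣ 0≤x)) x≤b)
    λ x≤0 → ≤-respˡ (R.sym (R.trans (R.sym (∣-z∣ (ρ x))) (R.trans (∣∣-cong (C.sym (ρ-neg x)))
      (∣ρ∣ (≤-by _ (x≤y⇒0≤y-x x≤0) (solveᴿ 1 (λ x → ⊝ x ⊖ κ 0ℚ ⊜ κ 0ℚ ⊖ x) ≈-refl x)))))) -x≤b

  -- The factor c will be σ. Leaving it on the left avoids dividing by σ, and g carries the
  -- decreasing quantity whose drops dominate the increments of f.
  telescope : ∀ (f : ℕ → ℂ) (g : ℕ → ℝ) (c err : ℝ) → ι 0ℚ ≤ c → ∀ M →
    (∀ j → j ℕ.< M → c * ∣ f (suc j) -ᶜ f j ∣ ≤ (g j - g (suc j)) + err) →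
    c * ∣ f M -ᶜ f 0 ∣ ≤ (g 0 - g M) + ι (nat M) * err
  telescope f g c err 0≤c zero h = ≤-reflexive (R.trans (R.*-congˡ (∣0ᶜ∣ (C.-‿inverseʳ (f 0))))
    (R.trans (solveᴿ 3 (λ c g e → c ⊗ κ 0ℚ ⊜ (g ⊖ g) ⊕ κ 0ℚ ⊗ e) ≈-refl c (g 0) err)
      (R.+-congˡ (R.*-congʳ (R.reflexive (≡.cong ι (≡.sym Rat.nat-0)))))))
  telescope f g c err 0≤c (suc M) h = begin
    c * ∣ f (suc M) -ᶜ f 0 ∣
      ≈⟨ R.*-congˡ (∣∣-cong (solveᶜ 3 (λ x y z → x ⊟ z ≋ (y ⊟ z) ⊞ (x ⊟ y)) C.refl (f (suc M)) (f M) (f 0))) ⟩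
    c * ∣ (f M -ᶜ f 0) +ᶜ (f (suc M) -ᶜ f M) ∣ ≤⟨ *-monoˡ-≤ 0≤c (∣z+w∣≤ _ _) ⟩
    c * (∣ f M -ᶜ f 0 ∣ + ∣ f (suc M) -ᶜ f M ∣) ≈⟨ R.distribˡ _ _ _ ⟩
    c * ∣ f M -ᶜ f 0 ∣ + c * ∣ f (suc M) -ᶜ f M ∣
      ≤⟨ +-mono-≤ (telescope f g c err 0≤c M λ j j<M → h j (ℕ.m≤n⇒m≤1+n j<M)) (h M ℕ.≤-refl) ⟩
    ((g 0 - g M) + ι (nat M) * err) + ((g M - g (suc M)) + err)
      ≈⟨ solveᴿ 5 (λ a b c n e → ((a ⊖ b) ⊕ n ⊗ e) ⊕ ((b ⊖ c) ⊕ e) ⊜ (a ⊖ c) ⊕ (κ 1ℚ ⊕ n) ⊗ e) ≈-refl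
           (g 0) (g M) (g (suc M)) (ι (nat M)) err ⟩
    (g 0 - g (suc M)) + (ι 1ℚ + ι (nat M)) * err
      ≈⟨ R.+-congˡ (R.*-congʳ (R.trans (R.reflexive (≡.cong ι (Rat.nat-suc M))) (ι-+ 1ℚ (nat M)))) ⟨
    (g 0 - g (suc M)) + ι (nat (suc M)) * err ∎
    where open ≤-Reasoning

  module Trapezoid (s : ℂ) (0≤σ : ι 0ℚ ≤ re s) where

    -- `K` is the constant |s|/2 of the trapezoidal bound times |s - 1|: all estimates are made for
    -- (s - 1) F n, which has no pole at 1.
    σ K : ℝ
    σ = re s
    K = ι ½ * (∣ s ∣ * ∣ s -ᶜ 1ᶜ ∣)

    -- The variable is w = log x, so that `power w` stands for x⁻ˢ and `decay w` for x^(-σ). Only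
    -- the ends of the unit intervals need a logarithm; the points between them are given by w.
    power : ℝ → ℂ
    power w = exp (-ᶜ s *ᶜ ρ w)

    decay : ℝ → ℝ
    decay w = expᴿ (- (σ * w))

    ∣power∣ : ∀ w → ∣ power w ∣ ≈ decay w
    ∣power∣ w = R.trans (∣exp∣ _) (expᴿ-cong (R.trans (re-* _ _) (R.trans (R.+-cong (R.*-congʳ (re-neg s)) R.refl)
      (solveᴿ 3 (λ a b w → ⊝ a ⊗ w ⊖ b ⊗ κ 0ℚ ⊜ ⊝ (a ⊗ w)) ≈-refl (re s) (im (-ᶜ s)) w))))

    power-+ : ∀ w h → power (w + h) ≈ᶜ power w *ᶜ power h
    power-+ w h = C.trans (exp-cong (C.trans (C.*-congˡ (ρ-+ w h)) (C.distribˡ _ _ _))) (exp-+ _ _)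

    decay-+ : ∀ w h → decay (w + h) ≈ decay w * decay h
    decay-+ w h = R.trans (expᴿ-cong (solveᴿ 3 (λ s w h → ⊝ (s ⊗ (w ⊕ h)) ⊜ ⊝ (s ⊗ w) ⊕ ⊝ (s ⊗ h)) ≈-refl σ w h)) (expᴿ-+ _ _)

    K-nonNeg : ι 0ℚ ≤ K
    K-nonNeg = *-nonNeg (ι-mono (ℚ.<⇒≤ (ℚ.positive⁻¹ ½))) (*-nonNeg (∣z∣-nonNeg _) (∣z∣-nonNeg _))

    -- x ↦ φ v (log x) is an antiderivative of s (s - 1) (v + 1/2 - x) x⁻ˢ⁻¹.
    φ : ℝ → ℝ → ℂ
    φ v w = power w *ᶜ (s *ᶜ ρ (expᴿ w) -ᶜ (s -ᶜ 1ᶜ) *ᶜ ρ (v + ι ½))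

    -- The coefficient of h² in `step`. It is the same for all steps within one unit interval and
    -- disappears as the subdivision is refined.
    error : ℝ → ℝ
    error v = K * (σ * σ) + σ * (∣ s ∣ * ((v + ι 1ℚ) * (∣ s -ᶜ 1ᶜ ∣ * ∣ s -ᶜ 1ᶜ ∣)) + ∣ s -ᶜ 1ᶜ ∣ * ((v + ι 1ℚ) * (∣ s ∣ * ∣ s ∣)))

    module Step (v w h : ℝ) (0≤v : ι 0ℚ ≤ v) (0≤w : ι 0ℚ ≤ w) (0≤h : ι 0ℚ ≤ h)
                (v≤x : v ≤ expᴿ w) (x≤v+1 : expᴿ w ≤ v + ι 1ℚ)
                (sh≤1 : ∣ s ∣ * h ≤ ι 1ℚ) (s-1h≤1 : ∣ s -ᶜ 1ᶜ ∣ * h ≤ ι 1ℚ) (σh≤1 : σ * h ≤ ι 1ℚ) where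

      a F G x m H F₀ G₀ : ℂ
      a = power w
      F = exp ((1ᶜ -ᶜ s) *ᶜ ρ h)
      G = power h
      x = ρ (expᴿ w)
      m = ρ (v + ι ½)
      H = ρ h
      F₀ = 1ᶜ +ᶜ (1ᶜ -ᶜ s) *ᶜ H
      G₀ = 1ᶜ +ᶜ (-ᶜ s) *ᶜ H

      -- `F₀` and `G₀` are the linear parts of the exponentials `F` and `G`. Their contributions
      -- combine to s (s - 1) h (m - x), and as m is the midpoint of the unit interval containing x,
      -- |m - x| ≤ 1/2 makes this at most K h. What remains is quadratic in h.
      φ-step : φ v (w + h) -ᶜ φ v w ≈ᶜ a *ᶜ (((s *ᶜ (s -ᶜ 1ᶜ)) *ᶜ (H *ᶜ (m -ᶜ x)) +ᶜ s *ᶜ (x *ᶜ (F -ᶜ F₀))) -ᶜ (s -ᶜ 1ᶜ) *ᶜ (m *ᶜ (G -ᶜ G₀)))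
      φ-step = C.trans (C.+-congʳ (C.trans (C.*-cong (power-+ w h)
            (C.+-congʳ (C.*-congˡ (C.trans (ρ-cong (expᴿ-+ w h)) (C.trans (ρ-* _ _) (C.*-congˡ (C.sym (exp-ρ h))))))))
          (C.trans (solveᶜ 7 (λ a G s x e n m → (a ⊠ G) ⊠ (s ⊠ (x ⊠ e) ⊟ n ⊠ m) ≋ a ⊠ (s ⊠ (x ⊠ (e ⊠ G)) ⊟ n ⊠ (m ⊠ G))) C.refl
              a G s x (exp (ρ h)) (s -ᶜ 1ᶜ) m)
            (C.*-congˡ (C.+-congʳ (C.*-congˡ (C.*-congˡ (C.trans (C.sym (exp-+ _ _))
              (exp-cong (solveᶜ 2 (λ s h → h ⊞ (⊟ s) ⊠ h ≋ (κᶜ 1ℚ ⊟ s) ⊠ h) C.refl s H)))))))))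
        ) (solveᶜ 7 (λ a s x m H F G →
            a ⊠ (s ⊠ (x ⊠ F) ⊟ (s ⊟ κᶜ 1ℚ) ⊠ (m ⊠ G)) ⊟ a ⊠ (s ⊠ x ⊟ (s ⊟ κᶜ 1ℚ) ⊠ m) ≋
            a ⊠ (((s ⊠ (s ⊟ κᶜ 1ℚ)) ⊠ (H ⊠ (m ⊟ x)) ⊞ s ⊠ (x ⊠ (F ⊟ (κᶜ 1ℚ ⊞ (κᶜ 1ℚ ⊟ s) ⊠ H)))) ⊟ (s ⊟ κᶜ 1ℚ) ⊠ (m ⊠ (G ⊟ (κᶜ 1ℚ ⊞ (⊟ s) ⊠ H)))))
          C.refl a s x m H F G)

      ∣H∣ : ∣ H ∣ ≈ h
      ∣H∣ = ∣ρ∣ 0≤h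

      0≤v+½ : ι 0ℚ ≤ v + ι ½
      0≤v+½ = +-nonNeg 0≤v (ι-mono (ℚ.<⇒≤ (ℚ.positive⁻¹ ½)))

      0≤v+1 : ι 0ℚ ≤ v + ι 1ℚ
      0≤v+1 = +-nonNeg 0≤v 0≤1

      ∣m-x∣ : ∣ m -ᶜ x ∣ ≤ ι ½
      ∣m-x∣ = ≤-respˡ (∣∣-cong (C.trans (ρ-+ _ _) (C.+-congˡ (ρ-neg _)))) (∣ρ∣≤
        (≤-by _ (x≤y⇒0≤y-x v≤x) (solveᴿ 2 (λ v x → κ ½ ⊖ ((v ⊕ κ ½) ⊖ x) ⊜ x ⊖ v) ≈-refl v (expᴿ w)))
        (≤-by _ (x≤y⇒0≤y-x x≤v+1) (solveᴿ 2 (λ v x → κ ½ ⊖ (⊝ ((v ⊕ κ ½) ⊖ x)) ⊜ (v ⊕ κ 1ℚ) ⊖ x) ≈-refl v (expᴿ w))))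

      ∣1-s∣ : ∣ 1ᶜ -ᶜ s ∣ ≈ ∣ s -ᶜ 1ᶜ ∣
      ∣1-s∣ = ∣z-w∣≈∣w-z∣ 1ᶜ s

      p q : ℝ
      p = ∣ s ∣
      q = ∣ s -ᶜ 1ᶜ ∣

      near : ∀ c {b} → ∣ c ∣ ≈ b → b * h ≤ ι 1ℚ → ∣ exp (c *ᶜ H) -ᶜ (1ᶜ +ᶜ c *ᶜ H) ∣ ≤ (b * b) * (h * h)
      near c {b} c≈b bh≤1 = ≤-trans (exp-near (≤-respˡ (R.sym eq) bh≤1)) (≤-reflexive (R.trans (R.*-cong eq eq)
          (solveᴿ 2 (λ b h → (b ⊗ h) ⊗ (b ⊗ h) ⊜ (b ⊗ b) ⊗ (h ⊗ h)) ≈-refl b h)))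
        where
        eq : ∣ c *ᶜ H ∣ ≈ b * h
        eq = R.trans (∣∣-* _ _) (R.*-cong c≈b ∣H∣)

      0≤h² : ι 0ℚ ≤ h * h
      0≤h² = *-nonNeg 0≤h 0≤h

      term₁ : ∣ (s *ᶜ (s -ᶜ 1ᶜ)) *ᶜ (H *ᶜ (m -ᶜ x)) ∣ ≤ (p * q) * (h * ι ½)
      term₁ = ≤-respˡ (R.sym (R.trans (∣∣-* _ _) (R.*-cong (∣∣-* _ _) (R.trans (∣∣-* _ _) (R.*-congʳ ∣H∣)))))
        (*-monoˡ-≤ (*-nonNeg (∣z∣-nonNeg _) (∣z∣-nonNeg _)) (*-monoˡ-≤ 0≤h ∣m-x∣))

      term₂ : ∣ s *ᶜ (x *ᶜ (F -ᶜ F₀)) ∣ ≤ p * ((v + ι 1ℚ) * ((q * q) * (h * h)))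
      term₂ = ≤-respˡ (R.sym (R.trans (∣∣-* _ _) (R.*-congˡ (R.trans (∣∣-* _ _) (R.*-congʳ (∣ρ∣ (expᴿ-nonNeg w)))))))
        (*-monoˡ-≤ (∣z∣-nonNeg _) (*-mono-≤ (expᴿ-nonNeg w) (*-nonNeg (*-nonNeg (∣z∣-nonNeg _) (∣z∣-nonNeg _)) 0≤h²)
          x≤v+1 (near (1ᶜ -ᶜ s) ∣1-s∣ s-1h≤1)))

      term₃ : ∣ (s -ᶜ 1ᶜ) *ᶜ (m *ᶜ (G -ᶜ G₀)) ∣ ≤ q * ((v + ι 1ℚ) * ((p * p) * (h * h)))
      term₃ = ≤-respˡ (R.sym (R.trans (∣∣-* _ _) (R.*-congˡ (R.trans (∣∣-* _ _) (R.*-congʳ (∣ρ∣ 0≤v+½))))))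
        (*-monoˡ-≤ (∣z∣-nonNeg _) (*-mono-≤ 0≤v+½ (*-nonNeg (*-nonNeg (∣z∣-nonNeg _) (∣z∣-nonNeg _)) 0≤h²)
          (+-mono-≤ ≤-refl (ι-mono (ℚ.<⇒≤ (Rat.half< Rat.0<1)))) (near (-ᶜ s) (∣-z∣ s) sh≤1)))

      y : ℝ
      y = decay w

      y≤1 : y ≤ ι 1ℚ
      y≤1 = expᴿ-neg≤1 (*-nonNeg 0≤σ 0≤w)

      D₁ : ℝ
      D₁ = p * ((v + ι 1ℚ) * (q * q)) + q * ((v + ι 1ℚ) * (p * p))

      0≤pq² : ι 0ℚ ≤ D₁
      0≤pq² = +-nonNeg (*-nonNeg (∣z∣-nonNeg _) (*-nonNeg 0≤v+1 (*-nonNeg (∣z∣-nonNeg _) (∣z∣-nonNeg _))))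
        (*-nonNeg (∣z∣-nonNeg _) (*-nonNeg 0≤v+1 (*-nonNeg (∣z∣-nonNeg _) (∣z∣-nonNeg _))))

      ∣step∣ : ∣ φ v (w + h) -ᶜ φ v w ∣ ≤ y * (K * h + D₁ * (h * h))
      ∣step∣ = ≤-respˡ (R.sym (R.trans (∣∣-cong φ-step) (R.trans (∣∣-* _ _) (R.*-congʳ (∣power∣ w)))))
        (*-monoˡ-≤ (expᴿ-nonNeg _) (≤-trans (∣z-w∣≤ _ _) (≤-trans (+-mono-≤ (≤-trans (∣z+w∣≤ _ _) (+-mono-≤ term₁ term₂)) term₃)
          (≤-reflexive (solveᴿ 5 (λ p q h v f → ((p ⊗ q) ⊗ (h ⊗ f) ⊕ p ⊗ (v ⊗ ((q ⊗ q) ⊗ (h ⊗ h)))) ⊕ q ⊗ (v ⊗ ((p ⊗ p) ⊗ (h ⊗ h))) ⊜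
            (f ⊗ (p ⊗ q)) ⊗ h ⊕ (p ⊗ (v ⊗ (q ⊗ q)) ⊕ q ⊗ (v ⊗ (p ⊗ p))) ⊗ (h ⊗ h)) ≈-refl p q h (v + ι 1ℚ) (ι ½))))))

      drop : y * (σ * h - (σ * h) * (σ * h)) ≤ decay w - decay (w + h)
      drop = ≤-respʳ (R.trans (R.distribˡ _ _ _) (R.+-cong (R.*-identityʳ y)
          (R.trans (solveᴿ 2 (λ a b → a ⊗ ⊝ b ⊜ ⊝ (a ⊗ b)) ≈-refl y (decay h)) (R.-‿cong (R.sym (decay-+ w h))))))
        (*-monoˡ-≤ (expᴿ-nonNeg _) (x-x²≤1-expᴿ-neg (*-nonNeg 0≤σ 0≤h) σh≤1))

      -- The main term σ K h y is K times the drop of `decay`, up to K (σh)² y by `drop`. This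
      -- excess and the remainder σ D₁ h² y go into `error v * (h * h)` because y ≤ 1.
      step : σ * ∣ φ v (w + h) -ᶜ φ v w ∣ ≤ (K * decay w - K * decay (w + h)) + error v * (h * h)
      step = ≤-trans (*-monoˡ-≤ 0≤σ ∣step∣) (≤-by _
        (+-nonNeg (*-nonNeg K-nonNeg (x≤y⇒0≤y-x drop)) (*-nonNeg (x≤y⇒0≤y-x y≤1)
          (*-nonNeg (+-nonNeg (*-nonNeg K-nonNeg (*-nonNeg 0≤σ 0≤σ)) (*-nonNeg 0≤σ 0≤pq²)) 0≤h²)))
        (solveᴿ 7 (λ K s D h y d d′ → ((K ⊗ d ⊖ K ⊗ d′) ⊕ (K ⊗ (s ⊗ s) ⊕ s ⊗ D) ⊗ (h ⊗ h)) ⊖ s ⊗ (y ⊗ (K ⊗ h ⊕ D ⊗ (h ⊗ h))) ⊜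
          K ⊗ ((d ⊖ d′) ⊖ y ⊗ (s ⊗ h ⊖ (s ⊗ h) ⊗ (s ⊗ h))) ⊕ (κ 1ℚ ⊖ y) ⊗ ((K ⊗ (s ⊗ s) ⊕ s ⊗ D) ⊗ (h ⊗ h)))
          ≈-refl K σ D₁ h y (decay w) (decay (w + h))))

    φ-cong : ∀ v {w w′} → w ≈ w′ → φ v w ≈ᶜ φ v w′
    φ-cong v w≈w′ = C.*-cong (exp-cong (C.*-congˡ (ρ-cong w≈w′))) (C.+-congʳ (C.*-congˡ (ρ-cong (expᴿ-cong w≈w′))))

    decay-cong : ∀ {w w′} → w ≈ w′ → decay w ≈ decay w′
    decay-cong w≈w′ = expᴿ-cong (R.-‿cong (R.*-congˡ w≈w′))

    module Segment (v l₀ l₁ : ℝ) (0≤v : ι 0ℚ ≤ v) (0≤l₀ : ι 0ℚ ≤ l₀) (l₀≤l₁ : l₀ ≤ l₁)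
                   (e₀ : expᴿ l₀ ≈ v) (e₁ : expᴿ l₁ ≈ v + ι 1ℚ) where

      δ : ℝ
      δ = l₁ - l₀

      0≤δ : ι 0ℚ ≤ δ
      0≤δ = x≤y⇒0≤y-x l₀≤l₁

      module Subdivision (N : ℕ) (small : (∣ s ∣ + ∣ s -ᶜ 1ᶜ ∣ + σ) * δ * ι (inv N) ≤ ι 1ℚ) where

        h : ℝ
        h = ι (inv N) * δ

        0≤h : ι 0ℚ ≤ h
        0≤h = *-nonNeg (ι-mono (Rat.inv-nonNeg N)) 0≤δ

        w : ℕ → ℝ
        w j = l₀ + ι (nat j) * h

        w-suc : ∀ j → w j + h ≈ w (suc j)
        w-suc j = R.trans (solveᴿ 3 (λ l n h → (l ⊕ n ⊗ h) ⊕ h ⊜ l ⊕ (κ 1ℚ ⊕ n) ⊗ h) ≈-refl l₀ (ι (nat j)) h)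
          (R.+-congˡ (R.*-congʳ (R.trans (R.sym (ι-+ _ _)) (R.reflexive (≡.cong ι (≡.sym (Rat.nat-suc j)))))))

        total : ι (nat (suc N)) * h ≈ δ
        total = R.trans (R.sym (R.*-assoc _ _ _)) (R.trans (R.*-congʳ (R.trans (R.sym (ι-* _ _)) (R.reflexive (≡.cong ι (Rat.nat*inv N)))))
          (R.*-identityˡ δ))

        w-last : w (suc N) ≈ l₁
        w-last = R.trans (R.+-congˡ total) (solveᴿ 2 (λ a b → a ⊕ (b ⊖ a) ⊜ b) ≈-refl l₀ l₁)

        w-first : w 0 ≈ l₀
        w-first = R.trans (R.+-congˡ (R.*-congʳ (R.reflexive (≡.cong ι Rat.nat-0)))) (solveᴿ 2 (λ l h → l ⊕ κ 0ℚ ⊗ h ⊜ l) ≈-refl l₀ h)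

        l₀≤w : ∀ j → l₀ ≤ w j
        l₀≤w j = ≤-by _ (*-nonNeg (ι-mono (Rat.nat-nonNeg j)) 0≤h) (solveᴿ 2 (λ l x → (l ⊕ x) ⊖ l ⊜ x) ≈-refl l₀ (ι (nat j) * h))

        w≤l₁ : ∀ j → j ℕ.< suc N → w j ≤ l₁
        w≤l₁ j j<M = ≤-respʳ w-last (+-mono-≤ ≤-refl (*-monoʳ-≤ 0≤h (ι-mono (Rat.nat-mono (ℕ.<⇒≤ j<M)))))

        part : ∀ {c} → ι 0ℚ ≤ (∣ s ∣ + ∣ s -ᶜ 1ᶜ ∣ + σ) - c → c * h ≤ ι 1ℚ
        part {c} 0≤rest = ≤-trans (≤-by _ (*-nonNeg 0≤rest 0≤h)
          (solveᴿ 4 (λ S c i d → S ⊗ d ⊗ i ⊖ c ⊗ (i ⊗ d) ⊜ (S ⊖ c) ⊗ (i ⊗ d)) ≈-refl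
            (∣ s ∣ + ∣ s -ᶜ 1ᶜ ∣ + σ) c (ι (inv N)) δ)) small

        -- N + 1 steps of length δ/(N + 1), each with an error proportional to its square,
        -- accumulate `error v` δ²/(N + 1). Letting N grow in `segment` plays the part of the
        -- integral.
        estimate : σ * ∣ φ v l₁ -ᶜ φ v l₀ ∣ ≤ (K * decay l₀ - K * decay l₁) + (error v * δ * δ) * ι (inv N)
        estimate = ≤-respˡ (R.*-congˡ (∣∣-cong (C.+-cong (φ-cong v w-last) (C.-‿cong (φ-cong v w-first)))))
          (≤-respʳ (R.+-cong (R.+-cong (R.*-congˡ (decay-cong w-first)) (R.-‿cong (R.*-congˡ (decay-cong w-last))))
              (R.trans (solveᴿ 3 (λ n e h → n ⊗ (e ⊗ (h ⊗ h)) ⊜ e ⊗ ((n ⊗ h) ⊗ h)) ≈-refl (ι (nat (suc N))) (error v) h)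
                (R.trans (R.*-congˡ (R.*-congʳ total)) (solveᴿ 3 (λ e d i → e ⊗ (d ⊗ (i ⊗ d)) ⊜ (e ⊗ d ⊗ d) ⊗ i) ≈-refl (error v) δ (ι (inv N))))))
            (telescope (λ j → φ v (w j)) (λ j → K * decay (w j)) σ (error v * (h * h)) 0≤σ (suc N) one))
          where
          one : ∀ j → j ℕ.< suc N → σ * ∣ φ v (w (suc j)) -ᶜ φ v (w j) ∣ ≤ (K * decay (w j) - K * decay (w (suc j))) + error v * (h * h)
          one j j<M = ≤-respˡ (R.*-congˡ (∣∣-cong (C.+-congʳ (φ-cong v (w-suc j)))))
            (≤-respʳ (R.+-congʳ (R.+-congˡ (R.-‿cong (R.*-congˡ (decay-cong (w-suc j))))))
              (Step.step v (w j) h 0≤v (≤-trans 0≤l₀ (l₀≤w j)) 0≤h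
                (≤-respˡ e₀ (expᴿ-mono (l₀≤w j))) (≤-respʳ e₁ (expᴿ-mono (w≤l₁ j j<M)))
                (part (≤-respʳ (solveᴿ 3 (λ p q s → q ⊕ s ⊜ (p ⊕ q ⊕ s) ⊖ p) ≈-refl ∣ s ∣ ∣ s -ᶜ 1ᶜ ∣ σ) (+-nonNeg (∣z∣-nonNeg _) 0≤σ)))
                (part (≤-respʳ (solveᴿ 3 (λ p q s → p ⊕ s ⊜ (p ⊕ q ⊕ s) ⊖ q) ≈-refl ∣ s ∣ ∣ s -ᶜ 1ᶜ ∣ σ) (+-nonNeg (∣z∣-nonNeg _) 0≤σ)))
                (part (≤-respʳ (solveᴿ 3 (λ p q s → p ⊕ q ⊜ (p ⊕ q ⊕ s) ⊖ s) ≈-refl ∣ s ∣ ∣ s -ᶜ 1ᶜ ∣ σ) (+-nonNeg (∣z∣-nonNeg _) (∣z∣-nonNeg _))))))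

      segment : σ * ∣ φ v l₁ -ᶜ φ v l₀ ∣ ≤ K * decay l₀ - K * decay l₁
      segment = ≤-limit λ ε 0<ε → bounds ε 0<ε (upperBound ((∣ s ∣ + ∣ s -ᶜ 1ᶜ ∣ + σ) * δ)) (upperBound (error v * δ * δ))
        where
        small-by : ∀ {x r i ε} → x ≤ ι (nat r) → 0ℚ ℚ.≤ i → nat r ℚ.* i ℚ.≤ ε → x * ι i ≤ ι ε
        small-by {r = r} {i} x≤r 0≤i h = ≤-trans (*-monoʳ-≤ (ι-mono 0≤i) x≤r) (≤-respˡ (ι-* _ _) (ι-mono h))
        bounds : ∀ ε → 0ℚ ℚ.< ε → ∃[ r ] (∣ s ∣ + ∣ s -ᶜ 1ᶜ ∣ + σ) * δ ≤ ι (nat r) → ∃[ r ] error v * δ * δ ≤ ι (nat r) →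
                 σ * ∣ φ v l₁ -ᶜ φ v l₀ ∣ ≤ (K * decay l₀ - K * decay l₁) + ι ε
        bounds ε 0<ε (r , hr) (t , ht) = choose (Rat.shrink (Rat.nat-nonNeg r) Rat.0<1) (Rat.shrink (Rat.nat-nonNeg t) 0<ε)
          where
          choose : ∃[ δ₁ ] 0ℚ ℚ.< δ₁ × nat r ℚ.* δ₁ ℚ.≤ 1ℚ → ∃[ δ₂ ] 0ℚ ℚ.< δ₂ × nat t ℚ.* δ₂ ℚ.≤ ε →
                   σ * ∣ φ v l₁ -ᶜ φ v l₀ ∣ ≤ (K * decay l₀ - K * decay l₁) + ι ε
          choose (δ₁ , 0<δ₁ , h₁) (δ₂ , 0<δ₂ , h₂) = pick (Rat.inv-small δ₁ 0<δ₁) (Rat.inv-small δ₂ 0<δ₂)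
            where
            pick : ∃[ N ] (∀ n → N ℕ.≤ n → inv n ℚ.≤ δ₁) → ∃[ N ] (∀ n → N ℕ.≤ n → inv n ℚ.≤ δ₂) →
                   σ * ∣ φ v l₁ -ᶜ φ v l₀ ∣ ≤ (K * decay l₀ - K * decay l₁) + ι ε
            pick (N₁ , s₁) (N₂ , s₂) = ≤-trans
              (Subdivision.estimate N (small-by hr (Rat.inv-nonNeg N)
                (ℚ.≤-trans (Rat.*-monoʳ-≤ (Rat.nat-nonNeg r) (s₁ N (ℕ.m≤m⊔n N₁ N₂))) h₁)))
              (+-mono-≤ ≤-refl (small-by ht (Rat.inv-nonNeg N)
                (ℚ.≤-trans (Rat.*-monoʳ-≤ (Rat.nat-nonNeg t) (s₂ N (ℕ.m≤n⊔m N₁ N₂))) h₂)))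
              where
              N : ℕ
              N = N₁ ℕ.⊔ N₂

  module Logarithms (l : ℕ → ℝ) (hl : ∀ n → expᴿ (l n) ≈ ι (nat (suc n))) where

    ι-nat-suc : ∀ n → ι (nat (suc n)) ≈ ι (nat n) + ι 1ℚ
    ι-nat-suc n = R.trans (R.reflexive (≡.cong ι (≡.trans (Rat.nat-suc n) (ℚ.+-comm 1ℚ (nat n))))) (ι-+ _ _)

    l-mono : ∀ n → l n ≤ l (suc n)
    l-mono n = expᴿ-cancel (≤-respˡ (R.sym (hl n)) (≤-respʳ (R.sym (hl (suc n))) (ι-mono (Rat.nat-mono (ℕ.n≤1+n (suc n))))))

    l-nonNeg : ∀ n → ι 0ℚ ≤ l n
    l-nonNeg n = expᴿ-cancel (≤-respˡ (R.sym expᴿ-0) (≤-respʳ (R.sym (hl n))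
      (≤-respˡ (R.reflexive (≡.cong ι Rat.nat-1)) (ι-mono (Rat.nat-mono (ℕ.s≤s (ℕ.z≤n {n})))))))

    l-zero : l 0 ≈ ι 0ℚ
    l-zero = expᴿ-injective (R.trans (hl 0) (R.trans (R.reflexive (≡.cong ι Rat.nat-1)) (R.sym expᴿ-0)))

    -- `A s n` is (n + 1)⁻ˢ, so the sum of its first n values runs over the integers from 1 to n.
    A : ℂ → ℕ → ℂ
    A s n = exp (-ᶜ s *ᶜ ρ (l n))

    -- (s - 1) times the approximation Σ_{k ≤ n} k⁻ˢ + (n + 1)⁻ˢ / 2 + (n + 1)¹⁻ˢ / (s - 1) of ζ(s).
    P : ℂ → ℕ → ℂ
    P s n = (s -ᶜ 1ᶜ) *ᶜ (∑ (A s) n +ᶜ ιᶜ ½ *ᶜ A s n) +ᶜ natᶜ (suc n) *ᶜ A s n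

    module _ (s : ℂ) (0≤σ : ι 0ℚ ≤ re s) where
      open Trapezoid s 0≤σ

      -- With v = n + 1, the values of `φ v` at the two ends of [n + 1, n + 2] are (n + 2)⁻ˢ (v + 1
      -- + (s - 1)/2) and (n + 1)⁻ˢ (v - (s - 1)/2), and their difference is exactly the increment
      -- of P. The correction terms in P are chosen for this.
      P-step : ∀ n → P s (suc n) -ᶜ P s n ≈ᶜ φ (ι (nat (suc n))) (l (suc n)) -ᶜ φ (ι (nat (suc n))) (l n)
      P-step n = C.trans (C.+-congʳ (C.+-congˡ (C.*-congʳ (natᶜ-suc (suc n))))) (C.trans
        (solveᶜ 5 (λ s S a a′ N → ((s ⊟ κᶜ 1ℚ) ⊠ ((S ⊞ a) ⊞ κᶜ ½ ⊠ a′) ⊞ (κᶜ 1ℚ ⊞ N) ⊠ a′) ⊟ ((s ⊟ κᶜ 1ℚ) ⊠ (S ⊞ κᶜ ½ ⊠ a) ⊞ N ⊠ a) ≋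
          a′ ⊠ (s ⊠ (κᶜ 1ℚ ⊞ N) ⊟ (s ⊟ κᶜ 1ℚ) ⊠ (N ⊞ κᶜ ½)) ⊟ a ⊠ (s ⊠ N ⊟ (s ⊟ κᶜ 1ℚ) ⊠ (N ⊞ κᶜ ½))) C.refl
          s (∑ (A s) n) (A s n) (A s (suc n)) (natᶜ (suc n)))
        (C.+-cong (C.*-congˡ (C.+-cong (C.*-congˡ (C.trans (C.sym (natᶜ-suc (suc n))) (ρ-cong (R.sym (hl (suc n))))))
            (C.-‿cong (C.*-congˡ (C.sym (ρ-+ _ _))))))
          (C.-‿cong (C.*-congˡ (C.+-cong (C.*-congˡ (ρ-cong (R.sym (hl n)))) (C.-‿cong (C.*-congˡ (C.sym (ρ-+ _ _)))))))))

      P-estimate-suc : ∀ n → σ * ∣ P s (suc n) -ᶜ P s n ∣ ≤ K * decay (l n) - K * decay (l (suc n))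
      P-estimate-suc n = ≤-respˡ (R.*-congˡ (∣∣-cong (C.sym (P-step n)))) (Segment.segment (ι (nat (suc n))) (l n) (l (suc n))
        (ι-mono (Rat.nat-nonNeg (suc n))) (l-nonNeg n) (l-mono n) (hl n) (R.trans (hl (suc n)) (ι-nat-suc (suc n))))

      P-estimate : ∀ {m n} → m ℕ.≤ n → σ * ∣ P s n -ᶜ P s m ∣ ≤ K * decay (l m) - K * decay (l n)
      P-estimate {m} {n} m≤n = ≡.subst (λ n → σ * ∣ P s n -ᶜ P s m ∣ ≤ K * decay (l m) - K * decay (l n)) (ℕ.m+[n∸m]≡n m≤n)
        (≡.subst (λ k → σ * ∣ P s (m ℕ.+ (n ℕ.∸ m)) -ᶜ P s k ∣ ≤ K * decay (l k) - K * decay (l (m ℕ.+ (n ℕ.∸ m)))) (ℕ.+-identityʳ m)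
          (≤-respʳ (solveᴿ 2 (λ x n → x ⊕ n ⊗ κ 0ℚ ⊜ x) ≈-refl _ (ι (nat (n ℕ.∸ m))))
            (telescope (λ j → P s (m ℕ.+ j)) (λ j → K * decay (l (m ℕ.+ j))) σ (ι 0ℚ) 0≤σ (n ℕ.∸ m)
              λ j _ → ≡.subst (λ i → σ * ∣ P s i -ᶜ P s (m ℕ.+ j) ∣ ≤ (K * decay (l (m ℕ.+ j)) - K * decay (l i)) + ι 0ℚ) (≡.sym (ℕ.+-suc m j))
                (≤-respʳ (R.sym (R.+-identityʳ _)) (P-estimate-suc (m ℕ.+ j))))))

      decay-nonNeg : ∀ w → ι 0ℚ ≤ decay w
      decay-nonNeg w = expᴿ-nonNeg _

      decay-l0 : decay (l 0) ≈ ι 1ℚ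
      decay-l0 = R.trans (expᴿ-cong (R.trans (R.-‿cong (R.*-congˡ l-zero)) (solveᴿ 1 (λ s → ⊝ (s ⊗ κ 0ℚ) ⊜ κ 0ℚ) ≈-refl σ))) expᴿ-0

      P-zero : P s 0 ≈ᶜ ιᶜ ½ *ᶜ (s -ᶜ 1ᶜ) +ᶜ 1ᶜ
      P-zero = C.trans (C.+-cong (C.*-congˡ (C.+-congˡ (C.*-congˡ A0≈1))) (C.*-cong (C.reflexive (≡.cong ιᶜ Rat.nat-1)) A0≈1))
        (solveᶜ 1 (λ s → (s ⊟ κᶜ 1ℚ) ⊠ (κᶜ 0ℚ ⊞ κᶜ ½ ⊠ κᶜ 1ℚ) ⊞ κᶜ 1ℚ ⊠ κᶜ 1ℚ ≋ κᶜ ½ ⊠ (s ⊟ κᶜ 1ℚ) ⊞ κᶜ 1ℚ) C.refl s)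
        where
        A0≈1 : A s 0 ≈ᶜ 1ᶜ
        A0≈1 = C.trans (exp-cong (C.trans (C.*-congˡ (ρ-cong l-zero)) (solveᶜ 1 (λ s → ⊟ s ⊠ κᶜ 0ℚ ≋ κᶜ 0ℚ) C.refl s))) exp-0

      P-bound : ∀ n → σ * ∣ P s n ∣ ≤ K + σ * (ι ½ * ∣ s -ᶜ 1ᶜ ∣ + ι 1ℚ)
      P-bound n = begin
        σ * ∣ P s n ∣ ≈⟨ R.*-congˡ (∣∣-cong (solveᶜ 2 (λ p q → p ≋ (p ⊟ q) ⊞ q) C.refl (P s n) (P s 0))) ⟩
        σ * ∣ (P s n -ᶜ P s 0) +ᶜ P s 0 ∣ ≤⟨ *-monoˡ-≤ 0≤σ (∣z+w∣≤ _ _) ⟩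
        σ * (∣ P s n -ᶜ P s 0 ∣ + ∣ P s 0 ∣) ≈⟨ R.distribˡ _ _ _ ⟩
        σ * ∣ P s n -ᶜ P s 0 ∣ + σ * ∣ P s 0 ∣ ≤⟨ +-mono-≤ (≤-trans (P-estimate ℕ.z≤n) total) (*-monoˡ-≤ 0≤σ first) ⟩
        K + σ * (ι ½ * ∣ s -ᶜ 1ᶜ ∣ + ι 1ℚ) ∎
        where
        open ≤-Reasoning
        total : K * decay (l 0) - K * decay (l n) ≤ K
        total = ≤-by _ (*-nonNeg K-nonNeg (decay-nonNeg (l n)))
          (R.trans (R.+-congˡ (R.-‿cong (R.+-congʳ (R.*-congˡ decay-l0))))
            (solveᴿ 2 (λ K d → K ⊖ (K ⊗ κ 1ℚ ⊖ K ⊗ d) ⊜ K ⊗ d) ≈-refl K (decay (l n))))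
        first : ∣ P s 0 ∣ ≤ ι ½ * ∣ s -ᶜ 1ᶜ ∣ + ι 1ℚ
        first = ≤-respˡ (∣∣-cong (C.sym P-zero)) (≤-trans (∣z+w∣≤ _ _) (≤-reflexive
          (R.+-cong (R.trans (∣∣-* _ _) (R.*-congʳ (∣ρ∣ (ι-mono (ℚ.<⇒≤ (ℚ.positive⁻¹ ½)))))) (∣ρ∣ 0≤1))))

-- Riemann sums along one side of a polygon.

module Paths where

  open Rat using (nat; inv)
  open Real
  open Complex
  open Exp

  ∑-bound : ∀ (a : ℕ → ℂ) b n → (∀ k → k ℕ.< n → ∣ a k ∣ ≤ b) → ∣ ∑ a n ∣ ≤ ι (nat n) * b
  ∑-bound a b zero    h = ≤-reflexive (R.trans (∣ρ∣ ≤-refl)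
    (R.sym (R.trans (R.*-congʳ (R.reflexive (≡.cong ι Rat.nat-0))) (R.zeroˡ b))))
  ∑-bound a b (suc n) h = ≤-trans (∣z+w∣≤ _ _) (≤-trans
    (+-mono-≤ (∑-bound a b n λ k k<n → h k (ℕ.m≤n⇒m≤1+n k<n)) (h n ℕ.≤-refl))
    (≤-reflexive (R.trans (solveᴿ 2 (λ n b → n ⊗ b ⊕ b ⊜ (κ 1ℚ ⊕ n) ⊗ b) ≈-refl (ι (nat n)) b)
      (R.*-congʳ (R.trans (R.sym (ι-+ _ _)) (R.reflexive (≡.cong ι (≡.sym (Rat.nat-suc n)))))))))

  ∑-telescope : ∀ (f : ℕ → ℂ) n → ∑ (λ k → f (suc k) -ᶜ f k) n ≈ᶜ f n -ᶜ f 0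
  ∑-telescope f zero    = C.sym (C.-‿inverseʳ (f 0))
  ∑-telescope f (suc n) = C.trans (C.+-congʳ (∑-telescope f n))
    (solveᶜ 3 (λ a b c → (a ⊟ b) ⊞ (c ⊟ a) ≋ c ⊟ b) C.refl (f n) (f 0) (f (suc n)))

  ∑-linear : ∀ c a b n → ∑ (λ k → c *ᶜ a k -ᶜ b k) n ≈ᶜ c *ᶜ ∑ a n -ᶜ ∑ b n
  ∑-linear c a b zero    = solveᶜ 1 (λ c → κᶜ 0ℚ ≋ c ⊠ κᶜ 0ℚ ⊟ κᶜ 0ℚ) C.refl c
  ∑-linear c a b (suc n) = C.trans (C.+-congʳ (∑-linear c a b n))
    (solveᶜ 5 (λ c x y u v → (c ⊠ x ⊟ y) ⊞ (c ⊠ u ⊟ v) ≋ c ⊠ (x ⊞ u) ⊟ (y ⊞ v)) C.refl _ _ _ _ _)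

  ∑-- : ∀ a b n → ∑ (λ k → a k -ᶜ b k) n ≈ᶜ ∑ a n -ᶜ ∑ b n
  ∑-- a b n = C.trans (∑-cong (λ k → C.+-congʳ (C.sym (C.*-identityˡ (a k)))) n)
    (C.trans (∑-linear 1ᶜ a b n) (C.+-congʳ (C.*-identityˡ _)))

  ∑-const : ∀ c n → ∑ (λ _ → c) n ≈ᶜ natᶜ n *ᶜ c
  ∑-const c zero    = C.sym (C.trans (C.*-congʳ (C.reflexive (≡.cong ιᶜ Rat.nat-0))) (C.zeroˡ c))
  ∑-const c (suc n) = C.trans (C.+-congʳ (∑-const c n)) (C.trans
    (solveᶜ 2 (λ n c → n ⊠ c ⊞ c ≋ (κᶜ 1ℚ ⊞ n) ⊠ c) C.refl (natᶜ n) c) (C.*-congʳ (C.sym (natᶜ-suc n))))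

  -- A segment with vertices p k, k ≤ N + 1, and direction D, seen from 0; F j k and F′ j k are
  -- the values of a function and its derivative at j/(N + 1) · p k.

  module Path (N : ℕ) (p q : ℕ → ℂ) (D : ℂ) (qp≈1 : ∀ k → q k *ᶜ p k ≈ᶜ 1ᶜ)
    (F F′ : ℕ → ℕ → ℂ) (ε : ℝ) (0≤ε : ι 0ℚ ≤ ε)
    (radial : ∀ j k → j ℕ.< suc N → k ℕ.< suc N →
      ∣ (F (suc j) k -ᶜ F j k) -ᶜ F′ j k *ᶜ (ιᶜ (inv N) *ᶜ p k) ∣ ≤ ε * (ι (inv N) * ∣ p k ∣))
    (tangential : ∀ j k → j ℕ.< suc N → k ℕ.< suc N →
      ∣ (F j (suc k) -ᶜ F j k) -ᶜ F′ j k *ᶜ (natᶜ j *ᶜ (ιᶜ (inv N) *ᶜ (ιᶜ (inv N) *ᶜ D))) ∣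
        ≤ ε * (ι (nat j) * (ι (inv N) * (ι (inv N) * ∣ D ∣))))
    where

    τ : ℂ
    τ = ιᶜ (inv N)

    -- The discrete dz/z: in the application τ D is p (k + 1) - p k, and q k inverts p k. `S j` is
    -- thus the part of ∮ f(rz) dz/z on this side, with r = j/(N + 1).
    weight : ℕ → ℂ
    weight k = (τ *ᶜ D) *ᶜ q k

    S : ℕ → ℂ
    S j = ∑ (λ k → weight k *ᶜ F j k) (suc N)

    ∣τ∣ : ∣ τ ∣ ≈ ι (inv N)
    ∣τ∣ = ∣ρ∣ (ι-mono (Rat.inv-nonNeg N))

    nτ : ι (nat (suc N)) * ι (inv N) ≈ ι 1ℚ
    nτ = R.trans (R.sym (ι-* _ _)) (R.reflexive (≡.cong ι (Rat.nat*inv N)))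

    private
      ∣qp∣ : ∀ k → ∣ q k ∣ * ∣ p k ∣ ≈ ι 1ℚ
      ∣qp∣ k = R.trans (R.sym (∣∣-* _ _)) (R.trans (∣∣-cong (qp≈1 k)) (∣ρ∣ 0≤1))

      ∣weight*error∣ : ∀ k z → ∣ z ∣ ≤ ε * (ι (inv N) * ∣ p k ∣) →
        ∣ weight k *ᶜ z ∣ ≤ ε * (ι (inv N) * (ι (inv N) * ∣ D ∣))
      ∣weight*error∣ k z h = begin
        ∣ (τ *ᶜ D) *ᶜ q k *ᶜ z ∣
          ≈⟨ R.trans (∣∣-* _ _) (R.*-congʳ (R.trans (∣∣-* _ _) (R.*-congʳ (R.trans (∣∣-* _ _) (R.*-congʳ ∣τ∣))))) ⟩
        (ι (inv N) * ∣ D ∣) * ∣ q k ∣ * ∣ z ∣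
          ≤⟨ *-monoˡ-≤ (*-nonNeg (*-nonNeg (ι-mono (Rat.inv-nonNeg N)) (∣z∣-nonNeg D)) (∣z∣-nonNeg _)) h ⟩
        (ι (inv N) * ∣ D ∣) * ∣ q k ∣ * (ε * (ι (inv N) * ∣ p k ∣))
          ≈⟨ solveᴿ 5 (λ t d q e p → (t ⊗ d) ⊗ q ⊗ (e ⊗ (t ⊗ p)) ⊜ (q ⊗ p) ⊗ (e ⊗ (t ⊗ (t ⊗ d)))) ≈-refl (ι (inv N)) (∣ D ∣) (∣ q k ∣) ε (∣ p k ∣) ⟩
        (∣ q k ∣ * ∣ p k ∣) * (ε * (ι (inv N) * (ι (inv N) * ∣ D ∣))) ≈⟨ R.trans (R.*-congʳ (∣qp∣ k)) (R.*-identityˡ _) ⟩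
        ε * (ι (inv N) * (ι (inv N) * ∣ D ∣)) ∎
        where open ≤-Reasoning

      weight-step : ∀ k c → c *ᶜ (τ *ᶜ (τ *ᶜ D)) ≈ᶜ weight k *ᶜ (c *ᶜ (τ *ᶜ p k))
      weight-step k c = C.trans (C.trans (C.sym (C.*-identityˡ _)) (C.*-congʳ (C.sym (qp≈1 k))))
        (solveᶜ 5 (λ q p c t d → (q ⊠ p) ⊠ (c ⊠ (t ⊠ (t ⊠ d))) ≋ ((t ⊠ d) ⊠ q) ⊠ (c ⊠ (t ⊠ p))) C.refl (q k) (p k) c τ D)

      S-difference : ∀ j → S (suc j) -ᶜ S j ≈ᶜ ∑ (λ k → weight k *ᶜ (F (suc j) k -ᶜ F j k)) (suc N)
      S-difference j = C.sym (C.trans (∑-cong (λ k → solveᶜ 3 (λ w a b → w ⊠ (a ⊟ b) ≋ w ⊠ a ⊟ w ⊠ b) C.refl (weight k) (F (suc j) k) (F j k)) (suc N))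
        (∑-- _ _ (suc N)))

    -- A radial step changes F by about F′ τ p k. The weight cancels p k and leaves F′ τ² D, which
    -- is 1/j of the tangential increment of F on the polygon scaled by j/(N + 1). The tangential
    -- increments telescope; multiplying by j avoids the division.
    step : ∀ j → j ℕ.< suc N →
      ∣ natᶜ j *ᶜ (S (suc j) -ᶜ S j) -ᶜ (F j (suc N) -ᶜ F j 0) ∣ ≤ ι (nat j) * ((ε + ε) * (ι (inv N) * ∣ D ∣))
    step j j<n = begin
      ∣ natᶜ j *ᶜ (S (suc j) -ᶜ S j) -ᶜ (F j (suc N) -ᶜ F j 0) ∣
        ≈⟨ ∣∣-cong (C.trans (∑-linear _ _ _ (suc N)) (C.+-cong (C.*-congˡ (C.sym (S-difference j))) (C.-‿cong (∑-telescope (F j) (suc N))))) ⟨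
      ∣ ∑ (λ k → natᶜ j *ᶜ (weight k *ᶜ (F (suc j) k -ᶜ F j k)) -ᶜ (F j (suc k) -ᶜ F j k)) (suc N) ∣
        ≤⟨ ∑-bound _ _ (suc N) each ⟩
      ι (nat (suc N)) * (ι (nat j) * ((ε + ε) * (ι (inv N) * (ι (inv N) * ∣ D ∣))))
        ≈⟨ solveᴿ 5 (λ n j e t d → n ⊗ (j ⊗ (e ⊗ (t ⊗ (t ⊗ d)))) ⊜ (n ⊗ t) ⊗ (j ⊗ (e ⊗ (t ⊗ d)))) ≈-refl (ι (nat (suc N))) (ι (nat j)) (ε + ε) (ι (inv N)) ∣ D ∣ ⟩
      (ι (nat (suc N)) * ι (inv N)) * (ι (nat j) * ((ε + ε) * (ι (inv N) * ∣ D ∣))) ≈⟨ R.trans (R.*-congʳ nτ) (R.*-identityˡ _) ⟩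
      ι (nat j) * ((ε + ε) * (ι (inv N) * ∣ D ∣)) ∎
      where
      open ≤-Reasoning
      each : ∀ k → k ℕ.< suc N → ∣ natᶜ j *ᶜ (weight k *ᶜ (F (suc j) k -ᶜ F j k)) -ᶜ (F j (suc k) -ᶜ F j k) ∣
        ≤ ι (nat j) * ((ε + ε) * (ι (inv N) * (ι (inv N) * ∣ D ∣)))
      each k k<n = begin
        ∣ natᶜ j *ᶜ (weight k *ᶜ (F (suc j) k -ᶜ F j k)) -ᶜ (F j (suc k) -ᶜ F j k) ∣
          ≈⟨ ∣∣-cong (C.trans (solveᶜ 5 (λ n w a b c → n ⊠ (w ⊠ a) ⊟ b ≋ (n ⊠ (w ⊠ (a ⊟ c))) ⊟ (b ⊟ n ⊠ (w ⊠ c))) C.refl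
               (natᶜ j) (weight k) (F (suc j) k -ᶜ F j k) (F j (suc k) -ᶜ F j k) (F′ j k *ᶜ (τ *ᶜ p k)))
               (C.+-congˡ (C.-‿cong (C.+-congˡ (C.-‿cong (C.trans (C.*-congˡ (C.sym (weight-step k (F′ j k))))
                 (solveᶜ 3 (λ n c t → n ⊠ (c ⊠ t) ≋ c ⊠ (n ⊠ t)) C.refl (natᶜ j) (F′ j k) (τ *ᶜ (τ *ᶜ D)))))))) ) ⟩
        ∣ natᶜ j *ᶜ (weight k *ᶜ r₁) -ᶜ r₂ ∣ ≤⟨ ∣z-w∣≤ _ _ ⟩
        ∣ natᶜ j *ᶜ (weight k *ᶜ r₁) ∣ + ∣ r₂ ∣
          ≤⟨ +-mono-≤ (≤-respˡ (R.sym (R.trans (∣∣-* _ _) (R.*-congʳ (∣ρ∣ (ι-mono (Rat.nat-nonNeg j))))))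
               (*-monoˡ-≤ (ι-mono (Rat.nat-nonNeg j)) (∣weight*error∣ k r₁ (radial j k j<n k<n)))) (tangential j k j<n k<n) ⟩
        ι (nat j) * (ε * (ι (inv N) * (ι (inv N) * ∣ D ∣))) + ε * (ι (nat j) * (ι (inv N) * (ι (inv N) * ∣ D ∣)))
          ≈⟨ solveᴿ 3 (λ j e t → j ⊗ (e ⊗ t) ⊕ e ⊗ (j ⊗ t) ⊜ j ⊗ ((e ⊕ e) ⊗ t)) ≈-refl (ι (nat j)) ε (ι (inv N) * (ι (inv N) * ∣ D ∣)) ⟩
        ι (nat j) * ((ε + ε) * (ι (inv N) * (ι (inv N) * ∣ D ∣))) ∎
        where
        r₁ r₂ : ℂ
        r₁ = (F (suc j) k -ᶜ F j k) -ᶜ F′ j k *ᶜ (τ *ᶜ p k)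
        r₂ = (F j (suc k) -ᶜ F j k) -ᶜ F′ j k *ᶜ (natᶜ j *ᶜ (τ *ᶜ (τ *ᶜ D)))

    -- For j = 0 the relation in `step` carries the factor 0. Instead, F′ is constant at the centre,
    -- so the change is about c τ D, and these values cancel once the directions of all sides are
    -- added.
    first-step : ∀ c → (∀ k → F′ 0 k ≈ᶜ c) → ∣ (S 1 -ᶜ S 0) -ᶜ (c *ᶜ τ) *ᶜ D ∣ ≤ ε * (ι (inv N) * ∣ D ∣)
    first-step c F′≈c = begin
      ∣ (S 1 -ᶜ S 0) -ᶜ (c *ᶜ τ) *ᶜ D ∣
        ≈⟨ ∣∣-cong (C.trans (∑-- _ _ (suc N)) (C.+-cong (C.sym (S-difference 0)) (C.-‿cong (C.trans (∑-const _ (suc N))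
             (C.trans (solveᶜ 4 (λ n c t d → n ⊠ (c ⊠ (t ⊠ (t ⊠ d))) ≋ (n ⊠ t) ⊠ ((c ⊠ t) ⊠ d)) C.refl (natᶜ (suc N)) c τ D)
               (C.trans (C.*-congʳ (nat*invᶜ N)) (C.*-identityˡ _))))))) ⟨
      ∣ ∑ (λ k → weight k *ᶜ (F 1 k -ᶜ F 0 k) -ᶜ c *ᶜ (τ *ᶜ (τ *ᶜ D))) (suc N) ∣ ≤⟨ ∑-bound _ _ (suc N) each ⟩
      ι (nat (suc N)) * (ε * (ι (inv N) * (ι (inv N) * ∣ D ∣)))
        ≈⟨ solveᴿ 4 (λ n e t d → n ⊗ (e ⊗ (t ⊗ (t ⊗ d))) ⊜ (n ⊗ t) ⊗ (e ⊗ (t ⊗ d))) ≈-refl (ι (nat (suc N))) ε (ι (inv N)) ∣ D ∣ ⟩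
      (ι (nat (suc N)) * ι (inv N)) * (ε * (ι (inv N) * ∣ D ∣)) ≈⟨ R.trans (R.*-congʳ nτ) (R.*-identityˡ _) ⟩
      ε * (ι (inv N) * ∣ D ∣) ∎
      where
      open ≤-Reasoning
      each : ∀ k → k ℕ.< suc N → ∣ weight k *ᶜ (F 1 k -ᶜ F 0 k) -ᶜ c *ᶜ (τ *ᶜ (τ *ᶜ D)) ∣ ≤ ε * (ι (inv N) * (ι (inv N) * ∣ D ∣))
      each k k<n = ≤-respˡ (∣∣-cong (C.trans (solveᶜ 3 (λ w a b → w ⊠ (a ⊟ b) ≋ w ⊠ a ⊟ w ⊠ b) C.refl (weight k) (F 1 k -ᶜ F 0 k) (F′ 0 k *ᶜ (τ *ᶜ p k)))
          (C.+-congˡ (C.-‿cong (C.trans (C.sym (weight-step k (F′ 0 k))) (C.*-congʳ (F′≈c k)))))))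
        (∣weight*error∣ k _ (radial 0 k (ℕ.s≤s ℕ.z≤n) k<n))

-- Closed polygons and an approximate Cauchy formula at the centre.

module Polygons where

  open Rat using (nat; inv)
  open Real
  open Complex
  open Exp
  open Paths

  next : Fin 4 → Fin 4
  next 0F = 1F
  next 1F = 2F
  next 2F = 3F
  next 3F = 0F

  opaque
    ∑₄ : (Fin 4 → ℂ) → ℂ
    ∑₄ a = ((a 0F +ᶜ a 1F) +ᶜ a 2F) +ᶜ a 3F

    ∑₄ᴿ : (Fin 4 → ℝ) → ℝ
    ∑₄ᴿ a = ((a 0F + a 1F) + a 2F) + a 3F

    ∑₄-cong : ∀ {a b} → (∀ i → a i ≈ᶜ b i) → ∑₄ a ≈ᶜ ∑₄ b
    ∑₄-cong h = C.+-cong (C.+-cong (C.+-cong (h 0F) (h 1F)) (h 2F)) (h 3F)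

    ∑₄ᴿ-mono : ∀ {a b} → (∀ i → a i ≤ b i) → ∑₄ᴿ a ≤ ∑₄ᴿ b
    ∑₄ᴿ-mono h = +-mono-≤ (+-mono-≤ (+-mono-≤ (h 0F) (h 1F)) (h 2F)) (h 3F)

    ∣∑₄∣≤ : ∀ a → ∣ ∑₄ a ∣ ≤ ∑₄ᴿ (λ i → ∣ a i ∣)
    ∣∑₄∣≤ a = ≤-trans (∣z+w∣≤ _ _) (+-mono-≤ (≤-trans (∣z+w∣≤ _ _) (+-mono-≤ (∣z+w∣≤ _ _) ≤-refl)) ≤-refl)

    ∑₄ᴿ-scale : ∀ c a → ∑₄ᴿ (λ i → c * a i) ≈ c * ∑₄ᴿ a
    ∑₄ᴿ-scale c a = solveᴿ 5 (λ c x y z w → ((c ⊗ x ⊕ c ⊗ y) ⊕ c ⊗ z) ⊕ c ⊗ w ⊜ c ⊗ (((x ⊕ y) ⊕ z) ⊕ w)) ≈-refl c (a 0F) (a 1F) (a 2F) (a 3F)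

    ∑₄-scale : ∀ c a → ∑₄ (λ i → c *ᶜ a i) ≈ᶜ c *ᶜ ∑₄ a
    ∑₄-scale c a = solveᶜ 5 (λ c x y z w → ((c ⊠ x ⊞ c ⊠ y) ⊞ c ⊠ z) ⊞ c ⊠ w ≋ c ⊠ (((x ⊞ y) ⊞ z) ⊞ w)) C.refl c (a 0F) (a 1F) (a 2F) (a 3F)

    ∑₄-- : ∀ a b → ∑₄ (λ i → a i -ᶜ b i) ≈ᶜ ∑₄ a -ᶜ ∑₄ b
    ∑₄-- a b = solveᶜ 8 (λ x y z w x′ y′ z′ w′ → (((x ⊟ x′) ⊞ (y ⊟ y′)) ⊞ (z ⊟ z′)) ⊞ (w ⊟ w′) ≋ (((x ⊞ y) ⊞ z) ⊞ w) ⊟ (((x′ ⊞ y′) ⊞ z′) ⊞ w′))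
      C.refl (a 0F) (a 1F) (a 2F) (a 3F) (b 0F) (b 1F) (b 2F) (b 3F)

    ∑₄ᴿ-nonNeg : ∀ {a : Fin 4 → ℝ} → (∀ i → ι 0ℚ ≤ a i) → ι 0ℚ ≤ ∑₄ᴿ a
    ∑₄ᴿ-nonNeg h = +-nonNeg (+-nonNeg (+-nonNeg (h 0F) (h 1F)) (h 2F)) (h 3F)

    ∑₄-closed : ∀ {a b : Fin 4 → ℂ} → (∀ i → b i ≈ᶜ a (next i)) → ∑₄ (λ i → b i -ᶜ a i) ≈ᶜ 0ᶜ
    ∑₄-closed {a} h = C.trans (C.+-cong (C.+-cong (C.+-cong (C.+-congʳ (h 0F)) (C.+-congʳ (h 1F))) (C.+-congʳ (h 2F))) (C.+-congʳ (h 3F)))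
      (solveᶜ 4 (λ x y z w → (((y ⊟ x) ⊞ (z ⊟ y)) ⊞ (w ⊟ z)) ⊞ (x ⊟ w) ≋ κᶜ 0ℚ) C.refl (a 0F) (a 1F) (a 2F) (a 3F))

    ∑₄-≡ : ∀ a → ∑₄ a ≡ ((a 0F +ᶜ a 1F) +ᶜ a 2F) +ᶜ a 3F
    ∑₄-≡ a = ≡.refl

    ∑₄ᴿ-≡ : ∀ a → ∑₄ᴿ a ≡ ((a 0F + a 1F) + a 2F) + a 3F
    ∑₄ᴿ-≡ a = ≡.refl

  -- The polygon bounds a region that is star-shaped about 0.  Since weight i k · p i k is the increment of
  -- the boundary, Σ weight · F j is almost independent of j: its radial derivative is a Riemann sum of F′ over
  -- a closed curve.

  module Polygon (N : ℕ) (p q : Fin 4 → ℕ → ℂ) (D : Fin 4 → ℂ) (qp≈1 : ∀ i k → q i k *ᶜ p i k ≈ᶜ 1ᶜ)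
    (F F′ : Fin 4 → ℕ → ℕ → ℂ) (ε : ℝ) (0≤ε : ι 0ℚ ≤ ε)
    (radial : ∀ i j k → j ℕ.< suc N → k ℕ.< suc N →
      ∣ (F i (suc j) k -ᶜ F i j k) -ᶜ F′ i j k *ᶜ (ιᶜ (inv N) *ᶜ p i k) ∣ ≤ ε * (ι (inv N) * ∣ p i k ∣))
    (tangential : ∀ i j k → j ℕ.< suc N → k ℕ.< suc N →
      ∣ (F i j (suc k) -ᶜ F i j k) -ᶜ F′ i j k *ᶜ (natᶜ j *ᶜ (ιᶜ (inv N) *ᶜ (ιᶜ (inv N) *ᶜ D i))) ∣
        ≤ ε * (ι (nat j) * (ι (inv N) * (ι (inv N) * ∣ D i ∣))))
    (closed : ∀ i j → F i j (suc N) ≈ᶜ F (next i) j 0) (∑D≈0 : ∑₄ D ≈ᶜ 0ᶜ)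
    (f c : ℂ) (F0≈f : ∀ i k → F i 0 k ≈ᶜ f) (F′0≈c : ∀ i k → F′ i 0 k ≈ᶜ c)
    where

    private
      module Side (i : Fin 4) = Path N (p i) (q i) (D i) (qp≈1 i) (F i) (F′ i) ε 0≤ε (radial i) (tangential i)

    weight : Fin 4 → ℕ → ℂ
    weight i = Side.weight i

    T : ℕ → ℂ
    T j = ∑₄ (λ i → Side.S i j)

    L : ℝ
    L = ∑₄ᴿ (λ i → ∣ D i ∣)

    L-nonNeg : ι 0ℚ ≤ L
    L-nonNeg = ∑₄ᴿ-nonNeg λ i → ∣z∣-nonNeg (D i)

    private
      nτ : ι (nat (suc N)) * ι (inv N) ≈ ι 1ℚ
      nτ = R.trans (R.sym (ι-* _ _)) (R.reflexive (≡.cong ι (Rat.nat*inv N)))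

      0≤τ : ι 0ℚ ≤ ι (inv N)
      0≤τ = ι-mono (Rat.inv-nonNeg N)

      boundary : ∀ j → ∑₄ (λ i → F i j (suc N) -ᶜ F i j 0) ≈ᶜ 0ᶜ
      boundary j = ∑₄-closed λ i → closed i j

      T-difference : ∀ j → ∑₄ (λ i → Side.S i (suc j) -ᶜ Side.S i j) ≈ᶜ T (suc j) -ᶜ T j
      T-difference j = ∑₄-- (λ i → Side.S i (suc j)) (λ i → Side.S i j)

      -- Closedness enters in two ways: for j = 0 the directions D add up to 0, and for j ≥ 1 the
      -- telescoped tangential increments of the four sides cancel.
      T-step : ∀ j → j ℕ.< suc N → ∣ T (suc j) -ᶜ T j ∣ ≤ (ε + ε) * (ι (inv N) * L)
      T-step zero _ = begin
        ∣ T 1 -ᶜ T 0 ∣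
          ≈⟨ ∣∣-cong (C.trans (∑₄-- _ _) (C.trans (C.+-cong (T-difference 0) (C.-‿cong (C.trans (∑₄-scale (c *ᶜ ιᶜ (inv N)) D) (C.*-congˡ ∑D≈0))))
               (solveᶜ 2 (λ t x → t ⊟ x ⊠ κᶜ 0ℚ ≋ t) C.refl (T 1 -ᶜ T 0) (c *ᶜ ιᶜ (inv N))))) ⟨
        ∣ ∑₄ (λ i → (Side.S i 1 -ᶜ Side.S i 0) -ᶜ (c *ᶜ ιᶜ (inv N)) *ᶜ D i) ∣
          ≤⟨ ≤-trans (∣∑₄∣≤ _) (∑₄ᴿ-mono (λ i → Side.first-step i c (F′0≈c i))) ⟩
        ∑₄ᴿ (λ i → ε * (ι (inv N) * ∣ D i ∣)) ≈⟨ R.trans (∑₄ᴿ-scale ε _) (R.*-congˡ (∑₄ᴿ-scale (ι (inv N)) _)) ⟩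
        ε * (ι (inv N) * L) ≤⟨ *-monoʳ-≤ (*-nonNeg 0≤τ L-nonNeg) (≤-by ε 0≤ε (solveᴿ 1 (λ e → (e ⊕ e) ⊖ e ⊜ e) ≈-refl ε)) ⟩
        (ε + ε) * (ι (inv N) * L) ∎
        where open ≤-Reasoning
      T-step (suc j) j<n = *-cancelˡ-≤ {q = 1ℚ} Rat.0<1 (ι-mono (Rat.1≤nat j)) (begin
        ι (nat (suc j)) * ∣ T (suc (suc j)) -ᶜ T (suc j) ∣
          ≈⟨ R.trans (R.*-congʳ (R.sym (∣ρ∣ (ι-mono (Rat.nat-nonNeg (suc j)))))) (R.sym (∣∣-* _ _)) ⟩
        ∣ natᶜ (suc j) *ᶜ (T (suc (suc j)) -ᶜ T (suc j)) ∣
          ≈⟨ ∣∣-cong (C.trans (∑₄-- _ _) (C.trans (C.+-cong (C.trans (∑₄-scale (natᶜ (suc j)) _) (C.*-congˡ (T-difference (suc j))))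
               (C.-‿cong (boundary (suc j)))) (solveᶜ 1 (λ x → x ⊟ κᶜ 0ℚ ≋ x) C.refl _))) ⟨
        ∣ ∑₄ (λ i → natᶜ (suc j) *ᶜ (Side.S i (suc (suc j)) -ᶜ Side.S i (suc j)) -ᶜ (F i (suc j) (suc N) -ᶜ F i (suc j) 0)) ∣
          ≤⟨ ≤-trans (∣∑₄∣≤ _) (∑₄ᴿ-mono (λ i → Side.step i (suc j) j<n)) ⟩
        ∑₄ᴿ (λ i → ι (nat (suc j)) * ((ε + ε) * (ι (inv N) * ∣ D i ∣)))
          ≈⟨ R.trans (∑₄ᴿ-scale _ _) (R.*-congˡ (R.trans (∑₄ᴿ-scale _ _) (R.*-congˡ (∑₄ᴿ-scale _ _)))) ⟩
        ι (nat (suc j)) * ((ε + ε) * (ι (inv N) * L)) ∎)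
        where open ≤-Reasoning

    T-near : ∣ T (suc N) -ᶜ T 0 ∣ ≤ (ε + ε) * L
    T-near = ≤-respˡ (∣∣-cong (∑-telescope T (suc N))) (≤-trans (∑-bound _ _ (suc N) T-step)
      (≤-reflexive (R.trans (solveᴿ 4 (λ n e t l → n ⊗ (e ⊗ (t ⊗ l)) ⊜ (n ⊗ t) ⊗ (e ⊗ l)) ≈-refl (ι (nat (suc N))) (ε + ε) (ι (inv N)) L)
        (R.trans (R.*-congʳ nτ) (R.*-identityˡ _)))))

    -- A Riemann sum of ∮ dz/z over the polygon.
    winding : ℂ
    winding = ∑₄ (λ i → ∑ (weight i) (suc N))

    T0 : T 0 ≈ᶜ f *ᶜ winding
    T0 = C.trans (∑₄-cong λ i → side i (suc N)) (∑₄-scale f (λ i → ∑ (weight i) (suc N)))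
      where
      side : ∀ i n → ∑ (λ k → weight i k *ᶜ F i 0 k) n ≈ᶜ f *ᶜ ∑ (weight i) n
      side i zero    = C.sym (C.zeroʳ f)
      side i (suc n) = C.trans (C.+-cong (side i n) (C.trans (C.*-congˡ (F0≈f i n)) (C.*-comm _ _))) (C.sym (C.distribˡ _ _ _))

    module _ (b η : ℝ) (0≤b : ι 0ℚ ≤ b) (q≤b : ∀ i k → k ℕ.< suc N → ∣ q i k ∣ ≤ b) (F≤η : ∀ i k → k ℕ.< suc N → ∣ F i (suc N) k ∣ ≤ η) where

      T-last : ∣ T (suc N) ∣ ≤ (b * η) * L
      T-last = ≤-trans (∣∑₄∣≤ (λ i → Side.S i (suc N))) (≤-trans (∑₄ᴿ-mono {b = λ i → (b * η) * ∣ D i ∣} λ i → ≤-trans (∑-bound _ _ (suc N) (each i)) (≤-reflexive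
          (R.trans (solveᴿ 4 (λ n t d x → n ⊗ ((t ⊗ d) ⊗ x) ⊜ (n ⊗ t) ⊗ (x ⊗ d)) ≈-refl (ι (nat (suc N))) (ι (inv N)) (∣ D i ∣) (b * η))
            (R.trans (R.*-congʳ nτ) (R.*-identityˡ _)))))
        (≤-reflexive (∑₄ᴿ-scale (b * η) (λ i → ∣ D i ∣))))
        where
        each : ∀ i k → k ℕ.< suc N → ∣ weight i k *ᶜ F i (suc N) k ∣ ≤ (ι (inv N) * ∣ D i ∣) * (b * η)
        each i k k<n = ≤-respˡ (R.sym (R.trans (∣∣-* _ _) (R.trans (R.*-congʳ (R.trans (∣∣-* _ _) (R.*-congʳ (R.trans (∣∣-* _ _) (R.*-congʳ (∣ρ∣ 0≤τ))))))
            (R.*-assoc _ _ _))))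
          (*-monoˡ-≤ (*-nonNeg 0≤τ (∣z∣-nonNeg _)) (*-mono-≤ (∣z∣-nonNeg _) (≤-trans (∣z∣-nonNeg _) (F≤η i k k<n)) (q≤b i k k<n) (F≤η i k k<n)))

      center-bound : ∣ f ∣ * ∣ winding ∣ ≤ (b * η + (ε + ε)) * L
      center-bound = ≤-respˡ (R.trans (∣∣-cong T0) (∣∣-* _ _)) (begin
        ∣ T 0 ∣ ≈⟨ ∣∣-cong (solveᶜ 2 (λ x y → x ≋ y ⊟ (y ⊟ x)) C.refl (T 0) (T (suc N))) ⟩
        ∣ T (suc N) -ᶜ (T (suc N) -ᶜ T 0) ∣ ≤⟨ ∣z-w∣≤ _ _ ⟩
        ∣ T (suc N) ∣ + ∣ T (suc N) -ᶜ T 0 ∣ ≤⟨ +-mono-≤ T-last T-near ⟩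
        (b * η) * L + (ε + ε) * L ≈⟨ R.distribʳ L _ _ ⟨
        (b * η + (ε + ε)) * L ∎)
        where open ≤-Reasoning

-- The rectangle, its mesh, and the maximum principle up to a constant.

module Rectangles where

  open Rat using (nat; inv; ¼)
  open Real
  open Complex
  open Exp
  open Polygons

  -- Offsets with rational coordinates: mesh points are then equal in the sense of `≡`, the closing
  -- of the polygon is an identity of rationals, and being the origin is decidable.
  Point : Set
  Point = ℚ × ℚ

  infixl 7 _·_

  _·_ : ℚ → Point → Point
  t · (x , y) = t ℚ.* x , t ℚ.* y

  opaque
    unfolding _+ᶜ_

    pt : Point → ℂ
    pt (x , y) = ι x +i ι y

    re-pt : ∀ u → re (pt u) ≈ ι (proj₁ u)
    re-pt u = ≈-refl

    im-pt : ∀ u → im (pt u) ≈ ι (proj₂ u)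
    im-pt u = ≈-refl

    pt-+ : ∀ x y x′ y′ → pt (x ℚ.+ x′ , y ℚ.+ y′) ≈ᶜ pt (x , y) +ᶜ pt (x′ , y′)
    pt-+ x y x′ y′ = ι-+ x x′ & ι-+ y y′

    pt-· : ∀ t u → pt (t · u) ≈ᶜ ιᶜ t *ᶜ pt u
    pt-· t (x , y) = R.trans (ι-* t x) (solveᴿ 3 (λ t x y → t ⊗ x ⊜ t ⊗ x ⊖ κ 0ℚ ⊗ y) ≈-refl (ι t) (ι x) (ι y))
      & R.trans (ι-* t y) (solveᴿ 3 (λ t x y → t ⊗ y ⊜ t ⊗ y ⊕ κ 0ℚ ⊗ x) ≈-refl (ι t) (ι x) (ι y))

    pt-* : ∀ x y x′ y′ → pt (x , y) *ᶜ pt (x′ , y′) ≈ᶜ pt (x ℚ.* x′ ℚ.- y ℚ.* y′ , x ℚ.* y′ ℚ.+ y ℚ.* x′)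
    pt-* x y x′ y′ = R.sym (R.trans (ι-+ _ _) (R.+-cong (ι-* x x′) (R.trans (ι-neg _) (R.-‿cong (ι-* y y′)))))
      & R.sym (R.trans (ι-+ _ _) (R.+-cong (ι-* x y′) (ι-* y x′)))

    pt-ι : ∀ x → pt (x , 0ℚ) ≈ᶜ ιᶜ x
    pt-ι x = C.refl

  ∣pt∣² : ∀ u → re (pt u) * re (pt u) + im (pt u) * im (pt u) ≈ ι (proj₁ u ℚ.* proj₁ u ℚ.+ proj₂ u ℚ.* proj₂ u)
  ∣pt∣² (x , y) = R.trans (R.+-cong (R.*-cong (re-pt _) (re-pt _)) (R.*-cong (im-pt _) (im-pt _)))
    (R.sym (R.trans (ι-+ _ _) (R.+-cong (ι-* x x) (ι-* y y))))

  ∣pt∣≤ : ∀ u {b} → 0ℚ ℚ.≤ b → proj₁ u ℚ.* proj₁ u ℚ.+ proj₂ u ℚ.* proj₂ u ℚ.≤ b ℚ.* b → ∣ pt u ∣ ≤ ι b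
  ∣pt∣≤ u {b} 0≤b h = ∣z∣≤ (pt u) (ι-mono 0≤b) (≤-respˡ (R.sym (∣pt∣² u)) (≤-respʳ (ι-* b b) (ι-mono h)))

  -- The height 7/4 is less than 2, which keeps the rectangle around σ + it at Im s ≥ 1/4 and so
  -- away from the pole. It is large enough that x + x² ≤ 45/16 < 49/16 = height² for the x up to
  -- 5/4 that occur, so that W decays on the horizontal sides.
  two four height : ℚ
  two    = 1ℚ ℚ.+ 1ℚ
  four   = two ℚ.+ two
  height = 1ℚ ℚ.+ (½ ℚ.+ ¼)

  private
    -- For closed rationals q - p computes, and instance search reads off its sign.
    decidably : ∀ {p q} → {{_ : ℚ.NonNegative (q ℚ.- p)}} → p ℚ.≤ q
    decidably {p} {q} {{nn}} = Rat.≤-by (q ℚ.- p) (ℚ.nonNegative⁻¹ (q ℚ.- p)) ≡.refl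

  module Rectangle (a : ℚ) (0<a : 0ℚ ℚ.< a) (a≤½ : a ℚ.≤ ½) where

    record Ω (u : Point) : Set where
      constructor inside
      field
        left   : ℚ.- a ℚ.≤ proj₁ u
        right  : proj₁ u ℚ.≤ two
        bottom : ℚ.- height ℚ.≤ proj₂ u
        top    : proj₂ u ℚ.≤ height

    -- `levelSide` covers top and bottom at once through y², the form in which the estimates use it.
    data Boundary (u : Point) : Set where
      leftSide   : proj₁ u ≡ ℚ.- a → Boundary u
      rightSide  : proj₁ u ≡ two → Boundary u
      levelSide  : proj₂ u ℚ.* proj₂ u ≡ height ℚ.* height → Boundary u

    0≤a : 0ℚ ℚ.≤ a
    0≤a = ℚ.<⇒≤ 0<a

    -- Counterclockwise from the lower right corner: right side upwards, top, left side downwards,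
    -- bottom.
    start dir : Fin 4 → Point
    start 0F = two , ℚ.- height
    start 1F = two , height
    start 2F = ℚ.- a , height
    start 3F = ℚ.- a , ℚ.- height
    dir 0F = 0ℚ , height ℚ.+ height
    dir 1F = ℚ.- (two ℚ.+ a) , 0ℚ
    dir 2F = 0ℚ , ℚ.- (height ℚ.+ height)
    dir 3F = two ℚ.+ a , 0ℚ

    along : ℚ → Fin 4 → Point
    along t i = proj₁ (start i) ℚ.+ t ℚ.* proj₁ (dir i) , proj₂ (start i) ℚ.+ t ℚ.* proj₂ (dir i)

    along-1 : ∀ i → along 1ℚ i ≡ along 0ℚ (next i)
    along-1 0F = ≡.cong₂ _,_ (solve 1 (λ a → con two :+ con 1ℚ :* con 0ℚ := con two :+ con 0ℚ :* :- (con two :+ a)) ≡.refl a) ≡.refl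
    along-1 1F = ≡.cong₂ _,_ (solve 1 (λ a → con two :+ con 1ℚ :* :- (con two :+ a) := :- a :+ con 0ℚ :* con 0ℚ) ≡.refl a) ≡.refl
    along-1 2F = ≡.cong₂ _,_ (solve 1 (λ a → :- a :+ con 1ℚ :* con 0ℚ := :- a :+ con 0ℚ :* (con two :+ a)) ≡.refl a) ≡.refl
    along-1 3F = ≡.cong₂ _,_ (solve 1 (λ a → :- a :+ con 1ℚ :* (con two :+ a) := con two :+ con 0ℚ :* con 0ℚ) ≡.refl a) ≡.refl

    private
      fixed : ∀ c t → c ℚ.+ t ℚ.* 0ℚ ≡ c
      fixed = solve 2 (λ c t → c :+ t :* con 0ℚ := c) ≡.refl

      between : ∀ {c d l r t} → l ℚ.≤ c → l ℚ.≤ c ℚ.+ d → c ℚ.≤ r → c ℚ.+ d ℚ.≤ r → 0ℚ ℚ.≤ t → t ℚ.≤ 1ℚ →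
                l ℚ.≤ c ℚ.+ t ℚ.* d × c ℚ.+ t ℚ.* d ℚ.≤ r
      between {c} {d} {l} {r} {t} l≤c l≤c+d c≤r c+d≤r 0≤t t≤1 =
        Rat.≤-by _ (Rat.+-nonNeg (Rat.*-nonNeg (Rat.p≤q⇒0≤q-p t≤1) (Rat.p≤q⇒0≤q-p l≤c)) (Rat.*-nonNeg 0≤t (Rat.p≤q⇒0≤q-p l≤c+d)))
          (solve 4 (λ c d l t → c :+ t :* d :- l := (con 1ℚ :- t) :* (c :- l) :+ t :* (c :+ d :- l)) ≡.refl c d l t) ,
        Rat.≤-by _ (Rat.+-nonNeg (Rat.*-nonNeg (Rat.p≤q⇒0≤q-p t≤1) (Rat.p≤q⇒0≤q-p c≤r)) (Rat.*-nonNeg 0≤t (Rat.p≤q⇒0≤q-p c+d≤r)))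
          (solve 4 (λ c d r t → r :- (c :+ t :* d) := (con 1ℚ :- t) :* (r :- c) :+ t :* (r :- (c :+ d))) ≡.refl c d r t)

      -a≤2 : ℚ.- a ℚ.≤ two
      -a≤2 = Rat.≤-by _ (Rat.+-nonNeg 0≤a (decidably {0ℚ} {two})) (solve 1 (λ a → con two :- :- a := a :+ con two) ≡.refl a)

      x-range : ∀ i → (ℚ.- a ℚ.≤ proj₁ (start i) × proj₁ (start i) ℚ.≤ two) ×
        (ℚ.- a ℚ.≤ proj₁ (start i) ℚ.+ proj₁ (dir i) × proj₁ (start i) ℚ.+ proj₁ (dir i) ℚ.≤ two)
      x-range 0F = (-a≤2 , ℚ.≤-refl) , (-a≤2 , ℚ.≤-refl)
      x-range 1F = (-a≤2 , ℚ.≤-refl) , ≡.subst (λ x → ℚ.- a ℚ.≤ x × x ℚ.≤ two)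
        (solve 1 (λ a → :- a := con two :+ :- (con two :+ a)) ≡.refl a) (ℚ.≤-refl , -a≤2)
      x-range 2F = (ℚ.≤-refl , -a≤2) , ≡.subst (λ x → ℚ.- a ℚ.≤ x × x ℚ.≤ two) (≡.sym (ℚ.+-identityʳ (ℚ.- a))) (ℚ.≤-refl , -a≤2)
      x-range 3F = (ℚ.≤-refl , -a≤2) , ≡.subst (λ x → ℚ.- a ℚ.≤ x × x ℚ.≤ two)
        (solve 1 (λ a → con two := :- a :+ (con two :+ a)) ≡.refl a) (-a≤2 , ℚ.≤-refl)

      y-range : ∀ i → (ℚ.- height ℚ.≤ proj₂ (start i) × proj₂ (start i) ℚ.≤ height) ×
        (ℚ.- height ℚ.≤ proj₂ (start i) ℚ.+ proj₂ (dir i) × proj₂ (start i) ℚ.+ proj₂ (dir i) ℚ.≤ height)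
      y-range 0F = (decidably , decidably) , (decidably , decidably)
      y-range 1F = (decidably , decidably) , (decidably , decidably)
      y-range 2F = (decidably , decidably) , (decidably , decidably)
      y-range 3F = (decidably , decidably) , (decidably , decidably)

    along∈Ω : ∀ {t} → 0ℚ ℚ.≤ t → t ℚ.≤ 1ℚ → ∀ i → Ω (along t i)
    along∈Ω 0≤t t≤1 i = inside (proj₁ xs) (proj₂ xs) (proj₁ ys) (proj₂ ys)
      where
      xr = x-range i
      yr = y-range i
      xs = between (proj₁ (proj₁ xr)) (proj₁ (proj₂ xr)) (proj₂ (proj₁ xr)) (proj₂ (proj₂ xr)) 0≤t t≤1
      ys = between (proj₁ (proj₁ yr)) (proj₁ (proj₂ yr)) (proj₂ (proj₁ yr)) (proj₂ (proj₂ yr)) 0≤t t≤1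

    ·∈Ω : ∀ {t u} → 0ℚ ℚ.≤ t → t ℚ.≤ 1ℚ → Ω u → Ω (t · u)
    ·∈Ω {t} {x , y} 0≤t t≤1 (inside l r b tp) = inside (proj₁ xs) (proj₂ xs) (proj₁ ys) (proj₂ ys)
      where
      scaled : ∀ {x l r} → l ℚ.≤ 0ℚ → 0ℚ ℚ.≤ r → l ℚ.≤ x → x ℚ.≤ r → l ℚ.≤ t ℚ.* x × t ℚ.* x ℚ.≤ r
      scaled {x} {l} {r} l≤0 0≤r l≤x x≤r = ≡.subst (λ z → l ℚ.≤ z × z ℚ.≤ r) (ℚ.+-identityˡ (t ℚ.* x))
        (between l≤0 (≡.subst (l ℚ.≤_) (≡.sym (ℚ.+-identityˡ x)) l≤x) 0≤r (≡.subst (ℚ._≤ r) (≡.sym (ℚ.+-identityˡ x)) x≤r) 0≤t t≤1)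
      xs = scaled (Rat.≤-by a 0≤a (solve 1 (λ a → con 0ℚ :- :- a := a) ≡.refl a)) (decidably {0ℚ} {two}) l r
      ys = scaled (decidably {ℚ.- height} {0ℚ}) (decidably {0ℚ} {height}) b tp

    private
      H² : ∀ z → z ≡ height → z ℚ.* z ≡ height ℚ.* height
      H² z ≡.refl = ≡.refl

      -H² : ∀ z → z ≡ ℚ.- height → z ℚ.* z ≡ height ℚ.* height
      -H² z ≡.refl = ≡.refl

    along∈∂ : ∀ t i → Boundary (along t i)
    along∈∂ t 0F = rightSide (fixed two t)
    along∈∂ t 1F = levelSide (H² _ (fixed height t))
    along∈∂ t 2F = leftSide (fixed (ℚ.- a) t)
    along∈∂ t 3F = levelSide (-H² _ (fixed (ℚ.- height) t))

    square : Point → ℚ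
    square u = proj₁ u ℚ.* proj₁ u ℚ.+ proj₂ u ℚ.* proj₂ u

    square≤8 : ∀ {u} → Ω u → square u ℚ.≤ four ℚ.+ four
    square≤8 {x , y} (inside l r b t) = Rat.≤-by _
      (Rat.+-nonNeg (Rat.+-nonNeg
        (Rat.*-nonNeg (Rat.p≤q⇒0≤q-p r) (ℚ.≤-trans (Rat.+-nonNeg (Rat.p≤q⇒0≤q-p l) (Rat.p≤q⇒0≤q-p (ℚ.≤-trans a≤½ (decidably {½} {two}))))
          (ℚ.≤-reflexive (solve 2 (λ a x → (x :- :- a) :+ (con two :- a) := con two :+ x) ≡.refl a x))))
        (Rat.*-nonNeg (Rat.p≤q⇒0≤q-p t) (ℚ.≤-trans (Rat.p≤q⇒0≤q-p b) (ℚ.≤-reflexive (solve 1 (λ y → y :- :- con height := con height :+ y) ≡.refl y)))))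
        (decidably {0ℚ} {(four ℚ.+ four) ℚ.- (two ℚ.* two ℚ.+ height ℚ.* height)}))
      (solve 2 (λ x y → (con four :+ con four) :- (x :* x :+ y :* y) :=
          (con two :- x) :* (con two :+ x) :+ (con height :- y) :* (con height :+ y) :+ ((con four :+ con four) :- (con two :* con two :+ con height :* con height)))
        ≡.refl x y)

    boundary-square : ∀ {u} → Boundary u → a ℚ.* a ℚ.≤ square u
    boundary-square {x , y} (leftSide ≡.refl) = Rat.≤-by _ (Rat.square-nonNeg y)
      (solve 2 (λ a y → (:- a :* :- a :+ y :* y) :- a :* a := y :* y) ≡.refl a y)
    boundary-square {x , y} (rightSide ≡.refl) = Rat.≤-by _ (Rat.+-nonNeg (Rat.square-nonNeg y)
        (Rat.*-nonNeg (Rat.p≤q⇒0≤q-p (ℚ.≤-trans a≤½ (decidably {½} {two}))) (Rat.+-nonNeg (decidably {0ℚ} {two}) 0≤a)))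
      (solve 2 (λ a y → (con two :* con two :+ y :* y) :- a :* a := y :* y :+ (con two :- a) :* (con two :+ a)) ≡.refl a y)
    boundary-square {x , y} (levelSide eq) = Rat.≤-by _ (Rat.+-nonNeg (Rat.square-nonNeg x)
        (Rat.*-nonNeg (Rat.p≤q⇒0≤q-p (ℚ.≤-trans a≤½ (decidably {½} {height}))) (Rat.+-nonNeg (decidably {0ℚ} {height}) 0≤a)))
      (≡.trans (≡.cong (λ z → (x ℚ.* x ℚ.+ z) ℚ.- a ℚ.* a) eq)
        (solve 2 (λ a x → (x :* x :+ con height :* con height) :- a :* a := x :* x :+ (con height :- a) :* (con height :+ a)) ≡.refl a x))

    -- Im (dir · conj p) takes this value at every point p of the side. It is nonnegative because a
    -- counterclockwise traversal keeps the origin on the left.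
    cross : Fin 4 → ℚ
    cross i = proj₁ (start i) ℚ.* proj₂ (dir i) ℚ.- proj₂ (start i) ℚ.* proj₁ (dir i)

    cross-nonNeg : ∀ i → 0ℚ ℚ.≤ cross i
    cross-nonNeg 0F = decidably
    cross-nonNeg 1F = Rat.≤-by _ (Rat.*-nonNeg (decidably {0ℚ} {height}) (Rat.+-nonNeg (decidably {0ℚ} {two}) 0≤a))
      (solve 1 (λ a → con two :* con 0ℚ :- con height :* :- (con two :+ a) :- con 0ℚ := con height :* (con two :+ a)) ≡.refl a)
    cross-nonNeg 2F = Rat.≤-by _ (Rat.*-nonNeg 0≤a (decidably {0ℚ} {height ℚ.+ height}))
      (solve 1 (λ a → :- a :* :- (con height :+ con height) :- con height :* con 0ℚ :- con 0ℚ := a :* (con height :+ con height)) ≡.refl a)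
    cross-nonNeg 3F = Rat.≤-by _ (Rat.*-nonNeg (decidably {0ℚ} {height}) (Rat.+-nonNeg (decidably {0ℚ} {two}) 0≤a))
      (solve 1 (λ a → :- a :* con 0ℚ :- :- con height :* (con two :+ a) :- con 0ℚ := con height :* (con two :+ a)) ≡.refl a)

    dir-square : ∀ i → square (dir i) ℚ.≤ four ℚ.* four
    dir-square 0F = decidably
    dir-square 1F = Rat.≤-by _ (Rat.*-nonNeg (Rat.p≤q⇒0≤q-p (ℚ.≤-trans a≤½ (decidably {½} {two}))) (Rat.+-nonNeg 0≤a (decidably {0ℚ} {four ℚ.+ two})))
      (solve 1 (λ a → con four :* con four :- (:- (con two :+ a) :* :- (con two :+ a) :+ con 0ℚ :* con 0ℚ) := (con two :- a) :* (a :+ (con four :+ con two))) ≡.refl a)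
    dir-square 2F = decidably
    dir-square 3F = Rat.≤-by _ (Rat.*-nonNeg (Rat.p≤q⇒0≤q-p (ℚ.≤-trans a≤½ (decidably {½} {two}))) (Rat.+-nonNeg 0≤a (decidably {0ℚ} {four ℚ.+ two})))
      (solve 1 (λ a → con four :* con four :- ((con two :+ a) :* (con two :+ a) :+ con 0ℚ :* con 0ℚ) := (con two :- a) :* (a :+ (con four :+ con two))) ≡.refl a)

    -- u is the offset, a rational point, from the centre of the rectangle.
    Differentiable : (Point → ℂ) → (Point → ℂ) → Set
    Differentiable f f′ = ∀ ε → 0ℚ ℚ.< ε → ∃[ δ ] 0ℚ ℚ.< δ × (∀ u v → Ω u → Ω v → ∣ pt v -ᶜ pt u ∣ ≤ ι δ →
      ∣ (f v -ᶜ f u) -ᶜ f′ u *ᶜ (pt v -ᶜ pt u) ∣ ≤ ι ε * ∣ pt v -ᶜ pt u ∣)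

    module Mesh (N : ℕ) where

      time : ℕ → ℚ
      time k = nat k ℚ.* inv N

      time-0 : time 0 ≡ 0ℚ
      time-0 = ≡.trans (≡.cong (ℚ._* inv N) Rat.nat-0) (ℚ.*-zeroˡ (inv N))

      time-1 : time (suc N) ≡ 1ℚ
      time-1 = Rat.nat*inv N

      time-nonNeg : ∀ k → 0ℚ ℚ.≤ time k
      time-nonNeg k = Rat.*-nonNeg (Rat.nat-nonNeg k) (Rat.inv-nonNeg N)

      time-≤1 : ∀ {k} → k ℕ.≤ suc N → time k ℚ.≤ 1ℚ
      time-≤1 {k} k≤n = ≡.subst (time k ℚ.≤_) time-1 (D.RationalLemmas.*-monoˡ (Rat.inv-nonNeg N) (Rat.nat-mono k≤n))

      time-suc : ∀ k → time (suc k) ≡ time k ℚ.+ inv N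
      time-suc k = ≡.trans (≡.cong (ℚ._* inv N) (Rat.nat-suc k))
        (solve 2 (λ n i → (con 1ℚ :+ n) :* i := n :* i :+ i) ≡.refl (nat k) (inv N))

      vertex : Fin 4 → ℕ → Point
      vertex i k = along (time k) i

      node : Fin 4 → ℕ → ℕ → Point
      node i j k = time j · vertex i k

      vertex∈Ω : ∀ i {k} → k ℕ.≤ suc N → Ω (vertex i k)
      vertex∈Ω i {k} k≤n = along∈Ω (time-nonNeg k) (time-≤1 k≤n) i

      node∈Ω : ∀ i {j k} → j ℕ.≤ suc N → k ℕ.≤ suc N → Ω (node i j k)
      node∈Ω i {j} j≤n k≤n = ·∈Ω (time-nonNeg j) (time-≤1 j≤n) (vertex∈Ω i k≤n)

      0<square : ∀ i k → 0ℚ ℚ.< square (vertex i k)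
      0<square i k = ℚ.<-≤-trans (D.RationalLemmas.*-pos 0<a 0<a) (boundary-square (along∈∂ (time k) i))

      r : Fin 4 → ℕ → ℚ
      r i k = Rat.recip (0<square i k)

      p q : Fin 4 → ℕ → ℂ
      p i k = pt (vertex i k)
      q i k = ιᶜ (r i k) *ᶜ pt (proj₁ (vertex i k) , ℚ.- proj₂ (vertex i k))

      qp≈1 : ∀ i k → q i k *ᶜ p i k ≈ᶜ 1ᶜ
      qp≈1 i k = C.trans (C.*-assoc _ _ _) (C.trans (C.*-congˡ (C.trans (pt-* x (ℚ.- y) x y)
          (C.reflexive (≡.cong pt (≡.cong₂ _,_ (solve 2 (λ x y → x :* x :- :- y :* y := x :* x :+ y :* y) ≡.refl x y)
            (solve 2 (λ x y → x :* y :+ :- y :* x := con 0ℚ) ≡.refl x y))))))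
        (C.trans (C.*-congˡ (pt-ι (square (vertex i k)))) (C.trans (C.sym (ρ-* _ _)) (ρ-cong (R.trans (R.sym (ι-* _ _))
          (R.reflexive (≡.cong ι (≡.trans (ℚ.*-comm (r i k) (square (vertex i k))) (Rat.recip-inverse (0<square i k))))))))))
        where
        x y : ℚ
        x = proj₁ (vertex i k)
        y = proj₂ (vertex i k)

      node-radial : ∀ i j k → pt (node i (suc j) k) -ᶜ pt (node i j k) ≈ᶜ ιᶜ (inv N) *ᶜ p i k
      node-radial i j k = C.trans (C.+-cong (C.trans (pt-· _ _) (C.*-congʳ
          (C.trans (C.reflexive (≡.cong ιᶜ (time-suc j))) (C.trans (ρ-cong (ι-+ _ _)) (ρ-+ _ _))))) (C.-‿cong (pt-· _ _)))
        (solveᶜ 3 (λ t i p → (t ⊞ i) ⊠ p ⊟ t ⊠ p ≋ i ⊠ p) C.refl (ιᶜ (time j)) (ιᶜ (inv N)) (p i k))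

      vertex-tangential : ∀ i k → p i (suc k) -ᶜ p i k ≈ᶜ ιᶜ (inv N) *ᶜ pt (dir i)
      vertex-tangential i k = C.trans (C.+-cong (C.trans (vertex-pt (suc k)) (C.+-congˡ (C.*-congʳ
          (C.trans (C.reflexive (≡.cong ιᶜ (time-suc k))) (C.trans (ρ-cong (ι-+ _ _)) (ρ-+ _ _)))))) (C.-‿cong (vertex-pt k)))
        (solveᶜ 4 (λ s t i d → (s ⊞ (t ⊞ i) ⊠ d) ⊟ (s ⊞ t ⊠ d) ≋ i ⊠ d) C.refl (pt (start i)) (ιᶜ (time k)) (ιᶜ (inv N)) (pt (dir i)))
        where
        vertex-pt : ∀ k → p i k ≈ᶜ pt (start i) +ᶜ ιᶜ (time k) *ᶜ pt (dir i)
        vertex-pt k = C.trans (pt-+ _ _ _ _) (C.+-congˡ (pt-· (time k) (dir i)))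

      node-tangential : ∀ i j k → pt (node i j (suc k)) -ᶜ pt (node i j k) ≈ᶜ natᶜ j *ᶜ (ιᶜ (inv N) *ᶜ (ιᶜ (inv N) *ᶜ pt (dir i)))
      node-tangential i j k = C.trans (C.+-cong (pt-· _ _) (C.-‿cong (pt-· _ _)))
        (C.trans (solveᶜ 3 (λ t a b → t ⊠ a ⊟ t ⊠ b ≋ t ⊠ (a ⊟ b)) C.refl (ιᶜ (time j)) (p i (suc k)) (p i k))
          (C.trans (C.*-cong (C.trans (ρ-cong (ι-* (nat j) (inv N))) (ρ-* _ _)) (vertex-tangential i k)) (C.*-assoc _ _ _)))

      ∣p∣≤4 : ∀ i {k} → k ℕ.≤ suc N → ∣ p i k ∣ ≤ ι four
      ∣p∣≤4 i k≤n = ∣pt∣≤ _ (decidably {0ℚ} {four}) (ℚ.≤-trans (square≤8 (vertex∈Ω i k≤n)) (decidably {four ℚ.+ four} {four ℚ.* four}))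

      ∣D∣≤4 : ∀ i → ∣ pt (dir i) ∣ ≤ ι four
      ∣D∣≤4 i = ∣pt∣≤ _ (decidably {0ℚ} {four}) (dir-square i)

      b : ℚ
      b = Rat.recip 0<a

      0≤b : 0ℚ ℚ.≤ b
      0≤b = ℚ.<⇒≤ (Rat.recip-pos 0<a)

      r-nonNeg : ∀ i k → 0ℚ ℚ.≤ r i k
      r-nonNeg i k = ℚ.<⇒≤ (Rat.recip-pos (0<square i k))

      -- |q|² = 1 / |p|² ≤ 1 / a²
      ∣q∣≤ : ∀ i k → ∣ q i k ∣ ≤ ι b
      ∣q∣≤ i k = ≤-respˡ (∣∣-cong (pt-· (r i k) (x , ℚ.- y))) (∣pt∣≤ _ 0≤b (≡.subst (ℚ._≤ b ℚ.* b) (≡.sym eq) bound))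
        where
        x y s : ℚ
        x = proj₁ (vertex i k)
        y = proj₂ (vertex i k)
        s = square (vertex i k)
        one : b ℚ.* a ≡ 1ℚ
        one = ≡.trans (ℚ.*-comm b a) (Rat.recip-inverse 0<a)
        sr : s ℚ.* r i k ≡ 1ℚ
        sr = Rat.recip-inverse (0<square i k)
        eq : (r i k ℚ.* x) ℚ.* (r i k ℚ.* x) ℚ.+ (r i k ℚ.* (ℚ.- y)) ℚ.* (r i k ℚ.* (ℚ.- y)) ≡ r i k
        eq = ≡.trans (solve 3 (λ r x y → (r :* x) :* (r :* x) :+ (r :* (:- y)) :* (r :* (:- y)) := ((x :* x :+ y :* y) :* r) :* r) ≡.refl (r i k) x y)
          (≡.trans (≡.cong (ℚ._* r i k) sr) (ℚ.*-identityˡ (r i k)))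
        bound : r i k ℚ.≤ b ℚ.* b
        bound = ≡.subst₂ ℚ._≤_
          (≡.trans (solve 3 (λ r a b → (a :* a) :* (r :* (b :* b)) := (b :* a) :* ((b :* a) :* r)) ≡.refl (r i k) a b)
            (≡.trans (≡.cong₂ (λ m n → m ℚ.* (n ℚ.* r i k)) one one) (≡.trans (ℚ.*-identityˡ _) (ℚ.*-identityˡ _))))
          (≡.trans (≡.sym (ℚ.*-assoc s (r i k) (b ℚ.* b))) (≡.trans (≡.cong (ℚ._* (b ℚ.* b)) sr) (ℚ.*-identityˡ _)))
          (D.RationalLemmas.*-monoˡ (Rat.*-nonNeg (r-nonNeg i k) (Rat.*-nonNeg 0≤b 0≤b)) (boundary-square (along∈∂ (time k) i)))

      -- Im ((dir · conj vertex) / |vertex|²) = cross / |vertex|²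
      im-weight : ∀ i k → im ((ιᶜ (inv N) *ᶜ pt (dir i)) *ᶜ q i k) ≈ ι (inv N ℚ.* (cross i ℚ.* r i k))
      im-weight i k = R.trans (im-≈ (C.trans
          (C.trans (solveᶜ 4 (λ t d r p → (t ⊠ d) ⊠ (r ⊠ p) ≋ (t ⊠ r) ⊠ (d ⊠ p)) C.refl (ιᶜ (inv N)) (pt (dir i)) (ιᶜ (r i k)) (pt (x , ℚ.- y)))
            (C.*-cong (C.trans (C.sym (ρ-* _ _)) (ρ-cong (R.sym (ι-* _ _)))) (pt-* dx dy x (ℚ.- y))))
          (C.sym (pt-· (inv N ℚ.* r i k) _))))
        (R.trans (im-pt _) (R.reflexive (≡.cong ι (solve 7 (λ n r sx sy t dx dy →
          (n :* r) :* (dx :* (:- (sy :+ t :* dy)) :+ dy :* (sx :+ t :* dx)) := n :* ((sx :* dy :- sy :* dx) :* r)) ≡.refl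
          (inv N) (r i k) (proj₁ (start i)) (proj₂ (start i)) (time k) dx dy))))
        where
        x y dx dy : ℚ
        x = proj₁ (vertex i k)
        y = proj₂ (vertex i k)
        dx = proj₁ (dir i)
        dy = proj₂ (dir i)

      eighth : ℚ
      eighth = ½ ℚ.* ¼

      eighth≤r : ∀ i {k} → k ℕ.≤ suc N → eighth ℚ.≤ r i k
      eighth≤r i {k} k≤n = ≡.subst₂ ℚ._≤_ (≡.trans (solve 2 (λ s r → s :* (r :* con eighth) := (s :* r) :* con eighth) ≡.refl s (r i k))
          (≡.trans (≡.cong (ℚ._* eighth) (Rat.recip-inverse (0<square i k))) (ℚ.*-identityˡ eighth)))
        (solve 1 (λ r → (con four :+ con four) :* (r :* con eighth) := r) ≡.refl (r i k))
        (D.RationalLemmas.*-monoˡ (Rat.*-nonNeg (r-nonNeg i k) (decidably {0ℚ} {eighth})) (square≤8 (vertex∈Ω i k≤n)))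
        where
        s : ℚ
        s = square (vertex i k)

      private
        im-∑ : ∀ (w : ℕ → ℂ) (c : ℚ) m → (∀ k → k ℕ.< m → ι c ≤ im (w k)) → ι (nat m) * ι c ≤ im (∑ w m)
        im-∑ w c zero    h = ≤-reflexive (R.trans (R.*-congʳ (R.reflexive (≡.cong ι Rat.nat-0))) (R.zeroˡ (ι c)))
        im-∑ w c (suc m) h = ≤-respˡ (R.trans (solveᴿ 2 (λ n c → n ⊗ c ⊕ c ⊜ (κ 1ℚ ⊕ n) ⊗ c) ≈-refl (ι (nat m)) (ι c))
            (R.*-congʳ (R.trans (R.sym (ι-+ _ _)) (R.reflexive (≡.cong ι (≡.sym (Rat.nat-suc m)))))))
          (≤-respʳ (R.sym (im-+ _ _)) (+-mono-≤ (im-∑ w c m λ k k<m → h k (ℕ.m≤n⇒m≤1+n k<m)) (h m ℕ.≤-refl)))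

      side-winding : ∀ i → ι (cross i ℚ.* eighth) ≤ im (∑ (λ k → (ιᶜ (inv N) *ᶜ pt (dir i)) *ᶜ q i k) (suc N))
      side-winding i = ≤-respˡ (R.trans (R.sym (ι-* _ _)) (R.reflexive (≡.cong ι
          (≡.trans (≡.sym (ℚ.*-assoc (nat (suc N)) (inv N) _)) (≡.trans (≡.cong (ℚ._* (cross i ℚ.* eighth)) (Rat.nat*inv N)) (ℚ.*-identityˡ _))))))
        (im-∑ (λ k → (ιᶜ (inv N) *ᶜ pt (dir i)) *ᶜ q i k) (inv N ℚ.* (cross i ℚ.* eighth)) (suc N) λ k k<n → ≤-respʳ (R.sym (im-weight i k))
          (ι-mono (Rat.*-monoʳ-≤ (Rat.inv-nonNeg N) (Rat.*-monoʳ-≤ (cross-nonNeg i) (eighth≤r i (ℕ.<⇒≤ k<n))))))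

      module Bound (f f′ : Point → ℂ) (ε δ : ℚ) (0<ε : 0ℚ ℚ.< ε) (mesh≤δ : inv N ℚ.* four ℚ.≤ δ)
        (near : ∀ u v → Ω u → Ω v → ∣ pt v -ᶜ pt u ∣ ≤ ι δ →
          ∣ (f v -ᶜ f u) -ᶜ f′ u *ᶜ (pt v -ᶜ pt u) ∣ ≤ ι ε * ∣ pt v -ᶜ pt u ∣)
        (η : ℝ) (f≤η : ∀ u → Ω u → Boundary u → ∣ f u ∣ ≤ η) where

        0≤τ : ι 0ℚ ≤ ι (inv N)
        0≤τ = ι-mono (Rat.inv-nonNeg N)

        origin : Point
        origin = 0ℚ , 0ℚ

        node-0 : ∀ i k → node i 0 k ≡ origin
        node-0 i k = ≡.trans (≡.cong (_· vertex i k) time-0) (≡.cong₂ _,_ (ℚ.*-zeroˡ (proj₁ (vertex i k))) (ℚ.*-zeroˡ (proj₂ (vertex i k))))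

        node-last : ∀ i k → node i (suc N) k ≡ vertex i k
        node-last i k = ≡.trans (≡.cong (_· vertex i k) time-1) (≡.cong₂ _,_ (ℚ.*-identityˡ (proj₁ (vertex i k))) (ℚ.*-identityˡ (proj₂ (vertex i k))))

        node-closed : ∀ i j → node i j (suc N) ≡ node (next i) j 0
        node-closed i j = ≡.cong (time j ·_) (≡.trans (≡.cong (λ t → along t i) time-1)
          (≡.trans (along-1 i) (≡.cong (λ t → along t (next i)) (≡.sym time-0))))

        ∣τz∣ : ∀ z → ∣ ιᶜ (inv N) *ᶜ z ∣ ≈ ι (inv N) * ∣ z ∣
        ∣τz∣ z = R.trans (∣∣-* _ _) (R.*-congʳ (∣ρ∣ 0≤τ))

        τz≤δ : ∀ {z} → ∣ z ∣ ≤ ι four → ι (inv N) * ∣ z ∣ ≤ ι δ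
        τz≤δ z≤4 = ≤-trans (*-monoˡ-≤ 0≤τ z≤4) (≤-respˡ (ι-* _ _) (ι-mono mesh≤δ))

        radial : ∀ i j k → j ℕ.< suc N → k ℕ.< suc N →
          ∣ (f (node i (suc j) k) -ᶜ f (node i j k)) -ᶜ f′ (node i j k) *ᶜ (ιᶜ (inv N) *ᶜ p i k) ∣ ≤ ι ε * (ι (inv N) * ∣ p i k ∣)
        radial i j k j<n k<n = ≤-respˡ (∣∣-cong (C.+-congˡ (C.-‿cong (C.*-congˡ eq)))) (≤-respʳ (R.*-congˡ (R.trans (∣∣-cong eq) (∣τz∣ _)))
          (near (node i j k) (node i (suc j) k) (node∈Ω i (ℕ.<⇒≤ j<n) (ℕ.<⇒≤ k<n)) (node∈Ω i j<n (ℕ.<⇒≤ k<n))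
            (≤-respˡ (R.sym (R.trans (∣∣-cong eq) (∣τz∣ _))) (τz≤δ (∣p∣≤4 i (ℕ.<⇒≤ k<n))))))
          where
          eq : pt (node i (suc j) k) -ᶜ pt (node i j k) ≈ᶜ ιᶜ (inv N) *ᶜ p i k
          eq = node-radial i j k

        tangential : ∀ i j k → j ℕ.< suc N → k ℕ.< suc N →
          ∣ (f (node i j (suc k)) -ᶜ f (node i j k)) -ᶜ f′ (node i j k) *ᶜ (natᶜ j *ᶜ (ιᶜ (inv N) *ᶜ (ιᶜ (inv N) *ᶜ pt (dir i)))) ∣
            ≤ ι ε * (ι (nat j) * (ι (inv N) * (ι (inv N) * ∣ pt (dir i) ∣)))
        tangential i j k j<n k<n = ≤-respˡ (∣∣-cong (C.+-congˡ (C.-‿cong (C.*-congˡ eq)))) (≤-respʳ (R.*-congˡ (R.trans (∣∣-cong eq) norm))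
          (near (node i j k) (node i j (suc k)) (node∈Ω i (ℕ.<⇒≤ j<n) (ℕ.<⇒≤ k<n)) (node∈Ω i (ℕ.<⇒≤ j<n) k<n)
            (≤-respˡ (R.sym (R.trans (∣∣-cong eq) norm)) (≤-trans shrink (τz≤δ (∣D∣≤4 i))))))
          where
          eq : pt (node i j (suc k)) -ᶜ pt (node i j k) ≈ᶜ natᶜ j *ᶜ (ιᶜ (inv N) *ᶜ (ιᶜ (inv N) *ᶜ pt (dir i)))
          eq = node-tangential i j k
          norm : ∣ natᶜ j *ᶜ (ιᶜ (inv N) *ᶜ (ιᶜ (inv N) *ᶜ pt (dir i))) ∣ ≈ ι (nat j) * (ι (inv N) * (ι (inv N) * ∣ pt (dir i) ∣))
          norm = R.trans (∣∣-* _ _) (R.*-cong (∣ρ∣ (ι-mono (Rat.nat-nonNeg j))) (R.trans (∣τz∣ _) (R.*-congˡ (∣τz∣ _))))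
          shrink : ι (nat j) * (ι (inv N) * (ι (inv N) * ∣ pt (dir i) ∣)) ≤ ι (inv N) * ∣ pt (dir i) ∣
          shrink = ≤-respˡ (R.*-assoc _ _ _) (≤-respʳ (R.*-identityˡ _) (*-monoʳ-≤ (*-nonNeg 0≤τ (∣z∣-nonNeg _))
            (≤-respˡ (ι-* _ _) (ι-mono (time-≤1 (ℕ.<⇒≤ j<n))))))

        ∑dir≈0 : ∑₄ (λ i → pt (dir i)) ≈ᶜ 0ᶜ
        ∑dir≈0 = C.trans (C.reflexive (∑₄-≡ _)) (C.trans (C.sym (C.trans (pt-+ _ _ _ _) (C.+-congʳ (C.trans (pt-+ _ _ _ _) (C.+-congʳ (pt-+ _ _ _ _))))))
          (C.trans (C.reflexive (≡.cong pt (≡.cong₂ _,_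
            (solve 1 (λ a → ((con 0ℚ :+ :- (con two :+ a)) :+ con 0ℚ) :+ (con two :+ a) := con 0ℚ) ≡.refl a) ≡.refl))) (pt-ι 0ℚ)))

        open Polygon N p q (λ i → pt (dir i)) qp≈1 (λ i j k → f (node i j k)) (λ i j k → f′ (node i j k)) (ι ε) (ι-mono (ℚ.<⇒≤ 0<ε))
          radial tangential (λ i j → C.reflexive (≡.cong f (node-closed i j))) ∑dir≈0 (f origin) (f′ origin)
          (λ i k → C.reflexive (≡.cong f (node-0 i k))) (λ i k → C.reflexive (≡.cong f′ (node-0 i k)))

        L≤16 : L ≤ ι (four ℚ.* four)
        L≤16 = ≤-trans (∑₄ᴿ-mono ∣D∣≤4) (≤-reflexive (R.trans (R.reflexive (∑₄ᴿ-≡ (λ _ → ι four)))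
          (solveᴿ 0 (((κ four ⊕ κ four) ⊕ κ four) ⊕ κ four ⊜ κ (four ℚ.* four)) ≈-refl)))

        -- All four sides add something nonnegative to the imaginary part, and the right side alone
        -- adds at least 7/8: there `cross` is 7, and |p|² ≤ 8 on the rectangle.
        ½≤winding : ι ½ ≤ ∣ winding ∣
        ½≤winding = ≤-trans (≤-trans (ι-mono big) (≤-respʳ split sum)) (im≤∣z∣ winding)
          where
          s : Fin 4 → ℂ
          s i = ∑ (weight i) (suc N)
          split : ((im (s 0F) + im (s 1F)) + im (s 2F)) + im (s 3F) ≈ im winding
          split = R.sym (R.trans (im-≈ (C.reflexive (∑₄-≡ s))) (R.trans (im-+ _ _) (R.+-congʳ (R.trans (im-+ _ _) (R.+-congʳ (im-+ _ _))))))
          sum : ι (cross 0F ℚ.* eighth) ≤ ((im (s 0F) + im (s 1F)) + im (s 2F)) + im (s 3F)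
          sum = ≤-respˡ (solveᴿ 1 (λ x → ((x ⊕ κ 0ℚ) ⊕ κ 0ℚ) ⊕ κ 0ℚ ⊜ x) ≈-refl _)
            (+-mono-≤ (+-mono-≤ (+-mono-≤ (side-winding 0F) (pos 1F)) (pos 2F)) (pos 3F))
            where
            pos : ∀ i → ι 0ℚ ≤ im (s i)
            pos i = ≤-trans (ι-mono (Rat.*-nonNeg (cross-nonNeg i) (decidably {0ℚ} {eighth}))) (side-winding i)
          big : ½ ℚ.≤ cross 0F ℚ.* eighth
          big = decidably {½} {(two ℚ.* (height ℚ.+ height) ℚ.- (ℚ.- height) ℚ.* 0ℚ) ℚ.* eighth}

        0≤η : ι 0ℚ ≤ η
        0≤η = ≤-trans (∣z∣-nonNeg _) (f≤η (vertex 0F 0) (vertex∈Ω 0F ℕ.z≤n) (along∈∂ (time 0) 0F))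

        result : ∣ f origin ∣ * ι ½ ≤ (ι b * η + (ι ε + ι ε)) * ι (four ℚ.* four)
        result = ≤-trans (*-monoˡ-≤ (∣z∣-nonNeg _) ½≤winding) (≤-trans
          (center-bound (ι b) η (ι-mono 0≤b) (λ i k _ → ∣q∣≤ i k)
            λ i k k<n → ≤-respˡ (R.reflexive (≡.cong (λ u → ∣ f u ∣) (≡.sym (node-last i k)))) (f≤η (vertex i k) (vertex∈Ω i (ℕ.<⇒≤ k<n)) (along∈∂ (time k) i)))
          (*-monoˡ-≤ (+-nonNeg (*-nonNeg (ι-mono 0≤b) 0≤η) (+-nonNeg 0≤ε 0≤ε)) L≤16))
          where
          0≤ε : ι 0ℚ ≤ ι ε
          0≤ε = ι-mono (ℚ.<⇒≤ 0<ε)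

    -- The bound 16 for the perimeter divided by the lower bound 1/2 for the winding sum.
    thirtytwo : ℚ
    thirtytwo = four ℚ.* four ℚ.+ four ℚ.* four

    -- The maximum principle up to a constant factor.
    center≤boundary : ∀ {f f′} → Differentiable f f′ → ∀ {η} → (∀ u → Ω u → Boundary u → ∣ f u ∣ ≤ η) →
                      ∣ f (0ℚ , 0ℚ) ∣ ≤ ι (thirtytwo ℚ.* Rat.recip 0<a) * η
    center≤boundary {f} {f′} d {η} f≤η = ≤-limit λ ε 0<ε → choose ε (Rat.shrink (decidably {0ℚ} {thirtytwo ℚ.+ thirtytwo}) 0<ε)
      where
      b : ℚ
      b = Rat.recip 0<a
      choose : ∀ ε → ∃[ ε₁ ] 0ℚ ℚ.< ε₁ × (thirtytwo ℚ.+ thirtytwo) ℚ.* ε₁ ℚ.≤ ε → ∣ f (0ℚ , 0ℚ) ∣ ≤ ι (thirtytwo ℚ.* b) * η + ι ε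
      choose ε (ε₁ , 0<ε₁ , h) = refine (d ε₁ 0<ε₁)
        where
        refine : ∃[ δ ] 0ℚ ℚ.< δ × (∀ u v → Ω u → Ω v → ∣ pt v -ᶜ pt u ∣ ≤ ι δ →
          ∣ (f v -ᶜ f u) -ᶜ f′ u *ᶜ (pt v -ᶜ pt u) ∣ ≤ ι ε₁ * ∣ pt v -ᶜ pt u ∣) → ∣ f (0ℚ , 0ℚ) ∣ ≤ ι (thirtytwo ℚ.* b) * η + ι ε
        refine (δ , 0<δ , near) = ≤-trans (≤-by _ (*-nonNeg (ι-mono (decidably {0ℚ} {two})) (x≤y⇒0≤y-x (Mesh.Bound.result N f f′ ε₁ δ 0<ε₁ mesh≤δ near η f≤η)))
            (R.trans (R.+-congʳ (R.+-congʳ (R.*-congʳ (ι-* thirtytwo b))))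
              (solveᴿ 4 (λ x b η e → ((κ thirtytwo ⊗ b) ⊗ η ⊕ κ (thirtytwo ℚ.+ thirtytwo) ⊗ e) ⊖ x ⊜ κ two ⊗ ((b ⊗ η ⊕ (e ⊕ e)) ⊗ κ (four ℚ.* four) ⊖ x ⊗ κ ½))
                ≈-refl (∣ f (0ℚ , 0ℚ) ∣) (ι b) η (ι ε₁))))
          (+-mono-≤ ≤-refl (≤-respˡ (ι-* _ _) (ι-mono h)))
          where
          quarter-δ : ℚ
          quarter-δ = ¼ ℚ.* δ
          small : ∃[ N ] (∀ n → N ℕ.≤ n → inv n ℚ.≤ quarter-δ)
          small = Rat.inv-small quarter-δ (D.RationalLemmas.*-pos (ℚ.positive⁻¹ ¼) 0<δ)
          N : ℕ
          N = proj₁ small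
          mesh≤δ : inv N ℚ.* four ℚ.≤ δ
          mesh≤δ = ≡.subst (inv N ℚ.* four ℚ.≤_) (solve 1 (λ d → (con ¼ :* d) :* con four := d) ≡.refl δ)
            (D.RationalLemmas.*-monoˡ (decidably {0ℚ} {four}) (proj₂ small N ℕ.≤-refl))

-- Differential calculus on the rectangle.

module Smoothness where

  open Rat using (nat; inv; ¼)
  open Real
  open Complex
  open Exp
  open ExpProperties
  open Rectangles

  module Smooth (a : ℚ) (0<a : 0ℚ ℚ.< a) (a≤½ : a ℚ.≤ ½) where

    open Rectangle a 0<a a≤½

    Nearby : (Point → Point → Set) → Set
    Nearby P = ∃[ δ ] 0ℚ ℚ.< δ × (∀ u v → Ω u → Ω v → ∣ pt v -ᶜ pt u ∣ ≤ ι δ → P u v)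

    nearby-map₂ : ∀ {P Q T : Point → Point → Set} → (∀ u v → Ω u → Ω v → P u v → Q u v → T u v) → Nearby P → Nearby Q → Nearby T
    nearby-map₂ h (δ₁ , 0<δ₁ , p) (δ₂ , 0<δ₂ , q) = δ₁ ℚ.⊓ δ₂ , Rat.⊓-pos 0<δ₁ 0<δ₂ , λ u v u∈ v∈ d →
      h u v u∈ v∈ (p u v u∈ v∈ (≤-trans d (ι-mono (ℚ.p⊓q≤p δ₁ δ₂)))) (q u v u∈ v∈ (≤-trans d (ι-mono (ℚ.p⊓q≤q δ₁ δ₂))))

    within : ∀ {δ} → 0ℚ ℚ.< δ → Nearby λ u v → ∣ pt v -ᶜ pt u ∣ ≤ ι δ
    within {δ} 0<δ = δ , 0<δ , λ u v _ _ d → d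

    Bounded : (Point → ℂ) → Set
    Bounded f = ∃[ n ] (∀ u → Ω u → ∣ f u ∣ ≤ ι (nat n))

    -- Differentiability is uniform, so the product and chain rules need bounds for the functions
    -- and their derivatives; carrying them in the record makes it closed under all operations used.
    record _′=_ (f f′ : Point → ℂ) : Set where
      constructor smooth
      field
        bounded      : Bounded f
        bounded′     : Bounded f′
        differential : Differentiable f f′
    open _′=_ public

    0≤nat : ∀ n → ι 0ℚ ≤ ι (nat n)
    0≤nat n = ι-mono (Rat.nat-nonNeg n)

    nat-+ : ∀ m n → ι (nat m) + ι (nat n) ≈ ι (nat (m ℕ.+ n))
    nat-+ m n = R.trans (R.sym (ι-+ _ _)) (R.reflexive (≡.cong ι (≡.sym (Rat.nat-+ m n))))

    nat-* : ∀ m n → ι (nat m) * ι (nat n) ≈ ι (nat (m ℕ.* n))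
    nat-* m n = R.trans (R.sym (ι-* _ _)) (R.reflexive (≡.cong ι (≡.sym (Rat.nat-* m n))))

    bounded-+ : ∀ {f g} → Bounded f → Bounded g → Bounded (λ u → f u +ᶜ g u)
    bounded-+ (m , p) (n , q) = m ℕ.+ n , λ u u∈ → ≤-trans (∣z+w∣≤ _ _) (≤-trans (+-mono-≤ (p u u∈) (q u u∈)) (≤-reflexive (nat-+ m n)))

    bounded-* : ∀ {f g} → Bounded f → Bounded g → Bounded (λ u → f u *ᶜ g u)
    bounded-* (m , p) (n , q) = m ℕ.* n , λ u u∈ → ≤-trans (≤-reflexive (∣∣-* _ _))
      (≤-trans (*-mono-≤ (∣z∣-nonNeg _) (0≤nat n) (p u u∈) (q u u∈)) (≤-reflexive (nat-* m n)))

    bounded-const : ∀ c → Bounded (λ _ → c)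
    bounded-const c = proj₁ (upperBound ∣ c ∣) , λ _ _ → proj₂ (upperBound ∣ c ∣)

    differentiable-zero : ∀ {f f′} → (∀ u v → (f v -ᶜ f u) -ᶜ f′ u *ᶜ (pt v -ᶜ pt u) ≈ᶜ 0ᶜ) → Differentiable f f′
    differentiable-zero h ε 0<ε = 1ℚ , Rat.0<1 , λ u v _ _ _ →
      ≤-trans (≤-reflexive (∣0ᶜ∣ (h u v))) (*-nonNeg (ι-mono (ℚ.<⇒≤ 0<ε)) (∣z∣-nonNeg _))

    const′ : ∀ c → (λ _ → c) ′= (λ _ → 0ᶜ)
    const′ c = smooth (bounded-const c) (bounded-const 0ᶜ)
      (differentiable-zero λ u v → solveᶜ 2 (λ c d → (c ⊟ c) ⊟ κᶜ 0ℚ ⊠ d ≋ κᶜ 0ℚ) C.refl c (pt v -ᶜ pt u))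

    pt-bounded : Bounded pt
    pt-bounded = proj₁ (upperBound (ι four)) , λ u u∈ → ≤-trans
      (∣pt∣≤ u (Rat.+-nonNeg 0≤2 0≤2) (ℚ.≤-trans (square≤8 u∈) 8≤16)) (proj₂ (upperBound (ι four)))
      where
      0≤2 : 0ℚ ℚ.≤ two
      0≤2 = ℚ.<⇒≤ (ℚ.positive⁻¹ two)
      8≤16 : four ℚ.+ four ℚ.≤ four ℚ.* four
      8≤16 = Rat.≤-by (four ℚ.+ four) (ℚ.<⇒≤ (ℚ.positive⁻¹ (four ℚ.+ four))) ≡.refl

    id′ : pt ′= (λ _ → 1ᶜ)
    id′ = smooth pt-bounded (bounded-const 1ᶜ)
      (differentiable-zero λ u v → solveᶜ 2 (λ x y → (y ⊟ x) ⊟ κᶜ 1ℚ ⊠ (y ⊟ x) ≋ κᶜ 0ℚ) C.refl (pt u) (pt v))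

    +′ : ∀ {f f′ g g′} → f ′= f′ → g ′= g′ → (λ u → f u +ᶜ g u) ′= (λ u → f′ u +ᶜ g′ u)
    +′ {f} {f′} {g} {g′} df dg = smooth (bounded-+ (bounded df) (bounded dg)) (bounded-+ (bounded′ df) (bounded′ dg))
      λ ε 0<ε → nearby-map₂ (λ u v _ _ p q → let d = pt v -ᶜ pt u in begin
        ∣ ((f v +ᶜ g v) -ᶜ (f u +ᶜ g u)) -ᶜ (f′ u +ᶜ g′ u) *ᶜ d ∣
          ≈⟨ ∣∣-cong (solveᶜ 7 (λ a b x y p q d → ((a ⊞ x) ⊟ (b ⊞ y)) ⊟ (p ⊞ q) ⊠ d ≋ ((a ⊟ b) ⊟ p ⊠ d) ⊞ ((x ⊟ y) ⊟ q ⊠ d)) C.refl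
               (f v) (f u) (g v) (g u) (f′ u) (g′ u) d) ⟩
        ∣ ((f v -ᶜ f u) -ᶜ f′ u *ᶜ d) +ᶜ ((g v -ᶜ g u) -ᶜ g′ u *ᶜ d) ∣ ≤⟨ ≤-trans (∣z+w∣≤ _ _) (+-mono-≤ p q) ⟩
        ι (½ ℚ.* ε) * ∣ d ∣ + ι (½ ℚ.* ε) * ∣ d ∣ ≈⟨ R.distribʳ _ _ _ ⟨
        (ι (½ ℚ.* ε) + ι (½ ℚ.* ε)) * ∣ d ∣ ≈⟨ R.*-congʳ (R.trans (R.sym (ι-+ _ _)) (R.reflexive (≡.cong ι (Rat.half+half ε)))) ⟩
        ι ε * ∣ d ∣ ∎)
        (differential df _ (Rat.half-pos 0<ε)) (differential dg _ (Rat.half-pos 0<ε))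
      where open ≤-Reasoning

    lipschitz : ∀ {f f′} (df : f ′= f′) → let M = suc (proj₁ (bounded′ df)) in
                Nearby λ u v → ∣ f v -ᶜ f u ∣ ≤ ι (nat M) * ∣ pt v -ᶜ pt u ∣
    lipschitz {f} {f′} df = nearby-map₂ (λ u v u∈ _ p _ → let d = pt v -ᶜ pt u in begin
        ∣ f v -ᶜ f u ∣ ≈⟨ ∣∣-cong (solveᶜ 2 (λ x y → x ≋ (x ⊟ y) ⊞ y) C.refl (f v -ᶜ f u) (f′ u *ᶜ d)) ⟩
        ∣ ((f v -ᶜ f u) -ᶜ f′ u *ᶜ d) +ᶜ f′ u *ᶜ d ∣ ≤⟨ ∣z+w∣≤ _ _ ⟩
        ∣ (f v -ᶜ f u) -ᶜ f′ u *ᶜ d ∣ + ∣ f′ u *ᶜ d ∣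
          ≤⟨ +-mono-≤ p (≤-trans (≤-reflexive (∣∣-* _ _)) (*-monoʳ-≤ (∣z∣-nonNeg _) (proj₂ (bounded′ df) u u∈))) ⟩
        ι 1ℚ * ∣ d ∣ + ι (nat n) * ∣ d ∣ ≈⟨ R.distribʳ _ _ _ ⟨
        (ι 1ℚ + ι (nat n)) * ∣ d ∣ ≈⟨ R.*-congʳ (R.trans (R.sym (ι-+ _ _)) (R.reflexive (≡.cong ι (≡.sym (Rat.nat-suc n))))) ⟩
        ι (nat (suc n)) * ∣ d ∣ ∎)
      (differential df 1ℚ Rat.0<1) (within Rat.0<1)
      where
      open ≤-Reasoning
      n = proj₁ (bounded′ df)

    *′ : ∀ {f f′ g g′} → f ′= f′ → g ′= g′ → (λ u → f u *ᶜ g u) ′= (λ u → f′ u *ᶜ g u +ᶜ f u *ᶜ g′ u)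
    *′ {f} {f′} {g} {g′} df dg = smooth (bounded-* (bounded df) (bounded dg))
      (bounded-+ (bounded-* (bounded′ df) (bounded dg)) (bounded-* (bounded df) (bounded′ dg)))
      λ ε 0<ε → choose ε (Rat.shrink (Rat.+-nonNeg (Rat.nat-nonNeg B) (Rat.nat-nonNeg A)) (Rat.half-pos 0<ε))
                         (Rat.shrink (Rat.*-nonNeg (Rat.nat-nonNeg A′) (Rat.nat-nonNeg M)) (Rat.half-pos 0<ε))
      where
      open ≤-Reasoning
      A = proj₁ (bounded df)
      A′ = proj₁ (bounded′ df)
      B = proj₁ (bounded dg)
      M = suc (proj₁ (bounded′ dg))
      choose : ∀ ε → ∃[ ε₁ ] 0ℚ ℚ.< ε₁ × (nat B ℚ.+ nat A) ℚ.* ε₁ ℚ.≤ ½ ℚ.* ε → ∃[ δ ] 0ℚ ℚ.< δ × (nat A′ ℚ.* nat M) ℚ.* δ ℚ.≤ ½ ℚ.* ε →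
        Nearby λ u v → ∣ (f v *ᶜ g v -ᶜ f u *ᶜ g u) -ᶜ (f′ u *ᶜ g u +ᶜ f u *ᶜ g′ u) *ᶜ (pt v -ᶜ pt u) ∣ ≤ ι ε * ∣ pt v -ᶜ pt u ∣
      choose ε (ε₁ , 0<ε₁ , h₁) (δ , 0<δ , h₂) = nearby-map₂ estimate
        (nearby-map₂ (λ _ _ _ _ p q → p , q) (differential df ε₁ 0<ε₁) (differential dg ε₁ 0<ε₁))
        (nearby-map₂ (λ _ _ _ _ p q → p , q) (lipschitz dg) (within 0<δ))
        where
        estimate : ∀ u v → Ω u → Ω v →
          ∣ (f v -ᶜ f u) -ᶜ f′ u *ᶜ (pt v -ᶜ pt u) ∣ ≤ ι ε₁ * ∣ pt v -ᶜ pt u ∣ × ∣ (g v -ᶜ g u) -ᶜ g′ u *ᶜ (pt v -ᶜ pt u) ∣ ≤ ι ε₁ * ∣ pt v -ᶜ pt u ∣ →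
          ∣ g v -ᶜ g u ∣ ≤ ι (nat M) * ∣ pt v -ᶜ pt u ∣ × ∣ pt v -ᶜ pt u ∣ ≤ ι δ →
          ∣ (f v *ᶜ g v -ᶜ f u *ᶜ g u) -ᶜ (f′ u *ᶜ g u +ᶜ f u *ᶜ g′ u) *ᶜ (pt v -ᶜ pt u) ∣ ≤ ι ε * ∣ pt v -ᶜ pt u ∣
        estimate u v u∈ v∈ (pf , pg) (lip , d≤δ) = begin
          ∣ (f v *ᶜ g v -ᶜ f u *ᶜ g u) -ᶜ (f′ u *ᶜ g u +ᶜ f u *ᶜ g′ u) *ᶜ d ∣
            ≈⟨ ∣∣-cong (solveᶜ 7 (λ fv fu gv gu f′ g′ d → (fv ⊠ gv ⊟ fu ⊠ gu) ⊟ (f′ ⊠ gu ⊞ fu ⊠ g′) ⊠ d ≋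
                 (((fv ⊟ fu) ⊟ f′ ⊠ d) ⊠ gv ⊞ fu ⊠ ((gv ⊟ gu) ⊟ g′ ⊠ d)) ⊞ (f′ ⊠ d) ⊠ (gv ⊟ gu)) C.refl (f v) (f u) (g v) (g u) (f′ u) (g′ u) d) ⟩
          ∣ (((f v -ᶜ f u) -ᶜ f′ u *ᶜ d) *ᶜ g v +ᶜ f u *ᶜ ((g v -ᶜ g u) -ᶜ g′ u *ᶜ d)) +ᶜ (f′ u *ᶜ d) *ᶜ (g v -ᶜ g u) ∣
            ≤⟨ ≤-trans (∣z+w∣≤ _ _) (+-mono-≤ (≤-trans (∣z+w∣≤ _ _) (+-mono-≤
                 (≤-trans (≤-reflexive (∣∣-* _ _)) (*-mono-≤ (∣z∣-nonNeg _) (0≤nat B) pf (proj₂ (bounded dg) v v∈)))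
                 (≤-trans (≤-reflexive (∣∣-* _ _)) (*-mono-≤ (∣z∣-nonNeg _) (*-nonNeg 0≤ε₁ (∣z∣-nonNeg d)) (proj₂ (bounded df) u u∈) pg))))
                 (≤-trans (≤-reflexive (R.trans (∣∣-* _ _) (R.*-congʳ (∣∣-* _ _))))
                   (*-mono-≤ (*-nonNeg (∣z∣-nonNeg _) (∣z∣-nonNeg d)) (*-nonNeg (0≤nat M) 0≤δ)
                     (*-monoʳ-≤ (∣z∣-nonNeg d) (proj₂ (bounded′ df) u u∈)) (≤-trans lip (*-monoˡ-≤ (0≤nat M) d≤δ))))) ⟩
          ((ι ε₁ * ∣ d ∣) * ι (nat B) + ι (nat A) * (ι ε₁ * ∣ d ∣)) + (ι (nat A′) * ∣ d ∣) * (ι (nat M) * ι δ)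
            ≈⟨ solveᴿ 7 (λ e d b a a′ m δ → ((e ⊗ d) ⊗ b ⊕ a ⊗ (e ⊗ d)) ⊕ (a′ ⊗ d) ⊗ (m ⊗ δ) ⊜ ((b ⊕ a) ⊗ e ⊕ (a′ ⊗ m) ⊗ δ) ⊗ d) ≈-refl
                 (ι ε₁) (∣ d ∣) (ι (nat B)) (ι (nat A)) (ι (nat A′)) (ι (nat M)) (ι δ) ⟩
          ((ι (nat B) + ι (nat A)) * ι ε₁ + (ι (nat A′) * ι (nat M)) * ι δ) * ∣ d ∣
            ≈⟨ R.*-congʳ (R.trans (R.+-cong (R.trans (R.*-congʳ (R.sym (ι-+ _ _))) (R.sym (ι-* _ _))) (R.trans (R.*-congʳ (R.sym (ι-* _ _))) (R.sym (ι-* _ _)))) (R.sym (ι-+ _ _))) ⟩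
          ι ((nat B ℚ.+ nat A) ℚ.* ε₁ ℚ.+ (nat A′ ℚ.* nat M) ℚ.* δ) * ∣ d ∣
            ≤⟨ *-monoʳ-≤ (∣z∣-nonNeg d) (ι-mono (ℚ.≤-trans (ℚ.+-mono-≤ h₁ h₂) (ℚ.≤-reflexive (Rat.half+half ε)))) ⟩
          ι ε * ∣ d ∣ ∎
          where
          d : ℂ
          d = pt v -ᶜ pt u
          0≤ε₁ : ι 0ℚ ≤ ι ε₁
          0≤ε₁ = ι-mono (ℚ.<⇒≤ 0<ε₁)
          0≤δ : ι 0ℚ ≤ ι δ
          0≤δ = ι-mono (ℚ.<⇒≤ 0<δ)

    exp-bounded : ∀ {f} → Bounded f → Bounded (λ u → exp (f u))
    exp-bounded (n , h) = proj₁ (upperBound (expᴿ (ι (nat n)))) , λ u u∈ → ≤-trans (≤-reflexive (∣exp∣ _))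
      (≤-trans (expᴿ-mono (≤-trans (re≤∣z∣ _) (h u u∈))) (proj₂ (upperBound (expᴿ (ι (nat n))))))

    exp′ : ∀ {f f′} → f ′= f′ → (λ u → exp (f u)) ′= (λ u → exp (f u) *ᶜ f′ u)
    exp′ {f} {f′} df = smooth be (bounded-* be (bounded′ df))
      λ ε 0<ε → choose ε (Rat.shrink (Rat.nat-nonNeg B) (Rat.half-pos 0<ε))
        (Rat.shrink (Rat.*-nonNeg (Rat.nat-nonNeg B) (Rat.*-nonNeg (Rat.nat-nonNeg M) (Rat.nat-nonNeg M))) (Rat.half-pos 0<ε))
        (Rat.shrink (Rat.nat-nonNeg M) Rat.0<1)
      where
      open ≤-Reasoning
      be : Bounded (λ u → exp (f u))
      be = exp-bounded (bounded df)
      B M : ℕ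
      B = proj₁ be
      M = suc (proj₁ (bounded′ df))
      choose : ∀ ε → ∃[ ε₁ ] 0ℚ ℚ.< ε₁ × nat B ℚ.* ε₁ ℚ.≤ ½ ℚ.* ε → ∃[ δ ] 0ℚ ℚ.< δ × (nat B ℚ.* (nat M ℚ.* nat M)) ℚ.* δ ℚ.≤ ½ ℚ.* ε →
        ∃[ δ ] 0ℚ ℚ.< δ × nat M ℚ.* δ ℚ.≤ 1ℚ →
        Nearby λ u v → ∣ (exp (f v) -ᶜ exp (f u)) -ᶜ (exp (f u) *ᶜ f′ u) *ᶜ (pt v -ᶜ pt u) ∣ ≤ ι ε * ∣ pt v -ᶜ pt u ∣
      choose ε (ε₁ , 0<ε₁ , h₁) (δ , 0<δ , h₂) (δ′ , 0<δ′ , h₃) = nearby-map₂ estimate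
        (nearby-map₂ (λ _ _ _ _ p q → p , q) (differential df ε₁ 0<ε₁) (lipschitz df))
        (nearby-map₂ (λ _ _ _ _ p q → p , q) (within 0<δ) (within 0<δ′))
        where
        estimate : ∀ u v → Ω u → Ω v →
          ∣ (f v -ᶜ f u) -ᶜ f′ u *ᶜ (pt v -ᶜ pt u) ∣ ≤ ι ε₁ * ∣ pt v -ᶜ pt u ∣ × ∣ f v -ᶜ f u ∣ ≤ ι (nat M) * ∣ pt v -ᶜ pt u ∣ →
          ∣ pt v -ᶜ pt u ∣ ≤ ι δ × ∣ pt v -ᶜ pt u ∣ ≤ ι δ′ →
          ∣ (exp (f v) -ᶜ exp (f u)) -ᶜ (exp (f u) *ᶜ f′ u) *ᶜ (pt v -ᶜ pt u) ∣ ≤ ι ε * ∣ pt v -ᶜ pt u ∣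
        estimate u v u∈ v∈ (pf , lip) (d≤δ , d≤δ′) = begin
          ∣ (exp (f v) -ᶜ e) -ᶜ (e *ᶜ f′ u) *ᶜ d ∣
            -- With k = f v - f u, exp (f v) = exp (f u) exp k reduces the claim to the behaviour of
            -- exp near 0, where `exp-near` applies once |k| ≤ 1.
            ≈⟨ ∣∣-cong (C.trans (C.+-congʳ (C.+-congʳ (C.trans (exp-cong (solveᶜ 2 (λ x y → x ≋ y ⊞ (x ⊟ y)) C.refl (f v) (f u))) (exp-+ (f u) k))))
                 (solveᶜ 5 (λ e E k f′ d → (e ⊠ E ⊟ e) ⊟ (e ⊠ f′) ⊠ d ≋ e ⊠ ((E ⊟ (κᶜ 1ℚ ⊞ k)) ⊞ (k ⊟ f′ ⊠ d))) C.refl e (exp k) k (f′ u) d)) ⟩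
          ∣ e *ᶜ ((exp k -ᶜ (1ᶜ +ᶜ k)) +ᶜ (k -ᶜ f′ u *ᶜ d)) ∣
            ≤⟨ ≤-trans (≤-reflexive (∣∣-* _ _)) (*-mono-≤ (∣z∣-nonNeg _) (+-nonNeg (*-nonNeg 0≤Md 0≤Md′) (*-nonNeg 0≤ε₁ (∣z∣-nonNeg d)))
                 (proj₂ be u u∈) (≤-trans (∣z+w∣≤ _ _) (+-mono-≤ (≤-trans (exp-near k≤1) (*-mono-≤ (∣z∣-nonNeg k) 0≤Md′ lip k≤Mδ)) pf))) ⟩
          ι (nat B) * ((ι (nat M) * ∣ d ∣) * (ι (nat M) * ι δ) + ι ε₁ * ∣ d ∣)
            ≈⟨ solveᴿ 5 (λ b m d δ e → b ⊗ ((m ⊗ d) ⊗ (m ⊗ δ) ⊕ e ⊗ d) ⊜ (b ⊗ e ⊕ (b ⊗ (m ⊗ m)) ⊗ δ) ⊗ d) ≈-refl (ι (nat B)) (ι (nat M)) (∣ d ∣) (ι δ) (ι ε₁) ⟩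
          (ι (nat B) * ι ε₁ + (ι (nat B) * (ι (nat M) * ι (nat M))) * ι δ) * ∣ d ∣
            ≈⟨ R.*-congʳ (R.trans (R.+-cong (R.sym (ι-* _ _)) (R.trans (R.*-congʳ (R.trans (R.*-congˡ (R.sym (ι-* _ _))) (R.sym (ι-* _ _)))) (R.sym (ι-* _ _)))) (R.sym (ι-+ _ _))) ⟩
          ι (nat B ℚ.* ε₁ ℚ.+ (nat B ℚ.* (nat M ℚ.* nat M)) ℚ.* δ) * ∣ d ∣
            ≤⟨ *-monoʳ-≤ (∣z∣-nonNeg d) (ι-mono (ℚ.≤-trans (ℚ.+-mono-≤ h₁ h₂) (ℚ.≤-reflexive (Rat.half+half ε)))) ⟩
          ι ε * ∣ d ∣ ∎
          where
          d e k : ℂ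
          d = pt v -ᶜ pt u
          e = exp (f u)
          k = f v -ᶜ f u
          0≤ε₁ : ι 0ℚ ≤ ι ε₁
          0≤ε₁ = ι-mono (ℚ.<⇒≤ 0<ε₁)
          0≤Md : ι 0ℚ ≤ ι (nat M) * ∣ d ∣
          0≤Md = *-nonNeg (0≤nat M) (∣z∣-nonNeg d)
          0≤Md′ : ι 0ℚ ≤ ι (nat M) * ι δ
          0≤Md′ = *-nonNeg (0≤nat M) (ι-mono (ℚ.<⇒≤ 0<δ))
          k≤Mδ : ∣ k ∣ ≤ ι (nat M) * ι δ
          k≤Mδ = ≤-trans lip (*-monoˡ-≤ (0≤nat M) d≤δ)
          k≤1 : ∣ k ∣ ≤ ι 1ℚ
          k≤1 = ≤-trans lip (≤-trans (*-monoˡ-≤ (0≤nat M) d≤δ′) (≤-respˡ (ι-* _ _) (ι-mono h₃)))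

    ∑′ : ∀ {f f′ : ℕ → Point → ℂ} → (∀ k → f k ′= f′ k) → ∀ n → (λ u → ∑ (λ k → f k u) n) ′= (λ u → ∑ (λ k → f′ k u) n)
    ∑′ h zero    = const′ 0ᶜ
    ∑′ h (suc n) = +′ (∑′ h n) (h n)

    cancel-∣∣ : ∀ {x y w q} → 0ℚ ℚ.< q → ι q ≤ ∣ w ∣ → x * ∣ w ∣ ≤ y * ∣ w ∣ → x ≤ y
    cancel-∣∣ 0<q q≤w h = *-cancelˡ-≤ 0<q q≤w (≤-respˡ (R.*-comm _ _) (≤-respʳ (R.*-comm _ _) h))

    ∣pt∣-pos : ∀ u → 0ℚ ℚ.< square u → ∃[ q ] 0ℚ ℚ.< q × ι q ≤ ∣ pt u ∣
    ∣pt∣-pos u 0<s = q , 0<q , ≤∣z∣ (pt u) (≤-respˡ (ι-* q q) (≤-respʳ (R.sym (∣pt∣² u)) (ι-mono (ℚ.≤-trans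
        (≡.subst (q ℚ.* q ℚ.≤_) (ℚ.*-identityʳ q) (Rat.*-monoʳ-≤ (ℚ.<⇒≤ 0<q) (ℚ.p⊓q≤p 1ℚ (square u)))) (ℚ.p⊓q≤q 1ℚ (square u))))))
      where
      q : ℚ
      q = 1ℚ ℚ.⊓ square u
      0<q : 0ℚ ℚ.< q
      0<q = Rat.⊓-pos Rat.0<1 0<s

    -- Walk from 0 to u in equal steps shorter than the modulus of differentiability: consecutive derivatives differ
    -- by at most 2, because both approximate the same difference quotient.
    module Chain {f f′ : Point → ℂ} (δ : ℚ) (near : ∀ u v → Ω u → Ω v → ∣ pt v -ᶜ pt u ∣ ≤ ι δ →
        ∣ (f v -ᶜ f u) -ᶜ f′ u *ᶜ (pt v -ᶜ pt u) ∣ ≤ ι 1ℚ * ∣ pt v -ᶜ pt u ∣)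
        (N : ℕ) (mesh≤δ : inv N ℚ.* four ℚ.≤ δ) (u : Point) (u∈Ω : Ω u) (0<u : 0ℚ ℚ.< square u) where

      open Mesh N using (time; time-0; time-1; time-nonNeg; time-≤1; time-suc)
      open ≤-Reasoning

      x : ℕ → Point
      x j = time j · u

      x∈Ω : ∀ {j} → j ℕ.≤ suc N → Ω (x j)
      x∈Ω {j} j≤n = ·∈Ω (time-nonNeg j) (time-≤1 j≤n) u∈Ω

      d : ℂ
      d = pt (inv N · u)

      x-step : ∀ j → pt (x (suc j)) -ᶜ pt (x j) ≈ᶜ d
      x-step j = C.trans (C.+-cong (C.trans (pt-· _ _) (C.*-congʳ
          (C.trans (C.reflexive (≡.cong ιᶜ (time-suc j))) (C.trans (ρ-cong (ι-+ _ _)) (ρ-+ _ _))))) (C.-‿cong (pt-· _ _)))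
        (C.trans (solveᶜ 3 (λ t i p → (t ⊞ i) ⊠ p ⊟ t ⊠ p ≋ i ⊠ p) C.refl (ιᶜ (time j)) (ιᶜ (inv N)) (pt u)) (C.sym (pt-· _ _)))

      x-back : ∀ j → pt (x j) -ᶜ pt (x (suc j)) ≈ᶜ -ᶜ d
      x-back j = C.trans (solveᶜ 2 (λ a b → a ⊟ b ≋ ⊟ (b ⊟ a)) C.refl (pt (x j)) (pt (x (suc j)))) (C.-‿cong (x-step j))

      ∣u∣≤4 : ∣ pt u ∣ ≤ ι four
      ∣u∣≤4 = ∣pt∣≤ u (ℚ.<⇒≤ (ℚ.positive⁻¹ four)) (ℚ.≤-trans (square≤8 u∈Ω)
        (Rat.≤-by (four ℚ.+ four) (ℚ.<⇒≤ (ℚ.positive⁻¹ (four ℚ.+ four))) ≡.refl))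

      ∣d∣ : ∣ d ∣ ≈ ι (inv N) * ∣ pt u ∣
      ∣d∣ = R.trans (∣∣-cong (pt-· _ _)) (R.trans (∣∣-* _ _) (R.*-congʳ (∣ρ∣ (ι-mono (Rat.inv-nonNeg N)))))

      ∣d∣≤ : ∣ d ∣ ≤ ι (inv N ℚ.* four)
      ∣d∣≤ = ≤-respˡ (R.sym ∣d∣) (≤-respʳ (R.sym (ι-* _ _)) (*-monoˡ-≤ (ι-mono (Rat.inv-nonNeg N)) ∣u∣≤4))

      ∣d∣≤δ : ∣ d ∣ ≤ ι δ
      ∣d∣≤δ = ≤-trans ∣d∣≤ (ι-mono mesh≤δ)

      d-pos : ∃[ q ] 0ℚ ℚ.< q × ι q ≤ ∣ d ∣
      d-pos = ∣pt∣-pos (inv N · u) (≡.subst (0ℚ ℚ.<_)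
        (solve 3 (λ i a b → (i :* i) :* (a :* a :+ b :* b) := (i :* a) :* (i :* a) :+ (i :* b) :* (i :* b)) ≡.refl (inv N) (proj₁ u) (proj₂ u))
        (D.RationalLemmas.*-pos (D.RationalLemmas.*-pos (Rat.inv-pos N) (Rat.inv-pos N)) 0<u))

      forward : ∀ j → j ℕ.< suc N → ∣ (f (x (suc j)) -ᶜ f (x j)) -ᶜ f′ (x j) *ᶜ d ∣ ≤ ι 1ℚ * ∣ d ∣
      forward j j<n = ≤-respˡ (∣∣-cong (C.+-congˡ (C.-‿cong (C.*-congˡ (x-step j))))) (≤-respʳ (R.*-congˡ (∣∣-cong (x-step j)))
        (near (x j) (x (suc j)) (x∈Ω (ℕ.<⇒≤ j<n)) (x∈Ω j<n) (≤-respˡ (R.sym (∣∣-cong (x-step j))) ∣d∣≤δ)))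

      backward : ∀ j → j ℕ.< suc N → ∣ (f (x j) -ᶜ f (x (suc j))) -ᶜ f′ (x (suc j)) *ᶜ (-ᶜ d) ∣ ≤ ι 1ℚ * ∣ d ∣
      backward j j<n = ≤-respˡ (∣∣-cong (C.+-congˡ (C.-‿cong (C.*-congˡ (x-back j))))) (≤-respʳ (R.*-congˡ (R.trans (∣∣-cong (x-back j)) (∣-z∣ d)))
        (near (x (suc j)) (x j) (x∈Ω j<n) (x∈Ω (ℕ.<⇒≤ j<n)) (≤-respˡ (R.sym (R.trans (∣∣-cong (x-back j)) (∣-z∣ d))) ∣d∣≤δ)))

      derivative-step : ∀ j → j ℕ.< suc N → ∣ f′ (x (suc j)) -ᶜ f′ (x j) ∣ ≤ ι two
      derivative-step j j<n = cancel-∣∣ {w = d} (proj₁ (proj₂ d-pos)) (proj₂ (proj₂ d-pos)) (begin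
        ∣ f′ (x (suc j)) -ᶜ f′ (x j) ∣ * ∣ d ∣ ≈⟨ ∣∣-* _ _ ⟨
        ∣ (f′ (x (suc j)) -ᶜ f′ (x j)) *ᶜ d ∣
          ≈⟨ ∣∣-cong (solveᶜ 5 (λ a b p q d → (q ⊟ p) ⊠ d ≋ ((b ⊟ a) ⊟ p ⊠ d) ⊞ ((a ⊟ b) ⊟ q ⊠ (⊟ d))) C.refl
               (f (x j)) (f (x (suc j))) (f′ (x j)) (f′ (x (suc j))) d) ⟩
        ∣ ((f (x (suc j)) -ᶜ f (x j)) -ᶜ f′ (x j) *ᶜ d) +ᶜ ((f (x j) -ᶜ f (x (suc j))) -ᶜ f′ (x (suc j)) *ᶜ (-ᶜ d)) ∣
          ≤⟨ ≤-trans (∣z+w∣≤ _ _) (+-mono-≤ (forward j j<n) (backward j j<n)) ⟩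
        ι 1ℚ * ∣ d ∣ + ι 1ℚ * ∣ d ∣ ≈⟨ solveᴿ 1 (λ d → κ 1ℚ ⊗ d ⊕ κ 1ℚ ⊗ d ⊜ κ two ⊗ d) ≈-refl (∣ d ∣) ⟩
        ι two * ∣ d ∣ ∎)

      walk : ∀ (g : ℕ → ℂ) c → (∀ j → j ℕ.< suc N → ∣ g (suc j) -ᶜ g j ∣ ≤ c) → ∀ j → j ℕ.≤ suc N → ∣ g j ∣ ≤ ∣ g 0 ∣ + ι (nat j) * c
      walk g c h zero    _   = ≤-reflexive (R.trans (solveᴿ 2 (λ g c → g ⊜ g ⊕ κ 0ℚ ⊗ c) ≈-refl (∣ g 0 ∣) c)
        (R.+-congˡ (R.*-congʳ (R.reflexive (≡.cong ι (≡.sym Rat.nat-0))))))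
      walk g c h (suc j) j<n = begin
        ∣ g (suc j) ∣ ≈⟨ ∣∣-cong (solveᶜ 2 (λ x y → x ≋ y ⊞ (x ⊟ y)) C.refl (g (suc j)) (g j)) ⟩
        ∣ g j +ᶜ (g (suc j) -ᶜ g j) ∣ ≤⟨ ≤-trans (∣z+w∣≤ _ _) (+-mono-≤ (walk g c h j (ℕ.<⇒≤ j<n)) (h j j<n)) ⟩
        (∣ g 0 ∣ + ι (nat j) * c) + c ≈⟨ solveᴿ 3 (λ g n c → (g ⊕ n ⊗ c) ⊕ c ⊜ g ⊕ (κ 1ℚ ⊕ n) ⊗ c) ≈-refl (∣ g 0 ∣) (ι (nat j)) c ⟩
        ∣ g 0 ∣ + (ι 1ℚ + ι (nat j)) * c ≈⟨ R.+-congˡ (R.*-congʳ (R.trans (R.sym (ι-+ _ _)) (R.reflexive (≡.cong ι (≡.sym (Rat.nat-suc j)))))) ⟩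
        ∣ g 0 ∣ + ι (nat (suc j)) * c ∎

      x-last : x (suc N) ≡ u
      x-last = ≡.trans (≡.cong (_· u) time-1) (≡.cong₂ _,_ (ℚ.*-identityˡ (proj₁ u)) (ℚ.*-identityˡ (proj₂ u)))

      x-first : x 0 ≡ (0ℚ , 0ℚ)
      x-first = ≡.trans (≡.cong (_· u) time-0) (≡.cong₂ _,_ (ℚ.*-zeroˡ (proj₁ u)) (ℚ.*-zeroˡ (proj₂ u)))

      C′ : ℝ
      C′ = ∣ f′ (0ℚ , 0ℚ) ∣ + ι (nat (suc N)) * ι two

      derivative-along : ∀ j → j ℕ.≤ suc N → ∣ f′ (x j) ∣ ≤ C′
      derivative-along j j≤n = ≤-trans (walk (λ j → f′ (x j)) (ι two) derivative-step j j≤n)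
        (+-mono-≤ (≤-reflexive (R.reflexive (≡.cong (λ u → ∣ f′ u ∣) x-first))) (*-monoʳ-≤ (ι-mono (ℚ.<⇒≤ (ℚ.positive⁻¹ two))) (ι-mono (Rat.nat-mono j≤n))))

      derivative-bound : ∣ f′ u ∣ ≤ C′
      derivative-bound = ≡.subst (λ u → ∣ f′ u ∣ ≤ C′) x-last (derivative-along (suc N) ℕ.≤-refl)

      value-step : ∀ j → j ℕ.< suc N → ∣ f (x (suc j)) -ᶜ f (x j) ∣ ≤ (ι 1ℚ + C′) * ι (inv N ℚ.* four)
      value-step j j<n = begin
        ∣ f (x (suc j)) -ᶜ f (x j) ∣ ≈⟨ ∣∣-cong (solveᶜ 2 (λ x y → x ≋ (x ⊟ y) ⊞ y) C.refl (f (x (suc j)) -ᶜ f (x j)) (f′ (x j) *ᶜ d)) ⟩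
        ∣ ((f (x (suc j)) -ᶜ f (x j)) -ᶜ f′ (x j) *ᶜ d) +ᶜ f′ (x j) *ᶜ d ∣
          ≤⟨ ≤-trans (∣z+w∣≤ _ _) (+-mono-≤ (forward j j<n) (≤-trans (≤-reflexive (∣∣-* _ _)) (*-monoʳ-≤ (∣z∣-nonNeg d) (derivative-along j (ℕ.<⇒≤ j<n))))) ⟩
        ι 1ℚ * ∣ d ∣ + C′ * ∣ d ∣ ≈⟨ R.distribʳ _ _ _ ⟨
        (ι 1ℚ + C′) * ∣ d ∣ ≤⟨ *-monoˡ-≤ (+-nonNeg 0≤1 (+-nonNeg (∣z∣-nonNeg _) (*-nonNeg (0≤nat (suc N)) (ι-mono (ℚ.<⇒≤ (ℚ.positive⁻¹ two)))))) ∣d∣≤ ⟩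
        (ι 1ℚ + C′) * ι (inv N ℚ.* four) ∎

      value-bound : ∣ f u ∣ ≤ ∣ f (0ℚ , 0ℚ) ∣ + ι (nat (suc N)) * ((ι 1ℚ + C′) * ι (inv N ℚ.* four))
      value-bound = ≡.subst₂ (λ u o → ∣ f u ∣ ≤ ∣ f o ∣ + ι (nat (suc N)) * ((ι 1ℚ + C′) * ι (inv N ℚ.* four))) x-last x-first
        (walk (λ j → f (x j)) _ value-step (suc N) ℕ.≤-refl)

    origin? : ∀ u → Dec (0ℚ ℚ.< square u)
    origin? u = 0ℚ ℚ.<? square u

    square-zero : ∀ u → square u ℚ.≤ 0ℚ → u ≡ (0ℚ , 0ℚ)
    square-zero (x , y) h = ≡.cong₂ _,_ (root-zero x (ℚ.≤-trans (Rat.≤-by _ (Rat.square-nonNeg y) (solve 2 (λ x y → (x :* x :+ y :* y) :- x :* x := y :* y) ≡.refl x y)) h))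
        (root-zero y (ℚ.≤-trans (Rat.≤-by _ (Rat.square-nonNeg x) (solve 2 (λ x y → (x :* x :+ y :* y) :- y :* y := x :* x) ≡.refl x y)) h))
      where
      root-zero : ∀ p → p ℚ.* p ℚ.≤ 0ℚ → p ≡ 0ℚ
      root-zero p h with ℚ.<-cmp p 0ℚ
      ... | tri≈ _ p≡0 _ = p≡0
      ... | tri< p<0 _ _ = contradiction (ℚ.<-≤-trans (≡.subst (0ℚ ℚ.<_) (solve 1 (λ p → :- p :* :- p := p :* p) ≡.refl p)
              (D.RationalLemmas.*-pos 0<-p 0<-p)) h) (ℚ.<-irrefl ≡.refl)
        where 0<-p = ℚ.neg-antimono-< p<0
      ... | tri> _ _ 0<p = contradiction (ℚ.<-≤-trans (D.RationalLemmas.*-pos 0<p 0<p) h) (ℚ.<-irrefl ≡.refl)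

    -- Uniform differentiability already forces both bounds, by the walk in `Chain` with the modulus
    -- for ε = 1. The origin is treated apart since the steps of the walk must have positive length.
    differentiable⇒smooth : ∀ {f f′} → Differentiable f f′ → f ′= f′
    differentiable⇒smooth {f} {f′} df = choose (df 1ℚ Rat.0<1)
      where
      everywhere : ∀ {g : Point → ℂ} {b} → ∣ g (0ℚ , 0ℚ) ∣ ≤ b → (∀ u → Ω u → 0ℚ ℚ.< square u → ∣ g u ∣ ≤ b) → Bounded g
      everywhere {g} {b} h₀ h = proj₁ (upperBound b) , λ u u∈ → ≤-trans (decide u u∈ (origin? u)) (proj₂ (upperBound b))
        where
        decide : ∀ u → Ω u → Dec (0ℚ ℚ.< square u) → ∣ g u ∣ ≤ b
        decide u u∈ (yes 0<u) = h u u∈ 0<u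
        decide u u∈ (no u≤0)  = ≡.subst (λ u → ∣ g u ∣ ≤ b) (≡.sym (square-zero u (ℚ.≮⇒≥ u≤0))) h₀
      choose : ∃[ δ ] 0ℚ ℚ.< δ × (∀ u v → Ω u → Ω v → ∣ pt v -ᶜ pt u ∣ ≤ ι δ →
        ∣ (f v -ᶜ f u) -ᶜ f′ u *ᶜ (pt v -ᶜ pt u) ∣ ≤ ι 1ℚ * ∣ pt v -ᶜ pt u ∣) → f ′= f′
      choose (δ , 0<δ , near) = smooth
        (everywhere {f} (≤-by _ (*-nonNeg (0≤nat (suc N)) (*-nonNeg (+-nonNeg 0≤1 0≤C′) (ι-mono (Rat.*-nonNeg (Rat.inv-nonNeg N) (ℚ.<⇒≤ (ℚ.positive⁻¹ four))))))
            (solveᴿ 2 (λ x y → (x ⊕ y) ⊖ x ⊜ y) ≈-refl (∣ f (0ℚ , 0ℚ) ∣) _))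
          (Chain.value-bound δ near N mesh≤δ))
        (everywhere {f′} (≤-by _ (*-nonNeg (0≤nat (suc N)) (ι-mono (ℚ.<⇒≤ (ℚ.positive⁻¹ two))))
            (solveᴿ 2 (λ x y → (x ⊕ y) ⊖ x ⊜ y) ≈-refl (∣ f′ (0ℚ , 0ℚ) ∣) _))
          (Chain.derivative-bound {f} δ near N mesh≤δ))
        df
        where
        small : ∃[ N ] (∀ n → N ℕ.≤ n → inv n ℚ.≤ ¼ ℚ.* δ)
        small = Rat.inv-small (¼ ℚ.* δ) (D.RationalLemmas.*-pos (ℚ.positive⁻¹ ¼) 0<δ)
        N : ℕ
        N = proj₁ small
        mesh≤δ : inv N ℚ.* four ℚ.≤ δ
        mesh≤δ = ≡.subst (inv N ℚ.* four ℚ.≤_) (solve 1 (λ d → (con ¼ :* d) :* con four := d) ≡.refl δ)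
          (D.RationalLemmas.*-monoˡ (ℚ.<⇒≤ (ℚ.positive⁻¹ four)) (proj₂ small N ℕ.≤-refl))
        0≤C′ : ι 0ℚ ≤ ∣ f′ (0ℚ , 0ℚ) ∣ + ι (nat (suc N)) * ι two
        0≤C′ = +-nonNeg (∣z∣-nonNeg _) (*-nonNeg (0≤nat (suc N)) (ι-mono (ℚ.<⇒≤ (ℚ.positive⁻¹ two))))

-- Logarithms of the natural numbers and the Dirichlet series for σ ≥ 5/4.

module Series where

  open Rat using (nat; inv; ¼)
  open Real
  open Complex
  open Exp
  open ExpProperties
  open Trapezoidal

  module _ (ζ : (s : ℂ) → s D.# D.1ℂ → ℂ) (isζ : D.IsRiemannZeta ζ) where
    open D.IsRiemannZeta isζ

    private
      1<2 : D.1ℝ D.< D.2ℝ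
      1<2 = D.mk< 1ℚ Rat.0<1 0 λ _ → ℚ.≤-reflexive ≡.refl

      -- The logarithms need no construction: each power in the Dirichlet series comes with a
      -- logarithm of its base, and the series at s = 2 yields one for every n.
      logarithm : ∀ n → Σ[ l ∈ ℝ ] D.IsLog (D.fromℚ (Rat.fromℕ (suc n))) l
      logarithm n = proj₁ power , proj₁ (proj₂ power)
        where power = proj₁ (proj₂ (dirichlet (D.fromℝ D.2ℝ) (inj₁ (inj₂ 1<2)) 1<2)) n

      log-exp : ∀ n {l} → D.IsLog (D.fromℚ (Rat.fromℕ (suc n))) l → expᴿ l ≈ ι (nat (suc n))
      log-exp n {l} h = R.trans (re-≈ (C.sym (C.trans (isExp h) (exp-cong (C.reflexive (≡-ρ l))))))
        (R.reflexive (≡.trans (≡-ι _) (≡.cong ι (≡.sym (Rat.nat≡fromℕ (suc n))))))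

    opaque
      log : ℕ → ℝ
      log n = proj₁ (logarithm n)

      expᴿ-log : ∀ n → expᴿ (log n) ≈ ι (nat (suc n))
      expᴿ-log n = log-exp n (proj₂ (logarithm n))

    open Logarithms log expᴿ-log

    -- The powers given at s contain logarithms of their own, which `expᴿ-injective` identifies with
    -- those obtained at s = 2.
    dirichlet-series : ∀ s (s#1 : s D.# D.1ℂ) → D.1ℝ D.< re s → ∑ (A s) ⟶ ζ s s#1
    dirichlet-series s s#1 1<σ = hasSum same (proj₂ (proj₂ d))
      where
      d = dirichlet s s#1 1<σ
      same : ∀ n → proj₁ d n ≈ᶜ A s n
      same n = from (proj₁ (proj₂ d) n)
        where
        from : ∀ {w} → D.IsPower (D.fromℚ (Rat.fromℕ (suc n))) (D.-ᶜ s) w → w ≈ᶜ A s n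
        from (l , isLog , isPower) = C.trans (isExp isPower) (exp-cong (C.trans (C.reflexive (≡ᶜ-* _ _))
          (C.*-cong (C.reflexive (≡ᶜ-neg s)) (C.trans (C.reflexive (≡-ρ l)) (ρ-cong (expᴿ-injective (R.trans (log-exp n isLog) (R.sym (expᴿ-log n)))))))))

    inverse-log : ∀ n → expᴿ (- log n) ≈ ι (inv n)
    inverse-log n = R.trans (R.trans (R.sym (R.*-identityˡ _)) (R.*-congʳ (R.trans (R.sym (R.reflexive (≡.cong ι (Rat.nat*inv n))))
        (R.trans (ι-* _ _) (R.trans (R.*-comm _ _) (R.*-congˡ (R.sym (expᴿ-log n))))))))
      (R.trans (R.*-assoc _ _ _) (R.trans (R.*-congˡ (expᴿ-inverse (log n))) (R.*-identityʳ _)))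

    private
      fourth : ℝ → ℝ
      fourth x = (x * x) * (x * x)

      -- (n + 1)^(-1/4)
      small : ℕ → ℝ
      small n = expᴿ (- (ι ¼ * log n))

      small-fourth : ∀ n → fourth (small n) ≈ ι (inv n)
      small-fourth n = R.trans (R.*-cong square square) (R.trans (R.sym (expᴿ-+ _ _)) (R.trans
          (expᴿ-cong (solveᴿ 1 (λ l → (⊝ (κ ¼ ⊗ l) ⊕ ⊝ (κ ¼ ⊗ l)) ⊕ (⊝ (κ ¼ ⊗ l) ⊕ ⊝ (κ ¼ ⊗ l)) ⊜ ⊝ l) ≈-refl (log n)))
          (inverse-log n)))
        where
        square : small n * small n ≈ expᴿ (- (ι ¼ * log n) + - (ι ¼ * log n))
        square = R.sym (expᴿ-+ _ _)

      -- The fourth power of `small n` is 1/(n + 1), so two applications of `≤-square` do the work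
      -- of a fourth root.
      small→0 : ∀ ε → 0ℚ ℚ.< ε → Eventually λ n → small n ≤ ι ε
      small→0 ε 0<ε = proj₁ s , λ n h → ≤-square 0≤ε (≤-square (*-nonNeg 0≤ε 0≤ε)
        (≤-respˡ (R.sym (small-fourth n)) (≤-respʳ (R.trans (ι-* _ _) (R.*-cong (ι-* _ _) (ι-* _ _))) (ι-mono (proj₂ s n h)))))
        where
        0<ε² : 0ℚ ℚ.< ε ℚ.* ε
        0<ε² = D.RationalLemmas.*-pos 0<ε 0<ε
        0≤ε : ι 0ℚ ≤ ι ε
        0≤ε = ι-mono (ℚ.<⇒≤ 0<ε)
        s : ∃[ N ] (∀ n → N ℕ.≤ n → inv n ℚ.≤ (ε ℚ.* ε) ℚ.* (ε ℚ.* ε))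
        s = Rat.inv-small _ (D.RationalLemmas.*-pos 0<ε² 0<ε²)

    module Right (s : ℂ) (s#1 : s D.# D.1ℂ) (σ≥ : ι (1ℚ ℚ.+ ¼) ≤ re s) where

      z : ℂ
      z = ζ s s#1

      1≤σ : ι 1ℚ ≤ re s
      1≤σ = ≤-trans (ι-mono (Rat.≤-by ¼ (ℚ.<⇒≤ (ℚ.positive⁻¹ ¼)) ≡.refl)) σ≥

      0≤σ : ι 0ℚ ≤ re s
      0≤σ = ≤-trans 0≤1 1≤σ

      open Trapezoid s 0≤σ

      series : ∑ (A s) ⟶ z
      series = dirichlet-series s s#1 (≤⇒< {1ℚ} {1ℚ ℚ.+ ¼} (D.RationalLemmas.p<p+q 1ℚ (ℚ.positive⁻¹ ¼)) σ≥)

      ∣A∣≤ : ∀ n → ∣ A s n ∣ ≤ small n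
      ∣A∣≤ n = ≤-respˡ (R.sym (∣power∣ (log n))) (expᴿ-mono (≤-by _ (*-nonNeg (x≤y⇒0≤y-x (≤-trans (ι-mono ¼≤5/4) σ≥)) (l-nonNeg n))
          (solveᴿ 2 (λ s l → ⊝ (κ ¼ ⊗ l) ⊖ ⊝ (s ⊗ l) ⊜ (s ⊖ κ ¼) ⊗ l) ≈-refl (re s) (log n))))
        where
        ¼≤5/4 : ¼ ℚ.≤ 1ℚ ℚ.+ ¼
        ¼≤5/4 = Rat.≤-by 1ℚ (ℚ.<⇒≤ Rat.0<1) ≡.refl

      -- |(n + 1)¹⁻ˢ| = (n + 1)^(1-σ) tends to 0 at a uniform rate only if σ keeps a distance from
      -- 1; the 1/4 in σ ≥ 5/4 is this distance.
      ∣nA∣≤ : ∀ n → ∣ natᶜ (suc n) *ᶜ A s n ∣ ≤ small n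
      ∣nA∣≤ n = ≤-respˡ (R.sym (R.trans (∣∣-* _ _) (R.trans (R.*-cong (R.trans (∣ρ∣ (ι-mono (Rat.nat-nonNeg (suc n)))) (R.sym (expᴿ-log n))) (∣power∣ (log n)))
          (R.sym (expᴿ-+ _ _)))))
        (expᴿ-mono (≤-by _ (*-nonNeg (x≤y⇒0≤y-x σ≥) (l-nonNeg n))
          (solveᴿ 2 (λ s l → ⊝ (κ ¼ ⊗ l) ⊖ (l ⊕ ⊝ (s ⊗ l)) ⊜ (s ⊖ κ (1ℚ ℚ.+ ¼)) ⊗ l) ≈-refl (re s) (log n))))

      P⟶ : P s ⟶ (s -ᶜ 1ᶜ) *ᶜ z
      P⟶ ε 0<ε = choose (upperBound (∣ s -ᶜ 1ᶜ ∣ * (ι 1ℚ + ι ½) + ι 1ℚ))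
        where
        open ≤-Reasoning
        q : ℝ
        q = ∣ s -ᶜ 1ᶜ ∣
        choose : ∃[ r ] q * (ι 1ℚ + ι ½) + ι 1ℚ ≤ ι (nat r) → Eventually λ n → ∣ P s n -ᶜ (s -ᶜ 1ᶜ) *ᶜ z ∣ ≤ ι ε
        choose (r , h) = refine (Rat.shrink (Rat.nat-nonNeg r) 0<ε)
          where
          refine : ∃[ δ ] 0ℚ ℚ.< δ × nat r ℚ.* δ ℚ.≤ ε → Eventually λ n → ∣ P s n -ᶜ (s -ᶜ 1ᶜ) *ᶜ z ∣ ≤ ι ε
          refine (δ , 0<δ , rδ≤ε) = eventually-map₂ (λ n p₁ p₂ → begin
            ∣ P s n -ᶜ (s -ᶜ 1ᶜ) *ᶜ z ∣
              ≈⟨ ∣∣-cong (solveᶜ 5 (λ q S a n z → (q ⊠ (S ⊞ κᶜ ½ ⊠ a) ⊞ n ⊠ a) ⊟ q ⊠ z ≋ q ⊠ ((S ⊟ z) ⊞ κᶜ ½ ⊠ a) ⊞ n ⊠ a) C.refl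
                   (s -ᶜ 1ᶜ) (∑ (A s) n) (A s n) (natᶜ (suc n)) z) ⟩
            ∣ (s -ᶜ 1ᶜ) *ᶜ ((∑ (A s) n -ᶜ z) +ᶜ ιᶜ ½ *ᶜ A s n) +ᶜ natᶜ (suc n) *ᶜ A s n ∣
              ≤⟨ ≤-trans (∣z+w∣≤ _ _) (+-mono-≤ (≤-trans (≤-reflexive (∣∣-* _ _)) (*-monoˡ-≤ (∣z∣-nonNeg _) (≤-trans (∣z+w∣≤ _ _)
                   (+-mono-≤ p₁ (≤-trans (≤-reflexive (R.trans (∣∣-* _ _) (R.*-congʳ (∣ρ∣ 0≤½)))) (*-monoˡ-≤ 0≤½ (≤-trans (∣A∣≤ n) p₂)))))))
                   (≤-trans (∣nA∣≤ n) p₂)) ⟩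
            q * (ι δ + ι ½ * ι δ) + ι δ ≈⟨ solveᴿ 2 (λ q d → q ⊗ (d ⊕ κ ½ ⊗ d) ⊕ d ⊜ (q ⊗ (κ 1ℚ ⊕ κ ½) ⊕ κ 1ℚ) ⊗ d) ≈-refl q (ι δ) ⟩
            (q * (ι 1ℚ + ι ½) + ι 1ℚ) * ι δ ≤⟨ *-monoʳ-≤ (ι-mono (ℚ.<⇒≤ 0<δ)) h ⟩
            ι (nat r) * ι δ ≈⟨ ι-* _ _ ⟨
            ι (nat r ℚ.* δ) ≤⟨ ι-mono rδ≤ε ⟩
            ι ε ∎) (series δ 0<δ) (small→0 δ 0<δ)
            where
            0≤½ : ι 0ℚ ≤ ι ½
            0≤½ = ι-mono (ℚ.<⇒≤ (ℚ.positive⁻¹ ½))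

      -- `P-estimate` with its upper index sent to infinity. Since σ ≥ 1, the factor σ may be
      -- dropped on the left, and (n + 1)^(-σ) ≤ 1/(n + 1) on the right.
      approximation : ∀ n → ∣ (s -ᶜ 1ᶜ) *ᶜ z -ᶜ P s n ∣ ≤ K * ι (inv n)
      approximation n = ⟶-≤ P⟶ (n , λ m n≤m → ≤-trans (≤-respˡ (R.*-identityˡ _) (*-monoʳ-≤ (∣z∣-nonNeg _) 1≤σ))
        (≤-trans (P-estimate s 0≤σ n≤m) (≤-trans
          (≤-by _ (*-nonNeg K-nonNeg (expᴿ-nonNeg (- (re s * log m)))) (solveᴿ 2 (λ a b → a ⊖ (a ⊖ b) ⊜ b) ≈-refl (K * decay (log n)) (K * decay (log m))))
          (*-monoˡ-≤ K-nonNeg (≤-respʳ (inverse-log n) (expᴿ-mono (≤-by _ (*-nonNeg (x≤y⇒0≤y-x 1≤σ) (l-nonNeg n))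
            (solveᴿ 2 (λ s l → ⊝ l ⊖ ⊝ (s ⊗ l) ⊜ (s ⊖ κ 1ℚ) ⊗ l) ≈-refl (re s) (log n)))))))))

-- Passage to 0 < σ ≤ 2 and the final estimate.

module Conclusion where

  open Rat using (nat; inv; ¼)
  open Real
  open Complex
  open Exp
  open ExpProperties
  open Trapezoidal
  open Rectangles
  open Smoothness
  open Series

  -- The order of choices matters: Λ makes the first summand small, and n is chosen afterwards to
  -- beat the now fixed `W Λ`, on whose growth nothing is assumed.
  two-scale-limit : ∀ {x : ℕ → ℝ} {c l r : ℝ} {w W : ℕ → ℝ} → ι 0ℚ ≤ c → ι 0ℚ ≤ l →
    (∀ ε → 0ℚ ℚ.< ε → ∃[ Λ ] w Λ ≤ ι ε) → (∀ Λ n → x n ≤ c * (l * w Λ + (r * W Λ) * ι (inv n))) →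
    ∀ ε → 0ℚ ℚ.< ε → ∃[ n ] x n ≤ ι ε
  two-scale-limit {x} {c} {l} {r} {w} {W} 0≤c 0≤l w-small bound ε 0<ε = chooseΛ (upperBound (c * l))
    where
    half-bound′ : ∀ {x r e} → x ≤ ι (nat r) → 0ℚ ℚ.≤ e → nat r ℚ.* e ℚ.≤ ½ ℚ.* ε → x * ι e ≤ ι (½ ℚ.* ε)
    half-bound′ x≤r 0≤e h = ≤-trans (*-monoʳ-≤ (ι-mono 0≤e) x≤r) (≤-respˡ (ι-* _ _) (ι-mono h))
    chooseΛ : ∃[ p ] c * l ≤ ι (nat p) → ∃[ n ] x n ≤ ι ε
    chooseΛ (p , hp) = shrunk (Rat.shrink (Rat.nat-nonNeg p) (Rat.half-pos 0<ε))
      where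
      shrunk : ∃[ δ ] 0ℚ ℚ.< δ × nat p ℚ.* δ ℚ.≤ ½ ℚ.* ε → ∃[ n ] x n ≤ ι ε
      shrunk (δ , 0<δ , pδ) = withΛ (w-small δ 0<δ)
        where
        withΛ : ∃[ Λ ] w Λ ≤ ι δ → ∃[ n ] x n ≤ ι ε
        withΛ (Λ , hΛ) = chooseₙ (upperBound (c * (r * W Λ)))
          where
          chooseₙ : ∃[ q ] c * (r * W Λ) ≤ ι (nat q) → ∃[ n ] x n ≤ ι ε
          chooseₙ (q , hq) = finish (Rat.shrink (Rat.nat-nonNeg q) (Rat.half-pos 0<ε))
            where
            finish : ∃[ δ ] 0ℚ ℚ.< δ × nat q ℚ.* δ ℚ.≤ ½ ℚ.* ε → ∃[ n ] x n ≤ ι ε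
            finish (δ′ , 0<δ′ , qδ′) = pick (Rat.inv-small δ′ 0<δ′)
              where
              open ≤-Reasoning
              pick : ∃[ n ] (∀ k → n ℕ.≤ k → inv k ℚ.≤ δ′) → ∃[ n ] x n ≤ ι ε
              pick (n , small) = n , (begin
                x n ≤⟨ bound Λ n ⟩
                c * (l * w Λ + (r * W Λ) * ι (inv n)) ≈⟨ solveᴿ 5 (λ c q w k i → c ⊗ (q ⊗ w ⊕ k ⊗ i) ⊜ (c ⊗ q) ⊗ w ⊕ (c ⊗ k) ⊗ i) ≈-refl c l (w Λ) (r * W Λ) (ι (inv n)) ⟩
                (c * l) * w Λ + (c * (r * W Λ)) * ι (inv n)
                  ≤⟨ +-mono-≤ (≤-trans (*-monoˡ-≤ (*-nonNeg 0≤c 0≤l) hΛ) (half-bound′ hp (ℚ.<⇒≤ 0<δ) pδ))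
                       (half-bound′ hq (Rat.inv-nonNeg n) (ℚ.≤-trans (Rat.*-monoʳ-≤ (Rat.nat-nonNeg q) (small n ℕ.≤-refl)) qδ′)) ⟩
                ι (½ ℚ.* ε) + ι (½ ℚ.* ε) ≈⟨ ι-+ _ _ ⟨
                ι (½ ℚ.* ε ℚ.+ ½ ℚ.* ε) ≡⟨ ≡.cong ι (Rat.half+half ε) ⟩
                ι ε ∎)

  -- The estimate is for (s - 1) ζ, so it first yields σ |s - 1| |ζ| ≤ |s - 1| (σ + t); then |s - 1|
  -- ≥ t ≥ 2 is cancelled.
  conclude : ∀ {σ t : ℝ} {s z : ℂ} {A : ℕ → ℂ} → ι 0ℚ ≤ σ → σ ≤ ι two → ι two ≤ t → re s ≈ σ → im s ≈ t →
    (∀ n → re s * ∣ A n ∣ ≤ ι ½ * (∣ s ∣ * ∣ s -ᶜ 1ᶜ ∣) + re s * (ι ½ * ∣ s -ᶜ 1ᶜ ∣ + ι 1ℚ)) →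
    (∀ ε → 0ℚ ℚ.< ε → ∃[ n ] ∣ (s -ᶜ 1ᶜ) *ᶜ z -ᶜ A n ∣ ≤ ι ε) → σ * ∣ z ∣ ≤ σ + t
  conclude {σ} {t} {s} {z} {A} 0≤σ σ≤2 2≤t re-s im-s A-bound A-close = *-cancelˡ-≤ (ℚ.positive⁻¹ two) 2≤q
    (≤-respˡ (solveᴿ 3 (λ s q z → s ⊗ (q ⊗ z) ⊜ q ⊗ (s ⊗ z)) ≈-refl σ q (∣ z ∣)) exact)
    where
    open ≤-Reasoning
    p q : ℝ
    p = ∣ s ∣
    q = ∣ s -ᶜ 1ᶜ ∣

    0≤½ : ι 0ℚ ≤ ι ½
    0≤½ = ι-mono (ℚ.<⇒≤ (ℚ.positive⁻¹ ½))

    0≤t : ι 0ℚ ≤ t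
    0≤t = ≤-trans (ι-mono (ℚ.<⇒≤ (ℚ.positive⁻¹ two))) 2≤t

    2≤q : ι two ≤ q
    2≤q = ≤-trans 2≤t (≤-trans (≤-reflexive (R.sym (R.trans (im-+ _ _) (R.trans (R.+-cong im-s (im-neg 1ᶜ))
      (solveᴿ 1 (λ x → x ⊕ ⊝ κ 0ℚ ⊜ x) ≈-refl t))))) (im≤∣z∣ _))

    p≤2t : p ≤ t + t
    p≤2t = ∣z∣≤ s (+-nonNeg 0≤t 0≤t) (≤-respˡ (R.sym (R.+-cong (R.*-cong re-s re-s) (R.*-cong im-s im-s)))
      (≤-by _ (+-nonNeg (*-nonNeg (x≤y⇒0≤y-x (≤-trans σ≤2 2≤t)) (+-nonNeg 0≤σ 0≤t)) (*-nonNeg (+-nonNeg 0≤t 0≤t) 0≤t))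
        (solveᴿ 2 (λ s t → (t ⊕ t) ⊗ (t ⊕ t) ⊖ (s ⊗ s ⊕ t ⊗ t) ⊜ (t ⊖ s) ⊗ (s ⊕ t) ⊕ (t ⊕ t) ⊗ t) ≈-refl σ t)))

    -- The term p q/2 is at most t q by p ≤ 2t, and the lone σ is at most σ q/2 by q ≥ 2.
    main : ι ½ * (p * q) + σ * (ι ½ * q + ι 1ℚ) ≤ q * (σ + t)
    main = ≤-by _ (+-nonNeg (*-nonNeg (*-nonNeg 0≤½ (∣z∣-nonNeg _)) (x≤y⇒0≤y-x p≤2t)) (*-nonNeg (*-nonNeg 0≤½ 0≤σ) (x≤y⇒0≤y-x 2≤q)))
      (solveᴿ 4 (λ p q s t → q ⊗ (s ⊕ t) ⊖ (κ ½ ⊗ (p ⊗ q) ⊕ s ⊗ (κ ½ ⊗ q ⊕ κ 1ℚ)) ⊜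
        (κ ½ ⊗ q) ⊗ ((t ⊕ t) ⊖ p) ⊕ (κ ½ ⊗ s) ⊗ (q ⊖ κ two)) ≈-refl p q σ t)

    approximate : ∀ ε → ∃[ n ] ∣ (s -ᶜ 1ᶜ) *ᶜ z -ᶜ A n ∣ ≤ ι ε → σ * (q * ∣ z ∣) ≤ q * (σ + t) + σ * ι ε
    approximate ε (n , h) = begin
      σ * (q * ∣ z ∣) ≈⟨ R.*-congˡ (R.trans (R.sym (∣∣-* _ _)) (∣∣-cong (solveᶜ 2 (λ x y → x ≋ y ⊞ (x ⊟ y)) C.refl ((s -ᶜ 1ᶜ) *ᶜ z) (A n)))) ⟩
      σ * ∣ A n +ᶜ ((s -ᶜ 1ᶜ) *ᶜ z -ᶜ A n) ∣ ≤⟨ *-monoˡ-≤ 0≤σ (≤-trans (∣z+w∣≤ _ _) (+-mono-≤ ≤-refl h)) ⟩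
      σ * (∣ A n ∣ + ι ε) ≈⟨ R.distribˡ _ _ _ ⟩
      σ * ∣ A n ∣ + σ * ι ε
        ≤⟨ +-mono-≤ (≤-trans (≤-respˡ (R.*-congʳ re-s) (≤-respʳ (R.+-congˡ (R.*-congʳ re-s)) (A-bound n))) main) ≤-refl ⟩
      q * (σ + t) + σ * ι ε ∎

    exact : σ * (q * ∣ z ∣) ≤ q * (σ + t)
    exact = ≤-limit λ ε 0<ε → ≤-trans (approximate (½ ℚ.* ε) (A-close _ (Rat.half-pos 0<ε))) (+-mono-≤ ≤-refl
      (≤-trans (*-monoʳ-≤ (ι-mono (ℚ.<⇒≤ (Rat.half-pos 0<ε))) σ≤2)
        (≤-reflexive (R.trans (R.*-congˡ (ι-* ½ ε)) (solveᴿ 1 (λ e → κ two ⊗ (κ ½ ⊗ e) ⊜ e) ≈-refl (ι ε))))))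

  ζ-resp : ∀ ζ → D.IsRiemannZeta ζ → ∀ {z w} (z#1 : z D.# D.1ℂ) (w#1 : w D.# D.1ℂ) → z ≈ᶜ w → ζ z z#1 ≈ᶜ ζ w w#1
  ζ-resp ζ isζ {z} {w} z#1 w#1 z≈w = proj₁ h & proj₂ h
    where
    h : ζ z z#1 D.≈ᶜ ζ w w#1
    h = D.IsRiemannZeta.ζ-cong isζ {z} {w} z#1 w#1 (re-≈ z≈w , im-≈ z≈w)

  module Bound (ζ : (s : ℂ) → s D.# D.1ℂ → ℂ) (isζ : D.IsRiemannZeta ζ) (σ t : ℝ)
    (g : ℚ) (0<g : 0ℚ ℚ.< g) (g≤σ : ι g ≤ σ) (2≤t : ι two ≤ t) where

    open D.IsRiemannZeta isζ using (holomorphic)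
    open D.Holomorphic holomorphic using (derivative; differentiable)

    -- a ≤ g/2 keeps the left side at Re s ≥ σ - a ≥ a, where P is bounded uniformly in n, and a ≤
    -- 1/2 gives -a + a² ≤ -a/2 for the decay of W on it.
    a : ℚ
    a = (½ ℚ.* g) ℚ.⊓ ½

    0<a : 0ℚ ℚ.< a
    0<a = Rat.⊓-pos (Rat.half-pos 0<g) (ℚ.positive⁻¹ ½)

    a≤½ : a ℚ.≤ ½
    a≤½ = ℚ.p⊓q≤q (½ ℚ.* g) ½

    a≤g/2 : a ℚ.≤ ½ ℚ.* g
    a≤g/2 = ℚ.p⊓q≤p (½ ℚ.* g) ½

    open Rectangle a 0<a a≤½
    open Smooth a 0<a a≤½
    open Logarithms (log ζ isζ) (expᴿ-log ζ isζ) using (A; P; P-bound)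

    opaque
      origin : Point
      origin = 0ℚ , 0ℚ

      origin≡ : origin ≡ (0ℚ , 0ℚ)
      origin≡ = ≡.refl

    s₀ : ℂ
    s₀ = σ +i t

    s : Point → ℂ
    s u = s₀ +ᶜ pt u

    re-s : ∀ u → re (s u) ≈ σ + ι (proj₁ u)
    re-s u = R.trans (re-+ _ _) (R.+-congˡ (re-pt u))

    im-s : ∀ u → im (s u) ≈ t + ι (proj₂ u)
    im-s u = R.trans (im-+ _ _) (R.+-congˡ (im-pt u))

    -- Off the rectangle the value of ζ is irrelevant; clamping makes it total in u.
    clamp : Point → Point
    clamp (x , y) = x , y ℚ.⊔ (ℚ.- height)

    clamp-Ω : ∀ {u} → Ω u → clamp u ≡ u
    clamp-Ω {x , y} (inside _ _ b _) = ≡.cong (x ,_) (ℚ.p≥q⇒p⊔q≡p b)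

    ¼≤im : ∀ u → ι ¼ ≤ im (s (clamp u))
    ¼≤im u = ≤-respʳ (R.sym (im-s (clamp u))) (≤-by _ (+-nonNeg (x≤y⇒0≤y-x 2≤t) (x≤y⇒0≤y-x (ι-mono (ℚ.p≤q⊔p (proj₂ u) (ℚ.- height)))))
      (solveᴿ 2 (λ t y → (t ⊕ y) ⊖ κ ¼ ⊜ (t ⊖ κ two) ⊕ (y ⊖ κ (ℚ.- height))) ≈-refl t (ι (proj₂ u ℚ.⊔ (ℚ.- height)))))

    s#1 : ∀ u → s (clamp u) D.# D.1ℂ
    s#1 u = inj₂ (inj₂ (≤⇒< {0ℚ} {¼} (ℚ.positive⁻¹ ¼) (¼≤im u)))

    Z Z′ : Point → ℂ
    Z u = ζ (s (clamp u)) (s#1 u)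
    Z′ u = derivative (s (clamp u)) (s#1 u)

    private
      ∣s₀∣-bound : ∃[ n ] ∣ s₀ ∣ ≤ ι (nat n)
      ∣s₀∣-bound = upperBound ∣ s₀ ∣

      opaque
        -- One member of the exhaustion has to contain the whole rectangle. The 8 leaves room for
        -- |pt u| ≤ 4 and for the 1 in `∣s∣+1≤`, and it makes 1/(m + 1) ≤ 1/4, while |s - 1| ≥ Im s
        -- ≥ 1/4.
        m : ℕ
        m = proj₁ ∣s₀∣-bound ℕ.+ 8

        m≡ : m ≡ proj₁ ∣s₀∣-bound ℕ.+ 8
        m≡ = ≡.refl

      nat-8 : four ℚ.+ four ℚ.≤ nat 8
      nat-8 = ≡.subst (four ℚ.+ four ℚ.≤_) (≡.sym (Rat.nat≡fromℕ 8)) (ℚ.≤-reflexive ≡.refl)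

      0≤four : 0ℚ ℚ.≤ four
      0≤four = ℚ.<⇒≤ (ℚ.positive⁻¹ four)

      ∣pt∣≤4 : ∀ {u} → Ω u → ∣ pt u ∣ ≤ ι four
      ∣pt∣≤4 {u} u∈ = ∣pt∣≤ u 0≤four (ℚ.≤-trans (square≤8 u∈) (Rat.≤-by (four ℚ.+ four) (Rat.+-nonNeg 0≤four 0≤four) ≡.refl))

    ∣s∣+1≤ : ∀ {u} → Ω u → ∣ s u ∣ + ι 1ℚ ≤ ι (nat m)
    ∣s∣+1≤ {u} u∈ = ≤-trans (+-mono-≤ (≤-trans (∣z+w∣≤ _ _) (+-mono-≤ (proj₂ ∣s₀∣-bound) (∣pt∣≤4 u∈))) ≤-refl) (≤-respˡ (R.sym (R.+-assoc _ _ _))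
      (≤-respʳ (R.trans (R.sym (ι-+ _ _)) (R.reflexive (≡.cong ι (≡.sym (≡.trans (≡.cong nat m≡) (Rat.nat-+ (proj₁ ∣s₀∣-bound) 8))))))
        (+-mono-≤ ≤-refl (≤-respˡ (ι-+ four 1ℚ) (ι-mono (ℚ.≤-trans (Rat.≤-by (1ℚ ℚ.+ two) (ℚ.<⇒≤ (ℚ.positive⁻¹ (1ℚ ℚ.+ two))) ≡.refl) nat-8))))))

    ∣s∣≤ : ∀ {u} → Ω u → ∣ s u ∣ ≤ ι (nat m)
    ∣s∣≤ {u} u∈ = ≤-trans (≤-by _ 0≤1 (solveᴿ 1 (λ x → (x ⊕ κ 1ℚ) ⊖ x ⊜ κ 1ℚ) ≈-refl (∣ s u ∣))) (∣s∣+1≤ u∈)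

    ∣s-1∣≤ : ∀ {u} → Ω u → ∣ s u -ᶜ 1ᶜ ∣ ≤ ι (nat m)
    ∣s-1∣≤ {u} u∈ = ≤-trans (≤-trans (∣z-w∣≤ _ _) (+-mono-≤ ≤-refl (≤-reflexive (∣ρ∣ 0≤1)))) (∣s∣+1≤ u∈)

    a≤re-s : ∀ {u} → Ω u → ι a ≤ re (s u)
    a≤re-s {u} (inside l _ _ _) = ≤-respʳ (R.sym (re-s u)) (≤-by _
      (+-nonNeg (+-nonNeg (x≤y⇒0≤y-x g≤σ) (x≤y⇒0≤y-x (ι-mono l))) (+-nonNeg 0≤g-2a 0≤g-2a))
      (R.trans (solveᴿ 4 (λ σ x a g → (σ ⊕ x) ⊖ a ⊜ ((σ ⊖ g) ⊕ (x ⊖ ⊝ a)) ⊕ ((κ ½ ⊗ g ⊖ a) ⊕ (κ ½ ⊗ g ⊖ a))) ≈-refl σ (ι (proj₁ u)) (ι a) (ι g))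
        (R.+-cong (R.+-congˡ (R.+-congˡ (R.-‿cong (R.sym (ι-neg a))))) (R.+-cong (R.+-congʳ (R.sym (ι-* ½ g))) (R.+-congʳ (R.sym (ι-* ½ g)))))))
      where
      0≤g-2a : ι 0ℚ ≤ ι (½ ℚ.* g) - ι a
      0≤g-2a = x≤y⇒0≤y-x (ι-mono a≤g/2)

    0≤re-s : ∀ {u} → Ω u → ι 0ℚ ≤ re (s u)
    0≤re-s u∈ = ≤-trans (ι-mono (ℚ.<⇒≤ 0<a)) (a≤re-s u∈)

    private
      inCompact : ∀ {u} → Ω u → D.InCompact m (s (clamp u))
      inCompact {u} u∈ = ≤⇒D≤ (≡.subst₂ _≤_ (≡.sym (≡-∣∣ _)) (≡.trans (≡.cong ι (Rat.nat≡fromℕ m)) (≡.sym (≡-ι _)))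
          (≡.subst (λ v → ∣ s v ∣ ≤ ι (nat m)) (≡.sym (clamp-Ω u∈)) (∣s∣≤ u∈))) ,
        ≤⇒D≤ (≡.subst₂ _≤_ (≡.trans (≡.cong ι (Rat.inv≡mesh m)) (≡.sym (≡-ι _))) (≡.sym (≡.trans (≡-∣∣ _) (≡.cong ∣_∣ (≡.trans (≡ᶜ-- _ _) (≡.cong (λ w → s (clamp u) -ᶜ w) ≡-1ℂ)))))
          (≤-trans (ι-mono mesh≤¼) (≤-trans (¼≤im u) (≤-trans (≤-reflexive im-eq) (im≤∣z∣ _)))))
        where
        im-eq : im (s (clamp u)) ≈ im (s (clamp u) -ᶜ 1ᶜ)
        im-eq = R.sym (R.trans (im-+ _ _) (R.trans (R.+-congˡ (im-neg 1ᶜ)) (solveᴿ 1 (λ x → x ⊕ ⊝ κ 0ℚ ⊜ x) ≈-refl _)))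
        mesh≤¼ : inv m ℚ.≤ ¼
        mesh≤¼ = Rat.inv≤ (ℚ.≤-trans (ℚ.≤-trans (Rat.≤-by 1ℚ (ℚ.<⇒≤ Rat.0<1) ≡.refl)
            (Rat.*-monoʳ-≤ (ℚ.<⇒≤ (ℚ.positive⁻¹ ¼)) nat-8))
          (Rat.*-monoʳ-≤ (ℚ.<⇒≤ (ℚ.positive⁻¹ ¼)) (Rat.nat-mono (ℕ.m≤n⇒m≤1+n (≡.subst (8 ℕ.≤_) (≡.sym m≡) (ℕ.m≤n+m 8 (proj₁ ∣s₀∣-bound)))))))

      s-difference : ∀ u v → s v -ᶜ s u ≈ᶜ pt v -ᶜ pt u
      s-difference u v = solveᶜ 3 (λ s x y → (s ⊞ y) ⊟ (s ⊞ x) ≋ y ⊟ x) C.refl s₀ (pt u) (pt v)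

    opaque
      Z-smooth : Z ′= Z′
      Z-smooth = differentiable⇒smooth λ ε 0<ε → convert ε (differentiable m ε 0<ε)
        where
        convert : ∀ ε → Σ[ δ ∈ ℚ ] 0ℚ ℚ.< δ ×
          (∀ z w (z#1 : z D.# D.1ℂ) (w#1 : w D.# D.1ℂ) → D.InCompact m z → D.InCompact m w → D.∣ w D.-ᶜ z ∣ D.≤ D.fromℚ δ →
           D.∣ ζ w w#1 D.-ᶜ ζ z z#1 D.-ᶜ derivative z z#1 D.*ᶜ (w D.-ᶜ z) ∣ D.≤ D.fromℚ ε D.* D.∣ w D.-ᶜ z ∣) →
          Nearby λ u v → ∣ (Z v -ᶜ Z u) -ᶜ Z′ u *ᶜ (pt v -ᶜ pt u) ∣ ≤ ι ε * ∣ pt v -ᶜ pt u ∣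
        convert ε (δ , 0<δ , near) = δ , 0<δ , λ u v u∈ v∈ d≤δ → let
            eq : s (clamp v) -ᶜ s (clamp u) ≈ᶜ pt v -ᶜ pt u
            eq = ≡.subst₂ (λ u′ v′ → s v′ -ᶜ s u′ ≈ᶜ pt v -ᶜ pt u) (≡.sym (clamp-Ω u∈)) (≡.sym (clamp-Ω v∈)) (s-difference u v)
            d-eq : D.∣ s (clamp v) D.-ᶜ s (clamp u) ∣ ≡ ∣ s (clamp v) -ᶜ s (clamp u) ∣
            d-eq = ≡.trans (≡-∣∣ _) (≡.cong ∣_∣ (≡ᶜ-- _ _))
            h = D≤⇒≤ (near (s (clamp u)) (s (clamp v)) (s#1 u) (s#1 v) (inCompact u∈) (inCompact v∈)
                  (≤⇒D≤ (≡.subst₂ _≤_ (≡.sym d-eq) (≡.sym (≡-ι δ)) (≤-respˡ (R.sym (∣∣-cong eq)) d≤δ))))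
          in ≤-respˡ (R.trans (R.reflexive (≡.trans (≡-∣∣ _) (≡.cong ∣_∣ (≡.trans (≡ᶜ-- _ _)
                 (≡.cong₂ _-ᶜ_ (≡ᶜ-- _ _) (≡.trans (≡ᶜ-* _ _) (≡.cong (Z′ u *ᶜ_) (≡ᶜ-- _ _))))))))
               (∣∣-cong (C.+-congˡ (C.-‿cong (C.*-congˡ eq)))))
             (≤-respʳ (R.trans (R.reflexive (≡.trans (≡-* _ _) (≡.cong₂ _*_ (≡-ι ε) d-eq))) (R.*-congˡ (∣∣-cong eq))) h)

    ′-cong : ∀ {f g f′} → (∀ u → f u ≈ᶜ g u) → f ′= f′ → g ′= f′
    ′-cong f≈g df = smooth (proj₁ (bounded df) , λ u u∈ → ≤-respˡ (∣∣-cong (f≈g u)) (proj₂ (bounded df) u u∈)) (bounded′ df)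
      λ ε 0<ε → let (δ , 0<δ , h) = differential df ε 0<ε in δ , 0<δ , λ u v u∈ v∈ d →
        ≤-respˡ (∣∣-cong (C.+-congʳ (C.+-cong (f≈g v) (C.-‿cong (f≈g u))))) (h u v u∈ v∈ d)

    Smooth-function : (Point → ℂ) → Set
    Smooth-function f = ∃[ f′ ] f ′= f′

    s-smooth : Smooth-function s
    s-smooth = _ , +′ (const′ s₀) id′

    s-1-smooth : Smooth-function (λ u → s u -ᶜ 1ᶜ)
    s-1-smooth = _ , +′ (proj₂ s-smooth) (const′ (-ᶜ 1ᶜ))

    opaque
      A-smooth : ∀ n → Smooth-function (λ u → A (s u) n)
      A-smooth n = _ , exp′ (′-cong (λ u → solveᶜ 2 (λ s l → (⊟ κᶜ 1ℚ ⊠ s) ⊠ l ≋ ⊟ s ⊠ l) C.refl (s u) (ρ (log ζ isζ n)))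
        (*′ (*′ (const′ (-ᶜ 1ᶜ)) (proj₂ s-smooth)) (const′ (ρ (log ζ isζ n)))))

    opaque
      P-smooth : ∀ n → Smooth-function (λ u → P (s u) n)
      P-smooth n = _ , +′ (*′ (proj₂ s-1-smooth) (+′ (∑′ (λ k → proj₂ (A-smooth k)) n) (*′ (const′ (ιᶜ ½)) (proj₂ (A-smooth n)))))
        (*′ (const′ (natᶜ (suc n))) (proj₂ (A-smooth n)))

    opaque
      s-1*Z-smooth : Smooth-function (λ u → (s u -ᶜ 1ᶜ) *ᶜ Z u)
      s-1*Z-smooth = _ , *′ (proj₂ s-1-smooth) Z-smooth

    Q : ℕ → Point → ℂ
    Q n u = (s u -ᶜ 1ᶜ) *ᶜ Z u -ᶜ P (s u) n

    opaque
      Q-smooth : ∀ n → Smooth-function (Q n)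
      Q-smooth n = _ , ′-cong (λ u → solveᶜ 2 (λ x y → x ⊞ ⊟ κᶜ 1ℚ ⊠ y ≋ x ⊟ y) C.refl ((s u -ᶜ 1ᶜ) *ᶜ Z u) (P (s u) n))
        (+′ (proj₂ s-1*Z-smooth) (*′ (const′ (-ᶜ 1ᶜ)) (proj₂ (P-smooth n))))

    -- |W| is less than 1 on the part of the boundary where Re s ≤ 5/4, and W = 1 at the centre.
    W : ℕ → Point → ℂ
    W Λ u = exp (natᶜ Λ *ᶜ (pt u +ᶜ pt u *ᶜ pt u))

    opaque
      W-smooth : ∀ Λ → Smooth-function (W Λ)
      W-smooth Λ = _ , exp′ (*′ (const′ (natᶜ Λ)) (+′ id′ (*′ id′ id′)))

    -- The real part of u + u², which by `∣exp∣` determines |W|.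
    v : Point → ℚ
    v (x , y) = x ℚ.+ (x ℚ.* x ℚ.- y ℚ.* y)

    ∣W∣ : ∀ Λ u → ∣ W Λ u ∣ ≈ expᴿ (ι (nat Λ) * ι (v u))
    ∣W∣ Λ (x , y) = R.trans (∣exp∣ _) (expᴿ-cong (R.trans (re-≈ (C.trans (C.*-congˡ (C.trans (C.+-congˡ (pt-* x y x y)) (C.sym (pt-+ _ _ _ _)))) (C.sym (pt-· (nat Λ) _))))
      (R.trans (re-pt _) (ι-* _ _))))

    private
      M : ℝ
      M = ι (nat m)

      0≤M : ι 0ℚ ≤ M
      0≤M = 0≤nat m

      0≤½ : ι 0ℚ ≤ ι ½
      0≤½ = ι-mono (ℚ.<⇒≤ (ℚ.positive⁻¹ ½))

      b : ℚ
      b = Rat.recip 0<a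

      0≤b : ι 0ℚ ≤ ι b
      0≤b = ι-mono (ℚ.<⇒≤ (Rat.recip-pos 0<a))

      -- `P-bound` controls Re s · |P|. Since Re s ≥ a on the rectangle, a bound independent of n
      -- costs the factor b = 1/a.
      B P-max Q-max : ℝ
      B = ι ½ * (M * M) + M * (ι ½ * M + ι 1ℚ)
      P-max = ι b * B
      Q-max = ι (nat (proj₁ (bounded (proj₂ s-1*Z-smooth)))) + P-max

      0≤Q-max : ι 0ℚ ≤ Q-max
      0≤Q-max = +-nonNeg (0≤nat _) (*-nonNeg 0≤b (+-nonNeg (*-nonNeg 0≤½ (*-nonNeg 0≤M 0≤M))
        (*-nonNeg 0≤M (+-nonNeg (*-nonNeg 0≤½ 0≤M) 0≤1))))

      K≤ : ∀ {u} → Ω u → ι ½ * (∣ s u ∣ * ∣ s u -ᶜ 1ᶜ ∣) ≤ ι ½ * (M * M)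
      K≤ u∈ = *-monoˡ-≤ 0≤½ (*-mono-≤ (∣z∣-nonNeg _) 0≤M (∣s∣≤ u∈) (∣s-1∣≤ u∈))

      ∣P∣≤ : ∀ n {u} → Ω u → ∣ P (s u) n ∣ ≤ P-max
      ∣P∣≤ n {u} u∈ = *-cancelˡ-≤ 0<a ≤-refl (≤-respʳ ab (≤-trans (*-monoʳ-≤ (∣z∣-nonNeg _) (a≤re-s u∈))
        (≤-trans (P-bound (s u) (0≤re-s u∈) n) (+-mono-≤ (K≤ u∈)
          (*-mono-≤ (0≤re-s u∈) (+-nonNeg (*-nonNeg 0≤½ 0≤M) 0≤1) (≤-trans (re≤∣z∣ _) (∣s∣≤ u∈))
            (+-mono-≤ (*-monoˡ-≤ 0≤½ (∣s-1∣≤ u∈)) ≤-refl))))))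
        where
        ab : B ≈ ι a * P-max
        ab = R.trans (R.sym (R.*-identityˡ B)) (R.trans (R.*-congʳ (R.trans (R.reflexive (≡.cong ι (≡.sym (Rat.recip-inverse 0<a)))) (ι-* a b)))
          (R.*-assoc _ _ _))

      ∣Q∣≤ : ∀ n {u} → Ω u → ∣ Q n u ∣ ≤ Q-max
      ∣Q∣≤ n {u} u∈ = ≤-trans (∣z-w∣≤ _ _) (+-mono-≤ (proj₂ (bounded (proj₂ s-1*Z-smooth)) u u∈) (∣P∣≤ n u∈))

      ∣Q∣-right : ∀ n {u} → Ω u → ι (1ℚ ℚ.+ ¼) ≤ re (s u) → ∣ Q n u ∣ ≤ (ι ½ * (M * M)) * ι (inv n)
      ∣Q∣-right n {u} u∈ h = ≤-trans
        (≡.subst (λ w → ∣ (s w -ᶜ 1ᶜ) *ᶜ Z u -ᶜ P (s w) n ∣ ≤ (ι ½ * (∣ s w ∣ * ∣ s w -ᶜ 1ᶜ ∣)) * ι (inv n)) (clamp-Ω u∈)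
          (Right.approximation ζ isζ (s (clamp u)) (s#1 u) (≡.subst (λ w → ι (1ℚ ℚ.+ ¼) ≤ re (s w)) (≡.sym (clamp-Ω u∈)) h) n))
        (*-monoʳ-≤ (ι-mono (Rat.inv-nonNeg n)) (K≤ u∈))

      v≤8 : ∀ {u} → Ω u → v u ℚ.≤ four ℚ.+ four
      v≤8 {x , y} (inside l r _ _) = Rat.≤-by _
        (Rat.+-nonNeg (Rat.+-nonNeg (Rat.p≤q⇒0≤q-p r) (Rat.*-nonNeg (Rat.p≤q⇒0≤q-p r)
            (Rat.+-nonNeg (Rat.+-nonNeg (Rat.p≤q⇒0≤q-p l) (Rat.p≤q⇒0≤q-p a≤½)) (ℚ.<⇒≤ (ℚ.positive⁻¹ (1ℚ ℚ.+ ½))))))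
          (Rat.+-nonNeg (ℚ.<⇒≤ (ℚ.positive⁻¹ two)) (Rat.square-nonNeg y)))
        (solve 3 (λ x y a → (con four :+ con four) :- (x :+ (x :* x :- y :* y)) :=
            ((con two :- x) :+ (con two :- x) :* (((x :- :- a) :+ (con ½ :- a)) :+ con (1ℚ ℚ.+ ½))) :+ (con two :+ y :* y)) ≡.refl x y a)

      -- On the left side the linear term of u + u² decides, since -a + a² ≤ -a/2 even at y = 0. On
      -- the horizontal sides -y² = -49/16 outweighs x + x² ≤ 45/16, the value at x = 5/4. The right
      -- side x = 2 contradicts x ≤ 5/4.
      v-left : ∀ {u} → Ω u → Boundary u → proj₁ u ℚ.≤ 1ℚ ℚ.+ ¼ → v u ℚ.≤ ℚ.- (½ ℚ.* a)
      v-left {x , y} _ (leftSide ≡.refl) _ = Rat.≤-by _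
        (Rat.+-nonNeg (Rat.*-nonNeg 0≤a (Rat.p≤q⇒0≤q-p a≤½)) (Rat.square-nonNeg y))
        (solve 2 (λ a y → :- (con ½ :* a) :- (:- a :+ (:- a :* :- a :- y :* y)) := a :* (con ½ :- a) :+ y :* y) ≡.refl a y)
      v-left {x , y} _ (rightSide ≡.refl) h = contradiction (ℚ.<-≤-trans 5/4<2 h) (ℚ.<-irrefl ≡.refl)
        where
        5/4<2 : 1ℚ ℚ.+ ¼ ℚ.< two
        5/4<2 = ℚ.+-monoʳ-< 1ℚ (ℚ.<-≤-trans (Rat.half< {½} (ℚ.positive⁻¹ ½)) (Rat.≤-by {½} {1ℚ} ½ (ℚ.<⇒≤ (ℚ.positive⁻¹ ½)) ≡.refl))
      v-left {x , y} (inside l _ _ _) (levelSide eq) h = Rat.≤-by _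
        (Rat.+-nonNeg (Rat.*-nonNeg (Rat.p≤q⇒0≤q-p h) (Rat.+-nonNeg (Rat.+-nonNeg (Rat.p≤q⇒0≤q-p l) (Rat.p≤q⇒0≤q-p a≤½)) (ℚ.<⇒≤ (ℚ.positive⁻¹ height))))
          (Rat.*-nonNeg (ℚ.<⇒≤ (ℚ.positive⁻¹ ½)) (Rat.p≤q⇒0≤q-p a≤½)))
        (≡.trans (≡.cong (λ z → ℚ.- (½ ℚ.* a) ℚ.- (x ℚ.+ (x ℚ.* x ℚ.- z))) eq)
          (solve 2 (λ x a → :- (con ½ :* a) :- (x :+ (x :* x :- con height :* con height)) :=
            (con (1ℚ ℚ.+ ¼) :- x) :* (((x :- :- a) :+ (con ½ :- a)) :+ con height) :+ con ½ :* (con ½ :- a)) ≡.refl x a))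

      x≤5/4 : ∀ {u} → re (s u) ≤ ι (1ℚ ℚ.+ ¼) → proj₁ u ℚ.≤ 1ℚ ℚ.+ ¼
      x≤5/4 {u} h = ι-cancel (≤-trans (≤-by _ (≤-trans (ι-mono (ℚ.<⇒≤ 0<g)) g≤σ)
        (solveᴿ 2 (λ σ x → (σ ⊕ x) ⊖ x ⊜ σ) ≈-refl σ (ι (proj₁ u)))) (≤-respˡ (re-s u) h))

      W-max : ℕ → ℝ
      W-max Λ = expᴿ (ι (nat Λ) * ι (four ℚ.+ four))

      W-min : ℕ → ℝ
      W-min Λ = expᴿ (- (ι (nat Λ) * ι (½ ℚ.* a)))

      ∣W∣≤ : ∀ Λ {u} → Ω u → ∣ W Λ u ∣ ≤ W-max Λ
      ∣W∣≤ Λ {u} u∈ = ≤-respˡ (R.sym (∣W∣ Λ u)) (expᴿ-mono (*-monoˡ-≤ (0≤nat Λ) (ι-mono (v≤8 u∈))))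

      ∣W∣-left : ∀ Λ {u} → v u ℚ.≤ ℚ.- (½ ℚ.* a) → ∣ W Λ u ∣ ≤ W-min Λ
      ∣W∣-left Λ {u} h = ≤-respˡ (R.sym (∣W∣ Λ u)) (expᴿ-mono (≤-respʳ
        (R.trans (R.*-congˡ (ι-neg _)) (solveᴿ 2 (λ x y → x ⊗ ⊝ y ⊜ ⊝ (x ⊗ y)) ≈-refl (ι (nat Λ)) (ι (½ ℚ.* a))))
        (*-monoˡ-≤ (0≤nat Λ) (ι-mono h))))

      η : ℕ → ℕ → ℝ
      η Λ n = Q-max * W-min Λ + ((ι ½ * (M * M)) * W-max Λ) * ι (inv n)

      0≤right : ∀ Λ n → ι 0ℚ ≤ ((ι ½ * (M * M)) * W-max Λ) * ι (inv n)
      0≤right Λ n = *-nonNeg (*-nonNeg (*-nonNeg 0≤½ (*-nonNeg 0≤M 0≤M)) (expᴿ-nonNeg _)) (ι-mono (Rat.inv-nonNeg n))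

      0≤left : ∀ Λ → ι 0ℚ ≤ Q-max * W-min Λ
      0≤left Λ = *-nonNeg 0≤Q-max (expᴿ-nonNeg _)

      -- Re s is a real and cannot be compared with 5/4 effectively; `≤-cases` allows it because an
      -- inequality is being proved. In either case one of the two nonnegative summands of `η` is
      -- enough.
      boundary-bound : ∀ Λ n u → Ω u → Boundary u → ∣ Q n u *ᶜ W Λ u ∣ ≤ η Λ n
      boundary-bound Λ n u u∈ u∂ = ≤-respˡ (R.sym (∣∣-* _ _)) (≤-cases {re (s u)} {ι (1ℚ ℚ.+ ¼)}
        (λ h → ≤-trans (*-mono-≤ (∣z∣-nonNeg _) (expᴿ-nonNeg _) (∣Q∣≤ n u∈) (∣W∣-left Λ (v-left u∈ u∂ (x≤5/4 h))))
          (≤-by _ (0≤right Λ n) (solveᴿ 2 (λ x y → (x ⊕ y) ⊖ x ⊜ y) ≈-refl (Q-max * W-min Λ) _)))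
        (λ h → ≤-trans (*-mono-≤ (∣z∣-nonNeg _) (expᴿ-nonNeg _) (∣Q∣-right n u∈ h) (∣W∣≤ Λ u∈))
          (≤-by _ (0≤left Λ) (solveᴿ 4 (λ x k i w → (x ⊕ (k ⊗ w) ⊗ i) ⊖ (k ⊗ i) ⊗ w ⊜ x) ≈-refl (Q-max * W-min Λ) (ι ½ * (M * M)) (ι (inv n)) (W-max Λ)))))

      pt-origin : pt origin ≈ᶜ 0ᶜ
      pt-origin = C.trans (C.reflexive (≡.cong pt origin≡)) (pt-ι 0ℚ)

      W-origin : ∀ Λ → W Λ origin ≈ᶜ 1ᶜ
      W-origin Λ = C.trans (exp-cong (C.trans (C.*-congˡ (C.+-cong pt-origin (C.*-cong pt-origin pt-origin)))
        (solveᶜ 1 (λ n → n ⊠ (κᶜ 0ℚ ⊞ κᶜ 0ℚ ⊠ κᶜ 0ℚ) ≋ κᶜ 0ℚ) C.refl (natᶜ Λ)))) exp-0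

      c : ℝ
      c = ι (thirtytwo ℚ.* b)

      0≤c : ι 0ℚ ≤ c
      0≤c = ι-mono (Rat.*-nonNeg (ℚ.<⇒≤ (ℚ.positive⁻¹ thirtytwo)) (ℚ.<⇒≤ (Rat.recip-pos 0<a)))

      center : ∀ Λ n → ∣ Q n origin ∣ ≤ c * η Λ n
      center Λ n = ≤-respˡ (∣∣-cong (C.trans (C.*-congˡ (W-origin Λ)) (C.*-identityʳ _)))
        (≡.subst (λ u → ∣ Q n u *ᶜ W Λ u ∣ ≤ c * η Λ n) (≡.sym origin≡) (center≤boundary (differential (*′ (proj₂ (Q-smooth n)) (proj₂ (W-smooth Λ)))) (boundary-bound Λ n)))

      -- e⁻ˣ ≤ 1/(1 + x)
      W-min-small : ∀ ε → 0ℚ ℚ.< ε → ∃[ Λ ] W-min Λ ≤ ι ε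
      W-min-small ε 0<ε = Λ , ≤-trans (≤-by _ (*-nonNeg (expᴿ-nonNeg _) (x≤y⇒0≤y-x large))
          (solveᴿ 3 (λ w x e → (w ⊗ (κ 1ℚ ⊕ x)) ⊗ e ⊖ w ⊜ w ⊗ ((κ 1ℚ ⊕ x) ⊗ e ⊖ κ 1ℚ)) ≈-refl (W-min Λ) x (ι ε)))
        (≤-respʳ (R.*-identityˡ _) (*-monoʳ-≤ 0≤ε (expᴿ-decay 0≤x)))
        where
        0<p : 0ℚ ℚ.< (½ ℚ.* a) ℚ.* ε
        0<p = D.RationalLemmas.*-pos (Rat.half-pos 0<a) 0<ε
        Λ : ℕ
        Λ = Rat.bound (Rat.recip 0<p)
        x : ℝ
        x = ι (nat Λ) * ι (½ ℚ.* a)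
        0≤ε : ι 0ℚ ≤ ι ε
        0≤ε = ι-mono (ℚ.<⇒≤ 0<ε)
        0≤x : ι 0ℚ ≤ x
        0≤x = *-nonNeg (0≤nat Λ) (ι-mono (ℚ.<⇒≤ (Rat.half-pos 0<a)))
        1≤ : 1ℚ ℚ.≤ (½ ℚ.* a) ℚ.* ε ℚ.* nat Λ
        1≤ = ≡.subst (ℚ._≤ (½ ℚ.* a) ℚ.* ε ℚ.* nat Λ) (Rat.recip-inverse 0<p) (Rat.*-monoʳ-≤ (ℚ.<⇒≤ 0<p) (Rat.nat-bound (Rat.recip 0<p)))
        large : ι 1ℚ ≤ (ι 1ℚ + x) * ι ε
        large = ≤-trans (ι-mono 1≤) (≤-respˡ (R.sym (R.trans (ι-* _ _) (R.*-congʳ (ι-* _ _))))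
          (≤-by _ 0≤ε (solveᴿ 3 (λ h e n → (κ 1ℚ ⊕ n ⊗ h) ⊗ e ⊖ (h ⊗ e) ⊗ n ⊜ e) ≈-refl (ι (½ ℚ.* a)) (ι ε) (ι (nat Λ)))))

    Q-small : ∀ ε → 0ℚ ℚ.< ε → ∃[ n ] ∣ Q n origin ∣ ≤ ι ε
    Q-small = two-scale-limit {λ n → ∣ Q n origin ∣} {c} {Q-max} {ι ½ * (M * M)} {W-min} {W-max} 0≤c 0≤Q-max W-min-small center

    private
      origin∈Ω : Ω origin
      origin∈Ω = ≡.subst Ω (≡.sym origin≡) (inside (Rat.≤-by a 0≤a (solve 1 (λ a → con 0ℚ :- :- a := a) ≡.refl a)) (ℚ.<⇒≤ (ℚ.positive⁻¹ two))
        (Rat.≤-by height 0≤h ≡.refl) 0≤h)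
        where
        0≤h : 0ℚ ℚ.≤ height
        0≤h = ℚ.<⇒≤ (ℚ.positive⁻¹ height)

      re-origin : re (s origin) ≈ σ
      re-origin = R.trans (re-s origin) (R.trans (R.+-congˡ (R.reflexive (≡.cong (λ u → ι (proj₁ u)) origin≡))) (R.+-identityʳ σ))

      im-origin : im (s origin) ≈ t
      im-origin = R.trans (im-s origin) (R.trans (R.+-congˡ (R.reflexive (≡.cong (λ u → ι (proj₂ u)) origin≡))) (R.+-identityʳ t))

    σ∣ζ∣≤σ+t : σ ≤ ι two → σ * ∣ Z origin ∣ ≤ σ + t
    σ∣ζ∣≤σ+t σ≤2 = conclude {σ} {t} {s origin} {Z origin} {P (s origin)} (≤-trans (ι-mono (ℚ.<⇒≤ 0<g)) g≤σ) σ≤2 2≤t re-origin im-origin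
      (P-bound (s origin) (0≤re-s origin∈Ω)) Q-small

    private
      s-clamp : ∀ u {w} → Ω u → s u ≈ᶜ w → s (clamp u) ≈ᶜ w
      s-clamp u {w} u∈ s≈w = ≡.subst (λ u → s u ≈ᶜ w) (≡.sym (clamp-Ω u∈)) s≈w

      -- The clamped centre is equal to σ + it only up to `_≈ᶜ_`, and it carries its own proof of
      -- being apart from 1; the congruence of ζ absorbs both differences.
      Z≈ζ : ∀ u {w} → s (clamp u) ≈ᶜ w → (w#1 : w D.# D.1ℂ) → Z u ≈ᶜ ζ w w#1
      Z≈ζ u {w} s≈w w#1 = ζ-resp ζ isζ {s (clamp u)} {w} (s#1 u) w#1 s≈w

    ζ-bound : σ ≤ ι two → (s₀#1 : s₀ D.# D.1ℂ) → σ * ∣ ζ s₀ s₀#1 ∣ ≤ σ + t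
    ζ-bound σ≤2 s₀#1 = ≤-respˡ (R.*-congˡ (∣∣-cong (Z≈ζ origin (s-clamp origin origin∈Ω (re-origin & im-origin)) s₀#1))) (σ∣ζ∣≤σ+t σ≤2)

open import Defs

proposition8 : (ζ : (s : ℂ) → s # 1ℂ → ℂ) → IsRiemannZeta ζ →
    (σ t : ℝ) (0<σ : 0ℝ < σ) → σ ≤ 2ℝ → (2≤t : 2ℝ ≤ t) →
    ∣ ζ (σ +i t) (2≤im⇒#1 2≤t) ∣ ≤ 1ℝ + t / σ [ 0<σ ]
proposition8 ζ isζ σ t 0<σ σ≤2 2≤t = from-gap (Real.<⇒gap 0<σ)
  where
  open Real using (ι) renaming (_+_ to _+ᴿ_; _*_ to _*ᴿ_; _≤_ to _≤ᴿ_)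
  w : ℂ
  w = ζ (σ +i t) (2≤im⇒#1 2≤t)
  -- The witness of 0 < σ yields a rational q with 0 < q ≤ σ. It fixes the width of the rectangle on
  -- the left and also allows σ to be cancelled from σ |ζ| ≤ σ + t = σ (1 + t/σ).
  from-gap : ∃[ q ] 0ℚ ℚ.< q × ι q ≤ᴿ σ → ∣ w ∣ ≤ 1ℝ + t / σ [ 0<σ ]
  from-gap (q , 0<q , q≤σ) = Complex.≤⇒D≤ (≡.subst₂ _≤ᴿ_ (≡.sym (Complex.≡-∣∣ w))
      (≡.sym (≡.trans (Complex.≡-+ 1ℝ (t / σ [ 0<σ ])) (≡.cong (_+ᴿ (t / σ [ 0<σ ])) (Complex.≡-ι 1ℚ))))
      (Complex.*-cancelˡ-≤ 0<q q≤σ (Real.≤-respʳ expand (Conclusion.Bound.ζ-bound ζ isζ σ t q 0<q q≤σ (2ι 2≤t) (ι2 σ≤2) (2≤im⇒#1 2≤t)))))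
    where
    2ι : 2ℝ ≤ t → ι Rectangles.two ≤ᴿ t
    2ι h = ≡.subst (_≤ᴿ t) (Complex.≡-ι Rectangles.two) (Complex.D≤⇒≤ h)
    ι2 : σ ≤ 2ℝ → σ ≤ᴿ ι Rectangles.two
    ι2 h = ≡.subst (σ ≤ᴿ_) (Complex.≡-ι Rectangles.two) (Complex.D≤⇒≤ h)
    expand : σ +ᴿ t ≈ σ *ᴿ (ι 1ℚ +ᴿ t / σ [ 0<σ ])
    expand = R.sym (R.trans (R.distribˡ σ (ι 1ℚ) (t / σ [ 0<σ ]))
      (R.+-cong (R.*-identityʳ σ) (R.trans (R.*-comm σ (t / σ [ 0<σ ])) (Real./-cancel t σ 0<σ))))
      where module R = Real.R
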